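{- Let $q = p^m$ be a prime power and let $n$ be a positive integer with $n \mid q-1$. Assume that for any divisor $\nu$ of $m$ with $\nu \neq m$ one has, uniformly, $$\gcd\left(n, \frac{p^m-1}{p^\nu-1}\right) \ll n^{\delta}\, \frac{q^{1-\delta}}{p^\nu}$$ with $\delta = 119/605$. Then $$\left|\sum_{x \in \mathbb{F}_q} \psi(x^n)\right| \ll q^{\frac{7-2\delta_2}{8}}\, n^{\frac{2+2\delta_2}{8}}$$ for any non-trivial additive character $\psi$ of $\mathbb{F}_q$, where $\delta_2 = 1/56 + o(1)$.
   Context: $\mathbb{F}_q$ is the finite field with $q = p^m$ elements, $p$ prime. The notation $X \ll Y$ means that there is an absolute constant $C$ such that $|X| \leq C|Y|$; in the hypothesis the same constant is used for all $\nu$ (uniformity), and the implied constant in the conclusion does not depend on $p, m, n, \psi$ (it may depend on the implied constant in the hypothesis). Convention on $o(1)$: it appears only in exponents and stands for implicit logarithmic factors; that is, the bound with $\delta_2$ replaced by $1/56$ holds up to a factor given by an absolute power of $\log q$. -}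

module Defs where

open import Algebra.Apartness.Bundles using (HeytingCommutativeRing; HeytingField)
open import Algebra.Bundles using (CommutativeRing)
open import Algebra.Bundles.Raw using (RawRing)
import Algebra.Definitions.RawSemiring as RawSemiringDefinitions
open import Algebra.Morphism.Structures using (module MonoidMorphisms)
open import Data.Bool.Base using (if_then_else_)
open import Data.Fin.Base using (Fin)
import Data.Integer.Base as ℤ
import Data.Integer.Properties as ℤ
open import Data.Nat.Base as ℕ using (ℕ; zero; suc; NonZero; _∸_)
open import Data.Nat.Coprimality using (1-coprimeTo)
open import Data.Nat.Divisibility using (_∣_)
open import Data.Nat.GCD using (gcd)
import Data.Nat.Properties as ℕ
open import Data.Nat.Primality using (Prime; prime⇒nonTrivial; prime⇒nonZero)
open import Data.Product.Base using (∃; Σ; _×_; _,_)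
open import Data.Rational.Base as ℚ
  using (ℚ; mkℚ; 0ℚ; 1ℚ; ½; Positive; NonNegative; nonNegative; *≤*; ↥_; ↧ₙ_)
import Data.Rational.Unnormalised.Base as ℚᵘ
import Data.Rational.Unnormalised.Properties as ℚᵘ
open import Data.Rational.Literals using (fromℤ)
import Data.Rational.Properties as ℚ
import Data.Rational.Solver as ℚ-Solver
open import Data.Sum.Base as Sum using (_⊎_; inj₁; inj₂; [_,_]′)
open import Function.Bundles using (Inverse)
open import Level using (0ℓ)
open import Relation.Binary.PropositionalEquality
  using (_≡_; _≢_; refl; sym; trans; cong; cong₂; subst; setoid)
open import Relation.Nullary.Decidable.Core using (Dec; does; yes; no)
open import Relation.Nullary.Negation.Core using (¬_; contradiction)

open RawSemiringDefinitions ℚ.+-*-rawSemiring using () renaming (_^_ to _^ℚ_)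

open ℚ.≤-Reasoning

∣∣-intro : ∀ {a e} → a ℚ.≤ e → ℚ.- a ℚ.≤ e → ℚ.∣ a ∣ ℚ.≤ e
∣∣-intro {a} p q with ℚ.∣p∣≡p∨∣p∣≡-p a
... | inj₁ eq = subst (ℚ._≤ _) (sym eq) p
... | inj₂ eq = subst (ℚ._≤ _) (sym eq) q

a≤∣a∣ : ∀ a → a ℚ.≤ ℚ.∣ a ∣
a≤∣a∣ a with ℚ.≤-total 0ℚ a
... | inj₁ 0≤a = ℚ.≤-reflexive (sym (ℚ.0≤p⇒∣p∣≡p 0≤a))
... | inj₂ a≤0 = ℚ.≤-trans a≤0 (ℚ.0≤∣p∣ a)

open ℚ-Solver.+-*-Solver using (solve; _:=_; _:+_; _:*_; _:-_; :-_)

∣-∣⇒≤ : ∀ a b {e} → ℚ.∣ a ℚ.- b ∣ ℚ.≤ e → a ℚ.≤ b ℚ.+ e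
∣-∣⇒≤ a b {e} p = begin
  a                ≡⟨ solve 2 (λ x y → x := y :+ (x :- y)) refl a b ⟩
  b ℚ.+ (a ℚ.- b)  ≤⟨ ℚ.+-monoʳ-≤ b (ℚ.≤-trans (a≤∣a∣ _) p) ⟩
  b ℚ.+ e          ∎

≤⇒-≤ : ∀ a b {e} → a ℚ.≤ b ℚ.+ e → a ℚ.- b ℚ.≤ e
≤⇒-≤ a b {e} p = begin
  a ℚ.- b          ≤⟨ ℚ.+-monoˡ-≤ (ℚ.- b) p ⟩
  b ℚ.+ e ℚ.- b    ≡⟨ solve 2 (λ x y → x :+ y :- x := y) refl b e ⟩
  e                ∎

≤⇒∣-∣ : ∀ a b {e} → a ℚ.≤ b ℚ.+ e → b ℚ.≤ a ℚ.+ e → ℚ.∣ a ℚ.- b ∣ ℚ.≤ e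
≤⇒∣-∣ a b {e} p q = ∣∣-intro (≤⇒-≤ a b p)
  (subst (ℚ._≤ e) (solve 2 (λ x y → y :- x := :- (x :- y)) refl a b) (≤⇒-≤ b a q))

½+½ : ∀ e → ½ ℚ.* e ℚ.+ ½ ℚ.* e ≡ e
½+½ e = trans (sym (ℚ.*-distribʳ-+ e ½ ½)) (ℚ.*-identityˡ e)

half-pos : ∀ e → Positive e → Positive (½ ℚ.* e)
half-pos e e>0 = ℚ.pos*pos⇒pos ½ e {{e>0}}

*-mono-≤ : ∀ {a b c d} → 0ℚ ℚ.≤ c → 0ℚ ℚ.≤ b → a ℚ.≤ b → c ℚ.≤ d →
           a ℚ.* c ℚ.≤ b ℚ.* d
*-mono-≤ {a} {b} {c} {d} 0≤c 0≤b a≤b c≤d = begin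
  a ℚ.* c  ≤⟨ ℚ.*-monoʳ-≤-nonNeg c {{nonNegative 0≤c}} a≤b ⟩
  b ℚ.* c  ≤⟨ ℚ.*-monoˡ-≤-nonNeg b {{nonNegative 0≤b}} c≤d ⟩
  b ℚ.* d  ∎

0≤+ : ∀ {a b} → 0ℚ ℚ.≤ a → 0ℚ ℚ.≤ b → 0ℚ ℚ.≤ a ℚ.+ b
0≤+ = ℚ.+-mono-≤

0≤* : ∀ {a b} → 0ℚ ℚ.≤ a → 0ℚ ℚ.≤ b → 0ℚ ℚ.≤ a ℚ.* b
0≤* {a} {b} 0≤a 0≤b =
  subst (ℚ._≤ a ℚ.* b) (ℚ.*-zeroˡ 0ℚ) (*-mono-≤ ℚ.≤-refl 0≤a 0≤a 0≤b)

0≤1 : 0ℚ ℚ.≤ 1ℚ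
0≤1 = ℚ.nonNegative⁻¹ 1ℚ

0≤pow : ∀ k {a} → 0ℚ ℚ.≤ a → 0ℚ ℚ.≤ a ^ℚ k
0≤pow zero    0≤a = 0≤1
0≤pow (suc k) 0≤a = 0≤* 0≤a (0≤pow k 0≤a)

pow-mono : ∀ k {a b} → 0ℚ ℚ.≤ a → a ℚ.≤ b → a ^ℚ k ℚ.≤ b ^ℚ k
pow-mono zero    0≤a a≤b = ℚ.≤-refl
pow-mono (suc k) 0≤a a≤b =
  *-mono-≤ (0≤pow k 0≤a) (ℚ.≤-trans 0≤a a≤b) a≤b (pow-mono k 0≤a a≤b)

pow-cancel : ∀ k {a b} → 0ℚ ℚ.≤ b → a ^ℚ k ℚ.< b ^ℚ k → a ℚ.≤ b
pow-cancel k {a} {b} 0≤b p with ℚ.≤-total a b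
... | inj₁ a≤b = a≤b
... | inj₂ b≤a = contradiction (ℚ.<-≤-trans p (pow-mono k 0≤b b≤a)) (ℚ.<-irrefl refl)

pow-super : ∀ k {a b} → 0ℚ ℚ.≤ a → 0ℚ ℚ.≤ b →
            a ^ℚ suc k ℚ.+ b ^ℚ suc k ℚ.≤ (a ℚ.+ b) ^ℚ suc k
pow-super k {a} {b} 0≤a 0≤b = begin
  a ℚ.* a ^ℚ k ℚ.+ b ℚ.* b ^ℚ k
    ≤⟨ ℚ.+-mono-≤
         (ℚ.*-monoˡ-≤-nonNeg a {{nonNegative 0≤a}} (pow-mono k 0≤a a≤a+b))
         (ℚ.*-monoˡ-≤-nonNeg b {{nonNegative 0≤b}} (pow-mono k 0≤b b≤a+b)) ⟩
  a ℚ.* (a ℚ.+ b) ^ℚ k ℚ.+ b ℚ.* (a ℚ.+ b) ^ℚ k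
    ≡⟨ ℚ.*-distribʳ-+ ((a ℚ.+ b) ^ℚ k) a b ⟨
  (a ℚ.+ b) ^ℚ suc k ∎
  where
  a≤a+b = subst (ℚ._≤ a ℚ.+ b) (ℚ.+-identityʳ a) (ℚ.+-monoʳ-≤ a 0≤b)
  b≤a+b = subst (ℚ._≤ a ℚ.+ b) (ℚ.+-identityˡ b) (ℚ.+-monoˡ-≤ b 0≤a)

1≤pow : ∀ k {a} → 1ℚ ℚ.≤ a → 1ℚ ℚ.≤ a ^ℚ k
1≤pow zero    1≤a = ℚ.≤-refl
1≤pow (suc k) 1≤a = *-mono-≤ 0≤1 (ℚ.≤-trans 0≤1 1≤a) 1≤a (1≤pow k 1≤a)

a≤pow : ∀ k {a} → 1ℚ ℚ.≤ a → a ℚ.≤ a ^ℚ suc k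
a≤pow k {a} 1≤a = begin
  a              ≡⟨ ℚ.*-identityʳ a ⟨
  a ℚ.* 1ℚ       ≤⟨ ℚ.*-monoˡ-≤-nonNeg a {{nonNegative (ℚ.≤-trans 0≤1 1≤a)}} (1≤pow k 1≤a) ⟩
  a ^ℚ suc k     ∎

pow-pos : ∀ k a → Positive a → Positive (a ^ℚ k)
pow-pos zero    a a>0 = _
pow-pos (suc k) a a>0 = ℚ.pos*pos⇒pos a {{a>0}} (a ^ℚ k) {{pow-pos k a a>0}}

ℕ→ℚ : ℕ → ℚ
ℕ→ℚ a = fromℤ (ℤ.+ a)

ℕ→ℚ-suc : ∀ a → ℕ→ℚ (suc a) ≡ ℕ→ℚ a ℚ.+ 1ℚ
ℕ→ℚ-suc a = ℚ.toℚᵘ-injective (ℚᵘ.≃-trans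
  (ℚᵘ.*≡* (cong (ℤ._* (ℤ.+ 1)) (trans (cong ℤ.+_ (ℕ.+-comm 1 a))
    (cong (ℤ._+ (ℤ.+ 1)) (sym (ℤ.*-identityʳ (ℤ.+ a)))))))
  (ℚᵘ.≃-sym (ℚ.toℚᵘ-homo-+ (ℕ→ℚ a) 1ℚ)))

ℕ→ℚ-* : ∀ a b → ℕ→ℚ (a ℕ.* b) ≡ ℕ→ℚ a ℚ.* ℕ→ℚ b
ℕ→ℚ-* a b = ℚ.toℚᵘ-injective (ℚᵘ.≃-trans
  (ℚᵘ.*≡* (cong (ℤ._* (ℤ.+ 1)) (ℤ.pos-* a b)))
  (ℚᵘ.≃-sym (ℚ.toℚᵘ-homo-* (ℕ→ℚ a) (ℕ→ℚ b))))

0≤ℕ→ℚ : ∀ a → 0ℚ ℚ.≤ ℕ→ℚ a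
0≤ℕ→ℚ a = ℚ.nonNegative⁻¹ (ℕ→ℚ a)

1/suc : ℕ → ℚ
1/suc n = mkℚ (ℤ.+ 1) n (1-coprimeTo (suc n))

1/suc-inverse : ∀ n → ℕ→ℚ (suc n) ℚ.* 1/suc n ≡ 1ℚ
1/suc-inverse n = ℚ.*-inverseʳ (ℕ→ℚ (suc n))

0≤1/suc : ∀ n → 0ℚ ℚ.≤ 1/suc n
0≤1/suc n = ℚ.nonNegative⁻¹ (1/suc n)

archimedean : ∀ e → Positive e → ∃ λ N → ∀ n → N ℕ.≤ n → 1/suc n ℚ.≤ e
archimedean (mkℚ (ℤ.+ suc a) d _) _ = d , λ n d≤n →
  *≤* (ℤ.+≤+ (ℕ.*-mono-≤ (ℕ.s≤s (ℕ.z≤n {a})) (ℕ.s≤s d≤n)))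

x≤∣↥x∣ : ∀ x → x ℚ.≤ ℕ→ℚ ℤ.∣ ↥ x ∣
x≤∣↥x∣ x@(mkℚ (ℤ.+ n) d _) = *≤* (subst (ℤ._≤ (ℤ.+ n) ℤ.* ℤ.+ suc d)
  (ℤ.pos-* n 1) (subst (ℤ.+ (n ℕ.* 1) ℤ.≤_) (ℤ.pos-* n (suc d))
    (ℤ.+≤+ (ℕ.*-monoʳ-≤ n (ℕ.s≤s ℕ.z≤n)))))
x≤∣↥x∣ x@(mkℚ ℤ.-[1+ n ] d _) =
  ℚ.≤-trans (ℚ.<⇒≤ (ℚ.negative⁻¹ x)) (0≤ℕ→ℚ (suc n))

-- Cauchy sequences of rationals; equality of reals is _≈ᴿ_.
record ℝ : Set where
  constructor mkℝ
  field
    seq    : ℕ → ℚ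
    cauchy : ∀ ε → Positive ε → ∃ λ N → ∀ m n → N ℕ.≤ m → N ℕ.≤ n →
             ℚ.∣ seq m ℚ.- seq n ∣ ℚ.≤ ε

open ℝ

infix 4 _≈ᴿ_ _≤ᴿ_

_≈ᴿ_ : ℝ → ℝ → Set
x ≈ᴿ y = ∀ ε → Positive ε → ∃ λ N → ∀ n → N ℕ.≤ n → ℚ.∣ seq x n ℚ.- seq y n ∣ ℚ.≤ ε

_≤ᴿ_ : ℝ → ℝ → Set
x ≤ᴿ y = ∀ ε → Positive ε → ∃ λ N → ∀ n → N ℕ.≤ n → seq x n ℚ.≤ seq y n ℚ.+ ε

fromℚ : ℚ → ℝ
fromℚ a .seq _ = a
fromℚ a .cauchy ε ε>0 = 0 , λ _ _ _ _ →
  subst (λ z → ℚ.∣ z ∣ ℚ.≤ ε) (sym (ℚ.+-inverseʳ a)) (ℚ.<⇒≤ (ℚ.positive⁻¹ ε {{ε>0}}))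

fromℕ : ℕ → ℝ
fromℕ a = fromℚ (ℕ→ℚ a)

infixl 6 _+ᴿ_
infixl 7 _*ᴿ_
infix  8 -ᴿ_

_+ᴿ_ : ℝ → ℝ → ℝ
(x +ᴿ y) .seq n = seq x n ℚ.+ seq y n
(x +ᴿ y) .cauchy ε ε>0
  with cauchy x (½ ℚ.* ε) (half-pos ε ε>0) | cauchy y (½ ℚ.* ε) (half-pos ε ε>0)
... | N₁ , p₁ | N₂ , p₂ = N₁ ℕ.⊔ N₂ , λ m n N≤m N≤n → begin
  ℚ.∣ (seq x m ℚ.+ seq y m) ℚ.- (seq x n ℚ.+ seq y n) ∣
    ≡⟨ cong ℚ.∣_∣ (solve 4 (λ a b c d → (a :+ b) :- (c :+ d) := (a :- c) :+ (b :- d)) refl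
         (seq x m) (seq y m) (seq x n) (seq y n)) ⟩
  ℚ.∣ (seq x m ℚ.- seq x n) ℚ.+ (seq y m ℚ.- seq y n) ∣
    ≤⟨ ℚ.∣p+q∣≤∣p∣+∣q∣ (seq x m ℚ.- seq x n) (seq y m ℚ.- seq y n) ⟩
  ℚ.∣ seq x m ℚ.- seq x n ∣ ℚ.+ ℚ.∣ seq y m ℚ.- seq y n ∣
    ≤⟨ ℚ.+-mono-≤
         (p₁ m n (ℕ.m⊔n≤o⇒m≤o N₁ N₂ N≤m) (ℕ.m⊔n≤o⇒m≤o N₁ N₂ N≤n))
         (p₂ m n (ℕ.m⊔n≤o⇒n≤o N₁ N₂ N≤m) (ℕ.m⊔n≤o⇒n≤o N₁ N₂ N≤n)) ⟩
  ½ ℚ.* ε ℚ.+ ½ ℚ.* ε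
    ≡⟨ ½+½ ε ⟩
  ε ∎

-ᴿ_ : ℝ → ℝ
(-ᴿ x) .seq n = ℚ.- seq x n
(-ᴿ x) .cauchy ε ε>0 with cauchy x ε ε>0
... | N , p = N , λ m n N≤m N≤n → subst (ℚ._≤ ε)
  (trans (sym (ℚ.∣-p∣≡∣p∣ (seq x m ℚ.- seq x n))) (cong ℚ.∣_∣ (ℚ.neg-distrib-+ (seq x m) (ℚ.- seq x n))))
  (p m n N≤m N≤n)

bounded : ∀ x → Σ ℚ λ B → Positive B × ∃ λ N → ∀ n → N ℕ.≤ n → ℚ.∣ seq x n ∣ ℚ.≤ B
bounded x with cauchy x 1ℚ _
... | N , p = ℚ.∣ a ∣ ℚ.+ 1ℚ , ℚ.nonNeg+pos⇒pos ℚ.∣ a ∣ {{ℚ.∣-∣-nonNeg a}} 1ℚ , N , λ n N≤n → begin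
  ℚ.∣ seq x n ∣                      ≡⟨ cong ℚ.∣_∣ (solve 2 (λ u v → u := v :+ (u :- v)) refl (seq x n) a) ⟩
  ℚ.∣ a ℚ.+ (seq x n ℚ.- a) ∣        ≤⟨ ℚ.∣p+q∣≤∣p∣+∣q∣ a (seq x n ℚ.- a) ⟩
  ℚ.∣ a ∣ ℚ.+ ℚ.∣ seq x n ℚ.- a ∣    ≤⟨ ℚ.+-monoʳ-≤ ℚ.∣ a ∣ (p n N N≤n ℕ.≤-refl) ⟩
  ℚ.∣ a ∣ ℚ.+ 1ℚ                     ∎
  where a = seq x N

scale : ∀ B → Positive B → ∀ ε → Positive ε → Σ ℚ λ δ → Positive δ × B ℚ.* δ ≡ ε
scale B B>0 ε ε>0 = 1/B ℚ.* ε , ℚ.pos*pos⇒pos 1/B {{ℚ.1/pos⇒pos B {{B>0}}}} ε {{ε>0}} ,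
  trans (sym (ℚ.*-assoc B 1/B ε)) (trans (cong (ℚ._* ε) (ℚ.*-inverseʳ B {{B≢0}})) (ℚ.*-identityˡ ε))
  where
  B≢0 = ℚ.pos⇒nonZero B {{B>0}}
  1/B = (ℚ.1/ B) {{B≢0}}

product-close : ∀ {a b c d B C δ₁ δ₂ ε} → Positive B → Positive C →
  B ℚ.* δ₁ ≡ ½ ℚ.* ε → C ℚ.* δ₂ ≡ ½ ℚ.* ε → ℚ.∣ a ∣ ℚ.≤ B → ℚ.∣ d ∣ ℚ.≤ C →
  ℚ.∣ b ℚ.- d ∣ ℚ.≤ δ₁ → ℚ.∣ a ℚ.- c ∣ ℚ.≤ δ₂ → ℚ.∣ a ℚ.* b ℚ.- c ℚ.* d ∣ ℚ.≤ ε
product-close {a} {b} {c} {d} {B} {C} {δ₁} {δ₂} {ε} B>0 C>0 Bδ₁ Cδ₂ ∣a∣≤B ∣d∣≤C b-d a-c = begin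
  ℚ.∣ a ℚ.* b ℚ.- c ℚ.* d ∣
    ≡⟨ cong ℚ.∣_∣ (solve 4 (λ a b c d → a :* b :- c :* d := a :* (b :- d) :+ d :* (a :- c)) refl a b c d) ⟩
  ℚ.∣ a ℚ.* (b ℚ.- d) ℚ.+ d ℚ.* (a ℚ.- c) ∣
    ≤⟨ ℚ.∣p+q∣≤∣p∣+∣q∣ (a ℚ.* (b ℚ.- d)) (d ℚ.* (a ℚ.- c)) ⟩
  ℚ.∣ a ℚ.* (b ℚ.- d) ∣ ℚ.+ ℚ.∣ d ℚ.* (a ℚ.- c) ∣
    ≡⟨ cong₂ ℚ._+_ (ℚ.∣p*q∣≡∣p∣*∣q∣ a (b ℚ.- d)) (ℚ.∣p*q∣≡∣p∣*∣q∣ d (a ℚ.- c)) ⟩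
  ℚ.∣ a ∣ ℚ.* ℚ.∣ b ℚ.- d ∣ ℚ.+ ℚ.∣ d ∣ ℚ.* ℚ.∣ a ℚ.- c ∣
    ≤⟨ ℚ.+-mono-≤
         (*-mono-≤ (ℚ.0≤∣p∣ (b ℚ.- d)) (0≤pos B>0) ∣a∣≤B b-d)
         (*-mono-≤ (ℚ.0≤∣p∣ (a ℚ.- c)) (0≤pos C>0) ∣d∣≤C a-c) ⟩
  B ℚ.* δ₁ ℚ.+ C ℚ.* δ₂
    ≡⟨ cong₂ ℚ._+_ Bδ₁ Cδ₂ ⟩
  ½ ℚ.* ε ℚ.+ ½ ℚ.* ε
    ≡⟨ ½+½ ε ⟩
  ε ∎
  where
  0≤pos : ∀ {q} → Positive q → 0ℚ ℚ.≤ q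
  0≤pos {q} q>0 = ℚ.<⇒≤ (ℚ.positive⁻¹ q {{q>0}})

*-cauchy : ∀ x y ε → Positive ε → ∃ λ N → ∀ m n → N ℕ.≤ m → N ℕ.≤ n →
  ℚ.∣ seq x m ℚ.* seq y m ℚ.- seq x n ℚ.* seq y n ∣ ℚ.≤ ε
*-cauchy x y ε ε>0 =
  let B , B>0 , M₁ , b₁ = bounded x
      C , C>0 , M₂ , b₂ = bounded y
      δ₁ , δ₁>0 , Bδ₁ = scale B B>0 (½ ℚ.* ε) (half-pos ε ε>0)
      δ₂ , δ₂>0 , Cδ₂ = scale C C>0 (½ ℚ.* ε) (half-pos ε ε>0)
      N₁ , p₁ = cauchy x δ₂ δ₂>0
      N₂ , p₂ = cauchy y δ₁ δ₁>0
      M = M₁ ℕ.⊔ M₂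
      N = N₁ ℕ.⊔ N₂
  in M ℕ.⊔ N , λ m n ≤m ≤n →
    let M≤m = ℕ.m⊔n≤o⇒m≤o M N ≤m
        M≤n = ℕ.m⊔n≤o⇒m≤o M N ≤n
        N≤m = ℕ.m⊔n≤o⇒n≤o M N ≤m
        N≤n = ℕ.m⊔n≤o⇒n≤o M N ≤n
    in product-close {seq x m} {seq y m} {seq x n} {seq y n} B>0 C>0 Bδ₁ Cδ₂
         (b₁ m (ℕ.m⊔n≤o⇒m≤o M₁ M₂ M≤m)) (b₂ n (ℕ.m⊔n≤o⇒n≤o M₁ M₂ M≤n))
         (p₂ m n (ℕ.m⊔n≤o⇒n≤o N₁ N₂ N≤m) (ℕ.m⊔n≤o⇒n≤o N₁ N₂ N≤n))
         (p₁ m n (ℕ.m⊔n≤o⇒m≤o N₁ N₂ N≤m) (ℕ.m⊔n≤o⇒m≤o N₁ N₂ N≤n))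

_*ᴿ_ : ℝ → ℝ → ℝ
(x *ᴿ y) .seq n = seq x n ℚ.* seq y n
(x *ᴿ y) .cauchy = *-cauchy x y

-- The greatest a ≤ N satisfying P, or 0 if there is none.
greatest : {P : ℕ → Set} → (∀ a → Dec (P a)) → ℕ → ℕ
greatest P? zero    = 0
greatest P? (suc N) = if does (P? (suc N)) then suc N else greatest P? N

greatest-sat : ∀ {P : ℕ → Set} (P? : ∀ a → Dec (P a)) N →
               greatest P? N ≡ 0 ⊎ P (greatest P? N)
greatest-sat P? zero = inj₁ refl
greatest-sat P? (suc N) with P? (suc N)
... | yes p = inj₂ p
... | no _  = greatest-sat P? N

greatest-max : ∀ {P : ℕ → Set} (P? : ∀ a → Dec (P a)) N →
               ¬ P (suc N) → ¬ P (suc (greatest P? N))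
greatest-max P? zero    ¬p = ¬p
greatest-max P? (suc N) ¬p with P? (suc N)
... | yes _ = ¬p
... | no ¬q = greatest-max P? N ¬q

grid : ℕ → ℕ → ℚ
grid n a = ℕ→ℚ a ℚ.* 1/suc n

0≤grid : ∀ n a → 0ℚ ℚ.≤ grid n a
0≤grid n a = 0≤* (0≤ℕ→ℚ a) (0≤1/suc n)

grid-suc : ∀ n a → grid n (suc a) ≡ grid n a ℚ.+ 1/suc n
grid-suc n a = trans (cong (ℚ._* 1/suc n) (ℕ→ℚ-suc a))
  (trans (ℚ.*-distribʳ-+ (1/suc n) (ℕ→ℚ a) 1ℚ)
    (cong (grid n a ℚ.+_) (ℚ.*-identityˡ (1/suc n))))

grid-integer : ∀ n M → grid n (suc n ℕ.* M) ≡ ℕ→ℚ M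
grid-integer n M = begin-equality
  ℕ→ℚ (suc n ℕ.* M) ℚ.* 1/suc n
    ≡⟨ cong (ℚ._* 1/suc n) (ℕ→ℚ-* (suc n) M) ⟩
  ℕ→ℚ (suc n) ℚ.* ℕ→ℚ M ℚ.* 1/suc n
    ≡⟨ solve 3 (λ a b c → a :* b :* c := a :* c :* b) refl (ℕ→ℚ (suc n)) (ℕ→ℚ M) (1/suc n) ⟩
  ℕ→ℚ (suc n) ℚ.* 1/suc n ℚ.* ℕ→ℚ M
    ≡⟨ cong (ℚ._* ℕ→ℚ M) (1/suc-inverse n) ⟩
  1ℚ ℚ.* ℕ→ℚ M
    ≡⟨ ℚ.*-identityˡ (ℕ→ℚ M) ⟩
  ℕ→ℚ M ∎

a<a+1 : ∀ a → a ℚ.< a ℚ.+ 1ℚ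
a<a+1 a = subst (ℚ._< a ℚ.+ 1ℚ) (ℚ.+-identityʳ a) (ℚ.+-monoʳ-< a (ℚ.positive⁻¹ 1ℚ))

≤grid-suc : ∀ n K {a} → a ≡ grid n K → a ℚ.≤ grid n (suc K)
≤grid-suc n K {a} eq = begin
  a                      ≡⟨ ℚ.+-identityʳ a ⟨
  a ℚ.+ 0ℚ               ≤⟨ ℚ.+-monoʳ-≤ a (0≤1/suc n) ⟩
  a ℚ.+ 1/suc n          ≡⟨ cong (ℚ._+ 1/suc n) eq ⟩
  grid n K ℚ.+ 1/suc n   ≡⟨ grid-suc n K ⟨
  grid n (suc K)         ∎

rootBound : ∀ k {x a b g} → x ℚ.≤ a → 0ℚ ℚ.≤ a → b ≡ a ℚ.+ 1ℚ → b ℚ.≤ g → x ℚ.< g ^ℚ suc k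
rootBound k {x} {a} {b} {g} x≤a 0≤a b≡a+1 b≤g = begin-strict
  x           ≤⟨ x≤a ⟩
  a           <⟨ a<a+1 a ⟩
  a ℚ.+ 1ℚ    ≡⟨ b≡a+1 ⟨
  b           ≤⟨ b≤g ⟩
  g           ≤⟨ a≤pow k (ℚ.≤-trans 1≤b b≤g) ⟩
  g ^ℚ suc k  ∎
  where
  1≤b : 1ℚ ℚ.≤ b
  1≤b = begin
    1ℚ          ≡⟨ ℚ.+-identityˡ 1ℚ ⟨
    0ℚ ℚ.+ 1ℚ   ≤⟨ ℚ.+-monoˡ-≤ 1ℚ 0≤a ⟩
    a ℚ.+ 1ℚ    ≡⟨ b≡a+1 ⟨
    b           ∎

rootNumerator-bound : ∀ k x n → x ℚ.< grid n (suc (suc n ℕ.* suc ℤ.∣ ↥ x ∣)) ^ℚ suc k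
rootNumerator-bound k x n = rootBound k (x≤∣↥x∣ x) (0≤ℕ→ℚ ℤ.∣ ↥ x ∣) (ℕ→ℚ-suc ℤ.∣ ↥ x ∣)
  (≤grid-suc n (suc n ℕ.* suc ℤ.∣ ↥ x ∣) (sym (grid-integer n (suc ℤ.∣ ↥ x ∣))))

opaque
  -- ⌊ (suc n) * x^(1/k) ⌋ when x ≥ 0 and k ≥ 1; the last argument of greatest
  -- is just an upper bound for it.
  rootNumerator : ℕ → ℚ → ℕ → ℕ
  rootNumerator k x n = greatest (λ a → grid n a ^ℚ k ℚ.≤? x) (suc n ℕ.* suc ℤ.∣ ↥ x ∣)

  rootNumerator-sat : ∀ k x n → rootNumerator k x n ≡ 0 ⊎ grid n (rootNumerator k x n) ^ℚ k ℚ.≤ x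
  rootNumerator-sat k x n =
    greatest-sat {λ a → grid n a ^ℚ k ℚ.≤ x} (λ a → grid n a ^ℚ k ℚ.≤? x) (suc n ℕ.* suc ℤ.∣ ↥ x ∣)

  rootNumerator-max : ∀ k x n → ¬ grid n (suc (rootNumerator (suc k) x n)) ^ℚ suc k ℚ.≤ x
  rootNumerator-max k x n =
    greatest-max {λ a → grid n a ^ℚ suc k ℚ.≤ x} (λ a → grid n a ^ℚ suc k ℚ.≤? x) (suc n ℕ.* suc ℤ.∣ ↥ x ∣)
      (λ p → ℚ.<-irrefl refl (ℚ.<-≤-trans (rootNumerator-bound k x n) p))

rootApprox : ℕ → ℚ → ℕ → ℚ
rootApprox k x n = grid n (rootNumerator k x n)

rootApprox-lower : ∀ k x n → rootApprox k x n ≡ 0ℚ ⊎ rootApprox k x n ^ℚ k ℚ.≤ x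
rootApprox-lower k x n =
  Sum.map₁ (λ eq → trans (cong (grid n) eq) (ℚ.*-zeroˡ (1/suc n))) (rootNumerator-sat k x n)

rootApprox-upper : ∀ k x n → x ℚ.< (rootApprox (suc k) x n ℚ.+ 1/suc n) ^ℚ suc k
rootApprox-upper k x n = subst (λ z → x ℚ.< z ^ℚ suc k) (grid-suc n (rootNumerator (suc k) x n))
  (ℚ.≰⇒> (rootNumerator-max k x n))

rootApprox-close : ∀ k x y m n {δ ε} → Positive δ → δ ℚ.+ δ ≡ ε → 1/suc n ℚ.≤ δ →
  x ℚ.≤ y ℚ.+ δ ^ℚ suc k → rootApprox (suc k) x m ℚ.≤ rootApprox (suc k) y n ℚ.+ ε
rootApprox-close k x y m n {δ} {ε} δ>0 2δ≡ε u≤δ x≤y = begin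
  a                       ≤⟨ [ (λ eq → subst (ℚ._≤ b ℚ.+ u ℚ.+ δ) (sym eq) 0≤b+u+δ) , cancel ]′
                               (rootApprox-lower (suc k) x m) ⟩
  b ℚ.+ u ℚ.+ δ           ≤⟨ ℚ.+-monoˡ-≤ δ (ℚ.+-monoʳ-≤ b u≤δ) ⟩
  b ℚ.+ δ ℚ.+ δ           ≡⟨ ℚ.+-assoc b δ δ ⟩
  b ℚ.+ (δ ℚ.+ δ)         ≡⟨ cong (b ℚ.+_) 2δ≡ε ⟩
  b ℚ.+ ε                 ∎
  where
  a = rootApprox (suc k) x m
  b = rootApprox (suc k) y n
  u = 1/suc n
  0≤δ = ℚ.<⇒≤ (ℚ.positive⁻¹ δ {{δ>0}})
  0≤b+u = 0≤+ (0≤grid n (rootNumerator (suc k) y n)) (0≤1/suc n)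
  0≤b+u+δ = 0≤+ 0≤b+u 0≤δ
  cancel : a ^ℚ suc k ℚ.≤ x → a ℚ.≤ b ℚ.+ u ℚ.+ δ
  cancel aᵏ≤x = pow-cancel (suc k) 0≤b+u+δ (begin-strict
    a ^ℚ suc k                            ≤⟨ aᵏ≤x ⟩
    x                                     ≤⟨ x≤y ⟩
    y ℚ.+ δ ^ℚ suc k                      <⟨ ℚ.+-monoˡ-< (δ ^ℚ suc k) (rootApprox-upper k y n) ⟩
    (b ℚ.+ u) ^ℚ suc k ℚ.+ δ ^ℚ suc k     ≤⟨ pow-super k 0≤b+u 0≤δ ⟩
    (b ℚ.+ u ℚ.+ δ) ^ℚ suc k              ∎)

root-cauchy : ∀ k → .{{NonZero k}} → ∀ x ε → Positive ε → ∃ λ N → ∀ m n → N ℕ.≤ m → N ℕ.≤ n →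
  ℚ.∣ rootApprox k (seq x m) m ℚ.- rootApprox k (seq x n) n ∣ ℚ.≤ ε
root-cauchy zero    x ε ε>0 = contradiction refl (ℕ.≢-nonZero⁻¹ 0)
root-cauchy (suc k) x ε ε>0
  with archimedean (½ ℚ.* ε) (half-pos ε ε>0)
     | cauchy x ((½ ℚ.* ε) ^ℚ suc k) (pow-pos (suc k) (½ ℚ.* ε) (half-pos ε ε>0))
... | N₁ , p₁ | N₂ , p₂ = N₁ ℕ.⊔ N₂ , λ m n N≤m N≤n →
  ≤⇒∣-∣ (rootApprox (suc k) (seq x m) m) (rootApprox (suc k) (seq x n) n)
    (close m n N≤m N≤n) (close n m N≤n N≤m)
  where
  close : ∀ m n → N₁ ℕ.⊔ N₂ ℕ.≤ m → N₁ ℕ.⊔ N₂ ℕ.≤ n →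
          rootApprox (suc k) (seq x m) m ℚ.≤ rootApprox (suc k) (seq x n) n ℚ.+ ε
  close m n N≤m N≤n = rootApprox-close k (seq x m) (seq x n) m n
    (half-pos ε ε>0) (½+½ ε) (p₁ n (ℕ.m⊔n≤o⇒m≤o N₁ N₂ N≤n))
    (∣-∣⇒≤ (seq x m) (seq x n) (p₂ m n (ℕ.m⊔n≤o⇒n≤o N₁ N₂ N≤m) (ℕ.m⊔n≤o⇒n≤o N₁ N₂ N≤n)))

-- The nonnegative k-th root of max(x, 0).
root : ∀ k → .{{NonZero k}} → ℝ → ℝ
root k x .seq n = rootApprox k (seq x n) n
root k x .cauchy = root-cauchy k x

infixr 8 _^ᴿ_

-- Rational powers of natural numbers: a^(s/t) is the t-th root of a^s.
_^ᴿ_ : ℕ → (r : ℚ) → .{{NonNegative r}} → ℝ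
a ^ᴿ r = root (↧ₙ r) (fromℕ (a ℕ.^ ℤ.∣ ↥ r ∣))

record ℂ : Set where
  constructor _+i_
  field
    re im : ℝ

open ℂ

ℂ-rawRing : RawRing 0ℓ 0ℓ
ℂ-rawRing = record
  { Carrier = ℂ
  ; _≈_     = λ z w → re z ≈ᴿ re w × im z ≈ᴿ im w
  ; _+_     = λ z w → (re z +ᴿ re w) +i (im z +ᴿ im w)
  ; _*_     = λ z w → (re z *ᴿ re w +ᴿ -ᴿ (im z *ᴿ im w)) +i (re z *ᴿ im w +ᴿ im z *ᴿ re w)
  ; -_      = λ z → (-ᴿ re z) +i (-ᴿ im z)
  ; 0#      = fromℕ 0 +i fromℕ 0
  ; 1#      = fromℕ 1 +i fromℕ 0
  }

module ℂ-Ring = RawRing ℂ-rawRing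

open RawSemiringDefinitions ℂ-Ring.rawSemiring using () renaming (sum to ∑)

modulus : ℂ → ℝ
modulus z = root 2 (re z *ᴿ re z +ᴿ im z *ᴿ im z)

-- Since _≈_ on a finite field is decidable, the apartness of a finite Heyting
-- field is necessarily the negation of _≈_: these are the usual finite fields.
record FiniteField (q : ℕ) : Set₁ where
  field
    heytingField : HeytingField 0ℓ 0ℓ 0ℓ

  open HeytingField heytingField using (heytingCommutativeRing)
  open CommutativeRing (HeytingCommutativeRing.commutativeRing heytingCommutativeRing) public
    using (Carrier; +-rawMonoid; rawRing) renaming (setoid to carrierSetoid)

  field
    enumeration : Inverse (setoid (Fin q)) carrierSetoid

module _ {q : ℕ} (F : FiniteField q) where
  open FiniteField F
  open RawSemiringDefinitions (RawRing.rawSemiring rawRing) using (_^_)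

  -- Preserving the units forces the values to be nonzero (and, the additive
  -- group being finite, roots of unity).
  IsAdditiveCharacter : (Carrier → ℂ) → Set
  IsAdditiveCharacter = IsMonoidHomomorphism
    where open MonoidMorphisms +-rawMonoid ℂ-Ring.*-rawMonoid

  NonTrivialCharacter : (Carrier → ℂ) → Set
  NonTrivialCharacter ψ = ∃ λ x → ¬ ψ x ℂ-Ring.≈ ℂ-Ring.1#

  monomialSum : (Carrier → ℂ) → ℕ → ℂ
  monomialSum ψ n = ∑ λ i → ψ (Inverse.to enumeration i ^ n)

p^ν∸1≢0 : ∀ {p} → Prime p → ∀ ν → .{{NonZero ν}} → NonZero (p ℕ.^ ν ∸ 1)
p^ν∸1≢0 {p} p-prime ν = ℕ.>-nonZero (ℕ.m<n⇒0<n∸m (ℕ.^-monoʳ-< p 1<p (ℕ.>-nonZero⁻¹ ν)))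
  where
  1<p = ℕ.nonTrivial⇒n>1 p {{prime⇒nonTrivial p-prime}}

-- δ₂ is the exponent without its o(1), which stands for a factor (log q)^A.
-- In the bound that factor appears as ⌈log₂ q⌉^A: for q ≥ 2, ⌈log₂ q⌉ and log q
-- differ by at most an absolute constant factor, which a real constant absorbs.
δ δ₂ : ℚ
δ  = ℤ.+ 119 ℚ./ 605
δ₂ = ℤ.+ 1 ℚ./ 56

-- The hypothesis on gcd (n, (p^m - 1)/(p^ν - 1)), with implied constant K. The
-- natural number division is exact because ν ∣ m.
GcdBound : ℝ → (p m n : ℕ) → Prime p → Set
GcdBound K p m n p-prime = ∀ ν → .{{_ : NonZero ν}} → ν ∣ m → ν ≢ m →
  fromℕ (gcd n (((p ℕ.^ m ∸ 1) ℕ./ (p ℕ.^ ν ∸ 1)) {{p^ν∸1≢0 p-prime ν}}))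
    ≤ᴿ K *ᴿ (n ^ᴿ δ *ᴿ (p ℕ.^ m) ^ᴿ (1ℚ ℚ.- δ) *ᴿ fromℚ (1/p^ ν))
  where
  1/p^_ : ℕ → ℚ
  1/p^ ν = (ℤ.+ 1 ℚ./ (p ℕ.^ ν)) {{ℕ.m^n≢0 p ν {{prime⇒nonZero p-prime}}}}

{-# OPTIONS --safe #-}
module Submission where

-- Let H be the group of n-th powers of nonzero elements, N = |H| and κ = (q - 1) / N ≤ n. The sum is 1 + κ g(1), where
-- g, the Fourier transform of H, is constant on H. Averaging |g|² over H gives |g(1)|² ≪ q. Averaging g² over H and using
-- Cauchy-Schwarz and the fourth moment of g gives |g(1)|⁸ ≪ q E², where E ≤ N² (1 + ρ) is the additive energy of H and
-- ρ the largest number of representations of a nonzero element as a sum of two elements of H. The first bound suffices if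
-- N^19 ≥ q^10, and the second one, with ρ^56 ≪ N^55, otherwise.
--
-- To bound ρ, replace H by ±H and let S = {s ∈ H : s - 1 ∈ pH} have σ elements, where p has ρ representations. Two dilates
-- of S by elements of H usually have a large intersection, which makes x - y a popular difference of pH for most x, y ∈ S.
-- As there are few popular differences, large subsets T of S have small difference sets with their dilates, and by the
-- inequalities of Petridis and Ruzsa so have iterated difference sets D of their union. Let R be the set of ratios
-- (a - b) / (c - d) with a, b, c, d in a suitable A₁ ⊆ S. If R is not closed under addition of 1 and multiplication
-- by E = A₁ / b₀, some (x , y) ↦ v x + w y is injective on T × T with values in such a D, which gives σ^44 ≪ N^43.
-- Otherwise there is a subfield between E and R. If it is proper, the hypothesis bounds its intersection with H; if not,
-- R is the whole field, and for an average ξ ∈ R the map given by v = 1 and w = - ξ has few collisions on H × H,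
-- so that q σ^46 ≪ N^43 (N^4 + q N²).

open import Defs
open import Data.Nat.Base using (ℕ; NonZero; _^_; _∸_)
open import Data.Nat.Divisibility using (_∣_)
open import Data.Nat.Logarithm using (⌈log₂_⌉)
open import Data.Nat.Primality using (Prime)
open import Data.Product.Base using (Σ)
open import Data.Rational.Base using (_/_) renaming (_+_ to _+ℚ_; _-_ to _-ℚ_; _*_ to _*ℚ_)

open import Algebra.Apartness.Bundles using (HeytingField)
open import Algebra.Bundles using (CommutativeRing)
open import Algebra.Bundles.Raw using (RawRing)
import Algebra.Definitions.RawSemiring as RawSemiringDefinitions
import Algebra.Morphism.RingMonomorphism as RingMonomorphism
open import Algebra.Morphism.Structures using (module RingMorphisms; module MonoidMorphisms)
import Algebra.Properties.CommutativeMonoid.Sum as CommutativeMonoidSum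
import Algebra.Properties.Ring as RingProperties
import Algebra.Properties.Semiring.Mult as SemiringMult
import Algebra.Properties.Semiring.Sum as SemiringSum
import Algebra.Solver.Ring as RingSolver
open import Algebra.Solver.Ring.AlmostCommutativeRing using (fromCommutativeRing; _-Raw-AlmostCommutative⟶_)
open import Algebra.Structures using (IsCommutativeRing)
open import Data.Bool.Base using (true; if_then_else_)
open import Data.Fin.Base using (Fin; zero; suc)
open import Data.Fin.Patterns using (0F; 1F; 2F; 3F; 4F)
open import Data.Fin.Permutation using (permutation)
import Data.Fin.Properties as Fin
import Data.Fin.Subset as Subset
import Data.Fin.Subset.Properties as Subset
import Data.Integer.Base as ℤ
open import Data.List.Base using (List; []; _∷_; filter; allFin)
import Data.List.Membership.DecPropositional as DecMembership
open import Data.List.Membership.Propositional.Properties using (∈-filter⁺; ∈-filter⁻; ∈-allFin)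
open import Data.List.Relation.Unary.Any using (here; there)
open import Data.Maybe.Base using (Maybe; just; nothing)
import Data.Nat.Base as ℕ
open import Data.Nat.Base
  using (zero; suc; _+_; _*_; _≤_; _<_; z≤n; s≤s; >-nonZero; >-nonZero⁻¹; nonTrivial⇒n>1)
import Data.Nat.DivMod as ℕ
open import Data.Nat.Divisibility
  using (divides; ∣m∣n⇒∣m+n; ∣-refl; _∣0; ∣m+n∣m⇒∣n; ∣⇒≤; m∣m*n; ∣1⇒≡1)
open import Data.Nat.GCD using (gcd; gcd-GCD; c*gcd[m,n]≡gcd[cm,cn]; module Bézout; gcd[m,n]≢0; gcd-comm)
open import Data.Nat.Primality using (prime⇒nonZero; prime⇒nonTrivial; euclidsLemma)
import Data.Nat.Properties as ℕ
import Data.Nat.Tactic.RingSolver as ℕ-Solver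
import Data.Product.Base as Product
open import Data.Product.Base using (∃; _×_; _,_; proj₁; proj₂)
import Data.Product.Properties as Product
import Data.Rational.Base as ℚ
open import Data.Rational.Base using (ℚ; 0ℚ; 1ℚ; ½; Positive)
import Data.Rational.Properties as ℚ
import Data.Rational.Solver as ℚ-Solver
import Data.Sum.Base as Sum
open import Data.Sum.Base using (_⊎_; inj₁; inj₂; [_,_]′)
open import Data.Unit.Base using (⊤; tt)
import Data.Vec.Base as Vec
open import Data.Vec.Base using (Vec; _∷_; []; replicate)
import Data.Vec.Functional as Vector
import Data.Vec.Properties as Vec
open import Function.Base using (_∘_; id)
open import Function.Bundles using (Inverse)
open import Level using (0ℓ)
import Relation.Binary.Reasoning.Setoid as SetoidReasoning
open import Relation.Binary.PropositionalEquality
  using (_≡_; _≢_; refl; sym; trans; cong; cong₂; subst; subst₂; module ≡-Reasoning)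
open import Relation.Nullary.Decidable
  using (Dec; does; yes; no; _×-dec_; _⊎-dec_; _→-dec_; ¬?; decidable-stable)
open import Relation.Nullary.Negation using (¬_; contradiction)
open import Algebra.Properties.Semiring.Sum ℕ.+-*-semiring
  using (sum; sum-cong-≗; ∑-distrib-+; ∑-comm; sum-permute; *-distribˡ-sum; *-distribʳ-sum; sum-replicate-zero)
open import Algebra.Properties.CommutativeSemiring.Exp (CommutativeRing.commutativeSemiring ℚ.+-*-commutativeRing)
  using () renaming (^-distrib-* to ^ℚ-distrib-*; ^-assocʳ to ^ℚ-*-assoc)
open RawSemiringDefinitions ℚ.+-*-rawSemiring using () renaming (_^_ to _^ℚ_)

open ℝ
open ℂ

-- The integer a - b is represented by the pair (a , b) with a = 0 or b = 0.
module IntegerSolver {c ℓ} (R : CommutativeRing c ℓ) where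
  private
    module R = CommutativeRing R
    open RingProperties R.ring
    open SemiringMult R.semiring using () renaming (_×_ to _·_; ×-homo-+ to ·-homo-+; ×1-homo-* to ·1-homo-*)
    open import Relation.Binary.Reasoning.Setoid R.setoid

    reduce : ℕ × ℕ → ℕ × ℕ
    reduce (zero  , b)     = zero , b
    reduce (suc a , zero)  = suc a , zero
    reduce (suc a , suc b) = reduce (a , b)

    add mul : ℕ × ℕ → ℕ × ℕ → ℕ × ℕ
    add (a , b) (a′ , b′) = a + a′ , b + b′
    mul (a , b) (a′ , b′) = a * a′ + b * b′ , a * b′ + b * a′

    minus : ℕ × ℕ → ℕ × ℕ
    minus (a , b) = b , a

    coefficients : RawRing 0ℓ 0ℓ
    coefficients = record
      { Carrier = ℕ × ℕ
      ; _≈_ = _≡_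
      ; _+_ = λ x y → reduce (add x y)
      ; _*_ = λ x y → reduce (mul x y)
      ; -_  = minus
      ; 0#  = 0 , 0
      ; 1#  = 1 , 0
      }

    ν : ℕ → R.Carrier
    ν zero          = R.0#
    ν (suc zero)    = R.1#
    ν (suc (suc a)) = R.1# R.+ ν (suc a)

    ν-· : ∀ a → ν a R.≈ a · R.1#
    ν-· zero          = R.refl
    ν-· (suc zero)    = R.sym (R.+-identityʳ R.1#)
    ν-· (suc (suc a)) = R.+-congˡ (ν-· (suc a))

    ⟦_⟧ : ℕ × ℕ → R.Carrier
    ⟦ a , zero ⟧  = ν a
    ⟦ a , suc b ⟧ = ν a R.- ν (suc b)

    δ⟦_⟧ : ℕ × ℕ → R.Carrier
    δ⟦ a , b ⟧ = a · R.1# R.- b · R.1#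

    ⟦⟧-δ : ∀ x → ⟦ x ⟧ R.≈ δ⟦ x ⟧
    ⟦⟧-δ (a , zero)  = R.trans (ν-· a) (R.sym (R.trans (R.+-congˡ -0#≈0#) (R.+-identityʳ _)))
    ⟦⟧-δ (a , suc b) = R.+-cong (ν-· a) (R.-‿cong (ν-· (suc b)))

    swap⁴ : ∀ u v w z → (u R.+ v) R.+ (w R.+ z) R.≈ (u R.+ w) R.+ (v R.+ z)
    swap⁴ u v w z = begin
      (u R.+ v) R.+ (w R.+ z)   ≈⟨ R.+-assoc u v _ ⟩
      u R.+ (v R.+ (w R.+ z))   ≈⟨ R.+-congˡ (R.sym (R.+-assoc v w z)) ⟩
      u R.+ ((v R.+ w) R.+ z)   ≈⟨ R.+-congˡ (R.+-congʳ (R.+-comm v w)) ⟩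
      u R.+ ((w R.+ v) R.+ z)   ≈⟨ R.+-congˡ (R.+-assoc w v z) ⟩
      u R.+ (w R.+ (v R.+ z))   ≈⟨ R.+-assoc u w _ ⟨
      (u R.+ w) R.+ (v R.+ z)   ∎

    reduce-δ : ∀ x → δ⟦ reduce x ⟧ R.≈ δ⟦ x ⟧
    reduce-δ (zero  , b)     = R.refl
    reduce-δ (suc a , zero)  = R.refl
    reduce-δ (suc a , suc b) = R.trans (reduce-δ (a , b)) (R.sym (begin
      (R.1# R.+ a · R.1#) R.- (R.1# R.+ b · R.1#)
        ≈⟨ R.+-congˡ (R.sym (-‿+-comm R.1# (b · R.1#))) ⟩
      (R.1# R.+ a · R.1#) R.+ (R.- R.1# R.- b · R.1#)
        ≈⟨ swap⁴ _ _ _ _ ⟩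
      (R.1# R.- R.1#) R.+ (a · R.1# R.- b · R.1#)
        ≈⟨ R.trans (R.+-congʳ (R.-‿inverseʳ R.1#)) (R.+-identityˡ _) ⟩
      a · R.1# R.- b · R.1# ∎))

    homo : _-Raw-AlmostCommutative⟶_ coefficients (fromCommutativeRing R)
    homo = record
      { ⟦_⟧    = ⟦_⟧
      ; +-homo = λ x y → R.trans (via (add x y)) (R.trans (+-homo x y) (R.+-cong (R.sym (⟦⟧-δ x)) (R.sym (⟦⟧-δ y))))
      ; *-homo = λ x y → R.trans (via (mul x y)) (R.trans (*-homo x y) (R.*-cong (R.sym (⟦⟧-δ x)) (R.sym (⟦⟧-δ y))))
      ; -‿homo = λ x → R.trans (⟦⟧-δ (minus x)) (R.trans (-‿homo x) (R.-‿cong (R.sym (⟦⟧-δ x))))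
      ; 0-homo = R.refl
      ; 1-homo = R.refl
      }
      where
      via : ∀ x → ⟦ reduce x ⟧ R.≈ δ⟦ x ⟧
      via x = R.trans (⟦⟧-δ (reduce x)) (reduce-δ x)
      +-homo : ∀ x y → δ⟦ add x y ⟧ R.≈ δ⟦ x ⟧ R.+ δ⟦ y ⟧
      +-homo (a , b) (a′ , b′) = begin
        (a + a′) · R.1# R.- (b + b′) · R.1#
          ≈⟨ R.+-cong (·-homo-+ R.1# a a′) (R.trans (R.-‿cong (·-homo-+ R.1# b b′)) (R.sym (-‿+-comm _ _))) ⟩
        (a · R.1# R.+ a′ · R.1#) R.+ (R.- (b · R.1#) R.- b′ · R.1#)
          ≈⟨ swap⁴ _ _ _ _ ⟩
        (a · R.1# R.- b · R.1#) R.+ (a′ · R.1# R.- b′ · R.1#) ∎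
      -‿homo : ∀ x → δ⟦ minus x ⟧ R.≈ R.- δ⟦ x ⟧
      -‿homo (a , b) = begin
        b · R.1# R.- a · R.1#                 ≈⟨ R.+-comm _ _ ⟩
        R.- (a · R.1#) R.+ b · R.1#           ≈⟨ R.+-congˡ (-‿involutive _) ⟨
        R.- (a · R.1#) R.- (R.- (b · R.1#))   ≈⟨ -‿+-comm _ _ ⟩
        R.- (a · R.1# R.- b · R.1#)           ∎
      *-homo : ∀ x y → δ⟦ mul x y ⟧ R.≈ δ⟦ x ⟧ R.* δ⟦ y ⟧
      *-homo (a , b) (a′ , b′) = R.sym (begin
        (A R.- B) R.* (A′ R.- B′)
          ≈⟨ R.distribʳ _ A (R.- B) ⟩
        A R.* (A′ R.- B′) R.+ (R.- B) R.* (A′ R.- B′)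
          ≈⟨ R.+-cong (R.distribˡ A A′ (R.- B′)) (R.distribˡ (R.- B) A′ (R.- B′)) ⟩
        (A R.* A′ R.+ A R.* (R.- B′)) R.+ ((R.- B) R.* A′ R.+ (R.- B) R.* (R.- B′))
          ≈⟨ R.+-congˡ (R.+-comm _ _) ⟩
        (A R.* A′ R.+ A R.* (R.- B′)) R.+ ((R.- B) R.* (R.- B′) R.+ (R.- B) R.* A′)
          ≈⟨ swap⁴ _ _ _ _ ⟩
        (A R.* A′ R.+ (R.- B) R.* (R.- B′)) R.+ (A R.* (R.- B′) R.+ (R.- B) R.* A′)
          ≈⟨ R.+-cong (R.+-cong (mult a a′) (R.trans (R.sym (-‿distribˡ-* B (R.- B′)))
               (R.trans (R.-‿cong (R.sym (-‿distribʳ-* B B′))) (R.trans (-‿involutive _) (mult b b′)))))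
             (R.trans (R.+-cong (R.trans (R.sym (-‿distribʳ-* A B′)) (R.-‿cong (mult a b′)))
                                (R.trans (R.sym (-‿distribˡ-* B A′)) (R.-‿cong (mult b a′))))
                      (-‿+-comm _ _)) ⟩
        ((a * a′) · R.1# R.+ (b * b′) · R.1#) R.- ((a * b′) · R.1# R.+ (b * a′) · R.1#)
          ≈⟨ R.+-cong (·-homo-+ R.1# (a * a′) (b * b′)) (R.-‿cong (·-homo-+ R.1# (a * b′) (b * a′))) ⟨
        (a * a′ + b * b′) · R.1# R.- (a * b′ + b * a′) · R.1# ∎)
        where
        A = a · R.1#
        B = b · R.1#
        A′ = a′ · R.1#
        B′ = b′ · R.1#
        mult : ∀ m n → (m · R.1#) R.* (n · R.1#) R.≈ (m * n) · R.1#
        mult m n = R.sym (·1-homo-* m n)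

    dec : ∀ x y → Maybe (⟦ x ⟧ R.≈ ⟦ y ⟧)
    dec x y with Product.≡-dec ℕ._≟_ ℕ._≟_ x y
    ... | yes refl = just R.refl
    ... | no _     = nothing

  open RingSolver coefficients (fromCommutativeRing R) homo dec public
    using (solve; con; _:=_; _:+_; _:*_; _:-_; :-_)

𝟙 : {P : Set} → Dec P → ℕ
𝟙 d = if does d then 1 else 0

𝟙-yes : {P : Set} (d : Dec P) → P → 𝟙 d ≡ 1
𝟙-yes (yes _) _ = refl
𝟙-yes (no ¬p) p = contradiction p ¬p

module _ {P : Set} where

  𝟙≤1 : (d : Dec P) → 𝟙 d ≤ 1
  𝟙≤1 (yes _) = ℕ.≤-refl
  𝟙≤1 (no _)  = z≤n

  𝟙-no : (d : Dec P) → ¬ P → 𝟙 d ≡ 0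
  𝟙-no (yes p) ¬p = contradiction p ¬p
  𝟙-no (no _)  _  = refl

  𝟙-mono : {Q : Set} (d : Dec P) (e : Dec Q) → (P → Q) → 𝟙 d ≤ 𝟙 e
  𝟙-mono (yes p) e f = ℕ.≤-reflexive (sym (𝟙-yes e (f p)))
  𝟙-mono (no _)  e f = z≤n

  𝟙-cong : {Q : Set} (d : Dec P) (e : Dec Q) → (P → Q) → (Q → P) → 𝟙 d ≡ 𝟙 e
  𝟙-cong (yes _) (yes _) _ _ = refl
  𝟙-cong (yes p) (no ¬q) f _ = contradiction (f p) ¬q
  𝟙-cong (no ¬p) (yes q) _ g = contradiction (g q) ¬p
  𝟙-cong (no _)  (no _)  _ _ = refl

  𝟙-idem : (d : Dec P) → 𝟙 d * 𝟙 d ≡ 𝟙 d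
  𝟙-idem (yes _) = refl
  𝟙-idem (no _)  = refl

  𝟙-× : {Q : Set} (d : Dec P) (e : Dec Q) → 𝟙 (d ×-dec e) ≡ 𝟙 d * 𝟙 e
  𝟙-× (yes _) (yes _) = refl
  𝟙-× (yes _) (no _)  = refl
  𝟙-× (no _)  _       = refl

∑-mono : ∀ {n} {f g : Fin n → ℕ} → (∀ i → f i ≤ g i) → sum f ≤ sum g
∑-mono {zero}  p = z≤n
∑-mono {suc n} p = ℕ.+-mono-≤ (p zero) (∑-mono (p ∘ suc))

∑-const : ∀ n c → sum {n} (λ _ → c) ≡ n * c
∑-const zero    c = refl
∑-const (suc n) c = cong (c +_) (∑-const n c)

term≤∑ : ∀ {n} (f : Fin n → ℕ) i → f i ≤ sum f
term≤∑ f zero    = ℕ.m≤m+n (f zero) _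
term≤∑ f (suc i) = ℕ.≤-trans (term≤∑ (f ∘ suc) i) (ℕ.m≤n+m _ (f zero))

∑-zero : ∀ {n} {f : Fin n → ℕ} → (∀ i → f i ≡ 0) → sum f ≡ 0
∑-zero {n} p = trans (sum-cong-≗ p) (sum-replicate-zero n)

∑-bij : ∀ {n} (f : Fin n → ℕ) (π π⁻¹ : Fin n → Fin n) →
        (∀ x → π (π⁻¹ x) ≡ x) → (∀ x → π⁻¹ (π x) ≡ x) → sum f ≡ sum (f ∘ π)
∑-bij f π π⁻¹ inv₁ inv₂ = sum-permute f (permutation π π⁻¹ inv₁ inv₂)

∑-atMostOne : ∀ {n} {P : Fin n → Set} (P? : ∀ x → Dec (P x)) →
              (∀ {x y} → P x → P y → x ≡ y) → sum (λ x → 𝟙 (P? x)) ≤ 1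
∑-atMostOne {zero}  P? u = z≤n
∑-atMostOne {suc n} {P} P? u with P? zero
... | yes p = ℕ.≤-reflexive (cong suc (∑-zero λ x → 𝟙-no (P? (suc x)) λ q → Fin.0≢1+n (u p q)))
... | no _  = ∑-atMostOne (P? ∘ suc) (λ p q → Fin.suc-injective (u p q))

∑²-distrib : ∀ {m n} (f : Fin m → ℕ) (g : Fin n → ℕ) → sum (λ i → sum (λ j → f i * g j)) ≡ sum f * sum g
∑²-distrib f g = trans (sum-cong-≗ (λ i → sym (*-distribˡ-sum (f i) g))) (sym (*-distribʳ-sum (sum g) f))

module Counting (q : ℕ) where

  infix 4 _∈_ _⊆_

  record FSet : Set₁ where
    constructor ⟨_⟩
    field
      {Mem} : Fin q → Set
      mem?  : ∀ x → Dec (Mem x)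

  open FSet public

  _∈_ : Fin q → FSet → Set
  x ∈ A = Mem A x

  _⊆_ : FSet → FSet → Set
  A ⊆ B = ∀ {x} → x ∈ A → x ∈ B

  ι : FSet → Fin q → ℕ
  ι A x = 𝟙 (mem? A x)

  opaque
    ⟦_⟧ : FSet → ℕ
    ⟦ A ⟧ = sum (ι A)

    ⟦⟧-sum : ∀ A → ⟦ A ⟧ ≡ sum (ι A)
    ⟦⟧-sum A = refl

  infixr 6 _∪_
  infixr 7 _∩_ _∖_

  _∪_ _∩_ _∖_ : FSet → FSet → FSet
  A ∪ B = ⟨ (λ x → mem? A x ⊎-dec mem? B x) ⟩
  A ∩ B = ⟨ (λ x → mem? A x ×-dec mem? B x) ⟩
  A ∖ B = ⟨ (λ x → mem? A x ×-dec ¬? (mem? B x)) ⟩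

  opaque
    unfolding ⟦_⟧

    ∣∣-mono : ∀ A B → A ⊆ B → ⟦ A ⟧ ≤ ⟦ B ⟧
    ∣∣-mono A B A⊆B = ∑-mono λ x → 𝟙-mono (mem? A x) (mem? B x) A⊆B

    ∣∣-cong : ∀ A B → A ⊆ B → B ⊆ A → ⟦ A ⟧ ≡ ⟦ B ⟧
    ∣∣-cong A B p q = ℕ.≤-antisym (∣∣-mono A B p) (∣∣-mono B A q)

    ∣∣-bij : ∀ A B (π π⁻¹ : Fin q → Fin q) → (∀ x → π (π⁻¹ x) ≡ x) → (∀ x → π⁻¹ (π x) ≡ x) →
             (∀ {x} → x ∈ A → π x ∈ B) → ⟦ A ⟧ ≤ ⟦ B ⟧
    ∣∣-bij A B π π⁻¹ inv₁ inv₂ p = ℕ.≤-trans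
      (∑-mono λ x → 𝟙-mono (mem? A x) (mem? B (π x)) p)
      (ℕ.≤-reflexive (sym (∑-bij (ι B) π π⁻¹ inv₁ inv₂)))

    ∣∪∣ : ∀ A B → ⟦ A ∪ B ⟧ ≤ ⟦ A ⟧ + ⟦ B ⟧
    ∣∪∣ A B = ℕ.≤-trans (∑-mono λ x → 𝟙-⊎ (mem? A x) (mem? B x))
      (ℕ.≤-reflexive (∑-distrib-+ (ι A) (ι B)))
      where
      𝟙-⊎ : {P Q : Set} (d : Dec P) (e : Dec Q) → 𝟙 (d ⊎-dec e) ≤ 𝟙 d + 𝟙 e
      𝟙-⊎ (yes _) e = s≤s z≤n
      𝟙-⊎ (no _) (yes _) = ℕ.≤-refl
      𝟙-⊎ (no _) (no _) = ℕ.≤-refl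

    ∣∖∣ : ∀ A B → B ⊆ A → ⟦ A ⟧ ≡ ⟦ B ⟧ + ⟦ A ∖ B ⟧
    ∣∖∣ A B B⊆A = trans (sum-cong-≗ λ x → split (mem? A x) (mem? B x) B⊆A) (∑-distrib-+ (ι B) (ι (A ∖ B)))
      where
      split : {P Q : Set} (d : Dec P) (e : Dec Q) → (Q → P) → 𝟙 d ≡ 𝟙 e + 𝟙 (d ×-dec ¬? e)
      split (yes _) (yes _) _ = refl
      split (yes _) (no _)  _ = refl
      split (no ¬p) (yes q) f = contradiction (f q) ¬p
      split (no _)  (no _)  _ = refl

    disjoint-+ : ∀ A B C → A ⊆ C → B ⊆ C → (∀ {x} → x ∈ A → ¬ x ∈ B) → ⟦ A ⟧ + ⟦ B ⟧ ≤ ⟦ C ⟧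
    disjoint-+ A B C A⊆C B⊆C d = ℕ.≤-trans (ℕ.≤-reflexive (sym (∑-distrib-+ (ι A) (ι B))))
      (∑-mono λ x → split (mem? A x) (mem? B x) (mem? C x) A⊆C B⊆C d)
      where
      split : {P Q R : Set} (d : Dec P) (e : Dec Q) (f : Dec R) → (P → R) → (Q → R) → (P → ¬ Q) → 𝟙 d + 𝟙 e ≤ 𝟙 f
      split (yes p) (yes q) _ _ _ n = contradiction q (n p)
      split (yes p) (no _)  f g _ _ = 𝟙-mono (yes p) f g
      split (no _)  e       f _ h _ = 𝟙-mono e f h

    ∣∣≥1 : ∀ A {x} → x ∈ A → 1 ≤ ⟦ A ⟧
    ∣∣≥1 A {x} p = ℕ.≤-trans (ℕ.≤-reflexive (sym (𝟙-yes (mem? A x) p))) (term≤∑ (ι A) x)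

    ∣∅∣ : ∀ A → (∀ {x} → ¬ x ∈ A) → ⟦ A ⟧ ≡ 0
    ∣∅∣ A ∉A = ∑-zero λ x → 𝟙-no (mem? A x) ∉A

    nonempty : ∀ A → 1 ≤ ⟦ A ⟧ → ∃ λ x → x ∈ A
    nonempty A p with Fin.any? (mem? A)
    ... | yes r = r
    ... | no ¬r = contradiction (ℕ.≤-trans p (ℕ.≤-reflexive (∑-zero λ x → 𝟙-no (mem? A x) (λ m → ¬r (x , m))))) λ()

  opaque
    unfolding ⟦_⟧

    ∣⋃∣ : ∀ {k} A (B : Fin k → FSet) → (∀ {x} → x ∈ A → ∃ λ i → x ∈ B i) → ⟦ A ⟧ ≤ sum (λ i → ⟦ B i ⟧)
    ∣⋃∣ A B cover = ℕ.≤-trans (∑-mono λ x → pointwise x (mem? A x) cover) (ℕ.≤-reflexive (∑-comm (λ x i → ι (B i) x)))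
      where
      pointwise : ∀ x {P : Set} (d : Dec P) → (P → ∃ λ i → x ∈ B i) → 𝟙 d ≤ sum (λ i → ι (B i) x)
      pointwise x (yes p) f = let i , x∈ = f p in
        ℕ.≤-trans (ℕ.≤-reflexive (sym (𝟙-yes (mem? (B i) x) x∈))) (term≤∑ (λ i → ι (B i) x) i)
      pointwise x (no _)  f = z≤n

  ⊇-by-size : ∀ A B → B ⊆ A → ⟦ A ⟧ ≤ ⟦ B ⟧ → A ⊆ B
  ⊇-by-size A B B⊆A A≤B {x} x∈A with mem? B x
  ... | yes r = r
  ... | no x∉B = contradiction (ℕ.≤-trans (ℕ.+-monoʳ-≤ ⟦ B ⟧ (∣∣≥1 (A ∖ B) (x∈A , x∉B)))
    (ℕ.≤-trans (ℕ.≤-reflexive (sym (∣∖∣ A B B⊆A))) (ℕ.≤-trans A≤B (ℕ.≤-reflexive (sym (ℕ.+-identityʳ _))))))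
    (λ le → contradiction (ℕ.+-cancelˡ-≤ ⟦ B ⟧ 1 0 le) λ())

  opaque
    unfolding ⟦_⟧

    fibre-≥ : ∀ (E : FSet) (f : Fin q → ℕ) k m → (∀ {t} → t ∈ E → k ≤ m * f t) → k * ⟦ E ⟧ ≤ m * sum f
    fibre-≥ E f k m p = begin
      k * ⟦ E ⟧                 ≡⟨ *-distribˡ-sum k (ι E) ⟩
      sum (λ t → k * ι E t)     ≤⟨ ∑-mono (λ t → step (mem? E t) p) ⟩
      sum (λ t → m * f t)       ≡⟨ *-distribˡ-sum m f ⟨
      m * sum f ∎
      where
      open ℕ.≤-Reasoning
      step : ∀ {t} {P : Set} (d : Dec P) → (P → k ≤ m * f t) → k * 𝟙 d ≤ m * f t
      step (yes p) h = ℕ.≤-trans (ℕ.≤-reflexive (ℕ.*-identityʳ k)) (h p)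
      step (no _)  h = ℕ.≤-trans (ℕ.≤-reflexive (ℕ.*-zeroʳ k)) z≤n

  ∑² : (Fin q → Fin q → ℕ) → ℕ
  ∑² f = sum λ x → sum λ y → f x y

  opaque
    unfolding ⟦_⟧

    ∣∣*∣∣ : ∀ A B → ∑² (λ x y → ι A x * ι B y) ≡ ⟦ A ⟧ * ⟦ B ⟧
    ∣∣*∣∣ A B = ∑²-distrib (ι A) (ι B)

record FieldOn (q : ℕ) : Set where
  infixl 6 _⊕_
  infixl 7 _⊗_
  infix  8 ⊖_
  field
    _⊕_ _⊗_  : Fin q → Fin q → Fin q
    ⊖_       : Fin q → Fin q
    𝟎 𝟏      : Fin q
    isCommutativeRing : IsCommutativeRing _≡_ _⊕_ _⊗_ ⊖_ 𝟎 𝟏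
    𝟎≢𝟏      : 𝟎 ≢ 𝟏
    inv      : Fin q → Fin q
    inv-𝟎    : inv 𝟎 ≡ 𝟎
    inverseʳ : ∀ {x} → x ≢ 𝟎 → x ⊗ inv x ≡ 𝟏

  commutativeRing : CommutativeRing 0ℓ 0ℓ
  commutativeRing = record { isCommutativeRing = isCommutativeRing }

module FieldSets {q : ℕ} (𝔽 : FieldOn q) where

  open FieldOn 𝔽 public
  open Counting q public
  open CommutativeRing commutativeRing public
    using ()
    renaming ( +-comm to ⊕-comm; +-assoc to ⊕-assoc; *-comm to ⊗-comm; *-assoc to ⊗-assoc
             ; zeroʳ to ⊗-zeroʳ; zeroˡ to ⊗-zeroˡ; *-identityʳ to ⊗-identityʳ; *-identityˡ to ⊗-identityˡ
             ; +-identityʳ to ⊕-identityʳ; +-identityˡ to ⊕-identityˡ; -‿inverseʳ to ⊖-inverseʳ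
             ; distribˡ to ⊗-distribˡ-⊕ )

  open IntegerSolver commutativeRing public

  infixl 6 _⊝_

  _⊝_ : Fin q → Fin q → Fin q
  x ⊝ y = x ⊕ ⊖ y

  ⊝⊕ : ∀ x y → x ⊝ y ⊕ y ≡ x
  ⊝⊕ = solve 2 (λ x y → x :- y :+ y := x) refl

  ⊕⊝ : ∀ x y → x ⊕ y ⊝ y ≡ x
  ⊕⊝ = solve 2 (λ x y → x :+ y :- y := x) refl

  ⊕⊝ˡ : ∀ x y → x ⊕ y ⊝ x ≡ y
  ⊕⊝ˡ = solve 2 (λ x y → x :+ y :- x := y) refl

  ⊝-⊝ : ∀ x y → x ⊝ (x ⊝ y) ≡ y
  ⊝-⊝ = solve 2 (λ x y → x :- (x :- y) := y) refl

  ⊖⊖ : ∀ x → ⊖ (⊖ x) ≡ x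
  ⊖⊖ = solve 1 (λ x → :- (:- x) := x) refl

  infixl 6 _⊞_

  _⊞_ : FSet → FSet → FSet
  U ⊞ W = ⟨ (λ t → Fin.any? λ x → mem? U x ×-dec mem? W (t ⊝ x)) ⟩

  neg : FSet → FSet
  neg U = ⟨ (λ x → mem? U (⊖ x)) ⟩

  shift : Fin q → FSet → FSet
  shift c U = ⟨ (λ x → mem? U (x ⊝ c)) ⟩

  ∈⊞ : ∀ U W {x y} → x ∈ U → y ∈ W → x ⊕ y ∈ U ⊞ W
  ∈⊞ U W {x} {y} p r = x , p , subst (_∈ W) (sym (⊕⊝ˡ x y)) r

  ∈⊞⁻ : ∀ U W {t} → t ∈ U ⊞ W → ∃ λ x → ∃ λ y → x ∈ U × y ∈ W × x ⊕ y ≡ t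
  ∈⊞⁻ U W {t} (x , p , r) = x , t ⊝ x , p , r , trans (⊕-comm x (t ⊝ x)) (⊝⊕ t x)

  ∈neg : ∀ U {x} → x ∈ U → ⊖ x ∈ neg U
  ∈neg U {x} = subst (_∈ U) (sym (⊖⊖ x))

  ⊞-mono : ∀ U U′ W W′ → U ⊆ U′ → W ⊆ W′ → U ⊞ W ⊆ U′ ⊞ W′
  ⊞-mono U U′ W W′ f g (x , p , r) = x , f p , g r

  opaque
    unfolding ⟦_⟧

    ∣neg∣ : ∀ U → ⟦ neg U ⟧ ≡ ⟦ U ⟧
    ∣neg∣ U = sym (∑-bij (ι U) ⊖_ ⊖_ ⊖⊖ ⊖⊖)

    ∣shift∣ : ∀ c U → ⟦ shift c U ⟧ ≡ ⟦ U ⟧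
    ∣shift∣ c U = sym (∑-bij (ι U) (_⊝ c) (_⊕ c) (λ x → ⊕⊝ x c) (λ x → ⊝⊕ x c))

    popular : ∀ D P Q k m → (∀ {t} → t ∈ D → k ≤ m * ⟦ P ∩ shift t Q ⟧) → k * ⟦ D ⟧ ≤ m * (⟦ P ⟧ * ⟦ Q ⟧)
    popular D P Q k m p = ℕ.≤-trans (fibre-≥ D (λ t → ⟦ P ∩ shift t Q ⟧) k m p)
      (ℕ.≤-reflexive (cong (m *_) (begin
        ∑² (λ t u → ι (P ∩ shift t Q) u)
          ≡⟨ sum-cong-≗ (λ t → sum-cong-≗ λ u → 𝟙-× (mem? P u) (mem? Q (u ⊝ t))) ⟩
        ∑² (λ t u → ι P u * ι Q (u ⊝ t))
          ≡⟨ ∑-comm (λ t u → ι P u * ι Q (u ⊝ t)) ⟩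
        ∑² (λ u t → ι P u * ι Q (u ⊝ t))
          ≡⟨ sum-cong-≗ (λ u → *-distribˡ-sum (ι P u) (λ t → ι Q (u ⊝ t))) ⟨
        sum (λ u → ι P u * sum (λ t → ι Q (u ⊝ t)))
          ≡⟨ sum-cong-≗ (λ u → cong (ι P u *_) (sym (∑-bij (ι Q) (u ⊝_) (u ⊝_) (⊝-⊝ u) (⊝-⊝ u)))) ⟩
        sum (λ u → ι P u * ⟦ Q ⟧)
          ≡⟨ *-distribʳ-sum ⟦ Q ⟧ (ι P) ⟨
        ⟦ P ⟧ * ⟦ Q ⟧ ∎)))
      where open ≡-Reasoning

  ruzsa-triangle : ∀ X U → ⟦ X ⟧ * ⟦ U ⊞ neg U ⟧ ≤ ⟦ X ⊞ U ⟧ * ⟦ X ⊞ U ⟧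
  ruzsa-triangle X U = subst (⟦ X ⟧ * ⟦ U ⊞ neg U ⟧ ≤_) (ℕ.*-identityˡ _) (popular (U ⊞ neg U) (X ⊞ U) (X ⊞ U) ⟦ X ⟧ 1 λ {t} t∈ →
    let u , v , u∈ , v∈ , eq = ∈⊞⁻ U (neg U) t∈ in
    ℕ.≤-trans (∣∣-bij X ((X ⊞ U) ∩ shift t (X ⊞ U)) (_⊕ u) (_⊝ u) (λ x → ⊝⊕ x u) (λ x → ⊕⊝ x u) λ {x} x∈ →
      ∈⊞ X U x∈ u∈ ,
      subst (_∈ X ⊞ U) (trans (lemma x u v) (cong (x ⊕ u ⊝_) eq)) (∈⊞ X U x∈ v∈))
      (ℕ.≤-reflexive (sym (ℕ.*-identityˡ _))))
    where
    lemma : ∀ x u v → x ⊕ ⊖ v ≡ x ⊕ u ⊝ (u ⊕ v)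
    lemma = solve 3 (λ x u v → x :+ :- v := x :+ u :- (u :+ v)) refl

  MinRatio : FSet → FSet → Set₁
  MinRatio X B = ∀ W → W ⊆ X → ⟦ X ⊞ B ⟧ * ⟦ W ⟧ ≤ ⟦ W ⊞ B ⟧ * ⟦ X ⟧

  fromSubset : Subset.Subset q → FSet
  fromSubset s = ⟨ (λ x → x Subset.∈? s) ⟩

  toSubset : FSet → Subset.Subset q
  toSubset A = Vec.tabulate (λ x → does (mem? A x))

  toSubset⁺ : ∀ A {x} → x ∈ A → x Subset.∈ toSubset A
  toSubset⁺ A {x} p = Vec.lookup⇒[]= x (toSubset A) (trans (Vec.lookup∘tabulate _ x) (isTrue (mem? A x) p))
    where
    isTrue : {P : Set} (d : Dec P) → P → does d ≡ true
    isTrue (yes _) _ = refl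
    isTrue (no ¬p) p = contradiction p ¬p

  toSubset⁻ : ∀ A {x} → x Subset.∈ toSubset A → x ∈ A
  toSubset⁻ A {x} p = isMem (mem? A x) (trans (sym (Vec.lookup∘tabulate _ x)) (Vec.[]=⇒lookup p))
    where
    isMem : {P : Set} (d : Dec P) → does d ≡ true → P
    isMem (yes p) _ = p

  minRatio-exists : ∀ n Z B → 1 ≤ ⟦ Z ⟧ → ⟦ Z ⟧ ≤ n → Σ FSet λ X →
    X ⊆ Z × 1 ≤ ⟦ X ⟧ × MinRatio X B × ⟦ X ⊞ B ⟧ * ⟦ Z ⟧ ≤ ⟦ Z ⊞ B ⟧ * ⟦ X ⟧
  minRatio-exists zero    Z B 1≤Z Z≤n = contradiction (ℕ.≤-trans 1≤Z Z≤n) λ()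
  minRatio-exists (suc n) Z B 1≤Z Z≤n
    with Subset.anySubset? (λ s → Fin.all? (λ x → imp (x Subset.∈? s) (mem? Z x))
           ×-dec (⟦ fromSubset s ⊞ B ⟧ * ⟦ Z ⟧ ℕ.<? ⟦ Z ⊞ B ⟧ * ⟦ fromSubset s ⟧))
    where
    imp : {P Q : Set} → Dec P → Dec Q → Dec (P → Q)
    imp (no ¬p) _       = yes λ p → contradiction p ¬p
    imp (yes p) (yes r) = yes λ _ → r
    imp (yes p) (no ¬r) = no λ f → ¬r (f p)
  ... | no ¬s = Z , id , 1≤Z , min , ℕ.≤-refl
    where
    min : MinRatio Z B
    min W W⊆Z = ℕ.≮⇒≥ λ lt → ¬s (s , (λ x x∈ → W⊆Z (toSubset⁻ W x∈)) ,
      subst₂ (λ a b → a * ⟦ Z ⟧ < ⟦ Z ⊞ B ⟧ * b) (∣∣-cong (W ⊞ B) (fromSubset s ⊞ B)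
          (⊞-mono W (fromSubset s) B B (toSubset⁺ W) id) (⊞-mono (fromSubset s) W B B (toSubset⁻ W) id))
        (∣∣-cong W (fromSubset s) (toSubset⁺ W) (toSubset⁻ W)) lt)
      where s = toSubset W
  ... | yes (s , s⊆ , lt) = let X , X⊆ , 1≤X , min , le = minRatio-exists n W B 1≤W (ℕ.≤-pred (ℕ.≤-trans W<Z Z≤n)) in
    X , (λ x∈ → s⊆ _ (X⊆ x∈)) , 1≤X , min , ratio-trans ⟦ X ⊞ B ⟧ ⟦ X ⟧ le
    where
    W = fromSubset s
    1≤W : 1 ≤ ⟦ W ⟧
    1≤W = ℕ.n≢0⇒n>0 λ eq → contradiction
      (subst (⟦ W ⊞ B ⟧ * ⟦ Z ⟧ <_) (trans (cong (⟦ Z ⊞ B ⟧ *_) eq) (ℕ.*-zeroʳ ⟦ Z ⊞ B ⟧)) lt) λ()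
    W<Z : ⟦ W ⟧ < ⟦ Z ⟧
    W<Z = ℕ.≰⇒> λ Z≤W → let same = ⊇-by-size Z W (s⊆ _) Z≤W in
      ℕ.<-irrefl refl (subst₂ (λ a b → a * ⟦ Z ⟧ < ⟦ Z ⊞ B ⟧ * b)
        (∣∣-cong (W ⊞ B) (Z ⊞ B) (⊞-mono W Z B B (s⊆ _) id) (⊞-mono Z W B B same id))
        (∣∣-cong W Z (s⊆ _) same) lt)
    ratio-trans : ∀ x b → x * ⟦ W ⟧ ≤ ⟦ W ⊞ B ⟧ * b → x * ⟦ Z ⟧ ≤ ⟦ Z ⊞ B ⟧ * b
    ratio-trans x b le = ℕ.*-cancelʳ-≤ _ _ ⟦ W ⟧ {{ℕ.>-nonZero 1≤W}} (begin
      x * ⟦ Z ⟧ * ⟦ W ⟧        ≡⟨ swap x ⟦ Z ⟧ ⟦ W ⟧ ⟩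
      x * ⟦ W ⟧ * ⟦ Z ⟧        ≤⟨ ℕ.*-monoˡ-≤ ⟦ Z ⟧ le ⟩
      ⟦ W ⊞ B ⟧ * b * ⟦ Z ⟧    ≡⟨ swap ⟦ W ⊞ B ⟧ b ⟦ Z ⟧ ⟩
      ⟦ W ⊞ B ⟧ * ⟦ Z ⟧ * b    ≤⟨ ℕ.*-monoˡ-≤ b (ℕ.<⇒≤ lt) ⟩
      ⟦ Z ⊞ B ⟧ * ⟦ W ⟧ * b    ≡⟨ swap ⟦ Z ⊞ B ⟧ ⟦ W ⟧ b ⟩
      ⟦ Z ⊞ B ⟧ * b * ⟦ W ⟧    ∎)
      where
      open ℕ.≤-Reasoning
      swap : ∀ a b c → a * b * c ≡ a * c * b
      swap = ℕ-Solver.solve-∀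

  open DecMembership (Fin._≟_ {q}) using (_∈?_) renaming (_∈_ to _∈ˡ_)

  ofList : List (Fin q) → FSet
  ofList cs = ⟨ (λ x → x ∈? cs) ⟩

  petridis-list : ∀ X B → MinRatio X B → ∀ cs →
    ⟦ (X ⊞ B) ⊞ ofList cs ⟧ * ⟦ X ⟧ ≤ ⟦ X ⊞ B ⟧ * ⟦ X ⊞ ofList cs ⟧
  petridis-list X B min [] = ℕ.≤-trans (ℕ.≤-reflexive (cong (_* ⟦ X ⟧)
    (∣∅∣ ((X ⊞ B) ⊞ ofList []) λ ()))) z≤n
  petridis-list X B min (c ∷ cs) = begin
    ⟦ XB ⊞ C′ ⟧ * ⟦ X ⟧
      ≤⟨ ℕ.*-monoˡ-≤ ⟦ X ⟧ upper ⟩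
    (⟦ XB ⊞ C ⟧ + ⟦ XB ∖ WB ⟧) * ⟦ X ⟧
      ≡⟨ ℕ.*-distribʳ-+ ⟦ X ⟧ ⟦ XB ⊞ C ⟧ ⟦ XB ∖ WB ⟧ ⟩
    ⟦ XB ⊞ C ⟧ * ⟦ X ⟧ + ⟦ XB ∖ WB ⟧ * ⟦ X ⟧
      ≤⟨ ℕ.+-mono-≤ (petridis-list X B min cs) rest ⟩
    ⟦ XB ⟧ * ⟦ X ⊞ C ⟧ + ⟦ XB ⟧ * ⟦ X ∖ W ⟧
      ≡⟨ ℕ.*-distribˡ-+ ⟦ XB ⟧ ⟦ X ⊞ C ⟧ ⟦ X ∖ W ⟧ ⟨
    ⟦ XB ⟧ * (⟦ X ⊞ C ⟧ + ⟦ X ∖ W ⟧)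
      ≤⟨ ℕ.*-monoʳ-≤ ⟦ XB ⟧ lower ⟩
    ⟦ XB ⟧ * ⟦ X ⊞ C′ ⟧ ∎
    where
    open ℕ.≤-Reasoning
    C = ofList cs
    C′ = ofList (c ∷ cs)
    XB = X ⊞ B
    W = X ∩ ⟨ (λ x → mem? (X ⊞ C) (x ⊕ c)) ⟩
    WB = W ⊞ B
    WB⊆XB : WB ⊆ XB
    WB⊆XB = ⊞-mono W X B B proj₁ id
    rest : ⟦ XB ∖ WB ⟧ * ⟦ X ⟧ ≤ ⟦ XB ⟧ * ⟦ X ∖ W ⟧
    rest = ℕ.+-cancelˡ-≤ (⟦ XB ⟧ * ⟦ W ⟧) _ _ (begin
      ⟦ XB ⟧ * ⟦ W ⟧ + ⟦ XB ∖ WB ⟧ * ⟦ X ⟧     ≤⟨ ℕ.+-monoˡ-≤ _ (min W proj₁) ⟩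
      ⟦ WB ⟧ * ⟦ X ⟧ + ⟦ XB ∖ WB ⟧ * ⟦ X ⟧     ≡⟨ ℕ.*-distribʳ-+ ⟦ X ⟧ ⟦ WB ⟧ ⟦ XB ∖ WB ⟧ ⟨
      (⟦ WB ⟧ + ⟦ XB ∖ WB ⟧) * ⟦ X ⟧           ≡⟨ cong₂ _*_ (sym (∣∖∣ XB WB WB⊆XB)) (∣∖∣ X W proj₁) ⟩
      ⟦ XB ⟧ * (⟦ W ⟧ + ⟦ X ∖ W ⟧)             ≡⟨ ℕ.*-distribˡ-+ ⟦ XB ⟧ ⟦ W ⟧ ⟦ X ∖ W ⟧ ⟩
      ⟦ XB ⟧ * ⟦ W ⟧ + ⟦ XB ⟧ * ⟦ X ∖ W ⟧ ∎)
    lower : ⟦ X ⊞ C ⟧ + ⟦ X ∖ W ⟧ ≤ ⟦ X ⊞ C′ ⟧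
    lower = ℕ.≤-trans (ℕ.+-monoʳ-≤ ⟦ X ⊞ C ⟧ (ℕ.≤-reflexive (sym (∣shift∣ c (X ∖ W)))))
      (disjoint-+ (X ⊞ C) (shift c (X ∖ W)) (X ⊞ C′)
        (⊞-mono X X C C′ id there)
        (λ {t} (t∈ , _) → subst (_∈ X ⊞ C′) (⊝⊕ t c) (∈⊞ X C′ t∈ (here refl)))
        λ {t} t∈ (x∈ , ∉W) → ∉W (x∈ , subst (_∈ X ⊞ C) (sym (⊝⊕ t c)) t∈))
    upper : ⟦ XB ⊞ C′ ⟧ ≤ ⟦ XB ⊞ C ⟧ + ⟦ XB ∖ WB ⟧
    upper = ℕ.≤-trans (∣∣-mono (XB ⊞ C′) ((XB ⊞ C) ∪ shift c (XB ∖ WB)) λ t∈ → cover (∈⊞⁻ XB C′ t∈))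
      (ℕ.≤-trans (∣∪∣ (XB ⊞ C) (shift c (XB ∖ WB))) (ℕ.+-monoʳ-≤ ⟦ XB ⊞ C ⟧ (ℕ.≤-reflexive (∣shift∣ c (XB ∖ WB)))))
      where
      reassoc : ∀ x b d → x ⊕ d ⊕ b ≡ x ⊕ b ⊕ d
      reassoc = solve 3 (λ x b d → x :+ d :+ b := x :+ b :+ d) refl
      cover : ∀ {t} → (∃ λ u → ∃ λ d → u ∈ XB × d ∈ C′ × u ⊕ d ≡ t) → t ∈ (XB ⊞ C) ∪ shift c (XB ∖ WB)
      cover (u , d , u∈ , there d∈ , refl) = inj₁ (∈⊞ XB C u∈ d∈)
      cover (u , d , u∈ , here refl , refl) with mem? WB u
      ... | no u∉ = inj₂ (subst (_∈ XB ∖ WB) (sym (⊕⊝ u c)) (u∈ , u∉))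
      ... | yes u∈W with ∈⊞⁻ W B u∈W
      ...   | x , b , (_ , xc∈) , b∈ , refl with ∈⊞⁻ X C xc∈
      ...     | y , d′ , y∈ , d′∈ , eq = inj₁ (subst (_∈ XB ⊞ C)
                 (trans (reassoc y d′ b) (trans (cong (_⊕ b) eq) (reassoc x b c)))
                 (∈⊞ XB C (∈⊞ X B y∈ b∈) d′∈))

module Growth {q : ℕ} (𝔽 : FieldOn q) where

  open FieldSets 𝔽

  ≢𝟎⇒inv≢𝟎 : ∀ {c} → c ≢ 𝟎 → inv c ≢ 𝟎
  ≢𝟎⇒inv≢𝟎 {c} c≢𝟎 eq = 𝟎≢𝟏 (trans (sym (⊗-zeroʳ c)) (trans (cong (c ⊗_) (sym eq)) (inverseʳ c≢𝟎)))

  inv-cancel : ∀ {c} → c ≢ 𝟎 → ∀ x → inv c ⊗ (c ⊗ x) ≡ x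
  inv-cancel {c} c≢𝟎 x = trans (solve 3 (λ c c′ x → c′ :* (c :* x) := c :* c′ :* x) refl c (inv c) x)
    (trans (cong (_⊗ x) (inverseʳ c≢𝟎)) (⊗-identityˡ x))

  inv-cancel′ : ∀ {c} → c ≢ 𝟎 → ∀ x → c ⊗ (inv c ⊗ x) ≡ x
  inv-cancel′ {c} c≢𝟎 x = trans (solve 3 (λ c c′ x → c :* (c′ :* x) := c :* c′ :* x) refl c (inv c) x)
    (trans (cong (_⊗ x) (inverseʳ c≢𝟎)) (⊗-identityˡ x))

  ⊗-cancelˡ : ∀ {c} → c ≢ 𝟎 → ∀ {x y} → c ⊗ x ≡ c ⊗ y → x ≡ y
  ⊗-cancelˡ {c} c≢𝟎 {x} {y} eq = trans (sym (inv-cancel c≢𝟎 x)) (trans (cong (inv c ⊗_) eq) (inv-cancel c≢𝟎 y))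

  ⊗≢𝟎 : ∀ {x y} → x ≢ 𝟎 → y ≢ 𝟎 → x ⊗ y ≢ 𝟎
  ⊗≢𝟎 {x} x≢𝟎 y≢𝟎 eq = y≢𝟎 (⊗-cancelˡ x≢𝟎 (trans eq (sym (⊗-zeroʳ x))))

  dil : Fin q → FSet → FSet
  dil c U = ⟨ (λ x → mem? U (inv c ⊗ x)) ⟩

  ∈dil : ∀ {c} U → c ≢ 𝟎 → ∀ {x} → x ∈ U → c ⊗ x ∈ dil c U
  ∈dil U c≢𝟎 {x} = subst (_∈ U) (sym (inv-cancel c≢𝟎 x))

  ∣dil∣ : ∀ {c} U → c ≢ 𝟎 → ⟦ dil c U ⟧ ≡ ⟦ U ⟧
  ∣dil∣ {c} U c≢𝟎 = ℕ.≤-antisym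
    (∣∣-bij (dil c U) U (inv c ⊗_) (c ⊗_) (inv-cancel c≢𝟎) (inv-cancel′ c≢𝟎) id)
    (∣∣-bij U (dil c U) (c ⊗_) (inv c ⊗_) (inv-cancel′ c≢𝟎) (inv-cancel c≢𝟎) (∈dil U c≢𝟎))

  petridis : ∀ X B → MinRatio X B → ∀ C → ⟦ (X ⊞ B) ⊞ C ⟧ * ⟦ X ⟧ ≤ ⟦ X ⊞ B ⟧ * ⟦ X ⊞ C ⟧
  petridis X B min C = ℕ.≤-trans
    (ℕ.*-monoˡ-≤ ⟦ X ⟧ (∣∣-mono ((X ⊞ B) ⊞ C) ((X ⊞ B) ⊞ C′) (⊞-mono (X ⊞ B) (X ⊞ B) C C′ id to)))
    (ℕ.≤-trans (petridis-list X B min cs)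
      (ℕ.*-monoʳ-≤ ⟦ X ⊞ B ⟧ (∣∣-mono (X ⊞ C′) (X ⊞ C) (⊞-mono X X C′ C id λ x∈ → proj₂ (∈-filter⁻ (mem? C) {xs = allFin q} x∈)))))
    where
    cs = filter (mem? C) (allFin q)
    C′ = ofList cs
    to : C ⊆ C′
    to {x} = ∈-filter⁺ (mem? C) (∈-allFin x)

  GrowthBound : FSet → FSet → ℕ → ℕ → Set₁
  GrowthBound X B b z = ∀ C → z * ⟦ X ⊞ (B ⊞ C) ⟧ ≤ b * ⟦ X ⊞ C ⟧

  ⊞-assoc-⊆ : ∀ A B C → A ⊞ (B ⊞ C) ⊆ (A ⊞ B) ⊞ C
  ⊞-assoc-⊆ A B C t∈ with ∈⊞⁻ A (B ⊞ C) t∈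
  ... | a , _ , a∈ , bc∈ , refl with ∈⊞⁻ B C bc∈
  ...   | b , c , b∈ , c∈ , refl = subst (_∈ (A ⊞ B) ⊞ C) (⊕-assoc a b c) (∈⊞ (A ⊞ B) C (∈⊞ A B a∈ b∈) c∈)

  growthSet : ∀ Z B → 1 ≤ ⟦ Z ⟧ → Σ FSet λ X → X ⊆ Z × 1 ≤ ⟦ X ⟧ × GrowthBound X B ⟦ Z ⊞ B ⟧ ⟦ Z ⟧
  growthSet Z B 1≤Z with minRatio-exists ⟦ Z ⟧ Z B 1≤Z ℕ.≤-refl
  ... | X , X⊆Z , 1≤X , min , ratio = X , X⊆Z , 1≤X , λ C →
    ℕ.*-cancelʳ-≤ _ _ ⟦ X ⟧ {{>-nonZero 1≤X}} (begin
      ⟦ Z ⟧ * ⟦ X ⊞ (B ⊞ C) ⟧ * ⟦ X ⟧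
        ≤⟨ ℕ.*-monoˡ-≤ ⟦ X ⟧ (ℕ.*-monoʳ-≤ ⟦ Z ⟧ (∣∣-mono (X ⊞ (B ⊞ C)) ((X ⊞ B) ⊞ C) (⊞-assoc-⊆ X B C))) ⟩
      ⟦ Z ⟧ * ⟦ (X ⊞ B) ⊞ C ⟧ * ⟦ X ⟧
        ≡⟨ ℕ.*-assoc ⟦ Z ⟧ _ _ ⟩
      ⟦ Z ⟧ * (⟦ (X ⊞ B) ⊞ C ⟧ * ⟦ X ⟧)
        ≤⟨ ℕ.*-monoʳ-≤ ⟦ Z ⟧ (petridis X B min C) ⟩
      ⟦ Z ⟧ * (⟦ X ⊞ B ⟧ * ⟦ X ⊞ C ⟧)
        ≡⟨ rearrange₁ ⟦ Z ⟧ ⟦ X ⊞ B ⟧ ⟦ X ⊞ C ⟧ ⟩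
      ⟦ X ⊞ B ⟧ * ⟦ Z ⟧ * ⟦ X ⊞ C ⟧
        ≤⟨ ℕ.*-monoˡ-≤ ⟦ X ⊞ C ⟧ ratio ⟩
      ⟦ Z ⊞ B ⟧ * ⟦ X ⟧ * ⟦ X ⊞ C ⟧
        ≡⟨ rearrange₂ ⟦ Z ⊞ B ⟧ ⟦ X ⟧ ⟦ X ⊞ C ⟧ ⟩
      ⟦ Z ⊞ B ⟧ * ⟦ X ⊞ C ⟧ * ⟦ X ⟧ ∎)
    where
    open ℕ.≤-Reasoning
    rearrange₁ : ∀ z u v → z * (u * v) ≡ u * z * v
    rearrange₁ = ℕ-Solver.solve-∀
    rearrange₂ : ∀ z u v → z * u * v ≡ z * v * u
    rearrange₂ = ℕ-Solver.solve-∀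

  0set : FSet
  0set = ⟨ (λ x → x Fin.≟ 𝟎) ⟩

  growth₁ : ∀ {X B b z} → GrowthBound X B b z → z * ⟦ X ⊞ B ⟧ ≤ b * ⟦ X ⟧
  growth₁ {X} {B} {b} {z} gr = ℕ.≤-trans
    (ℕ.*-monoʳ-≤ z (∣∣-mono (X ⊞ B) (X ⊞ (B ⊞ 0set)) (⊞-mono X X B (B ⊞ 0set) id λ {x} x∈ →
      subst (_∈ B ⊞ 0set) (⊕-identityʳ x) (∈⊞ B 0set x∈ refl))))
    (ℕ.≤-trans (gr 0set) (ℕ.*-monoʳ-≤ b (∣∣-mono (X ⊞ 0set) X λ t∈ → zero⁻ (∈⊞⁻ X 0set t∈))))
    where
    zero⁻ : ∀ {t} → (∃ λ x → ∃ λ y → x ∈ X × y ≡ 𝟎 × x ⊕ y ≡ t) → t ∈ X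
    zero⁻ (x , _ , x∈ , refl , refl) = subst (_∈ X) (sym (⊕-identityʳ x)) x∈

  -- Three applications of the growth bound, combined by the Ruzsa triangle inequality.
  ruzsa-growth : ∀ X W U b z → 1 ≤ ⟦ X ⟧ → ⟦ X ⟧ ≤ ⟦ W ⟧ → z * (z * (z * ⟦ W ⊞ U ⟧)) ≤ b * (b * (b * ⟦ X ⟧)) →
                 ⟦ U ⊞ neg U ⟧ * z ^ 6 ≤ b ^ 6 * ⟦ X ⟧
  ruzsa-growth X W U b z 1≤X X≤W h = ℕ.*-cancelʳ-≤ _ _ ⟦ W ⟧ {{>-nonZero (ℕ.≤-trans 1≤X X≤W)}} (begin
    ⟦ U ⊞ neg U ⟧ * z ^ 6 * ⟦ W ⟧
      ≡⟨ rearrange₁ ⟦ U ⊞ neg U ⟧ (z ^ 6) ⟦ W ⟧ ⟩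
    ⟦ W ⟧ * ⟦ U ⊞ neg U ⟧ * z ^ 6
      ≤⟨ ℕ.*-monoˡ-≤ (z ^ 6) (ruzsa-triangle W U) ⟩
    ⟦ W ⊞ U ⟧ * ⟦ W ⊞ U ⟧ * z ^ 6
      ≡⟨ rearrange₂ ⟦ W ⊞ U ⟧ z ⟩
    (z * (z * (z * ⟦ W ⊞ U ⟧))) * (z * (z * (z * ⟦ W ⊞ U ⟧)))
      ≤⟨ ℕ.*-mono-≤ h h ⟩
    (b * (b * (b * ⟦ X ⟧))) * (b * (b * (b * ⟦ X ⟧)))
      ≡⟨ rearrange₂ ⟦ X ⟧ b ⟨
    ⟦ X ⟧ * ⟦ X ⟧ * b ^ 6
      ≤⟨ ℕ.*-monoˡ-≤ (b ^ 6) (ℕ.*-monoʳ-≤ ⟦ X ⟧ X≤W) ⟩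
    ⟦ X ⟧ * ⟦ W ⟧ * b ^ 6
      ≡⟨ rearrange₃ ⟦ X ⟧ ⟦ W ⟧ (b ^ 6) ⟩
    b ^ 6 * ⟦ X ⟧ * ⟦ W ⟧ ∎)
    where
    open ℕ.≤-Reasoning
    rearrange₁ : ∀ u z w → u * z * w ≡ w * u * z
    rearrange₁ = ℕ-Solver.solve-∀
    rearrange₂ : ∀ w z → w * w * (z * (z * (z * (z * (z * (z * 1)))))) ≡ (z * (z * (z * w))) * (z * (z * (z * w)))
    rearrange₂ = ℕ-Solver.solve-∀
    rearrange₃ : ∀ x w b → x * w * b ≡ b * x * w
    rearrange₃ = ℕ-Solver.solve-∀

  triple-sum-bound : ∀ X B b z → 1 ≤ ⟦ X ⟧ → GrowthBound X B b z → let U = B ⊞ (B ⊞ B) in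
                     ⟦ U ⊞ neg U ⟧ * z ^ 6 ≤ b ^ 6 * ⟦ X ⟧
  triple-sum-bound X B b z 1≤X gr = ruzsa-growth X X (B ⊞ (B ⊞ B)) b z 1≤X ℕ.≤-refl (begin
    z * (z * (z * ⟦ X ⊞ (B ⊞ (B ⊞ B)) ⟧))  ≤⟨ ℕ.*-monoʳ-≤ z (ℕ.*-monoʳ-≤ z (gr (B ⊞ B))) ⟩
    z * (z * (b * ⟦ X ⊞ (B ⊞ B) ⟧))        ≡⟨ cong (z *_) (swap z b _) ⟩
    z * (b * (z * ⟦ X ⊞ (B ⊞ B) ⟧))        ≤⟨ ℕ.*-monoʳ-≤ z (ℕ.*-monoʳ-≤ b (gr B)) ⟩
    z * (b * (b * ⟦ X ⊞ B ⟧))              ≡⟨ trans (swap z b _) (cong (b *_) (swap z b _)) ⟩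
    b * (b * (z * ⟦ X ⊞ B ⟧))              ≤⟨ ℕ.*-monoʳ-≤ b (ℕ.*-monoʳ-≤ b (growth₁ {X} {B} {b} {z} gr)) ⟩
    b * (b * (b * ⟦ X ⟧)) ∎)
    where
    open ℕ.≤-Reasoning
    swap : ∀ z b x → z * (b * x) ≡ b * (z * x)
    swap = ℕ-Solver.solve-∀

  mixed-sum-bound : ∀ X B b z e → e ≢ 𝟎 → 1 ≤ ⟦ X ⟧ → GrowthBound X B b z → neg (dil e X) ⊆ B →
                    let U = B ⊞ neg (dil e B) in ⟦ U ⊞ neg U ⟧ * z ^ 6 ≤ b ^ 6 * ⟦ X ⟧
  mixed-sum-bound X B b z e e≢𝟎 1≤X gr eX⊆B = ruzsa-growth X W U b z 1≤X X≤W (begin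
    z * (z * (z * ⟦ W ⊞ U ⟧))
      ≤⟨ ℕ.*-monoʳ-≤ z (ℕ.*-monoʳ-≤ z (ℕ.*-monoʳ-≤ z (∣∣-mono (W ⊞ U) (X ⊞ (B ⊞ neg (eX ⊞ eB))) regroup))) ⟩
    z * (z * (z * ⟦ X ⊞ (B ⊞ neg (eX ⊞ eB)) ⟧))
      ≤⟨ ℕ.*-monoʳ-≤ z (ℕ.*-monoʳ-≤ z (gr (neg (eX ⊞ eB)))) ⟩
    z * (z * (b * ⟦ X ⊞ neg (eX ⊞ eB) ⟧))
      ≤⟨ ℕ.*-monoʳ-≤ z (ℕ.*-monoʳ-≤ z (ℕ.*-monoʳ-≤ b scaled)) ⟩
    z * (z * (b * ⟦ X ⊞ (B ⊞ C) ⟧))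
      ≡⟨ cong (z *_) (swap z b _) ⟩
    z * (b * (z * ⟦ X ⊞ (B ⊞ C) ⟧))
      ≤⟨ ℕ.*-monoʳ-≤ z (ℕ.*-monoʳ-≤ b (gr C)) ⟩
    z * (b * (b * ⟦ X ⊞ C ⟧))
      ≤⟨ ℕ.*-monoʳ-≤ z (ℕ.*-monoʳ-≤ b (ℕ.*-monoʳ-≤ b scaled′)) ⟩
    z * (b * (b * ⟦ X ⊞ B ⟧))
      ≡⟨ trans (swap z b _) (cong (b *_) (swap z b _)) ⟩
    b * (b * (z * ⟦ X ⊞ B ⟧))
      ≤⟨ ℕ.*-monoʳ-≤ b (ℕ.*-monoʳ-≤ b (growth₁ {X} {B} {b} {z} gr)) ⟩
    b * (b * (b * ⟦ X ⟧)) ∎)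
    where
    open ℕ.≤-Reasoning
    swap : ∀ z b x → z * (b * x) ≡ b * (z * x)
    swap = ℕ-Solver.solve-∀
    eX = dil e X
    eB = dil e B
    U = B ⊞ neg eB
    W = X ⊞ neg eX
    C = dil (inv e) (neg X)
    X≤W : ⟦ X ⟧ ≤ ⟦ W ⟧
    X≤W = let x₀ , x₀∈ = nonempty X 1≤X in
      ∣∣-bij X W (_⊝ e ⊗ x₀) (_⊕ e ⊗ x₀) (λ x → ⊕⊝ x _) (λ x → ⊝⊕ x _)
        λ x∈ → ∈⊞ X (neg eX) x∈ (∈neg eX (∈dil X e≢𝟎 x₀∈))
    regroup : W ⊞ U ⊆ X ⊞ (B ⊞ neg (eX ⊞ eB))
    regroup t∈ with ∈⊞⁻ W U t∈
    ... | _ , _ , w∈ , u∈ , refl with ∈⊞⁻ X (neg eX) w∈ | ∈⊞⁻ B (neg eB) u∈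
    ...   | x , y , x∈ , y∈ , refl | s , r , s∈ , r∈ , refl =
      subst (_∈ X ⊞ (B ⊞ neg (eX ⊞ eB)))
        (solve 4 (λ x y s r → x :+ (s :+ :- (:- y :+ :- r)) := x :+ y :+ (s :+ r)) refl x y s r)
        (∈⊞ X (B ⊞ neg (eX ⊞ eB)) x∈ (∈⊞ B (neg (eX ⊞ eB)) s∈ (∈neg (eX ⊞ eB) (∈⊞ eX eB y∈ r∈))))
    unscale : ∀ x → inv (inv e) ⊗ (inv e ⊗ x) ≡ x
    unscale = inv-cancel (≢𝟎⇒inv≢𝟎 e≢𝟎)
    scaled : ⟦ X ⊞ neg (eX ⊞ eB) ⟧ ≤ ⟦ X ⊞ (B ⊞ C) ⟧
    scaled = ∣∣-bij (X ⊞ neg (eX ⊞ eB)) (X ⊞ (B ⊞ C)) (λ t → inv e ⊗ (⊖ t)) (λ t → ⊖ (e ⊗ t))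
      (λ t → trans (cong (inv e ⊗_) (⊖⊖ _)) (inv-cancel e≢𝟎 t))
      (λ t → trans (cong ⊖_ (inv-cancel′ e≢𝟎 _)) (⊖⊖ t)) to
      where
      to : ∀ {t} → t ∈ X ⊞ neg (eX ⊞ eB) → inv e ⊗ (⊖ t) ∈ X ⊞ (B ⊞ C)
      to t∈ with ∈⊞⁻ X (neg (eX ⊞ eB)) t∈
      ... | x , u , x∈ , u∈ , refl with ∈⊞⁻ eX eB u∈
      ...   | y , r , y∈ , r∈ , eq = subst (_∈ X ⊞ (B ⊞ C))
        (trans (solve 4 (λ f x y r → f :* y :+ (f :* r :+ f :* :- x) := f :* (:- x :+ (y :+ r))) refl (inv e) x y r)
          (cong (inv e ⊗_) (trans (cong (⊖ x ⊕_) eq) (solve 2 (λ x u → :- x :+ :- u := :- (x :+ u)) refl x u))))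
        (∈⊞ X (B ⊞ C) y∈ (∈⊞ B C r∈ (subst (_∈ neg X) (sym (unscale (⊖ x))) (∈neg X x∈))))
    scaled′ : ⟦ X ⊞ C ⟧ ≤ ⟦ X ⊞ B ⟧
    scaled′ = ℕ.≤-trans (∣∣-bij (X ⊞ C) (X ⊞ neg eX) (λ t → ⊖ (e ⊗ t)) (λ t → inv e ⊗ (⊖ t))
      (λ t → trans (cong ⊖_ (inv-cancel′ e≢𝟎 _)) (⊖⊖ t))
      (λ t → trans (cong (inv e ⊗_) (⊖⊖ _)) (inv-cancel e≢𝟎 t)) to)
      (∣∣-mono (X ⊞ neg eX) (X ⊞ B) (⊞-mono X X (neg eX) B id eX⊆B))
      where
      to : ∀ {t} → t ∈ X ⊞ C → ⊖ (e ⊗ t) ∈ X ⊞ neg eX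
      to t∈ with ∈⊞⁻ X C t∈
      ... | x , u , x∈ , u∈ , refl = subst (_∈ X ⊞ neg eX)
        (trans (cong (λ w → ⊖ w ⊕ ⊖ (e ⊗ x)) inv-u) (solve 3 (λ e x u → :- (e :* u) :+ :- (e :* x) := :- (e :* (x :+ u))) refl e x u))
        (∈⊞ X (neg eX) u∈ (∈neg eX (∈dil X e≢𝟎 x∈)))
        where
        inv-u : inv (inv e) ⊗ u ≡ e ⊗ u
        inv-u = ⊗-cancelˡ (≢𝟎⇒inv≢𝟎 e≢𝟎) (trans (inv-cancel′ (≢𝟎⇒inv≢𝟎 e≢𝟎) u) (sym (inv-cancel e≢𝟎 u)))

opaque
  e e′ e₂ : ℕ
  e  = 1280
  e′ = 160
  e₂ = 8

  e≡8e′ : e ≡ 8 * e′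
  e≡8e′ = refl

  e′≡160 : e′ ≡ 160
  e′≡160 = refl

  e₂≡8 : e₂ ≡ 8
  e₂≡8 = refl

module _ {q : ℕ} (𝔽 : FieldOn q) where

  open FieldSets 𝔽
  open Growth 𝔽

  record IsSubgroup (H : FSet) : Set where
    field
      𝟏∈H  : 𝟏 ∈ H
      H-⊗  : ∀ {x y} → x ∈ H → y ∈ H → x ⊗ y ∈ H
      H-inv : ∀ {x} → x ∈ H → inv x ∈ H
      H≢𝟎  : ∀ {x} → x ∈ H → x ≢ 𝟎

  record IsSymmetricSubgroup (H : FSet) : Set where
    field
      𝟏∈    : 𝟏 ∈ H
      ⊖𝟏∈   : ⊖ 𝟏 ∈ H
      ⊗∈    : ∀ {x y} → x ∈ H → y ∈ H → x ⊗ y ∈ H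
      inv∈  : ∀ {x} → x ∈ H → inv x ∈ H
      ∈⇒≢𝟎  : ∀ {x} → x ∈ H → x ≢ 𝟎

module Inverses {q : ℕ} (𝔽 : FieldOn q) where

  open FieldSets 𝔽
  open Growth 𝔽

  inv-unique : ∀ {x y} → x ≢ 𝟎 → x ⊗ y ≡ 𝟏 → y ≡ inv x
  inv-unique x≢𝟎 eq = ⊗-cancelˡ x≢𝟎 (trans eq (sym (inverseʳ x≢𝟎)))

  inv-inv : ∀ x → inv (inv x) ≡ x
  inv-inv x with x Fin.≟ 𝟎
  ... | yes refl = trans (cong inv inv-𝟎) inv-𝟎
  ... | no x≢𝟎   = sym (inv-unique (≢𝟎⇒inv≢𝟎 x≢𝟎) (trans (⊗-comm _ x) (inverseʳ x≢𝟎)))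

  inv-⊗ : ∀ {x y} → x ≢ 𝟎 → y ≢ 𝟎 → inv (x ⊗ y) ≡ inv x ⊗ inv y
  inv-⊗ {x} {y} x≢𝟎 y≢𝟎 = sym (inv-unique (⊗≢𝟎 x≢𝟎 y≢𝟎) (begin
    x ⊗ y ⊗ (inv x ⊗ inv y)   ≡⟨ solve 4 (λ x y x′ y′ → x :* y :* (x′ :* y′) := x :* x′ :* (y :* y′)) refl x y (inv x) (inv y) ⟩
    x ⊗ inv x ⊗ (y ⊗ inv y)   ≡⟨ cong₂ _⊗_ (inverseʳ x≢𝟎) (inverseʳ y≢𝟎) ⟩
    𝟏 ⊗ 𝟏                     ≡⟨ ⊗-identityˡ 𝟏 ⟩
    𝟏                         ∎))
    where open ≡-Reasoning

  inverseˡ : ∀ {x} → x ≢ 𝟎 → inv x ⊗ x ≡ 𝟏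
  inverseˡ x≢𝟎 = trans (⊗-comm _ _) (inverseʳ x≢𝟎)

  inv-𝟏 : inv 𝟏 ≡ 𝟏
  inv-𝟏 = sym (inv-unique (λ eq → 𝟎≢𝟏 (sym eq)) (⊗-identityˡ 𝟏))

module CayleyGraph {q : ℕ} (𝔽 : FieldOn q)
  (H : Counting.FSet q) (H-sub : IsSymmetricSubgroup 𝔽 H)
  (p : Fin q) (p≢𝟎 : p ≢ FieldOn.𝟎 𝔽) where

  open FieldSets 𝔽
  open Growth 𝔽
  open Inverses 𝔽
  open IsSymmetricSubgroup H-sub

  N : ℕ
  N = ⟦ H ⟧

  1≤N : 1 ≤ N
  1≤N = ∣∣≥1 H 𝟏∈

  pH S : FSet
  pH = dil p H
  S = ⟨ (λ s → mem? H s ×-dec mem? pH (s ⊝ 𝟏)) ⟩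

  σ : ℕ
  σ = ⟦ S ⟧

  codeg : FSet → Fin q → Fin q → ℕ
  codeg U x y = ⟦ dil x U ∩ dil y U ⟧

  Bad : FSet → ℕ → Fin q → Fin q → Set
  Bad U e x y = e * N * codeg U x y < ⟦ U ⟧ * ⟦ U ⟧

  bad? : ∀ U e x y → Dec (Bad U e x y)
  bad? U e x y = e * N * codeg U x y ℕ.<? ⟦ U ⟧ * ⟦ U ⟧

  codeg-sym : ∀ U x y → codeg U x y ≡ codeg U y x
  codeg-sym U x y = ∣∣-cong (dil x U ∩ dil y U) (dil y U ∩ dil x U) (λ (u , v) → v , u) (λ (u , v) → v , u)

  codeg-dil : ∀ U {g x y} → g ≢ 𝟎 → x ≢ 𝟎 → y ≢ 𝟎 → codeg U (g ⊗ x) (g ⊗ y) ≡ codeg U x y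
  codeg-dil U {g} {x} {y} g≢𝟎 x≢𝟎 y≢𝟎 = ℕ.≤-antisym
    (∣∣-bij (dil (g ⊗ x) U ∩ dil (g ⊗ y) U) (dil x U ∩ dil y U) (inv g ⊗_) (g ⊗_) (inv-cancel g≢𝟎) (inv-cancel′ g≢𝟎)
      λ (u , v) → subst (_∈ U) (move x≢𝟎 _) u , subst (_∈ U) (move y≢𝟎 _) v)
    (∣∣-bij (dil x U ∩ dil y U) (dil (g ⊗ x) U ∩ dil (g ⊗ y) U) (g ⊗_) (inv g ⊗_) (inv-cancel′ g≢𝟎) (inv-cancel g≢𝟎)
      λ {t} (u , v) → subst (_∈ U) (sym (trans (move x≢𝟎 _) (cong (inv x ⊗_) (inv-cancel g≢𝟎 t)))) u ,
                      subst (_∈ U) (sym (trans (move y≢𝟎 _) (cong (inv y ⊗_) (inv-cancel g≢𝟎 t)))) v)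
    where
    move : ∀ {x} → x ≢ 𝟎 → ∀ t → inv (g ⊗ x) ⊗ t ≡ inv x ⊗ (inv g ⊗ t)
    move {x} x≢𝟎 t = trans (cong (_⊗ t) (inv-⊗ g≢𝟎 x≢𝟎))
      (solve 3 (λ g x t → g :* x :* t := x :* (g :* t)) refl (inv g) (inv x) t)

  codeg-inv : ∀ U {x y} → x ≢ 𝟎 → y ≢ 𝟎 → codeg U (inv x) (inv y) ≡ codeg U x y
  codeg-inv U {x} {y} x≢𝟎 y≢𝟎 = begin
    codeg U (inv x) (inv y)
      ≡⟨ codeg-dil U (⊗≢𝟎 x≢𝟎 y≢𝟎) (≢𝟎⇒inv≢𝟎 x≢𝟎) (≢𝟎⇒inv≢𝟎 y≢𝟎) ⟨
    codeg U (x ⊗ y ⊗ inv x) (x ⊗ y ⊗ inv y)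
      ≡⟨ cong₂ (codeg U) (trans (solve 3 (λ x y x′ → x :* y :* x′ := x′ :* (x :* y)) refl x y (inv x)) (inv-cancel x≢𝟎 y))
                         (trans (solve 3 (λ x y y′ → x :* y :* y′ := y′ :* (y :* x)) refl x y (inv y)) (inv-cancel y≢𝟎 x)) ⟩
    codeg U y x
      ≡⟨ codeg-sym U y x ⟩
    codeg U x y ∎
    where open ≡-Reasoning

  badPair? : ∀ U e a b → Dec (a ∈ U × b ∈ U × Bad U e a b)
  badPair? U e a b = mem? U a ×-dec (mem? U b ×-dec bad? U e a b)

  badRow : FSet → ℕ → Fin q → ℕ
  badRow U e a = sum λ b → 𝟙 (badPair? U e a b)

  -- The graph is invariant under H, so the few pairs of H with small codegree are equally distributed
  -- over the neighbourhoods zU.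
  few-bad-pairs : ∀ U e → U ⊆ H → (∀ {x} → x ∈ U → inv x ∈ U) → e * sum (badRow U e) ≤ ⟦ U ⟧ * ⟦ U ⟧
  few-bad-pairs U e U⊆H U-inv = ℕ.*-cancelˡ-≤ N {{>-nonZero 1≤N}} (ℕ.*-cancelˡ-≤ N {{>-nonZero 1≤N}} (begin
    N * (N * (e * bad))
      ≡⟨ rearrange₁ N e bad ⟩
    e * N * (N * bad)
      ≤⟨ ℕ.*-monoʳ-≤ (e * N) translate ⟩
    e * N * ∑² (λ a b → sum (K a b))
      ≡⟨ trans (*-distribˡ-sum (e * N) (λ a → sum λ b → sum (K a b)))
               (sum-cong-≗ λ a → *-distribˡ-sum (e * N) (λ b → sum (K a b))) ⟩
    ∑² (λ a b → e * N * sum (K a b))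
      ≤⟨ ∑-mono (λ a → ∑-mono λ b → bound a b) ⟩
    ∑² (λ a b → ι H a * ι H b * (⟦ U ⟧ * ⟦ U ⟧))
      ≡⟨ sum-cong-≗ (λ a → sym (*-distribʳ-sum (⟦ U ⟧ * ⟦ U ⟧) (λ b → ι H a * ι H b))) ⟩
    sum (λ a → sum (λ b → ι H a * ι H b) * (⟦ U ⟧ * ⟦ U ⟧))
      ≡⟨ *-distribʳ-sum (⟦ U ⟧ * ⟦ U ⟧) (λ a → sum (λ b → ι H a * ι H b)) ⟨
    ∑² (λ a b → ι H a * ι H b) * (⟦ U ⟧ * ⟦ U ⟧)
      ≡⟨ cong (_* (⟦ U ⟧ * ⟦ U ⟧)) (∣∣*∣∣ H H) ⟩
    N * N * (⟦ U ⟧ * ⟦ U ⟧)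
      ≡⟨ ℕ.*-assoc N N _ ⟩
    N * (N * (⟦ U ⟧ * ⟦ U ⟧)) ∎))
    where
    open ℕ.≤-Reasoning
    bad : ℕ
    bad = sum (badRow U e)
    rearrange₁ : ∀ n e b → n * (n * (e * b)) ≡ e * n * (n * b)
    rearrange₁ = ℕ-Solver.solve-∀
    K? : ∀ a b z → Dec ((a ∈ H × b ∈ H × Bad U e a b) × (z ∈ dil a U ∩ dil b U))
    K? a b z = (mem? H a ×-dec (mem? H b ×-dec bad? U e a b)) ×-dec mem? (dil a U ∩ dil b U) z
    K : Fin q → Fin q → Fin q → ℕ
    K a b z = 𝟙 (K? a b z)
    W : Fin q → Fin q → FSet
    W a b = dil a U ∩ dil b U
    none : ∀ {x y} → e * N * sum {q} (λ _ → 0) ≤ x * y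
    none = ℕ.≤-trans (ℕ.≤-reflexive (trans (cong (e * N *_) (∑-zero {q} λ _ → refl)) (ℕ.*-zeroʳ (e * N)))) z≤n
    bound′ : ∀ a b {P Q : Set} (d₁ : Dec P) (d₂ : Dec Q) (d₃ : Dec (Bad U e a b)) →
             e * N * sum (λ z → 𝟙 ((d₁ ×-dec (d₂ ×-dec d₃)) ×-dec mem? (W a b) z)) ≤ 𝟙 d₁ * 𝟙 d₂ * (⟦ U ⟧ * ⟦ U ⟧)
    bound′ a b (no _)  d₂      d₃      = none {0} {0}
    bound′ a b (yes _) (no _)  d₃      = none {0} {0}
    bound′ a b (yes _) (yes _) (no _)  = none {1}
    bound′ a b (yes _) (yes _) (yes β) = ℕ.≤-trans
      (ℕ.≤-reflexive (cong (e * N *_) (sym (⟦⟧-sum (W a b))))) (ℕ.≤-trans (ℕ.<⇒≤ β) (ℕ.≤-reflexive (sym (ℕ.+-identityʳ _))))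
    bound : ∀ a b → e * N * sum (K a b) ≤ ι H a * ι H b * (⟦ U ⟧ * ⟦ U ⟧)
    bound a b = bound′ a b (mem? H a) (mem? H b) (bad? U e a b)
    inner : ∀ z (d : Dec (z ∈ H)) → 𝟙 d * bad ≤ ∑² (λ a b → K a b z)
    inner z (no _)  = z≤n
    inner z (yes z∈) = begin
      1 * bad
        ≡⟨ ℕ.*-identityˡ bad ⟩
      ∑² (λ a b → 𝟙 (badPair? U e a b))
        ≡⟨ ∑-bij (badRow U e) (inv z ⊗_) (z ⊗_) (inv-cancel z≢𝟎) (inv-cancel′ z≢𝟎) ⟩
      sum (λ a → badRow U e (inv z ⊗ a))
        ≡⟨ sum-cong-≗ (λ a → ∑-bij (λ b → 𝟙 (badPair? U e (inv z ⊗ a) b)) (inv z ⊗_) (z ⊗_) (inv-cancel z≢𝟎) (inv-cancel′ z≢𝟎)) ⟩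
      ∑² (λ a b → 𝟙 (badPair? U e (inv z ⊗ a) (inv z ⊗ b)))
        ≤⟨ ∑-mono (λ a → ∑-mono λ b → 𝟙-mono (badPair? U e (inv z ⊗ a) (inv z ⊗ b)) (K? a b z) (to a b)) ⟩
      ∑² (λ a b → K a b z) ∎
      where
      z≢𝟎 = ∈⇒≢𝟎 z∈
      back : ∀ {a} → inv z ⊗ a ∈ U → a ∈ H
      back {a} u = subst (_∈ H) (inv-cancel′ z≢𝟎 a) (⊗∈ z∈ (U⊆H u))
      flip : ∀ {a} → inv z ⊗ a ∈ U → z ∈ dil a U
      flip {a} u = subst (_∈ U) (trans (inv-⊗ (≢𝟎⇒inv≢𝟎 z≢𝟎) (∈⇒≢𝟎 (back u)))
        (trans (cong (_⊗ inv a) (inv-inv z)) (⊗-comm z (inv a)))) (U-inv u)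
      to : ∀ a b → inv z ⊗ a ∈ U × inv z ⊗ b ∈ U × Bad U e (inv z ⊗ a) (inv z ⊗ b) →
           (a ∈ H × b ∈ H × Bad U e a b) × (z ∈ dil a U ∩ dil b U)
      to a b (u , v , β) = (back u , back v ,
        subst (λ k → e * N * k < ⟦ U ⟧ * ⟦ U ⟧) (codeg-dil U (≢𝟎⇒inv≢𝟎 z≢𝟎) (∈⇒≢𝟎 (back u)) (∈⇒≢𝟎 (back v))) β) ,
        (flip u , flip v)
    translate : N * bad ≤ ∑² (λ a b → sum (K a b))
    translate = begin
      N * bad                                    ≡⟨ trans (cong (_* bad) (⟦⟧-sum H)) (*-distribʳ-sum bad (ι H)) ⟩
      sum (λ z → ι H z * bad)                    ≤⟨ ∑-mono (λ z → inner z (mem? H z)) ⟩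
      sum (λ z → ∑² (λ a b → K a b z))           ≡⟨ ∑-comm (λ z a → sum λ b → K a b z) ⟩
      ∑² (λ a z → sum (λ b → K a b z))           ≡⟨ sum-cong-≗ (λ a → ∑-comm (λ z b → K a b z)) ⟩
      ∑² (λ a b → sum (K a b))                   ∎

  S⊆H : S ⊆ H
  S⊆H = proj₁

  S-inv : ∀ {x} → x ∈ S → inv x ∈ S
  S-inv {x} (x∈ , d∈) = inv∈ x∈ , subst (_∈ H) eq (⊗∈ ⊖𝟏∈ (⊗∈ (inv∈ x∈) d∈))
    where
    eq : ⊖ 𝟏 ⊗ (inv x ⊗ (inv p ⊗ (x ⊝ 𝟏))) ≡ inv p ⊗ (inv x ⊝ 𝟏)
    eq = trans (solve 4 (λ o x′ p′ x → :- o :* (x′ :* (p′ :* (x :- o))) := p′ :* (o :* o :* x′ :- o :* (x :* x′))) refl 𝟏 (inv x) (inv p) x)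
      (cong (inv p ⊗_) (cong₂ _⊝_ (trans (cong (_⊗ inv x) (⊗-identityˡ 𝟏)) (⊗-identityˡ _))
                                  (trans (⊗-identityˡ _) (inverseʳ (∈⇒≢𝟎 x∈)))))

  Pop : FSet
  Pop = ⟨ (λ t → σ * σ ℕ.≤? e * N * ⟦ pH ∩ shift t pH ⟧) ⟩

  ∣Pop∣ : σ * σ * ⟦ Pop ⟧ ≤ e * N * (N * N)
  ∣Pop∣ = subst (λ n → σ * σ * ⟦ Pop ⟧ ≤ e * N * (n * n)) (∣dil∣ H p≢𝟎) (popular Pop pH pH (σ * σ) (e * N) id)

  good⇒popular : ∀ {x y} → x ∈ H → y ∈ H → ¬ Bad S e x y → x ⊝ y ∈ Pop
  good⇒popular {x} {y} x∈ y∈ good = ℕ.≤-trans (ℕ.≮⇒≥ good) (ℕ.*-monoʳ-≤ (e * N)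
    (∣∣-bij (dil x S ∩ dil y S) (pH ∩ shift (x ⊝ y) pH) (x ⊝_) (x ⊝_) (⊝-⊝ x) (⊝-⊝ x) λ {z} ((_ , u) , (_ , v)) →
      neighbour x∈ u , subst (_∈ pH) (solve 3 (λ x y z → y :- z := x :- z :- (x :- y)) refl x y z) (neighbour y∈ v)))
    where
    neighbour : ∀ {x z} → x ∈ H → inv x ⊗ z ⊝ 𝟏 ∈ pH → x ⊝ z ∈ pH
    neighbour {x} {z} x∈ u = subst (_∈ H) eq (⊗∈ ⊖𝟏∈ (⊗∈ x∈ u))
      where
      eq : ⊖ 𝟏 ⊗ (x ⊗ (inv p ⊗ (inv x ⊗ z ⊝ 𝟏))) ≡ inv p ⊗ (x ⊝ z)
      eq = trans (solve 5 (λ o x p′ x′ z → :- o :* (x :* (p′ :* (x′ :* z :- o))) := p′ :* (o :* o :* x :- o :* (x :* x′) :* z)) refl 𝟏 x (inv p) (inv x) z)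
        (cong (inv p ⊗_) (cong₂ _⊝_ (trans (cong (_⊗ x) (⊗-identityˡ 𝟏)) (⊗-identityˡ _))
          (trans (cong (_⊗ z) (trans (⊗-identityˡ _) (inverseʳ (∈⇒≢𝟎 x∈)))) (⊗-identityˡ z))))

¬×⇒⊎ : {P Q : Set} → Dec P → ¬ (P × Q) → ¬ P ⊎ ¬ Q
¬×⇒⊎ (yes p) f = inj₂ λ r → f (p , r)
¬×⇒⊎ (no ¬p) f = inj₁ ¬p

⊎-trichotomy : {P Q : Set} → Dec P → Dec Q → P ⊎ Q ⊎ (¬ P × ¬ Q)
⊎-trichotomy (yes p) _       = inj₁ p
⊎-trichotomy (no _)  (yes r) = inj₂ (inj₁ r)
⊎-trichotomy (no ¬p) (no ¬r) = inj₂ (inj₂ (¬p , ¬r))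

quarter : ∀ {k} → k ≡ 160 → ∀ {x s} → k * x ≤ 5 * (8 * s) → 4 * x ≤ s
quarter refl {x} {s} h = ℕ.*-cancelˡ-≤ 40 (subst₂ _≤_ (ℕ.*-assoc 40 4 x) (sym (ℕ.*-assoc 5 8 s)) h)

module CoreSets {q : ℕ} (𝔽 : FieldOn q)
  (H : Counting.FSet q) (H-sub : IsSymmetricSubgroup 𝔽 H)
  (p : Fin q) (p≢𝟎 : p ≢ FieldOn.𝟎 𝔽)
  (1≤σ : 1 ≤ CayleyGraph.σ 𝔽 H H-sub p p≢𝟎) where

  open FieldSets 𝔽
  open Growth 𝔽
  open Inverses 𝔽
  open IsSymmetricSubgroup H-sub
  open CayleyGraph 𝔽 H H-sub p p≢𝟎

  S′ : FSet
  S′ = ⟨ (λ x → mem? S x ×-dec (e′ * badRow S e x ℕ.≤? σ)) ⟩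

  S′⊆S : S′ ⊆ S
  S′⊆S = proj₁

  instance
    σ-nonZero : NonZero σ
    σ-nonZero = >-nonZero 1≤σ

    e′-nonZero : NonZero e′
    e′-nonZero = subst NonZero (sym e′≡160) _

  ∣S∖S′∣ : 8 * ⟦ S ∖ S′ ⟧ ≤ σ
  ∣S∖S′∣ = ℕ.*-cancelˡ-≤ e′ (ℕ.*-cancelˡ-≤ σ (begin
    σ * (e′ * (8 * ⟦ S ∖ S′ ⟧))
      ≡⟨ rearrange₁ σ e′ 8 _ ⟩
    8 * e′ * (σ * ⟦ S ∖ S′ ⟧)
      ≡⟨ cong (_* (σ * ⟦ S ∖ S′ ⟧)) e≡8e′ ⟨
    e * (σ * ⟦ S ∖ S′ ⟧)
      ≤⟨ ℕ.*-monoʳ-≤ e (fibre-≥ (S ∖ S′) (badRow S e) σ e′ (λ (x∈ , x∉) → ℕ.<⇒≤ (ℕ.≰⇒> λ le → x∉ (x∈ , le)))) ⟩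
    e * (e′ * sum (badRow S e))
      ≡⟨ rearrange₂ e e′ _ ⟩
    e′ * (e * sum (badRow S e))
      ≤⟨ ℕ.*-monoʳ-≤ e′ (few-bad-pairs S e S⊆H S-inv) ⟩
    e′ * (σ * σ)
      ≡⟨ rearrange₂ e′ σ σ ⟩
    σ * (e′ * σ) ∎))
    where
    open ℕ.≤-Reasoning
    rearrange₁ : ∀ s e k x → s * (e * (k * x)) ≡ k * e * (s * x)
    rearrange₁ = ℕ-Solver.solve-∀
    rearrange₂ : ∀ a b c → a * (b * c) ≡ b * (a * c)
    rearrange₂ = ℕ-Solver.solve-∀

  S′⊆H : S′ ⊆ H
  S′⊆H x∈ = S⊆H (S′⊆S x∈)

  S′-inv : ∀ {x} → x ∈ S′ → inv x ∈ S′
  S′-inv {x} (x∈ , few) = S-inv x∈ , ℕ.≤-trans (ℕ.*-monoʳ-≤ e′ (begin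
    sum (λ y → 𝟙 (badPair? S e (inv x) y))
      ≡⟨ ∑-bij (λ y → 𝟙 (badPair? S e (inv x) y)) inv inv inv-inv inv-inv ⟩
    sum (λ y → 𝟙 (badPair? S e (inv x) (inv y)))
      ≤⟨ ∑-mono (λ y → 𝟙-mono (badPair? S e (inv x) (inv y)) (badPair? S e x y) λ (_ , y∈ , β) →
           let y∈′ = subst (_∈ S) (inv-inv y) (S-inv y∈) in
           x∈ , y∈′ , subst (λ k → e * N * k < σ * σ) (codeg-inv S (∈⇒≢𝟎 (S⊆H x∈)) (∈⇒≢𝟎 (S⊆H y∈′))) β) ⟩
    sum (λ y → 𝟙 (badPair? S e x y)) ∎)) few
    where open ℕ.≤-Reasoning

  σ≤S+ : σ ≡ ⟦ S′ ⟧ + ⟦ S ∖ S′ ⟧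
  σ≤S+ = ∣∖∣ S S′ S′⊆S

  1≤S′ : 1 ≤ ⟦ S′ ⟧
  1≤S′ = ℕ.n≢0⇒n>0 λ eq → contradiction (ℕ.≤-trans (ℕ.*-monoʳ-≤ 8 (ℕ.≤-reflexive (trans σ≤S+ (cong (_+ ⟦ S ∖ S′ ⟧) eq)))) ∣S∖S′∣)
    (ℕ.<⇒≱ (ℕ.≤-trans (ℕ.≤-reflexive (ℕ.+-comm 1 σ)) (ℕ.+-monoʳ-≤ σ (ℕ.≤-trans 1≤σ (ℕ.m≤m+n σ _)))))

  opaque
    centre : ∃ λ b → b ∈ S′ × e₂ * badRow S′ e₂ b ≤ ⟦ S′ ⟧
    centre = decidable-stable (Fin.any? (λ b → mem? S′ b ×-dec (e₂ * badRow S′ e₂ b ℕ.≤? ⟦ S′ ⟧))) λ ¬r → contradiction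
      (ℕ.≤-trans (fibre-≥ S′ (badRow S′ e₂) (suc ⟦ S′ ⟧) e₂ (λ {b} b∈ → ℕ.≰⇒> λ le → ¬r (b , b∈ , le)))
        (few-bad-pairs S′ e₂ S′⊆H S′-inv))
      (ℕ.<⇒≱ (ℕ.+-monoˡ-≤ (⟦ S′ ⟧ * ⟦ S′ ⟧) 1≤S′))

  b₀ : Fin q
  b₀ = proj₁ centre

  b₀∈S′ : b₀ ∈ S′
  b₀∈S′ = proj₁ (proj₂ centre)

  b₀∈H : b₀ ∈ H
  b₀∈H = S′⊆H b₀∈S′

  A₁ : FSet
  A₁ = S′ ∩ ⟨ (λ a → ¬? (bad? S′ e₂ b₀ a)) ⟩

  ∣S′∖A₁∣ : 8 * ⟦ S′ ∖ A₁ ⟧ ≤ ⟦ S′ ⟧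
  ∣S′∖A₁∣ = subst (λ k → k * ⟦ S′ ∖ A₁ ⟧ ≤ ⟦ S′ ⟧) e₂≡8 (ℕ.≤-trans (ℕ.*-monoʳ-≤ e₂ (begin
    ⟦ S′ ∖ A₁ ⟧
      ≤⟨ ∣∣-mono (S′ ∖ A₁) ⟨ badPair? S′ e₂ b₀ ⟩ to ⟩
    ⟦ ⟨ badPair? S′ e₂ b₀ ⟩ ⟧
      ≡⟨ ⟦⟧-sum ⟨ badPair? S′ e₂ b₀ ⟩ ⟩
    badRow S′ e₂ b₀ ∎)) (proj₂ (proj₂ centre)))
    where
    open ℕ.≤-Reasoning
    to : ∀ {a} → a ∈ S′ ∖ A₁ → b₀ ∈ S′ × a ∈ S′ × Bad S′ e₂ b₀ a
    to {a} (a∈ , a∉) = b₀∈S′ , a∈ , decidable-stable (bad? S′ e₂ b₀ a) λ ¬β → a∉ (a∈ , ¬β)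

  Y : Fin q → FSet
  Y c = dil b₀ S′ ∩ dil c S′

  ∣Y∣ : ∀ {c} → c ∈ A₁ → ⟦ S′ ⟧ * ⟦ S′ ⟧ ≤ e₂ * N * ⟦ Y c ⟧
  ∣Y∣ (_ , ¬β) = ℕ.≮⇒≥ ¬β

  1≤Y : ∀ {c} → c ∈ A₁ → 1 ≤ ⟦ Y c ⟧
  1≤Y {c} c∈ = ℕ.n≢0⇒n>0 λ eq → contradiction
    (ℕ.≤-trans (ℕ.*-mono-≤ 1≤S′ 1≤S′) (ℕ.≤-trans (∣Y∣ c∈) (ℕ.≤-reflexive (trans (cong (e₂ * N *_) eq) (ℕ.*-zeroʳ (e₂ * N)))))) λ()

  badIn : Fin q → Fin q → Fin q → ℕ
  badIn g c x = ⟦ Y c ∩ ⟨ bad? S e (g ⊗ x) ⟩ ⟧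

  Exc : Fin q → Fin q → FSet
  Exc g c = S ∩ ⟨ (λ x → ¬? (4 * badIn g c x ℕ.≤? ⟦ Y c ⟧)) ⟩

  ∣Exc∣ : ∀ {g c} → g ∈ H → c ∈ A₁ → Y c ⊆ dil g S′ → e′ * ⟦ Exc g c ⟧ ≤ 4 * σ
  ∣Exc∣ {g} {c} g∈ c∈ Y⊆ = ℕ.*-cancelˡ-≤ ⟦ Y c ⟧ {{>-nonZero (1≤Y c∈)}} (begin
    ⟦ Y c ⟧ * (e′ * ⟦ Exc g c ⟧)
      ≡⟨ rearrange₂ ⟦ Y c ⟧ e′ _ ⟩
    e′ * (⟦ Y c ⟧ * ⟦ Exc g c ⟧)
      ≤⟨ ℕ.*-monoʳ-≤ e′ (fibre-≥ (Exc g c) row ⟦ Y c ⟧ 4 large) ⟩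
    e′ * (4 * sum row)
      ≡⟨ rearrange₂ e′ 4 _ ⟩
    4 * (e′ * sum row)
      ≡⟨ cong (λ k → 4 * (e′ * k)) (∑-comm (λ x y → 𝟙 (P? x y))) ⟩
    4 * (e′ * sum (λ y → sum (λ x → 𝟙 (P? x y))))
      ≡⟨ cong (4 *_) (*-distribˡ-sum e′ (λ y → sum (λ x → 𝟙 (P? x y)))) ⟩
    4 * sum (λ y → e′ * sum (λ x → 𝟙 (P? x y)))
      ≤⟨ ℕ.*-monoʳ-≤ 4 (∑-mono λ y → column y (mem? (Y c) y)) ⟩
    4 * sum (λ y → ι (Y c) y * σ)
      ≡⟨ cong (4 *_) (trans (sym (*-distribʳ-sum σ (ι (Y c)))) (cong (_* σ) (sym (⟦⟧-sum (Y c))))) ⟩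
    4 * (⟦ Y c ⟧ * σ)
      ≡⟨ rearrange₂ 4 ⟦ Y c ⟧ σ ⟩
    ⟦ Y c ⟧ * (4 * σ) ∎)
    where
    open ℕ.≤-Reasoning
    rearrange₂ : ∀ a b c → a * (b * c) ≡ b * (a * c)
    rearrange₂ = ℕ-Solver.solve-∀
    P? : ∀ x y → Dec (y ∈ Y c × x ∈ S × Bad S e (g ⊗ x) y)
    P? x y = mem? (Y c) y ×-dec (mem? S x ×-dec bad? S e (g ⊗ x) y)
    row : Fin q → ℕ
    row x = sum λ y → 𝟙 (P? x y)
    large : ∀ {x} → x ∈ Exc g c → ⟦ Y c ⟧ ≤ 4 * row x
    large {x} (x∈ , many) = ℕ.≤-trans (ℕ.<⇒≤ (ℕ.≰⇒> many)) (ℕ.*-monoʳ-≤ 4 (begin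
      badIn g c x
        ≡⟨ ⟦⟧-sum (Y c ∩ ⟨ bad? S e (g ⊗ x) ⟩) ⟩
      sum (ι (Y c ∩ ⟨ bad? S e (g ⊗ x) ⟩))
        ≤⟨ ∑-mono (λ y → 𝟙-mono (mem? (Y c ∩ ⟨ bad? S e (g ⊗ x) ⟩) y) (P? x y) λ (y∈ , β) → y∈ , x∈ , β) ⟩
      row x ∎))
    column : ∀ y (d : Dec (y ∈ Y c)) → e′ * sum (λ x → 𝟙 (d ×-dec (mem? S x ×-dec bad? S e (g ⊗ x) y))) ≤ 𝟙 d * σ
    column y (no _)  = ℕ.≤-reflexive (trans (cong (e′ *_) (∑-zero {q} λ _ → refl)) (ℕ.*-zeroʳ e′))
    column y (yes y∈) = ℕ.≤-trans (ℕ.*-monoʳ-≤ e′ (∑-mono λ x →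
        𝟙-mono (mem? S x ×-dec bad? S e (g ⊗ x) y) (badPair? S e (inv g ⊗ y) x) λ (x∈ , β) →
          S′⊆S (Y⊆ y∈) , x∈ , subst (λ k → e * N * k < σ * σ) (begin-equality
            codeg S (g ⊗ x) y
              ≡⟨ cong (codeg S (g ⊗ x)) (inv-cancel′ g≢𝟎 y) ⟨
            codeg S (g ⊗ x) (g ⊗ (inv g ⊗ y))
              ≡⟨ codeg-dil S g≢𝟎 (∈⇒≢𝟎 (S⊆H x∈)) (∈⇒≢𝟎 (S′⊆H (Y⊆ y∈))) ⟩
            codeg S x (inv g ⊗ y)
              ≡⟨ codeg-sym S x (inv g ⊗ y) ⟩
            codeg S (inv g ⊗ y) x ∎) β))
      (ℕ.≤-trans (proj₂ (Y⊆ y∈)) (ℕ.≤-reflexive (sym (ℕ.*-identityˡ σ))))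
      where g≢𝟎 = ∈⇒≢𝟎 g∈

  G : Fin q → FSet
  G c = A₁ ∩ ⟨ (λ x → (4 * badIn b₀ c x ℕ.≤? ⟦ Y c ⟧) ×-dec (4 * badIn c c x ℕ.≤? ⟦ Y c ⟧)) ⟩

  ∣A₁∖G∣ : ∀ {c} → c ∈ A₁ → e′ * ⟦ A₁ ∖ G c ⟧ ≤ 8 * σ
  ∣A₁∖G∣ {c} c∈ = begin
    e′ * ⟦ A₁ ∖ G c ⟧
      ≤⟨ ℕ.*-monoʳ-≤ e′ (ℕ.≤-trans (∣∣-mono (A₁ ∖ G c) (Exc b₀ c ∪ Exc c c) to) (∣∪∣ (Exc b₀ c) (Exc c c))) ⟩
    e′ * (⟦ Exc b₀ c ⟧ + ⟦ Exc c c ⟧)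
      ≡⟨ ℕ.*-distribˡ-+ e′ ⟦ Exc b₀ c ⟧ ⟦ Exc c c ⟧ ⟩
    e′ * ⟦ Exc b₀ c ⟧ + e′ * ⟦ Exc c c ⟧
      ≤⟨ ℕ.+-mono-≤ (∣Exc∣ b₀∈H c∈ proj₁) (∣Exc∣ (S′⊆H (proj₁ c∈)) c∈ proj₂) ⟩
    4 * σ + 4 * σ
      ≡⟨ double σ ⟩
    8 * σ ∎
    where
    open ℕ.≤-Reasoning
    double : ∀ s → 4 * s + 4 * s ≡ 8 * s
    double = ℕ-Solver.solve-∀
    to : A₁ ∖ G c ⊆ Exc b₀ c ∪ Exc c c
    to {x} (x∈ , x∉) = [ (λ ¬u → inj₁ (S′⊆S (proj₁ x∈) , ¬u)) , (λ ¬v → inj₂ (S′⊆S (proj₁ x∈) , ¬v)) ]′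
      (¬×⇒⊎ (4 * badIn b₀ c x ℕ.≤? ⟦ Y c ⟧) λ uv → x∉ (x∈ , uv))

  module Multipliers {k : ℕ} (k≤5 : k ≤ 5) (c : Fin k → Fin q) (c∈ : ∀ i → c i ∈ A₁) where

    T : FSet
    T = A₁ ∩ ⟨ (λ x → Fin.all? λ i → mem? (G (c i)) x) ⟩

    T⊆A₁ : T ⊆ A₁
    T⊆A₁ = proj₁

    ∣A₁∖T∣ : 4 * ⟦ A₁ ∖ T ⟧ ≤ σ
    ∣A₁∖T∣ = quarter e′≡160 (begin
      e′ * ⟦ A₁ ∖ T ⟧
        ≤⟨ ℕ.*-monoʳ-≤ e′ (∣⋃∣ (A₁ ∖ T) (λ i → A₁ ∖ G (c i)) to) ⟩
      e′ * sum (λ i → ⟦ A₁ ∖ G (c i) ⟧)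
        ≡⟨ *-distribˡ-sum e′ (λ i → ⟦ A₁ ∖ G (c i) ⟧) ⟩
      sum (λ i → e′ * ⟦ A₁ ∖ G (c i) ⟧)
        ≤⟨ ∑-mono (λ i → ∣A₁∖G∣ (c∈ i)) ⟩
      sum {k} (λ _ → 8 * σ)
        ≡⟨ ∑-const k (8 * σ) ⟩
      k * (8 * σ)
        ≤⟨ ℕ.*-monoˡ-≤ (8 * σ) k≤5 ⟩
      5 * (8 * σ) ∎)
      where
      open ℕ.≤-Reasoning
      to : ∀ {x} → x ∈ A₁ ∖ T → ∃ λ i → x ∈ A₁ ∖ G (c i)
      to {x} (x∈ , x∉) = let i , ∉G = Fin.¬∀⟶∃¬ k _ (λ i → mem? (G (c i)) x) (λ all → x∉ (x∈ , all)) in i , x∈ , ∉G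

    ∣T∣ : σ ≤ 2 * ⟦ T ⟧
    ∣T∣ = ℕ.*-cancelˡ-≤ 4 (ℕ.+-cancelˡ-≤ (4 * σ) _ _ (begin
      4 * σ + 4 * σ
        ≡⟨ collect σ ⟩
      8 * σ
        ≡⟨ cong (8 *_) (trans σ≤S+ (cong (_+ ⟦ S ∖ S′ ⟧) (trans (∣∖∣ S′ A₁ proj₁) (cong (_+ ⟦ S′ ∖ A₁ ⟧) (∣∖∣ A₁ T T⊆A₁))))) ⟩
      8 * (⟦ T ⟧ + ⟦ A₁ ∖ T ⟧ + ⟦ S′ ∖ A₁ ⟧ + ⟦ S ∖ S′ ⟧)
        ≡⟨ spread ⟦ T ⟧ _ _ _ ⟩
      2 * (4 * ⟦ A₁ ∖ T ⟧) + 8 * ⟦ S′ ∖ A₁ ⟧ + 8 * ⟦ S ∖ S′ ⟧ + 4 * (2 * ⟦ T ⟧)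
        ≤⟨ ℕ.+-monoˡ-≤ (4 * (2 * ⟦ T ⟧)) (ℕ.+-mono-≤ (ℕ.+-mono-≤ (ℕ.*-monoʳ-≤ 2 ∣A₁∖T∣)
             (ℕ.≤-trans ∣S′∖A₁∣ (∣∣-mono S′ S S′⊆S))) ∣S∖S′∣) ⟩
      2 * σ + σ + σ + 4 * (2 * ⟦ T ⟧)
        ≡⟨ cong (_+ 4 * (2 * ⟦ T ⟧)) (collect′ σ) ⟩
      4 * σ + 4 * (2 * ⟦ T ⟧) ∎))
      where
      open ℕ.≤-Reasoning
      collect : ∀ s → 4 * s + 4 * s ≡ 8 * s
      collect = ℕ-Solver.solve-∀
      collect′ : ∀ s → 2 * s + s + s ≡ 4 * s
      collect′ = ℕ-Solver.solve-∀
      spread : ∀ t u v w → 8 * (t + u + v + w) ≡ 2 * (4 * u) + 8 * v + 8 * w + 4 * (2 * t)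
      spread = ℕ-Solver.solve-∀

    D : Fin k → FSet
    D i = dil b₀ T ⊞ neg (dil (c i) T)

    difference-bound : ∀ i → ⟦ Y (c i) ⟧ * ⟦ D i ⟧ ≤ 2 * (⟦ Pop ⟧ * ⟦ Pop ⟧)
    difference-bound i = popular (D i) Pop Pop ⟦ Y (c i) ⟧ 2 λ t∈ → count (∈⊞⁻ (dil b₀ T) (neg (dil (c i) T)) t∈)
      where
      open ℕ.≤-Reasoning
      count : ∀ {t} → (∃ λ u → ∃ λ v → u ∈ dil b₀ T × v ∈ neg (dil (c i) T) × u ⊕ v ≡ t) →
              ⟦ Y (c i) ⟧ ≤ 2 * ⟦ Pop ∩ shift t Pop ⟧
      count (u , v , x∈ , x′∈ , refl) = ℕ.*-cancelˡ-≤ 2 (ℕ.+-cancelˡ-≤ (2 * y) _ _ (begin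
        2 * y + 2 * y
          ≡⟨ collect y ⟩
        4 * y
          ≤⟨ ℕ.*-monoʳ-≤ 4 (ℕ.≤-trans (∣∣-mono (Y (c i)) (Good ∪ (Bad₁ ∪ Bad₂)) split)
               (ℕ.≤-trans (∣∪∣ Good (Bad₁ ∪ Bad₂)) (ℕ.+-mono-≤ good (∣∪∣ Bad₁ Bad₂)))) ⟩
        4 * (⟦ Pop ∩ shift (u ⊕ v) Pop ⟧ + (⟦ Bad₁ ⟧ + ⟦ Bad₂ ⟧))
          ≡⟨ spread ⟦ Pop ∩ shift (u ⊕ v) Pop ⟧ ⟦ Bad₁ ⟧ ⟦ Bad₂ ⟧ ⟩
        4 * ⟦ Bad₁ ⟧ + 4 * ⟦ Bad₂ ⟧ + 2 * (2 * ⟦ Pop ∩ shift (u ⊕ v) Pop ⟧)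
          ≤⟨ ℕ.+-monoˡ-≤ _ (ℕ.+-mono-≤ (proj₁ (proj₂ (proj₂ x∈ i))) (proj₂ (proj₂ (proj₂ x′∈ i)))) ⟩
        y + y + 2 * (2 * ⟦ Pop ∩ shift (u ⊕ v) Pop ⟧)
          ≡⟨ cong (_+ 2 * (2 * ⟦ Pop ∩ shift (u ⊕ v) Pop ⟧)) (cong (y +_) (sym (ℕ.+-identityʳ y))) ⟩
        2 * y + 2 * (2 * ⟦ Pop ∩ shift (u ⊕ v) Pop ⟧) ∎))
        where
        y = ⟦ Y (c i) ⟧
        ci∈H = S′⊆H (proj₁ (c∈ i))
        bu = b₀ ⊗ (inv b₀ ⊗ u)
        cv = c i ⊗ (inv (c i) ⊗ (⊖ v))
        bu≡ : bu ≡ u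
        bu≡ = inv-cancel′ (∈⇒≢𝟎 b₀∈H) u
        cv≡ : cv ≡ ⊖ v
        cv≡ = inv-cancel′ (∈⇒≢𝟎 ci∈H) (⊖ v)
        bu∈H : bu ∈ H
        bu∈H = ⊗∈ b₀∈H (S′⊆H (proj₁ (T⊆A₁ x∈)))
        cv∈H : cv ∈ H
        cv∈H = ⊗∈ ci∈H (S′⊆H (proj₁ (T⊆A₁ x′∈)))
        Bad₁ Bad₂ Good : FSet
        Bad₁ = Y (c i) ∩ ⟨ bad? S e bu ⟩
        Bad₂ = Y (c i) ∩ ⟨ bad? S e cv ⟩
        Good = Y (c i) ∩ ⟨ (λ y → ¬? (bad? S e bu y) ×-dec ¬? (bad? S e cv y)) ⟩
        split : Y (c i) ⊆ Good ∪ (Bad₁ ∪ Bad₂)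
        split {z} z∈ = [ (λ β → inj₂ (inj₁ (z∈ , β))) , [ (λ γ → inj₂ (inj₂ (z∈ , γ))) , (λ ¬βγ → inj₁ (z∈ , ¬βγ)) ]′ ]′
          (⊎-trichotomy (bad? S e bu z) (bad? S e cv z))
        good : ⟦ Good ⟧ ≤ ⟦ Pop ∩ shift (u ⊕ v) Pop ⟧
        good = ∣∣-bij Good (Pop ∩ shift (u ⊕ v) Pop) (u ⊝_) (u ⊝_) (⊝-⊝ u) (⊝-⊝ u) λ {z} (z∈ , ¬β , ¬γ) →
          let z∈H = subst (_∈ H) (inv-cancel′ (∈⇒≢𝟎 b₀∈H) z) (⊗∈ b₀∈H (S′⊆H (proj₁ z∈))) in
          subst (λ w → w ⊝ z ∈ Pop) bu≡ (good⇒popular bu∈H z∈H ¬β) ,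
          subst (_∈ Pop) (trans (cong (_⊝ z) cv≡) (solve 3 (λ u v z → :- v :- z := u :- z :- (u :+ v)) refl u v z))
            (good⇒popular cv∈H z∈H ¬γ)
        collect : ∀ s → 2 * s + 2 * s ≡ 4 * s
        collect = ℕ-Solver.solve-∀
        spread : ∀ g u v → 4 * (g + (u + v)) ≡ 4 * u + 4 * v + 2 * (2 * g)
        spread = ℕ-Solver.solve-∀

    C₁ : ℕ
    C₁ = 8 * e₂ * (e * e)

    difference-bound′ : ∀ i → ⟦ D i ⟧ * σ ^ 6 ≤ C₁ * N ^ 7
    difference-bound′ i = begin
      d * σ ^ 6
        ≡⟨ rearrange₁ d σ ⟩
      (σ * σ) * d * (σ * σ) * (σ * σ)
        ≤⟨ ℕ.*-monoˡ-≤ (σ * σ) (ℕ.*-monoˡ-≤ (σ * σ) (ℕ.*-monoˡ-≤ d (ℕ.*-mono-≤ σ≤2S′ σ≤2S′))) ⟩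
      (2 * s * (2 * s)) * d * (σ * σ) * (σ * σ)
        ≡⟨ rearrange₂ s d (σ * σ) ⟩
      4 * (s * s) * d * ((σ * σ) * (σ * σ))
        ≤⟨ ℕ.*-monoˡ-≤ _ (ℕ.*-monoˡ-≤ d (ℕ.*-monoʳ-≤ 4 (∣Y∣ (c∈ i)))) ⟩
      4 * (e₂ * N * y) * d * ((σ * σ) * (σ * σ))
        ≡⟨ rearrange₃ e₂ N y d ((σ * σ) * (σ * σ)) ⟩
      4 * e₂ * N * (y * d) * ((σ * σ) * (σ * σ))
        ≤⟨ ℕ.*-monoˡ-≤ _ (ℕ.*-monoʳ-≤ (4 * e₂ * N) (difference-bound i)) ⟩
      4 * e₂ * N * (2 * (⟦ Pop ⟧ * ⟦ Pop ⟧)) * ((σ * σ) * (σ * σ))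
        ≡⟨ rearrange₄ e₂ N ⟦ Pop ⟧ (σ * σ) ⟩
      8 * e₂ * N * ((σ * σ * ⟦ Pop ⟧) * (σ * σ * ⟦ Pop ⟧))
        ≤⟨ ℕ.*-monoʳ-≤ (8 * e₂ * N) (ℕ.*-mono-≤ ∣Pop∣ ∣Pop∣) ⟩
      8 * e₂ * N * ((e * N * (N * N)) * (e * N * (N * N)))
        ≡⟨ rearrange₅ e₂ e N ⟩
      8 * e₂ * (e * e) * N ^ 7 ∎
      where
      open ℕ.≤-Reasoning
      d = ⟦ D i ⟧
      s = ⟦ S′ ⟧
      y = ⟦ Y (c i) ⟧
      σ≤2S′ : σ ≤ 2 * s
      σ≤2S′ = ℕ.≤-trans ∣T∣ (ℕ.*-monoʳ-≤ 2 (∣∣-mono T S′ (λ x∈ → proj₁ (T⊆A₁ x∈))))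
      rearrange₁ : ∀ d s → d * (s * (s * (s * (s * (s * (s * 1)))))) ≡ (s * s) * d * (s * s) * (s * s)
      rearrange₁ = ℕ-Solver.solve-∀
      rearrange₂ : ∀ s d t → (2 * s * (2 * s)) * d * t * t ≡ 4 * (s * s) * d * (t * t)
      rearrange₂ = ℕ-Solver.solve-∀
      rearrange₃ : ∀ e n y d t → 4 * (e * n * y) * d * t ≡ 4 * e * n * (y * d) * t
      rearrange₃ = ℕ-Solver.solve-∀
      rearrange₄ : ∀ e n p t → 4 * e * n * (2 * (p * p)) * (t * t) ≡ 8 * e * n * ((t * p) * (t * p))
      rearrange₄ = ℕ-Solver.solve-∀
      rearrange₅ : ∀ f e n → 8 * f * n * ((e * n * (n * n)) * (e * n * (n * n))) ≡
                   8 * f * (e * e) * (n * (n * (n * (n * (n * (n * (n * 1)))))))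
      rearrange₅ = ℕ-Solver.solve-∀

^-distribʳ-* : ∀ k m n → (m * n) ^ k ≡ m ^ k * n ^ k
^-distribʳ-* zero    m n = refl
^-distribʳ-* (suc k) m n = trans (cong (m * n *_) (^-distribʳ-* k m n)) (rearrange m n (m ^ k) (n ^ k))
  where
  rearrange : ∀ m n u v → m * n * (u * v) ≡ m * u * (n * v)
  rearrange = ℕ-Solver.solve-∀

size-bound : ∀ d b t x s n c → d * t ^ 6 ≤ b ^ 6 * x → s ≤ 2 * t → x ≤ n → b * s ^ 6 ≤ c * n ^ 7 →
             d * s ^ 42 ≤ (2 ^ 6 * c ^ 6) * n ^ 43
size-bound d b t x s n c h₁ h₂ h₃ h₄ = begin
  d * s ^ 42
    ≡⟨ cong (d *_) (trans (ℕ.^-distribˡ-+-* s 6 36) (cong (s ^ 6 *_) (sym (ℕ.^-*-assoc s 6 6)))) ⟩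
  d * (s ^ 6 * (s ^ 6) ^ 6)
    ≤⟨ ℕ.*-monoʳ-≤ d (ℕ.*-monoˡ-≤ ((s ^ 6) ^ 6) (ℕ.^-monoˡ-≤ 6 h₂)) ⟩
  d * ((2 * t) ^ 6 * (s ^ 6) ^ 6)
    ≡⟨ cong (λ u → d * (u * (s ^ 6) ^ 6)) (^-distribʳ-* 6 2 t) ⟩
  d * (2 ^ 6 * t ^ 6 * (s ^ 6) ^ 6)
    ≡⟨ rearrange₁ d (2 ^ 6) (t ^ 6) ((s ^ 6) ^ 6) ⟩
  2 ^ 6 * ((d * t ^ 6) * (s ^ 6) ^ 6)
    ≤⟨ ℕ.*-monoʳ-≤ (2 ^ 6) (ℕ.*-monoˡ-≤ ((s ^ 6) ^ 6) (ℕ.≤-trans h₁ (ℕ.*-monoʳ-≤ (b ^ 6) h₃))) ⟩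
  2 ^ 6 * ((b ^ 6 * n) * (s ^ 6) ^ 6)
    ≡⟨ cong (2 ^ 6 *_) (rearrange₂ (b ^ 6) n ((s ^ 6) ^ 6)) ⟩
  2 ^ 6 * ((b ^ 6 * (s ^ 6) ^ 6) * n)
    ≡⟨ cong (λ u → 2 ^ 6 * (u * n)) (^-distribʳ-* 6 b (s ^ 6)) ⟨
  2 ^ 6 * ((b * s ^ 6) ^ 6 * n)
    ≤⟨ ℕ.*-monoʳ-≤ (2 ^ 6) (ℕ.*-monoˡ-≤ n (ℕ.^-monoˡ-≤ 6 h₄)) ⟩
  2 ^ 6 * ((c * n ^ 7) ^ 6 * n)
    ≡⟨ cong (λ u → 2 ^ 6 * (u * n)) (trans (^-distribʳ-* 6 c (n ^ 7)) (cong (c ^ 6 *_) (ℕ.^-*-assoc n 7 6))) ⟩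
  2 ^ 6 * (c ^ 6 * n ^ 42 * n)
    ≡⟨ rearrange₃ (2 ^ 6) (c ^ 6) (n ^ 42) n ⟩
  2 ^ 6 * c ^ 6 * (n * n ^ 42) ∎
  where
  open ℕ.≤-Reasoning
  rearrange₁ : ∀ d k t s → d * (k * t * s) ≡ k * ((d * t) * s)
  rearrange₁ = ℕ-Solver.solve-∀
  rearrange₂ : ∀ b n s → b * n * s ≡ b * s * n
  rearrange₂ = ℕ-Solver.solve-∀
  rearrange₃ : ∀ k c m n → k * (c * m * n) ≡ k * c * (n * m)
  rearrange₃ = ℕ-Solver.solve-∀

2xy≤x²+y² : ∀ x y → 2 * (x * y) ≤ x * x + y * y
2xy≤x²+y² x y with ℕ.≤-total x y
... | inj₁ x≤y = subst (λ y → 2 * (x * y) ≤ x * x + y * y) (ℕ.m+[n∸m]≡n x≤y) (bound x (y ∸ x))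
  where
  bound : ∀ x k → 2 * (x * (x + k)) ≤ x * x + (x + k) * (x + k)
  bound x k = ℕ.≤-trans (ℕ.m≤m+n _ (k * k)) (ℕ.≤-reflexive (identity x k))
    where
    identity : ∀ x k → 2 * (x * (x + k)) + k * k ≡ x * x + (x + k) * (x + k)
    identity = ℕ-Solver.solve-∀
... | inj₂ y≤x = subst (λ x → 2 * (x * y) ≤ x * x + y * y) (ℕ.m+[n∸m]≡n y≤x) (bound y (x ∸ y))
  where
  bound : ∀ y k → 2 * ((y + k) * y) ≤ (y + k) * (y + k) + y * y
  bound y k = ℕ.≤-trans (ℕ.m≤m+n _ (k * k)) (ℕ.≤-reflexive (identity y k))
    where
    identity : ∀ y k → 2 * ((y + k) * y) + k * k ≡ (y + k) * (y + k) + y * y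
    identity = ℕ-Solver.solve-∀

cauchy-schwarz : ∀ {n} (a b : Fin n → ℕ) →
  sum (λ i → a i * b i) * sum (λ i → a i * b i) ≤ sum (λ i → a i * a i) * sum (λ i → b i * b i)
cauchy-schwarz {n} a b = ℕ.*-cancelˡ-≤ 2 (begin
  2 * (sum ab * sum ab)
    ≡⟨ cong (2 *_) (∑²-distrib ab ab) ⟨
  2 * sum (λ i → sum λ j → ab i * ab j)
    ≡⟨ trans (*-distribˡ-sum 2 (λ i → sum λ j → ab i * ab j)) (sum-cong-≗ λ i → *-distribˡ-sum 2 (λ j → ab i * ab j)) ⟩
  sum (λ i → sum λ j → 2 * (ab i * ab j))
    ≤⟨ ∑-mono (λ i → ∑-mono λ j → pointwise (a i) (b i) (a j) (b j)) ⟩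
  sum (λ i → sum λ j → aa i * bb j + bb i * aa j)
    ≡⟨ trans (sum-cong-≗ λ i → ∑-distrib-+ (λ j → aa i * bb j) (λ j → bb i * aa j))
             (∑-distrib-+ (λ i → sum λ j → aa i * bb j) (λ i → sum λ j → bb i * aa j)) ⟩
  sum (λ i → sum λ j → aa i * bb j) + sum (λ i → sum λ j → bb i * aa j)
    ≡⟨ cong₂ _+_ (∑²-distrib aa bb) (∑²-distrib bb aa) ⟩
  sum aa * sum bb + sum bb * sum aa
    ≡⟨ twice (sum aa) (sum bb) ⟩
  2 * (sum aa * sum bb) ∎)
  where
  open ℕ.≤-Reasoning
  ab aa bb : Fin n → ℕ
  ab i = a i * b i
  aa i = a i * a i
  bb i = b i * b i
  twice : ∀ x y → x * y + y * x ≡ 2 * (x * y)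
  twice = ℕ-Solver.solve-∀
  pointwise : ∀ a b c d → 2 * ((a * b) * (c * d)) ≤ (a * a) * (d * d) + (b * b) * (c * c)
  pointwise a b c d = subst₂ _≤_ (identity₁ a b c d) (identity₂ a b c d) (2xy≤x²+y² (a * d) (b * c))
    where
    identity₁ : ∀ a b c d → 2 * ((a * d) * (b * c)) ≡ 2 * ((a * b) * (c * d))
    identity₁ = ℕ-Solver.solve-∀
    identity₂ : ∀ a b c d → (a * d) * (a * d) + (b * c) * (b * c) ≡ (a * a) * (d * d) + (b * b) * (c * c)
    identity₂ = ℕ-Solver.solve-∀

opaque
  unfolding e e₂

  C₂ : ℕ
  C₂ = 2 ^ 6 * (5 * (8 * e₂ * (e * e))) ^ 6

  1≤C₂ : 1 ≤ C₂
  1≤C₂ = ℕ.≤ᵇ⇒≤ 1 C₂ _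

C₃ : ℕ
C₃ = 4 * C₂

opaque
  unfolding e e₂ C₂

  2^44≤C₃ : 2 ^ 44 ≤ C₃
  2^44≤C₃ = ℕ.≤ᵇ⇒≤ (2 ^ 44) C₃ _

module Pivot {q : ℕ} (𝔽 : FieldOn q)
  (H : Counting.FSet q) (H-sub : IsSymmetricSubgroup 𝔽 H)
  (p : Fin q) (p≢𝟎 : p ≢ FieldOn.𝟎 𝔽)
  (1≤σ : 1 ≤ CayleyGraph.σ 𝔽 H H-sub p p≢𝟎) where

  open FieldSets 𝔽
  open Growth 𝔽
  open Inverses 𝔽
  open IsSymmetricSubgroup H-sub
  open CayleyGraph 𝔽 H H-sub p p≢𝟎
  open CoreSets 𝔽 H H-sub p p≢𝟎 1≤σ

  A₁⊆H : A₁ ⊆ H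
  A₁⊆H x∈ = S′⊆H (proj₁ x∈)

  A₁≢𝟎 : ∀ {x} → x ∈ A₁ → x ≢ 𝟎
  A₁≢𝟎 x∈ = ∈⇒≢𝟎 (A₁⊆H x∈)

  reps : FSet → FSet → Fin q → Fin q → Fin q → ℕ
  reps U V v w z = sum λ y → 𝟙 (mem? V y ×-dec mem? U (inv v ⊗ (z ⊝ w ⊗ y)))

  ∑-reps : ∀ U V v w → v ≢ 𝟎 → sum (reps U V v w) ≡ ⟦ V ⟧ * ⟦ U ⟧
  ∑-reps U V v w v≢𝟎 = begin
    sum (λ z → sum λ y → 𝟙 (mem? V y ×-dec mem? U (inv v ⊗ (z ⊝ w ⊗ y))))
      ≡⟨ ∑-comm (λ z y → 𝟙 (mem? V y ×-dec mem? U (inv v ⊗ (z ⊝ w ⊗ y)))) ⟩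
    sum (λ y → sum λ z → 𝟙 (mem? V y ×-dec mem? U (inv v ⊗ (z ⊝ w ⊗ y))))
      ≡⟨ sum-cong-≗ (λ y → sum-cong-≗ λ z → 𝟙-× (mem? V y) (mem? U (inv v ⊗ (z ⊝ w ⊗ y)))) ⟩
    sum (λ y → sum λ z → ι V y * ι U (inv v ⊗ (z ⊝ w ⊗ y)))
      ≡⟨ sum-cong-≗ (λ y → sym (*-distribˡ-sum (ι V y) (λ z → ι U (inv v ⊗ (z ⊝ w ⊗ y))))) ⟩
    sum (λ y → ι V y * sum (λ z → ι U (inv v ⊗ (z ⊝ w ⊗ y))))
      ≡⟨ sum-cong-≗ (λ y → cong (ι V y *_) (sym (trans (⟦⟧-sum U) (∑-bij (ι U)
           (λ z → inv v ⊗ (z ⊝ w ⊗ y)) (λ x → v ⊗ x ⊕ w ⊗ y)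
           (λ x → trans (cong (inv v ⊗_) (⊕⊝ (v ⊗ x) (w ⊗ y))) (inv-cancel v≢𝟎 x))
           (λ z → trans (cong (_⊕ w ⊗ y) (inv-cancel′ v≢𝟎 _)) (⊝⊕ z (w ⊗ y))))))) ⟩
    sum (λ y → ι V y * ⟦ U ⟧)
      ≡⟨ *-distribʳ-sum ⟦ U ⟧ (ι V) ⟨
    sum (ι V) * ⟦ U ⟧
      ≡⟨ cong (_* ⟦ U ⟧) (⟦⟧-sum V) ⟨
    ⟦ V ⟧ * ⟦ U ⟧ ∎
    where open ≡-Reasoning

  LinearValues : FSet → Fin q → Fin q → FSet → Set
  LinearValues T v w D = ∀ {x y} → x ∈ T → y ∈ T → v ⊗ x ⊕ w ⊗ y ∈ D

  reps-support : ∀ T v w D → v ≢ 𝟎 → LinearValues T v w D → ∀ z → reps T T v w z ≤ reps T T v w z * ι D z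
  reps-support T v w D v≢𝟎 val z = aux (mem? D z) λ {y} (y∈ , x∈) →
    subst (_∈ D) (trans (cong (_⊕ w ⊗ y) (inv-cancel′ v≢𝟎 _)) (⊝⊕ z (w ⊗ y))) (val x∈ y∈)
    where
    aux : (d : Dec (z ∈ D)) → (∀ {y} → y ∈ T × inv v ⊗ (z ⊝ w ⊗ y) ∈ T → z ∈ D) → reps T T v w z ≤ reps T T v w z * 𝟙 d
    aux (yes _) _ = ℕ.≤-reflexive (sym (ℕ.*-identityʳ _))
    aux (no z∉) f = ℕ.≤-trans (ℕ.≤-reflexive (∑-zero λ y → 𝟙-no (mem? T y ×-dec mem? T (inv v ⊗ (z ⊝ w ⊗ y))) λ m → z∉ (f m))) z≤n

  injective-count : ∀ T v w D → v ≢ 𝟎 → LinearValues T v w D →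
    (∀ {x x′ y y′} → x ∈ T → x′ ∈ T → y ∈ T → y′ ∈ T → v ⊗ x ⊕ w ⊗ y ≡ v ⊗ x′ ⊕ w ⊗ y′ → y ≡ y′) →
    ⟦ T ⟧ * ⟦ T ⟧ ≤ ⟦ D ⟧
  injective-count T v w D v≢𝟎 val inj = begin
    ⟦ T ⟧ * ⟦ T ⟧                             ≡⟨ ∑-reps T T v w v≢𝟎 ⟨
    sum (reps T T v w)                        ≤⟨ ∑-mono (reps-support T v w D v≢𝟎 val) ⟩
    sum (λ z → reps T T v w z * ι D z)        ≤⟨ ∑-mono (λ z → ℕ.*-monoˡ-≤ (ι D z) (∑-atMostOne (P? z) (unique z))) ⟩
    sum (λ z → 1 * ι D z)                     ≡⟨ sum-cong-≗ (λ z → ℕ.*-identityˡ (ι D z)) ⟩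
    sum (ι D)                                 ≡⟨ ⟦⟧-sum D ⟨
    ⟦ D ⟧                                     ∎
    where
    open ℕ.≤-Reasoning
    P? : ∀ z y → Dec (y ∈ T × inv v ⊗ (z ⊝ w ⊗ y) ∈ T)
    P? z y = mem? T y ×-dec mem? T (inv v ⊗ (z ⊝ w ⊗ y))
    value : ∀ z y → v ⊗ (inv v ⊗ (z ⊝ w ⊗ y)) ⊕ w ⊗ y ≡ z
    value z y = trans (cong (_⊕ w ⊗ y) (inv-cancel′ v≢𝟎 _)) (⊝⊕ z (w ⊗ y))
    unique : ∀ z {y y′} → y ∈ T × inv v ⊗ (z ⊝ w ⊗ y) ∈ T → y′ ∈ T × inv v ⊗ (z ⊝ w ⊗ y′) ∈ T → y ≡ y′
    unique z {y} {y′} (y∈ , x∈) (y′∈ , x′∈) = inj x∈ x′∈ y∈ y′∈ (trans (value z y) (sym (value z y′)))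

  module Union {k} (k≤5 : k ≤ 5) (c : Fin k → Fin q) (c∈ : ∀ i → c i ∈ A₁) where

    open Multipliers k≤5 c c∈ public

    Z B −B : FSet
    Z = dil b₀ T
    B = ⟨ (λ t → Fin.any? λ i → mem? (dil (c i) T) t) ⟩
    −B = neg B

    ∈−B : ∀ i {x} → x ∈ T → ⊖ (c i ⊗ x) ∈ −B
    ∈−B i x∈ = ∈neg B (i , ∈dil T (A₁≢𝟎 (c∈ i)) x∈)

    ∣Z∣ : ⟦ Z ⟧ ≡ ⟦ T ⟧
    ∣Z∣ = ∣dil∣ T (∈⇒≢𝟎 b₀∈H)

    ∣Z−B∣ : ⟦ Z ⊞ −B ⟧ * σ ^ 6 ≤ (5 * C₁) * N ^ 7
    ∣Z−B∣ = begin
      ⟦ Z ⊞ −B ⟧ * σ ^ 6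
        ≤⟨ ℕ.*-monoˡ-≤ (σ ^ 6) (∣⋃∣ (Z ⊞ −B) D λ (z , z∈ , i , m) → i , z , z∈ , m) ⟩
      sum (λ i → ⟦ D i ⟧) * σ ^ 6
        ≡⟨ *-distribʳ-sum (σ ^ 6) (λ i → ⟦ D i ⟧) ⟩
      sum (λ i → ⟦ D i ⟧ * σ ^ 6)
        ≤⟨ ∑-mono difference-bound′ ⟩
      sum {k} (λ _ → C₁ * N ^ 7)
        ≡⟨ ∑-const k _ ⟩
      k * (C₁ * N ^ 7)
        ≤⟨ ℕ.*-monoˡ-≤ (C₁ * N ^ 7) k≤5 ⟩
      5 * (C₁ * N ^ 7)
        ≡⟨ ℕ.*-assoc 5 C₁ (N ^ 7) ⟨
      (5 * C₁) * N ^ 7 ∎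
      where open ℕ.≤-Reasoning

    1≤T : 1 ≤ ⟦ T ⟧
    1≤T = ℕ.n≢0⇒n>0 λ eq → contradiction (ℕ.≤-trans 1≤σ (ℕ.≤-trans ∣T∣ (ℕ.≤-reflexive (cong (2 *_) eq)))) λ()

    opaque
      growing : Σ FSet λ X → X ⊆ Z × 1 ≤ ⟦ X ⟧ × GrowthBound X −B ⟦ Z ⊞ −B ⟧ ⟦ Z ⟧
      growing = growthSet Z −B (subst (1 ≤_) (sym ∣Z∣) 1≤T)

    X : FSet
    X = proj₁ growing

    ∣X∣ : ⟦ X ⟧ ≤ N
    ∣X∣ = ∣∣-mono X H λ x∈ → let x∈Z = proj₁ (proj₂ growing) x∈ in
      subst (_∈ H) (inv-cancel′ (∈⇒≢𝟎 b₀∈H) _) (⊗∈ b₀∈H (A₁⊆H (T⊆A₁ x∈Z)))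

  module _ {k} (k≤5 : k ≤ 5) (c : Fin k → Fin q) (c∈ : ∀ i → c i ∈ A₁) where

    open Union k≤5 c c∈

    opaque
      unfolding C₂

      values-bound : ∀ D → ⟦ D ⟧ * ⟦ Z ⟧ ^ 6 ≤ ⟦ Z ⊞ −B ⟧ ^ 6 * ⟦ X ⟧ → ⟦ D ⟧ * σ ^ 42 ≤ C₂ * N ^ 43
      values-bound D h = size-bound ⟦ D ⟧ ⟦ Z ⊞ −B ⟧ ⟦ T ⟧ ⟦ X ⟧ σ N (5 * C₁)
        (subst (λ z → ⟦ D ⟧ * z ^ 6 ≤ ⟦ Z ⊞ −B ⟧ ^ 6 * ⟦ X ⟧) ∣Z∣ h) ∣T∣ ∣X∣ ∣Z−B∣

    opaque
      triple : FSet
      triple = (−B ⊞ (−B ⊞ −B)) ⊞ neg (−B ⊞ (−B ⊞ −B))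

      triple-bound : ⟦ triple ⟧ * σ ^ 42 ≤ C₂ * N ^ 43
      triple-bound = values-bound triple
        (triple-sum-bound X −B ⟦ Z ⊞ −B ⟧ ⟦ Z ⟧ (proj₁ (proj₂ (proj₂ growing))) (proj₂ (proj₂ (proj₂ growing))))

      ∈triple : ∀ {u v w x y z} → u ∈ −B → v ∈ −B → w ∈ −B → x ∈ −B → y ∈ −B → z ∈ −B →
                (u ⊕ (v ⊕ w)) ⊝ (x ⊕ (y ⊕ z)) ∈ triple
      ∈triple u∈ v∈ w∈ x∈ y∈ z∈ = ∈⊞ U (neg U) (sum₃ u∈ v∈ w∈) (∈neg U (sum₃ x∈ y∈ z∈))
        where
        U : FSet
        U = −B ⊞ (−B ⊞ −B)
        sum₃ : ∀ {u v w} → u ∈ −B → v ∈ −B → w ∈ −B → u ⊕ (v ⊕ w) ∈ U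
        sum₃ u∈ v∈ w∈ = ∈⊞ −B (−B ⊞ −B) u∈ (∈⊞ −B −B v∈ w∈)

    module _ (e : Fin q) (e≢𝟎 : e ≢ 𝟎) (eZ⊆B : dil e Z ⊆ B) where

      opaque
        mixed : FSet
        mixed = (−B ⊞ neg (dil e −B)) ⊞ neg (−B ⊞ neg (dil e −B))

        mixed-bound : ⟦ mixed ⟧ * σ ^ 42 ≤ C₂ * N ^ 43
        mixed-bound = values-bound mixed
          (mixed-sum-bound X −B ⟦ Z ⊞ −B ⟧ ⟦ Z ⟧ e e≢𝟎 (proj₁ (proj₂ (proj₂ growing))) (proj₂ (proj₂ (proj₂ growing)))
            λ t∈ → eZ⊆B (proj₁ (proj₂ growing) t∈))

        ∈mixed : ∀ {u v x y} → ⊖ u ∈ −B → ⊖ v ∈ −B → ⊖ x ∈ −B → ⊖ y ∈ −B → (⊖ u ⊕ e ⊗ v) ⊝ (⊖ x ⊕ e ⊗ y) ∈ mixed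
        ∈mixed u∈ v∈ x∈ y∈ = ∈⊞ U (neg U) (part u∈ v∈) (∈neg U (part x∈ y∈))
          where
          U : FSet
          U = −B ⊞ neg (dil e −B)
          part : ∀ {u v} → ⊖ u ∈ −B → ⊖ v ∈ −B → ⊖ u ⊕ e ⊗ v ∈ U
          part {u} {v} u∈ v∈ = ∈⊞ −B (neg (dil e −B)) u∈
            (subst (_∈ −B) (trans (sym (inv-cancel e≢𝟎 (⊖ v)))
              (cong (inv e ⊗_) (solve 2 (λ e v → e :* :- v := :- (e :* v)) refl e v))) v∈)

record IsSubfield {q : ℕ} (𝔽 : FieldOn q) (M : Counting.FSet q) : Set where
  open FieldSets 𝔽
  field
    𝟎∈   : 𝟎 ∈ M
    𝟏∈   : 𝟏 ∈ M
    ⊕∈   : ∀ {x y} → x ∈ M → y ∈ M → x ⊕ y ∈ M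
    ⊖∈   : ∀ {x} → x ∈ M → ⊖ x ∈ M
    ⊗∈   : ∀ {x y} → x ∈ M → y ∈ M → x ⊗ y ∈ M
    inv∈ : ∀ {x} → x ∈ M → inv x ∈ M

-- The additive stabiliser K of R contains 1 and is stable under E; the multiplicative
-- stabiliser of K is then a field, and it contains E and is contained in R.
module Stabiliser {q : ℕ} (𝔽 : FieldOn q) (R E : Counting.FSet q) where

  open FieldSets 𝔽
  open Growth 𝔽
  open Inverses 𝔽

  K M : FSet
  K = ⟨ (λ r → Fin.all? λ ξ → mem? R ξ →-dec mem? R (ξ ⊕ r)) ⟩
  M = ⟨ (λ m → Fin.all? λ k → mem? K k →-dec mem? K (m ⊗ k)) ⟩

  ⊗-stable⁻¹ : ∀ A {c} → c ≢ 𝟎 → (∀ {x} → x ∈ A → c ⊗ x ∈ A) → ∀ {x} → c ⊗ x ∈ A → x ∈ A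
  ⊗-stable⁻¹ A {c} c≢𝟎 stable {x} cx∈ = ⊇-by-size (dil (inv c) A) A
    (λ {y} y∈ → subst (λ d → d ⊗ y ∈ A) (sym (inv-inv c)) (stable y∈))
    (ℕ.≤-reflexive (∣dil∣ A (≢𝟎⇒inv≢𝟎 c≢𝟎))) (subst (λ d → d ⊗ x ∈ A) (sym (inv-inv c)) cx∈)

  ⊕-stable⁻¹ : ∀ A {c} → (∀ {x} → x ∈ A → x ⊕ c ∈ A) → ∀ {x} → x ⊕ c ∈ A → x ∈ A
  ⊕-stable⁻¹ A {c} stable {x} xc∈ = ⊇-by-size (shift (⊖ c) A) A
    (λ {y} y∈ → subst (λ d → y ⊕ d ∈ A) (sym (⊖⊖ c)) (stable y∈))
    (ℕ.≤-reflexive (∣shift∣ (⊖ c) A)) (subst (λ d → x ⊕ d ∈ A) (sym (⊖⊖ c)) xc∈)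

  module _ (𝟎∈R : 𝟎 ∈ R) (R+𝟏 : ∀ {ξ} → ξ ∈ R → ξ ⊕ 𝟏 ∈ R)
           (E≢𝟎 : ∀ {e} → e ∈ E → e ≢ 𝟎) (ER : ∀ {e ξ} → e ∈ E → ξ ∈ R → e ⊗ ξ ∈ R) where

    K⊆R : K ⊆ R
    K⊆R {r} r∈ = subst (_∈ R) (⊕-identityˡ r) (r∈ 𝟎 𝟎∈R)

    K-⊖ : ∀ {r} → r ∈ K → ⊖ r ∈ K
    K-⊖ {r} r∈ ξ ξ∈ = ⊕-stable⁻¹ R (λ {x} → r∈ x) (subst (_∈ R) (sym (⊝⊕ ξ r)) ξ∈)

    K-⊕ : ∀ {r s} → r ∈ K → s ∈ K → r ⊕ s ∈ K
    K-⊕ {r} {s} r∈ s∈ ξ ξ∈ = subst (_∈ R) (⊕-assoc ξ r s) (s∈ _ (r∈ ξ ξ∈))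

    K-E : ∀ {e r} → e ∈ E → r ∈ K → e ⊗ r ∈ K
    K-E {e} {r} e∈ r∈ ξ ξ∈ = subst (_∈ R)
      (trans (solve 3 (λ e x r → e :* (x :+ r) := e :* x :+ e :* r) refl e (inv e ⊗ ξ) r) (cong (_⊕ e ⊗ r) e⁻¹ξ))
      (ER e∈ (r∈ _ (⊗-stable⁻¹ R (E≢𝟎 e∈) (ER e∈) (subst (_∈ R) (sym e⁻¹ξ) ξ∈))))
      where e⁻¹ξ = inv-cancel′ (E≢𝟎 e∈) ξ

    𝟏∈K : 𝟏 ∈ K
    𝟏∈K ξ = R+𝟏

    M⊆R : M ⊆ R
    M⊆R {m} m∈ = K⊆R (subst (_∈ K) (⊗-identityʳ m) (m∈ 𝟏 𝟏∈K))

    E⊆M : E ⊆ M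
    E⊆M e∈ k = K-E e∈

    M-⊗ : ∀ {x y} → x ∈ M → y ∈ M → x ⊗ y ∈ M
    M-⊗ {x} {y} x∈ y∈ k k∈ = subst (_∈ K) (sym (⊗-assoc x y k)) (x∈ _ (y∈ k k∈))

    M-𝟎 : 𝟎 ∈ M
    M-𝟎 k k∈ = subst (_∈ K) (trans (⊖-inverseʳ k) (sym (⊗-zeroˡ k))) (K-⊕ k∈ (K-⊖ k∈))

    M-𝟏 : 𝟏 ∈ M
    M-𝟏 k k∈ = subst (_∈ K) (sym (⊗-identityˡ k)) k∈

    M-isSubfield : IsSubfield 𝔽 M
    M-isSubfield = record
      { 𝟎∈ = M-𝟎
      ; 𝟏∈ = M-𝟏
      ; ⊕∈ = λ {x} {y} x∈ y∈ k k∈ → subst (_∈ K)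
          (solve 3 (λ x y k → x :* k :+ y :* k := (x :+ y) :* k) refl x y k) (K-⊕ (x∈ k k∈) (y∈ k k∈))
      ; ⊖∈ = λ {x} x∈ k k∈ → subst (_∈ K) (solve 2 (λ x k → :- (x :* k) := :- x :* k) refl x k) (K-⊖ (x∈ k k∈))
      ; ⊗∈ = M-⊗
      ; inv∈ = M-inv
      }
      where
      M-inv : ∀ {x} → x ∈ M → inv x ∈ M
      M-inv {x} x∈ = go (x Fin.≟ 𝟎)
        where
        go : Dec (x ≡ 𝟎) → inv x ∈ M
        go (yes eq)   = subst (_∈ M) (sym (trans (cong inv eq) inv-𝟎)) M-𝟎
        go (no x≢𝟎) = ⊗-stable⁻¹ M x≢𝟎 (M-⊗ x∈) (subst (_∈ M) (sym (inverseʳ x≢𝟎)) M-𝟏)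

injective-arithmetic : ∀ s t d c n → s ≤ 2 * t → t * t ≤ d → d * s ^ 42 ≤ c * n → s ^ 44 ≤ 4 * c * n
injective-arithmetic s t d c n h₁ h₂ h₃ = begin
  s * (s * s ^ 42)            ≤⟨ ℕ.*-mono-≤ h₁ (ℕ.*-monoˡ-≤ (s ^ 42) h₁) ⟩
  2 * t * (2 * t * s ^ 42)    ≡⟨ rearrange t (s ^ 42) ⟩
  4 * (t * t * s ^ 42)        ≤⟨ ℕ.*-monoʳ-≤ 4 (ℕ.*-monoˡ-≤ (s ^ 42) h₂) ⟩
  4 * (d * s ^ 42)            ≤⟨ ℕ.*-monoʳ-≤ 4 h₃ ⟩
  4 * (c * n)                 ≡⟨ ℕ.*-assoc 4 c n ⟨
  4 * c * n                   ∎
  where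
  open ℕ.≤-Reasoning
  rearrange : ∀ t s → 2 * t * (2 * t * s) ≡ 4 * (t * t * s)
  rearrange = ℕ-Solver.solve-∀

module Dichotomy {q : ℕ} (𝔽 : FieldOn q)
  (H : Counting.FSet q) (H-sub : IsSymmetricSubgroup 𝔽 H)
  (p : Fin q) (p≢𝟎 : p ≢ FieldOn.𝟎 𝔽)
  (1≤σ : 1 ≤ CayleyGraph.σ 𝔽 H H-sub p p≢𝟎) where

  open FieldSets 𝔽
  open Growth 𝔽
  open Inverses 𝔽
  open IsSymmetricSubgroup H-sub
  open CayleyGraph 𝔽 H H-sub p p≢𝟎
  open CoreSets 𝔽 H H-sub p p≢𝟎 1≤σ
  open Pivot 𝔽 H H-sub p p≢𝟎 1≤σ

  R : FSet
  R = ⟨ (λ ξ → Fin.any? λ a → Fin.any? λ b → Fin.any? λ c → Fin.any? λ d →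
    (mem? A₁ a ×-dec mem? A₁ b ×-dec mem? A₁ c ×-dec mem? A₁ d) ×-dec ¬? (c Fin.≟ d) ×-dec (a ⊝ b Fin.≟ ξ ⊗ (c ⊝ d))) ⟩

  ⊝≢𝟎 : ∀ {x y} → x ≢ y → x ⊝ y ≢ 𝟎
  ⊝≢𝟎 {x} {y} x≢y eq = x≢y (trans (sym (⊝⊕ x y)) (trans (cong (_⊕ y) eq) (⊕-identityˡ y)))

  no-collision : ∀ {T v w} D → T ⊆ A₁ → σ ≤ 2 * ⟦ T ⟧ → ⟦ D ⟧ * σ ^ 42 ≤ C₂ * N ^ 43 → v ≢ 𝟎 → LinearValues T v w D →
                 ∀ {ξ} → w ≡ ξ ⊗ v → ¬ ξ ∈ R → σ ^ 44 ≤ C₃ * N ^ 43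
  no-collision {T} {v} {w} D T⊆ σ≤ D≤ v≢𝟎 val {ξ} w≡ ξ∉ =
    injective-arithmetic σ ⟦ T ⟧ ⟦ D ⟧ C₂ (N ^ 43) σ≤ (injective-count T v w D v≢𝟎 val unique) D≤
    where
    unique : ∀ {x x′ y y′} → x ∈ T → x′ ∈ T → y ∈ T → y′ ∈ T → v ⊗ x ⊕ w ⊗ y ≡ v ⊗ x′ ⊕ w ⊗ y′ → y ≡ y′
    unique {x} {x′} {y} {y′} x∈ x′∈ y∈ y′∈ eq = decidable-stable (y Fin.≟ y′) λ y≢y′ →
      ξ∉ (x , x′ , y′ , y , (T⊆ x∈ , T⊆ x′∈ , T⊆ y′∈ , T⊆ y∈) , (λ eq → y≢y′ (sym eq)) , ⊗-cancelˡ v≢𝟎 (≡.begin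
        v ⊗ (x ⊝ x′)
          ≡.≡⟨ solve 6 (λ v x x′ w y y′ → v :* (x :- x′) := v :* x :+ w :* y :- v :* x′ :- w :* y) refl v x x′ w y y′ ⟩
        v ⊗ x ⊕ w ⊗ y ⊝ v ⊗ x′ ⊝ w ⊗ y
          ≡.≡⟨ cong (λ z → z ⊝ v ⊗ x′ ⊝ w ⊗ y) eq ⟩
        v ⊗ x′ ⊕ w ⊗ y′ ⊝ v ⊗ x′ ⊝ w ⊗ y
          ≡.≡⟨ solve 5 (λ v x′ w y y′ → v :* x′ :+ w :* y′ :- v :* x′ :- w :* y := w :* (y′ :- y)) refl v x′ w y y′ ⟩
        w ⊗ (y′ ⊝ y)
          ≡.≡⟨ cong (_⊗ (y′ ⊝ y)) w≡ ⟩
        ξ ⊗ v ⊗ (y′ ⊝ y)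
          ≡.≡⟨ solve 3 (λ k v z → k :* v :* z := v :* (k :* z)) refl ξ v (y′ ⊝ y) ⟩
        v ⊗ (ξ ⊗ (y′ ⊝ y)) ≡.∎))
      where module ≡ = ≡-Reasoning

  quadruple : Fin q → Fin q → Fin q → Fin q → Fin 4 → Fin q
  quadruple a b c d = Vec.lookup (a ∷ b ∷ c ∷ d ∷ [])

  quadruple∈ : ∀ {a b c d} → a ∈ A₁ × b ∈ A₁ × c ∈ A₁ × d ∈ A₁ → ∀ i → quadruple a b c d i ∈ A₁
  quadruple∈ (a∈ , b∈ , c∈ , d∈) 0F = a∈
  quadruple∈ (a∈ , b∈ , c∈ , d∈) 1F = b∈
  quadruple∈ (a∈ , b∈ , c∈ , d∈) 2F = c∈
  quadruple∈ (a∈ , b∈ , c∈ , d∈) 3F = d∈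

  4≤5 : 4 ≤ 5
  4≤5 = ℕ.n≤1+n 4

  +𝟏-closed : ∀ {ξ} → ξ ∈ R → ¬ ξ ⊕ 𝟏 ∈ R → σ ^ 44 ≤ C₃ * N ^ 43
  +𝟏-closed {ξ} (a , b , c , d , abcd∈ , c≢d , eq) =
    no-collision (triple 4≤5 m m∈) T⊆A₁ ∣T∣ (triple-bound 4≤5 m m∈) (⊝≢𝟎 c≢d)
      (λ {x} {y} x∈ y∈ → subst (_∈ triple 4≤5 m m∈)
        (solve 6 (λ a b c d x y → :- (d :* x) :+ (:- (d :* y) :+ :- (b :* y)) :- (:- (c :* x) :+ (:- (c :* y) :+ :- (a :* y)))
          := (c :- d) :* x :+ ((a :- b) :+ (c :- d)) :* y) refl a b c d x y)
        (∈triple 4≤5 m m∈ (∈−B 3F x∈) (∈−B 3F y∈) (∈−B 1F y∈) (∈−B 2F x∈) (∈−B 2F y∈) (∈−B 0F y∈)))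
      (trans (cong₂ _⊕_ eq (sym (⊗-identityˡ (c ⊝ d))))
        (solve 3 (λ k o v → k :* v :+ o :* v := (k :+ o) :* v) refl ξ 𝟏 (c ⊝ d)))
    where
    m = quadruple a b c d
    m∈ = quadruple∈ abcd∈
    open Union 4≤5 m m∈

  E : FSet
  E = ⟨ (λ e → mem? A₁ (b₀ ⊗ e)) ⟩

  E≢𝟎 : ∀ {e} → e ∈ E → e ≢ 𝟎
  E≢𝟎 e∈ eq = A₁≢𝟎 e∈ (trans (cong (b₀ ⊗_) eq) (⊗-zeroʳ b₀))

  E-closed : ∀ {e ξ} → e ∈ E → ξ ∈ R → ¬ e ⊗ ξ ∈ R → σ ^ 44 ≤ C₃ * N ^ 43
  E-closed {e} {ξ} e∈ (a , b , c , d , abcd∈@(a∈ , b∈ , c∈ , d∈) , c≢d , eq) =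
    no-collision (mixed ℕ.≤-refl m m∈ e (E≢𝟎 e∈) eZ⊆B) T⊆A₁ ∣T∣ (mixed-bound ℕ.≤-refl m m∈ e (E≢𝟎 e∈) eZ⊆B) (⊝≢𝟎 c≢d)
      (λ {x} {y} x∈ y∈ → subst (_∈ mixed ℕ.≤-refl m m∈ e (E≢𝟎 e∈) eZ⊆B)
        (solve 7 (λ a b c d e x y → :- (d :* x) :+ e :* (a :* y) :- (:- (c :* x) :+ e :* (b :* y))
          := (c :- d) :* x :+ (e :* (a :- b)) :* y) refl a b c d e x y)
        (∈mixed ℕ.≤-refl m m∈ e (E≢𝟎 e∈) eZ⊆B (∈−B 3F x∈) (∈−B 0F y∈) (∈−B 2F x∈) (∈−B 1F y∈)))
      (trans (cong (e ⊗_) eq) (sym (⊗-assoc e ξ (c ⊝ d))))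
    where
    m : Fin 5 → Fin q
    m = Vec.lookup (a ∷ b ∷ c ∷ d ∷ b₀ ⊗ e ∷ [])
    m∈ : ∀ i → m i ∈ A₁
    m∈ 0F = a∈
    m∈ 1F = b∈
    m∈ 2F = c∈
    m∈ 3F = d∈
    m∈ 4F = e∈
    open Union ℕ.≤-refl m m∈
    eZ⊆B : dil e Z ⊆ B
    eZ⊆B {t} t∈ = 4F , subst (_∈ T) (trans (sym (⊗-assoc (inv b₀) (inv e) t)) (cong (_⊗ t) (sym (inv-⊗ (∈⇒≢𝟎 b₀∈H) (E≢𝟎 e∈))))) t∈

  -- M is a proper subfield containing the large subset E of H, unless every ξ is a ratio.
  M : FSet
  M = Stabiliser.M 𝔽 R E

  module _ (large : ¬ σ ^ 44 ≤ C₃ * N ^ 43) (𝟎∈R : 𝟎 ∈ R) where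

    open Stabiliser 𝔽 R E using (M-isSubfield; E⊆M; M⊆R)

    R+𝟏 : ∀ {ξ} → ξ ∈ R → ξ ⊕ 𝟏 ∈ R
    R+𝟏 {ξ} ξ∈ = decidable-stable (mem? R (ξ ⊕ 𝟏)) λ ∉ → large (+𝟏-closed ξ∈ ∉)

    ER : ∀ {e ξ} → e ∈ E → ξ ∈ R → e ⊗ ξ ∈ R
    ER {e} {ξ} e∈ ξ∈ = decidable-stable (mem? R (e ⊗ ξ)) λ ∉ → large (E-closed e∈ ξ∈ ∉)

    subfield : IsSubfield 𝔽 M
    subfield = M-isSubfield 𝟎∈R R+𝟏 E≢𝟎 ER

    M⊆Ratios : M ⊆ R
    M⊆Ratios = M⊆R 𝟎∈R R+𝟏 E≢𝟎 ER

    σ≤2∣H∩M∣ : σ ≤ 2 * ⟦ H ∩ M ⟧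
    σ≤2∣H∩M∣ = ℕ.≤-trans ∣T∣ (ℕ.*-monoʳ-≤ 2 (∣∣-bij T (H ∩ M) (inv b₀ ⊗_) (b₀ ⊗_)
      (inv-cancel (∈⇒≢𝟎 b₀∈H)) (inv-cancel′ (∈⇒≢𝟎 b₀∈H))
      λ x∈ → ⊗∈ (inv∈ b₀∈H) (A₁⊆H (T⊆A₁ x∈)) ,
        E⊆M 𝟎∈R R+𝟏 E≢𝟎 ER (subst (_∈ A₁) (sym (inv-cancel′ (∈⇒≢𝟎 b₀∈H) _)) (T⊆A₁ x∈))))
      where open Multipliers {0} z≤n (λ ()) (λ ())

  𝟎∈R-or-small : 𝟎 ∈ R ⊎ σ ≤ 2
  𝟎∈R-or-small = go (Fin.any? λ c → Fin.any? λ d → mem? A₁ c ×-dec mem? A₁ d ×-dec ¬? (c Fin.≟ d))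
    where
    open Multipliers {0} z≤n (λ ()) (λ ())
    go : Dec (∃ λ c → ∃ λ d → c ∈ A₁ × d ∈ A₁ × c ≢ d) → 𝟎 ∈ R ⊎ σ ≤ 2
    go (yes (c , d , c∈ , d∈ , c≢d)) = inj₁ (c , c , c , d , (c∈ , c∈ , c∈ , d∈) , c≢d ,
      trans (⊖-inverseʳ c) (sym (⊗-zeroˡ (c ⊝ d))))
    go (no ¬r) = inj₂ (ℕ.≤-trans ∣T∣ (ℕ.*-monoʳ-≤ 2 (ℕ.≤-trans (∣∣-mono T A₁ T⊆A₁)
      (ℕ.≤-trans (ℕ.≤-reflexive (⟦⟧-sum A₁)) (∑-atMostOne (mem? A₁) λ {x} {y} x∈ y∈ →
        decidable-stable (x Fin.≟ y) λ x≢y → ¬r (x , y , x∈ , y∈ , x≢y))))))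

  collisions : Fin q → ℕ
  collisions ξ = sum λ z → reps H H 𝟏 ξ z * reps H H 𝟏 ξ z

collision-arithmetic : ∀ s t d c k → s ≤ 2 * t → t * t * (t * t) ≤ c * d → d * s ^ 42 ≤ k → s ^ 46 ≤ 16 * k * c
collision-arithmetic s t d c k h₁ h₂ h₃ = begin
  s * (s * (s * (s * s ^ 42)))
    ≤⟨ ℕ.*-mono-≤ h₁ (ℕ.*-mono-≤ h₁ (ℕ.*-mono-≤ h₁ (ℕ.*-monoˡ-≤ (s ^ 42) h₁))) ⟩
  2 * t * (2 * t * (2 * t * (2 * t * s ^ 42)))
    ≡⟨ rearrange₁ t (s ^ 42) ⟩
  16 * (t * t * (t * t) * s ^ 42)
    ≤⟨ ℕ.*-monoʳ-≤ 16 (ℕ.*-monoˡ-≤ (s ^ 42) h₂) ⟩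
  16 * (c * d * s ^ 42)
    ≡⟨ cong (16 *_) (ℕ.*-assoc c d (s ^ 42)) ⟩
  16 * (c * (d * s ^ 42))
    ≤⟨ ℕ.*-monoʳ-≤ 16 (ℕ.*-monoʳ-≤ c h₃) ⟩
  16 * (c * k)
    ≡⟨ rearrange₂ c k ⟩
  16 * k * c ∎
  where
  open ℕ.≤-Reasoning
  rearrange₁ : ∀ t s → 2 * t * (2 * t * (2 * t * (2 * t * s))) ≡ 16 * (t * t * (t * t) * s)
  rearrange₁ = ℕ-Solver.solve-∀
  rearrange₂ : ∀ c k → 16 * (c * k) ≡ 16 * k * c
  rearrange₂ = ℕ-Solver.solve-∀

module Collisions {q : ℕ} (𝔽 : FieldOn q)
  (H : Counting.FSet q) (H-sub : IsSymmetricSubgroup 𝔽 H)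
  (p : Fin q) (p≢𝟎 : p ≢ FieldOn.𝟎 𝔽)
  (1≤σ : 1 ≤ CayleyGraph.σ 𝔽 H H-sub p p≢𝟎) where

  open FieldSets 𝔽
  open Growth 𝔽
  open Inverses 𝔽
  open IsSymmetricSubgroup H-sub
  open CayleyGraph 𝔽 H H-sub p p≢𝟎
  open CoreSets 𝔽 H H-sub p p≢𝟎 1≤σ
  open Pivot 𝔽 H H-sub p p≢𝟎 1≤σ
  open Dichotomy 𝔽 H H-sub p p≢𝟎 1≤σ

  h : Fin q → Fin q → Fin q → ℕ
  h ξ z y = ι H y * ι H (z ⊝ ξ ⊗ y)

  reps≡ : ∀ ξ z → reps H H 𝟏 ξ z ≡ sum (h ξ z)
  reps≡ ξ z = sum-cong-≗ λ y → trans (𝟙-× (mem? H y) (mem? H (inv 𝟏 ⊗ (z ⊝ ξ ⊗ y))))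
    (cong (λ t → ι H y * ι H t) (trans (cong (_⊗ (z ⊝ ξ ⊗ y)) inv-𝟏) (⊗-identityˡ _)))

  ∑-shift : ∀ a → sum (λ z → ι H (z ⊝ a)) ≡ N
  ∑-shift a = trans (sym (⟦⟧-sum (shift a H))) (∣shift∣ a H)

  module _ (y y′ : Fin q) where

    pairCollisions : ℕ
    pairCollisions = ∑² λ ξ z → h ξ z y * h ξ z y′

    diagonal : pairCollisions ≤ ι H y * (q * N)
    diagonal = begin
      ∑² (λ ξ z → h ξ z y * h ξ z y′)
        ≤⟨ ∑-mono (λ ξ → ∑-mono λ z → ℕ.*-monoʳ-≤ (h ξ z y) (ℕ.*-mono-≤ (𝟙≤1 (mem? H y′)) (𝟙≤1 (mem? H (z ⊝ ξ ⊗ y′))))) ⟩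
      ∑² (λ ξ z → h ξ z y * 1)
        ≡⟨ sum-cong-≗ (λ ξ → trans (sum-cong-≗ λ z → ℕ.*-identityʳ (h ξ z y))
             (trans (sym (*-distribˡ-sum (ι H y) (λ z → ι H (z ⊝ ξ ⊗ y)))) (cong (ι H y *_) (∑-shift (ξ ⊗ y))))) ⟩
      sum {q} (λ _ → ι H y * N)
        ≡⟨ ∑-const q _ ⟩
      q * (ι H y * N)
        ≡⟨ swap q (ι H y) N ⟩
      ι H y * (q * N) ∎
      where
      open ℕ.≤-Reasoning
      swap : ∀ a b c → a * (b * c) ≡ b * (a * c)
      swap = ℕ-Solver.solve-∀

    off-diagonal : y ≢ y′ → pairCollisions ≡ ι H y * ι H y′ * (N * N)
    off-diagonal y≢y′ = begin
      ∑² (λ ξ z → ι H y * ι H (z ⊝ ξ ⊗ y) * (ι H y′ * ι H (z ⊝ ξ ⊗ y′)))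
        ≡⟨ sum-cong-≗ (λ ξ → ∑-bij (λ z → ι H y * ι H (z ⊝ ξ ⊗ y) * (ι H y′ * ι H (z ⊝ ξ ⊗ y′)))
             (_⊕ ξ ⊗ y) (_⊝ ξ ⊗ y) (λ z → ⊝⊕ z (ξ ⊗ y)) (λ x → ⊕⊝ x (ξ ⊗ y))) ⟩
      ∑² (λ ξ x → ι H y * ι H (x ⊕ ξ ⊗ y ⊝ ξ ⊗ y) * (ι H y′ * ι H (x ⊕ ξ ⊗ y ⊝ ξ ⊗ y′)))
        ≡⟨ sum-cong-≗ (λ ξ → sum-cong-≗ λ x → trans
             (cong₂ (λ s t → ι H y * ι H s * (ι H y′ * ι H t)) (⊕⊝ x (ξ ⊗ y))
               (solve 4 (λ x k y y′ → x :+ k :* y :- k :* y′ := k :* (y :- y′) :- :- x) refl x ξ y y′))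
             (rearrange (ι H y) (ι H x) (ι H y′) _)) ⟩
      ∑² (λ ξ x → ι H y * ι H y′ * (ι H x * ι H (ξ ⊗ (y ⊝ y′) ⊝ ⊖ x)))
        ≡⟨ ∑-comm (λ ξ x → ι H y * ι H y′ * (ι H x * ι H (ξ ⊗ (y ⊝ y′) ⊝ ⊖ x))) ⟩
      ∑² (λ x ξ → ι H y * ι H y′ * (ι H x * ι H (ξ ⊗ (y ⊝ y′) ⊝ ⊖ x)))
        ≡⟨ sum-cong-≗ (λ x → trans (sym (*-distribˡ-sum (ι H y * ι H y′) (λ ξ → ι H x * ι H (ξ ⊗ (y ⊝ y′) ⊝ ⊖ x))))
             (cong (ι H y * ι H y′ *_) (trans (sym (*-distribˡ-sum (ι H x) (λ ξ → ι H (ξ ⊗ (y ⊝ y′) ⊝ ⊖ x)))) (cong (ι H x *_) (scaled (⊖ x)))))) ⟩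
      sum (λ x → ι H y * ι H y′ * (ι H x * N))
        ≡⟨ *-distribˡ-sum (ι H y * ι H y′) (λ x → ι H x * N) ⟨
      ι H y * ι H y′ * sum (λ x → ι H x * N)
        ≡⟨ cong (ι H y * ι H y′ *_) (trans (sym (*-distribʳ-sum N (ι H))) (cong (_* N) (sym (⟦⟧-sum H)))) ⟩
      ι H y * ι H y′ * (N * N) ∎
      where
      open ≡-Reasoning
      rearrange : ∀ a b c d → a * b * (c * d) ≡ a * c * (b * d)
      rearrange = ℕ-Solver.solve-∀
      scaled : ∀ a → sum (λ ξ → ι H (ξ ⊗ (y ⊝ y′) ⊝ a)) ≡ N
      scaled a = trans (sym (∑-bij (λ t → ι H (t ⊝ a)) (_⊗ (y ⊝ y′)) (λ t → inv (y ⊝ y′) ⊗ t)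
        (λ t → trans (⊗-comm _ _) (inv-cancel′ (⊝≢𝟎 y≢y′) t))
        (λ ξ → trans (cong (inv (y ⊝ y′) ⊗_) (⊗-comm ξ _)) (inv-cancel (⊝≢𝟎 y≢y′) ξ)))) (∑-shift a)

    pair-bound : pairCollisions ≤ 𝟙 (y Fin.≟ y′) * (ι H y * (q * N)) + ι H y * ι H y′ * (N * N)
    pair-bound = go (y Fin.≟ y′)
      where
      go : (d : Dec (y ≡ y′)) → pairCollisions ≤ 𝟙 d * (ι H y * (q * N)) + ι H y * ι H y′ * (N * N)
      go (yes _)    = ℕ.≤-trans diagonal (ℕ.≤-trans (ℕ.≤-reflexive (sym (ℕ.*-identityˡ _))) (ℕ.m≤m+n _ _))
      go (no y≢y′) = ℕ.≤-reflexive (off-diagonal y≢y′)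

  ∑-collisions : sum collisions ≤ N ^ 4 + q * N ^ 2
  ∑-collisions = begin
    ∑² (λ ξ z → reps H H 𝟏 ξ z * reps H H 𝟏 ξ z)
      ≡⟨ sum-cong-≗ (λ ξ → sum-cong-≗ λ z → trans (cong₂ _*_ (reps≡ ξ z) (reps≡ ξ z)) (sym (∑²-distrib (h ξ z) (h ξ z)))) ⟩
    sum (λ ξ → sum λ z → sum λ y → sum λ y′ → h ξ z y * h ξ z y′)
      ≡⟨ sum-cong-≗ (λ ξ → trans (∑-comm (λ z y → sum λ y′ → h ξ z y * h ξ z y′))
           (sum-cong-≗ λ y → ∑-comm (λ z y′ → h ξ z y * h ξ z y′))) ⟩
    sum (λ ξ → sum λ y → sum λ y′ → sum λ z → h ξ z y * h ξ z y′)
      ≡⟨ trans (∑-comm (λ ξ y → sum λ y′ → sum λ z → h ξ z y * h ξ z y′))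
           (sum-cong-≗ λ y → ∑-comm (λ ξ y′ → sum λ z → h ξ z y * h ξ z y′)) ⟩
    ∑² pairCollisions
      ≤⟨ ∑-mono (λ y → ∑-mono λ y′ → pair-bound y y′) ⟩
    ∑² (λ y y′ → 𝟙 (y Fin.≟ y′) * (ι H y * (q * N)) + ι H y * ι H y′ * (N * N))
      ≡⟨ trans (sum-cong-≗ λ y → ∑-distrib-+ (λ y′ → 𝟙 (y Fin.≟ y′) * (ι H y * (q * N))) (λ y′ → ι H y * ι H y′ * (N * N)))
           (∑-distrib-+ (λ y → sum λ y′ → 𝟙 (y Fin.≟ y′) * (ι H y * (q * N))) (λ y → sum λ y′ → ι H y * ι H y′ * (N * N))) ⟩
    ∑² (λ y y′ → 𝟙 (y Fin.≟ y′) * (ι H y * (q * N))) + ∑² (λ y y′ → ι H y * ι H y′ * (N * N))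
      ≤⟨ ℕ.+-monoˡ-≤ _ (∑-mono λ y → ℕ.≤-trans (ℕ.≤-reflexive (sym (*-distribʳ-sum (ι H y * (q * N)) (λ y′ → 𝟙 (y Fin.≟ y′)))))
           (ℕ.*-monoˡ-≤ (ι H y * (q * N)) (∑-atMostOne (λ y′ → y Fin.≟ y′) λ p r → trans (sym p) r))) ⟩
    sum (λ y → 1 * (ι H y * (q * N))) + ∑² (λ y y′ → ι H y * ι H y′ * (N * N))
      ≡⟨ cong₂ _+_ (trans (sum-cong-≗ λ y → ℕ.*-identityˡ (ι H y * (q * N))) (trans (sym (*-distribʳ-sum (q * N) (ι H))) (cong (_* (q * N)) (sym (⟦⟧-sum H)))))
           (trans (sum-cong-≗ λ y → sym (*-distribʳ-sum (N * N) (λ y′ → ι H y * ι H y′)))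
             (trans (sym (*-distribʳ-sum (N * N) (λ y → sum λ y′ → ι H y * ι H y′))) (cong (_* (N * N)) (∣∣*∣∣ H H)))) ⟩
    N * (q * N) + N * N * (N * N)
      ≡⟨ rearrange N q ⟩
    N ^ 4 + q * N ^ 2 ∎
    where
    open ℕ.≤-Reasoning
    rearrange : ∀ n q → n * (q * n) + n * n * (n * n) ≡ n * (n * (n * (n * 1))) + q * (n * (n * 1))
    rearrange = ℕ-Solver.solve-∀

  many-collisions : ∀ {ξ} → ξ ∈ R → σ ^ 46 ≤ 16 * (C₂ * N ^ 43) * collisions ξ
  many-collisions {ξ} (a , b , c , d , abcd∈ , c≢d , eq) =
    collision-arithmetic σ t ⟦ 𝒟 ⟧ (collisions ξ) (C₂ * N ^ 43) ∣T∣ squares (triple-bound 4≤5 m m∈)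
    where
    open ℕ.≤-Reasoning
    m = quadruple a b c d
    m∈ = quadruple∈ abcd∈
    open Union 4≤5 m m∈
    t = ⟦ T ⟧
    v = c ⊝ d
    w = a ⊝ b
    v≢𝟎 = ⊝≢𝟎 c≢d
    𝒟 = triple 4≤5 m m∈
    r : Fin q → ℕ
    r = reps T T v w
    values : LinearValues T v w 𝒟
    values {x} {y} x∈ y∈ = subst (_∈ 𝒟)
      (solve 6 (λ a b c d x y → :- (d :* x) :+ (:- (b :* y) :+ :- (c :* x)) :- (:- (c :* x) :+ (:- (a :* y) :+ :- (c :* x)))
        := (c :- d) :* x :+ (a :- b) :* y) refl a b c d x y)
      (∈triple 4≤5 m m∈ (∈−B 3F x∈) (∈−B 1F y∈) (∈−B 2F x∈) (∈−B 2F x∈) (∈−B 0F y∈) (∈−B 2F x∈))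
    total : t * t ≤ sum (λ z → r z * ι 𝒟 z)
    total = ℕ.≤-trans (ℕ.≤-reflexive (sym (∑-reps T T v w v≢𝟎))) (∑-mono (reps-support T v w 𝒟 v≢𝟎 values))
    T⊆H : T ⊆ H
    T⊆H x∈ = A₁⊆H (T⊆A₁ x∈)
    normalise : ∀ z y → inv v ⊗ (v ⊗ z ⊝ w ⊗ y) ≡ inv 𝟏 ⊗ (z ⊝ ξ ⊗ y)
    normalise z y = trans (cong (λ k → inv v ⊗ (v ⊗ z ⊝ k ⊗ y)) eq)
      (trans (cong (inv v ⊗_) (solve 4 (λ v z k y → v :* z :- k :* v :* y := v :* (z :- k :* y)) refl v z ξ y))
        (trans (inv-cancel v≢𝟎 _) (trans (sym (⊗-identityˡ _)) (cong (_⊗ (z ⊝ ξ ⊗ y)) (sym inv-𝟏)))))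
    energy : sum (λ z → r z * r z) ≤ collisions ξ
    energy = ℕ.≤-trans (ℕ.≤-reflexive (∑-bij (λ z → r z * r z) (v ⊗_) (inv v ⊗_) (inv-cancel′ v≢𝟎) (inv-cancel v≢𝟎)))
      (∑-mono λ z → ℕ.*-mono-≤ (le z) (le z))
      where
      le : ∀ z → r (v ⊗ z) ≤ reps H H 𝟏 ξ z
      le z = ∑-mono λ y → 𝟙-mono (mem? T y ×-dec mem? T (inv v ⊗ (v ⊗ z ⊝ w ⊗ y)))
        (mem? H y ×-dec mem? H (inv 𝟏 ⊗ (z ⊝ ξ ⊗ y))) λ (y∈ , x∈) → T⊆H y∈ , subst (_∈ H) (normalise z y) (T⊆H x∈)
    squares : t * t * (t * t) ≤ collisions ξ * ⟦ 𝒟 ⟧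
    squares = begin
      t * t * (t * t)
        ≤⟨ ℕ.*-mono-≤ total total ⟩
      sum (λ z → r z * ι 𝒟 z) * sum (λ z → r z * ι 𝒟 z)
        ≤⟨ cauchy-schwarz r (ι 𝒟) ⟩
      sum (λ z → r z * r z) * sum (λ z → ι 𝒟 z * ι 𝒟 z)
        ≤⟨ ℕ.*-mono-≤ energy (ℕ.≤-reflexive (trans (sum-cong-≗ λ z → 𝟙-idem (mem? 𝒟 z)) (sym (⟦⟧-sum 𝒟)))) ⟩
      collisions ξ * ⟦ 𝒟 ⟧ ∎

  all-ratios : (∀ ξ → ξ ∈ R) → q * σ ^ 46 ≤ 16 * (C₂ * N ^ 43) * (N ^ 4 + q * N ^ 2)
  all-ratios all = begin
    q * σ ^ 46
      ≡⟨ ∑-const q (σ ^ 46) ⟨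
    sum {q} (λ _ → σ ^ 46)
      ≤⟨ ∑-mono (λ ξ → many-collisions (all ξ)) ⟩
    sum (λ ξ → 16 * (C₂ * N ^ 43) * collisions ξ)
      ≡⟨ *-distribˡ-sum (16 * (C₂ * N ^ 43)) collisions ⟨
    16 * (C₂ * N ^ 43) * sum collisions
      ≤⟨ ℕ.*-monoʳ-≤ (16 * (C₂ * N ^ 43)) ∑-collisions ⟩
    16 * (C₂ * N ^ 43) * (N ^ 4 + q * N ^ 2) ∎
    where open ℕ.≤-Reasoning

core : ∀ {q} (𝔽 : FieldOn q) H (H-sub : IsSymmetricSubgroup 𝔽 H) p (p≢𝟎 : p ≢ FieldOn.𝟎 𝔽) →
  let open FieldSets 𝔽
      open CayleyGraph 𝔽 H H-sub p p≢𝟎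
  in 1 ≤ σ →
     σ ^ 44 ≤ C₃ * N ^ 43
     ⊎ q * σ ^ 46 ≤ 16 * (C₂ * N ^ 43) * (N ^ 4 + q * N ^ 2)
     ⊎ Σ FSet λ M → IsSubfield 𝔽 M × (∃ λ x → ¬ x ∈ M) × σ ≤ 2 * ⟦ H ∩ M ⟧
core {q} 𝔽 H H-sub p p≢𝟎 1≤σ = small? (σ ^ 44 ℕ.≤? C₃ * N ^ 43)
  where
  open FieldSets 𝔽
  open CayleyGraph 𝔽 H H-sub p p≢𝟎
  open Dichotomy 𝔽 H H-sub p p≢𝟎 1≤σ
  open Collisions 𝔽 H H-sub p p≢𝟎 1≤σ
  Outcome : Set₁
  Outcome = σ ^ 44 ≤ C₃ * N ^ 43
     ⊎ q * σ ^ 46 ≤ 16 * (C₂ * N ^ 43) * (N ^ 4 + q * N ^ 2)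
     ⊎ Σ FSet λ M → IsSubfield 𝔽 M × (∃ λ x → ¬ x ∈ M) × σ ≤ 2 * ⟦ H ∩ M ⟧
  tiny : σ ≤ 2 → σ ^ 44 ≤ C₃ * N ^ 43
  tiny σ≤2 = ℕ.≤-trans (ℕ.^-monoˡ-≤ 44 σ≤2) (ℕ.≤-trans 2^44≤C₃ (ℕ.≤-trans (ℕ.≤-reflexive (sym (ℕ.*-identityʳ C₃)))
    (ℕ.*-monoʳ-≤ C₃ (ℕ.m^n>0 N {{>-nonZero 1≤N}} 43))))
  proper? : (large : ¬ σ ^ 44 ≤ C₃ * N ^ 43) (𝟎∈R : 𝟎 ∈ R) → Dec (∃ λ x → ¬ x ∈ M) → Outcome
  proper? large 𝟎∈R (yes x∉) = inj₂ (inj₂ (M , subfield large 𝟎∈R , x∉ , σ≤2∣H∩M∣ large 𝟎∈R))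
  proper? large 𝟎∈R (no ¬x∉) = inj₂ (inj₁ (all-ratios λ ξ → M⊆Ratios large 𝟎∈R (decidable-stable (mem? M ξ) λ ξ∉ → ¬x∉ (ξ , ξ∉))))
  small? : Dec (σ ^ 44 ≤ C₃ * N ^ 43) → Outcome
  small? (yes small) = inj₁ small
  small? (no large)  = [ (λ 𝟎∈R → proper? large 𝟎∈R (Fin.any? λ x → ¬? (mem? M x))) , (λ σ≤2 → inj₁ (tiny σ≤2)) ]′ 𝟎∈R-or-small

module FiniteFieldFacts {q : ℕ} (𝔽 : FieldOn q) where

  open FieldSets 𝔽
  open Growth 𝔽
  open Inverses 𝔽
  open CommutativeMonoidSum (CommutativeRing.*-commutativeMonoid commutativeRing) using ()
    renaming (sum to prod; sum-permute to prod-permute; ∑-distrib-+ to prod-⊗; sum-cong-≗ to prod-cong)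

  pow : Fin q → ℕ → Fin q
  pow x zero    = 𝟏
  pow x (suc k) = x ⊗ pow x k

  pow-+ : ∀ x j k → pow x (j + k) ≡ pow x j ⊗ pow x k
  pow-+ x zero    k = sym (⊗-identityˡ _)
  pow-+ x (suc j) k = trans (cong (x ⊗_) (pow-+ x j k)) (sym (⊗-assoc x _ _))

  pow-⊗ : ∀ x y k → pow (x ⊗ y) k ≡ pow x k ⊗ pow y k
  pow-⊗ x y zero    = sym (⊗-identityˡ 𝟏)
  pow-⊗ x y (suc k) = trans (cong (x ⊗ y ⊗_) (pow-⊗ x y k))
    (solve 4 (λ x y u v → x :* y :* (u :* v) := x :* u :* (y :* v)) refl x y (pow x k) (pow y k))

  pow-𝟏 : ∀ k → pow 𝟏 k ≡ 𝟏
  pow-𝟏 zero    = refl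
  pow-𝟏 (suc k) = trans (⊗-identityˡ _) (pow-𝟏 k)

  pow-* : ∀ x j k → pow x (j * k) ≡ pow (pow x k) j
  pow-* x zero    k = refl
  pow-* x (suc j) k = trans (pow-+ x k (j * k)) (cong (pow x k ⊗_) (pow-* x j k))

  pow≢𝟎 : ∀ {x} → x ≢ 𝟎 → ∀ k → pow x k ≢ 𝟎
  pow≢𝟎 x≢𝟎 zero    eq = 𝟎≢𝟏 (sym eq)
  pow≢𝟎 x≢𝟎 (suc k) = ⊗≢𝟎 x≢𝟎 (pow≢𝟎 x≢𝟎 k)

  pick : {P : Set} → Dec P → Fin q → Fin q
  pick d x = if does d then x else 𝟏

  prod-pick : ∀ {n} {P : Fin n → Set} (P? : ∀ i → Dec (P i)) x → prod (λ i → pick (P? i) x) ≡ pow x (sum (λ i → 𝟙 (P? i)))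
  prod-pick {zero}  P? x = refl
  prod-pick {suc n} P? x with P? zero
  ... | yes _ = cong (x ⊗_) (prod-pick (P? ∘ suc) x)
  ... | no _  = trans (⊗-identityˡ _) (prod-pick (P? ∘ suc) x)

  prod≢𝟎 : ∀ {n} (f : Fin n → Fin q) → (∀ i → f i ≢ 𝟎) → prod f ≢ 𝟎
  prod≢𝟎 {zero}  f f≢𝟎 eq = 𝟎≢𝟏 (sym eq)
  prod≢𝟎 {suc n} f f≢𝟎 = ⊗≢𝟎 (f≢𝟎 zero) (prod≢𝟎 (f ∘ suc) (f≢𝟎 ∘ suc))

  -- Multiplication by x permutes U, so it does not change the product of all elements of U.
  fermat : ∀ U x → x ≢ 𝟎 → (∀ {y} → y ∈ U → y ≢ 𝟎) → (∀ {y} → y ∈ U → x ⊗ y ∈ U) → pow x ⟦ U ⟧ ≡ 𝟏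
  fermat U x x≢𝟎 U≢𝟎 xU = sym (⊗-cancelˡ P≢𝟎 (begin
    P ⊗ 𝟏
      ≡⟨ ⊗-identityʳ P ⟩
    prod f
      ≡⟨ prod-permute f (permutation (x ⊗_) (inv x ⊗_) (inv-cancel′ x≢𝟎) (inv-cancel x≢𝟎)) ⟩
    prod (λ y → f (x ⊗ y))
      ≡⟨ prod-cong (λ y → step y (mem? U (x ⊗ y)) (mem? U y) xU (Stabiliser.⊗-stable⁻¹ 𝔽 U U U x≢𝟎 xU)) ⟩
    prod (λ y → pick (mem? U y) x ⊗ f y)
      ≡⟨ prod-⊗ (λ y → pick (mem? U y) x) f ⟩
    prod (λ y → pick (mem? U y) x) ⊗ P
      ≡⟨ ⊗-comm _ P ⟩
    P ⊗ prod (λ y → pick (mem? U y) x)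
      ≡⟨ cong (P ⊗_) (trans (prod-pick (mem? U) x) (cong (pow x) (sym (⟦⟧-sum U)))) ⟩
    P ⊗ pow x ⟦ U ⟧ ∎))
    where
    open ≡-Reasoning
    f : Fin q → Fin q
    f y = pick (mem? U y) y
    P = prod f
    P≢𝟎 : P ≢ 𝟎
    P≢𝟎 = prod≢𝟎 f λ y → nonzero y (mem? U y) U≢𝟎
      where
      nonzero : ∀ y {Q : Set} (d : Dec Q) → (Q → y ≢ 𝟎) → pick d y ≢ 𝟎
      nonzero y (yes y∈) f = f y∈
      nonzero y (no _) f eq = 𝟎≢𝟏 (sym eq)
    step : ∀ y {Q Q′ : Set} (d : Dec Q) (d′ : Dec Q′) → (Q′ → Q) → (Q → Q′) → pick d (x ⊗ y) ≡ pick d′ x ⊗ pick d′ y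
    step y (yes _) (yes _) _ _ = refl
    step y (yes p) (no ¬p) _ g = contradiction (g p) ¬p
    step y (no ¬p) (yes p) f _ = contradiction (f p) ¬p
    step y (no _)  (no _)  _ _ = sym (⊗-identityˡ 𝟏)

  -- The value at x of the monic polynomial whose lower coefficients are as.
  monic : ∀ {d} → Vec (Fin q) d → Fin q → Fin q
  monic []       x = 𝟏
  monic (a ∷ as) x = a ⊕ x ⊗ monic as x

  divide : ∀ {d} → Fin q → Vec (Fin q) (suc d) → Vec (Fin q) d
  divide r (a ∷ [])            = []
  divide r (a ∷ as@(_ ∷ _))    = monic as r ∷ divide r as

  divide-correct : ∀ {d} r (as : Vec (Fin q) (suc d)) x → monic as x ⊝ monic as r ≡ (x ⊝ r) ⊗ monic (divide r as) x
  divide-correct r (a ∷ []) x = solve 4 (λ a o x r → a :+ x :* o :- (a :+ r :* o) := (x :- r) :* o) refl a 𝟏 x r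
  divide-correct r (a ∷ as@(_ ∷ _)) x = trans
    (solve 5 (λ a x r u v → a :+ x :* u :- (a :+ r :* v) := x :* (u :- v) :+ (x :- r) :* v) refl a x r (monic as x) (monic as r))
    (trans (cong (λ t → x ⊗ t ⊕ (x ⊝ r) ⊗ monic as r) (divide-correct r as x))
      (solve 4 (λ x r m v → x :* ((x :- r) :* m) :+ (x :- r) :* v := (x :- r) :* (v :+ x :* m)) refl x r (monic (divide r as) x) (monic as r)))

  roots : ∀ {d} → Vec (Fin q) d → FSet
  roots as = ⟨ (λ x → monic as x Fin.≟ 𝟎) ⟩

  ∣singleton∣ : ∀ r → ⟦ ⟨ Fin._≟ r ⟩ ⟧ ≤ 1
  ∣singleton∣ r = ℕ.≤-trans (ℕ.≤-reflexive (⟦⟧-sum ⟨ Fin._≟ r ⟩)) (∑-atMostOne (Fin._≟ r) λ p s → trans p (sym s))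

  ∣roots∣ : ∀ {d} (as : Vec (Fin q) d) → ⟦ roots as ⟧ ≤ d
  ∣roots∣ [] = ℕ.≤-reflexive (∣∅∣ (roots []) λ eq → 𝟎≢𝟏 (sym eq))
  ∣roots∣ {suc d} as = go (Fin.any? (mem? (roots as)))
    where
    go : Dec (∃ λ r → r ∈ roots as) → ⟦ roots as ⟧ ≤ suc d
    go (no ¬r)       = ℕ.≤-trans (ℕ.≤-reflexive (∣∅∣ (roots as) λ {x} x∈ → ¬r (x , x∈))) z≤n
    go (yes (r , r∈)) = ℕ.≤-trans (∣∣-mono (roots as) (⟨ Fin._≟ r ⟩ ∪ roots (divide r as)) λ {x} x∈ → split x x∈ (x Fin.≟ r))
      (ℕ.≤-trans (∣∪∣ ⟨ Fin._≟ r ⟩ (roots (divide r as))) (ℕ.+-mono-≤ (∣singleton∣ r) (∣roots∣ (divide r as))))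
      where
      split : ∀ x → x ∈ roots as → Dec (x ≡ r) → x ∈ ⟨ Fin._≟ r ⟩ ∪ roots (divide r as)
      split x x∈ (yes eq) = inj₁ eq
      split x x∈ (no x≢r) = inj₂ (⊗-cancelˡ (λ eq → x≢r (trans (sym (⊝⊕ x r)) (trans (cong (_⊕ r) eq) (⊕-identityˡ r))))
        (trans (sym (divide-correct r as x)) (trans (cong₂ _⊝_ x∈ r∈) (trans (⊖-inverseʳ 𝟎) (sym (⊗-zeroʳ _))))))

  unityRoots : ℕ → FSet
  unityRoots d = ⟨ (λ x → pow x d Fin.≟ 𝟏) ⟩

  ∣unityRoots∣ : ∀ d → .{{NonZero d}} → ⟦ unityRoots d ⟧ ≤ d
  ∣unityRoots∣ (suc d) = ℕ.≤-trans (∣∣-mono (unityRoots (suc d)) (roots (⊖ 𝟏 ∷ replicate d 𝟎)) λ {x} x∈ →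
    trans (cong (λ t → ⊖ 𝟏 ⊕ x ⊗ t) (monic-replicate d x)) (trans (cong (⊖ 𝟏 ⊕_) x∈) (trans (⊕-comm _ 𝟏) (⊖-inverseʳ 𝟏))))
    (∣roots∣ (⊖ 𝟏 ∷ replicate d 𝟎))
    where
    monic-replicate : ∀ d x → monic (replicate d 𝟎) x ≡ pow x d
    monic-replicate zero    x = refl
    monic-replicate (suc d) x = trans (⊕-identityˡ _) (cong (x ⊗_) (monic-replicate d x))

  Units : FSet
  Units = ⟨ (λ x → ¬? (x Fin.≟ 𝟎)) ⟩

  ∣∖𝟎∣ : ∀ A → 𝟎 ∈ A → ⟦ A ⟧ ≡ suc ⟦ A ∩ Units ⟧
  ∣∖𝟎∣ A 𝟎∈ = trans (∣∖∣ A ⟨ Fin._≟ 𝟎 ⟩ (λ eq → subst (_∈ A) (sym eq) 𝟎∈))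
    (cong₂ _+_ (ℕ.≤-antisym (∣singleton∣ 𝟎) (∣∣≥1 ⟨ Fin._≟ 𝟎 ⟩ {𝟎} refl)) (∣∣-cong (A ∖ ⟨ Fin._≟ 𝟎 ⟩) (A ∩ Units) id id))

  All : FSet
  All = ⟨_⟩ {Mem = λ _ → ⊤} (λ _ → yes tt)

  ∣All∣ : ⟦ All ⟧ ≡ q
  ∣All∣ = trans (⟦⟧-sum All) (trans (∑-const q 1) (ℕ.*-identityʳ q))

  ∣Units∣ : q ≡ suc ⟦ Units ⟧
  ∣Units∣ = trans (sym ∣All∣) (trans (∣∖𝟎∣ All tt) (cong suc (∣∣-cong (All ∩ Units) Units proj₂ (λ x∈ → tt , x∈))))

  fermat-units : ∀ {x} → x ≢ 𝟎 → pow x ⟦ Units ⟧ ≡ 𝟏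
  fermat-units {x} x≢𝟎 = fermat Units x x≢𝟎 id (⊗≢𝟎 x≢𝟎)

prime-power-divisor : ∀ {p} → Prime p → ∀ m {d} → d ∣ p ^ m → ∃ λ ν → d ≡ p ^ ν
prime-power-divisor         p-prime zero    d∣1 = 0 , ∣1⇒≡1 d∣1
prime-power-divisor {p} p-prime (suc m) {d} (divides e eq)
  with euclidsLemma e d p-prime (divides (p ^ m) (trans (sym eq) (ℕ.*-comm p (p ^ m))))
... | inj₁ (divides e′ refl) = prime-power-divisor p-prime m (divides e′
  (ℕ.*-cancelˡ-≡ (p ^ m) (e′ * d) p {{prime⇒nonZero p-prime}} (trans eq (rearrange e′ p d))))
  where
  rearrange : ∀ e p d → e * p * d ≡ p * (e * d)
  rearrange = ℕ-Solver.solve-∀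
... | inj₂ (divides d′ refl) = Product.map suc (λ eq′ → trans (ℕ.*-comm d′ p) (cong (p *_) eq′))
  (prime-power-divisor p-prime m (divides e
    (ℕ.*-cancelˡ-≡ (p ^ m) (e * d′) p {{prime⇒nonZero p-prime}} (trans eq (rearrange e p d′)))))
  where
  rearrange : ∀ e p d → e * (d * p) ≡ p * (e * d)
  rearrange = ℕ-Solver.solve-∀

exponent-divides : ∀ {p} → Prime p → ∀ ν → .{{NonZero ν}} → ∀ n m → m ≤ n → p ^ ν ∸ 1 ∣ p ^ m ∸ 1 → ν ∣ m
exponent-divides {p} p-prime ν n m m≤n h with ν ℕ.≤? m
exponent-divides {p} p-prime ν n zero m≤n h | no _ = ν ∣0
exponent-divides {p} p-prime ν n (suc m) m≤n h | no ν≰m =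
  contradiction (∣⇒≤ {{ℕ.>-nonZero (ℕ.m<n⇒0<n∸m (ℕ.^-monoʳ-< p 1<p {0} {suc m} (s≤s z≤n)))}} h)
    (ℕ.<⇒≱ (ℕ.∸-monoˡ-< (ℕ.^-monoʳ-< p 1<p {suc m} {ν} (ℕ.≰⇒> ν≰m)) (ℕ.m^n>0 p {{prime⇒nonZero p-prime}} (suc m))))
  where 1<p = ℕ.nonTrivial⇒n>1 p {{prime⇒nonTrivial p-prime}}
exponent-divides {p} p-prime ν zero m m≤n h | yes ν≤m =
  contradiction (ℕ.n≤0⇒n≡0 (ℕ.≤-trans ν≤m m≤n)) (ℕ.≢-nonZero⁻¹ ν)
exponent-divides {p} p-prime ν (suc n) m m≤n h | yes ν≤m = subst (ν ∣_) (ℕ.m+[n∸m]≡n ν≤m)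
  (∣m∣n⇒∣m+n ∣-refl (exponent-divides p-prime ν n (m ∸ ν)
    (ℕ.≤-trans (ℕ.∸-monoʳ-≤ m (ℕ.>-nonZero⁻¹ ν)) (ℕ.∸-monoˡ-≤ 1 m≤n))
    (∣m+n∣m⇒∣n (subst (p ^ ν ∸ 1 ∣_) split h) (m∣m*n (p ^ (m ∸ ν))))))
  where
  P Q : ℕ
  P = p ^ ν
  Q = p ^ (m ∸ ν)
  1≤p^ : ∀ k → 1 ≤ p ^ k
  1≤p^ k = ℕ.m^n>0 p {{prime⇒nonZero p-prime}} k
  split : p ^ m ∸ 1 ≡ (P ∸ 1) * Q + (Q ∸ 1)
  split = begin
    p ^ m ∸ 1                          ≡⟨ cong (λ k → p ^ k ∸ 1) (ℕ.m+[n∸m]≡n ν≤m) ⟨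
    p ^ (ν + (m ∸ ν)) ∸ 1              ≡⟨ cong (_∸ 1) (ℕ.^-distribˡ-+-* p ν (m ∸ ν)) ⟩
    P * Q ∸ 1                          ≡⟨ cong (λ k → k * Q ∸ 1) (ℕ.m∸n+n≡m (1≤p^ ν)) ⟨
    (P ∸ 1 + 1) * Q ∸ 1                ≡⟨ cong (_∸ 1) (trans (ℕ.*-distribʳ-+ Q (P ∸ 1) 1) (cong ((P ∸ 1) * Q +_) (ℕ.*-identityˡ Q))) ⟩
    (P ∸ 1) * Q + Q ∸ 1                ≡⟨ ℕ.+-∸-assoc ((P ∸ 1) * Q) (1≤p^ (m ∸ ν)) ⟩
    (P ∸ 1) * Q + (Q ∸ 1)              ∎
    where open ≡-Reasoning

gcd-exchange : ∀ n k r Q → k * n ≡ Q * r → gcd k r * n ≡ r * gcd n Q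
gcd-exchange n k r Q eq = begin
  gcd k r * n            ≡⟨ trans (ℕ.*-comm _ n) (c*gcd[m,n]≡gcd[cm,cn] n k r) ⟩
  gcd (n * k) (n * r)    ≡⟨ cong₂ gcd (trans (ℕ.*-comm n k) (trans eq (ℕ.*-comm Q r))) (ℕ.*-comm n r) ⟩
  gcd (r * Q) (r * n)    ≡⟨ c*gcd[m,n]≡gcd[cm,cn] r Q n ⟨
  r * gcd Q n            ≡⟨ cong (r *_) (gcd-comm Q n) ⟩
  r * gcd n Q            ∎
  where open ≡-Reasoning

module Subfields {q : ℕ} (𝔽 : FieldOn q) where

  open FieldSets 𝔽
  open Growth 𝔽
  open Inverses 𝔽
  open FiniteFieldFacts 𝔽

  -- Lagrange's theorem, by removing one class at a time.
  module Lagrange (_~_ : Fin q → Fin q → Set) (_~?_ : ∀ a b → Dec (a ~ b)) (k : ℕ) (A₀ : FSet)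
    (saturated : ∀ {a b} → a ∈ A₀ → a ~ b → b ∈ A₀)
    (~-refl : ∀ {a} → a ∈ A₀ → a ~ a)
    (~-cancel : ∀ {a b c} → a ∈ A₀ → b ∈ A₀ → b ~ c → a ~ c → a ~ b)
    (class-size : ∀ {a} → a ∈ A₀ → ⟦ ⟨ a ~?_ ⟩ ⟧ ≡ k) where

    private
      strip : ∀ n A → ⟦ A ⟧ ≤ n → A ⊆ A₀ → (∀ {a b} → a ∈ A → a ~ b → b ∈ A) → Dec (∃ λ a → a ∈ A) → k ∣ ⟦ A ⟧
      strip n A A≤n A⊆ sat (no ¬a) = subst (k ∣_) (sym (∣∅∣ A λ {x} x∈ → ¬a (x , x∈))) (k ∣0)
      strip zero A A≤n A⊆ sat (yes (a , a∈)) = contradiction (ℕ.≤-trans (∣∣≥1 A a∈) A≤n) λ()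
      strip (suc n) A A≤n A⊆ sat (yes (a , a∈)) = subst (k ∣_) (sym size)
        (∣m∣n⇒∣m+n ∣-refl (strip n A′ (ℕ.≤-pred (ℕ.≤-trans smaller A≤n)) (λ x∈ → A⊆ (proj₁ x∈))
          (λ (b∈ , a≁b) b~c → sat b∈ b~c , λ a~c → a≁b (~-cancel (A⊆ a∈) (A⊆ b∈) b~c a~c)) (Fin.any? (mem? A′))))
        where
        class A′ : FSet
        class = ⟨ a ~?_ ⟩
        A′ = A ∖ class
        size : ⟦ A ⟧ ≡ k + ⟦ A′ ⟧
        size = trans (∣∖∣ A class (sat a∈)) (cong (_+ ⟦ A′ ⟧) (class-size (A⊆ a∈)))
        smaller : suc ⟦ A′ ⟧ ≤ ⟦ A ⟧
        smaller = ℕ.≤-trans (ℕ.+-monoˡ-≤ ⟦ A′ ⟧ (subst (1 ≤_) (class-size (A⊆ a∈)) (∣∣≥1 class (~-refl (A⊆ a∈)))))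
          (ℕ.≤-reflexive (sym size))

    lagrange : k ∣ ⟦ A₀ ⟧
    lagrange = strip ⟦ A₀ ⟧ A₀ ℕ.≤-refl id saturated (Fin.any? (mem? A₀))

  module _ {M : FSet} (M-sub : IsSubfield 𝔽 M) where

    open IsSubfield M-sub

    M* : FSet
    M* = M ∩ Units

    ∣M∣∣q : ⟦ M ⟧ ∣ q
    ∣M∣∣q = subst (⟦ M ⟧ ∣_) ∣All∣ (Lagrange.lagrange (λ a b → b ⊝ a ∈ M) (λ a b → mem? M (b ⊝ a)) ⟦ M ⟧ All
      (λ _ _ → tt)
      (λ {a} _ → subst (_∈ M) (sym (⊖-inverseʳ a)) 𝟎∈)
      (λ {a} {b} {c} _ _ b~c a~c → subst (_∈ M)
        (solve 3 (λ a b c → c :- a :+ :- (c :- b) := b :- a) refl a b c) (⊕∈ a~c (⊖∈ b~c)))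
      (λ {a} _ → ∣shift∣ a M))

    ∣M*∣∣∣Units∣ : ⟦ M* ⟧ ∣ ⟦ Units ⟧
    ∣M*∣∣∣Units∣ = Lagrange.lagrange (λ a b → inv a ⊗ b ∈ M*) (λ a b → mem? M* (inv a ⊗ b)) ⟦ M* ⟧ Units
      (λ {a} {b} _ (_ , u) b≡𝟎 → u (trans (cong (inv a ⊗_) b≡𝟎) (⊗-zeroʳ _)))
      (λ {a} a≢𝟎 → subst (_∈ M*) (sym (inverseˡ a≢𝟎)) (𝟏∈ , λ eq → 𝟎≢𝟏 (sym eq)))
      (λ {a} {b} {c} a≢𝟎 b≢𝟎 (b~c , u) (a~c , _) →
        let c≢𝟎 = λ c≡𝟎 → u (trans (cong (inv b ⊗_) c≡𝟎) (⊗-zeroʳ _)) in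
        subst (_∈ M) (begin
          inv a ⊗ c ⊗ inv (inv b ⊗ c)     ≡⟨ cong (inv a ⊗ c ⊗_) (trans (inv-⊗ (≢𝟎⇒inv≢𝟎 b≢𝟎) c≢𝟎) (cong (_⊗ inv c) (inv-inv b))) ⟩
          inv a ⊗ c ⊗ (b ⊗ inv c)         ≡⟨ solve 4 (λ a c b c′ → a :* c :* (b :* c′) := c :* c′ :* (a :* b)) refl (inv a) c b (inv c) ⟩
          c ⊗ inv c ⊗ (inv a ⊗ b)         ≡⟨ cong (_⊗ (inv a ⊗ b)) (inverseʳ c≢𝟎) ⟩
          𝟏 ⊗ (inv a ⊗ b)                 ≡⟨ ⊗-identityˡ _ ⟩
          inv a ⊗ b ∎) (⊗∈ a~c (inv∈ b~c)) , ⊗≢𝟎 (≢𝟎⇒inv≢𝟎 a≢𝟎) b≢𝟎)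
      (λ {a} a≢𝟎 → ∣dil∣ M* a≢𝟎)
      where open ≡-Reasoning

    ∣M*∣ : ⟦ M ⟧ ∸ 1 ≡ ⟦ M* ⟧
    ∣M*∣ = cong (_∸ 1) (∣∖𝟎∣ M 𝟎∈)

    q∸1 : q ∸ 1 ≡ ⟦ Units ⟧
    q∸1 = trans (cong (_∸ 1) ∣Units∣) refl

    subfield-degree : ∀ {p m} → Prime p → q ≡ p ^ m → (∃ λ x → ¬ x ∈ M) →
                      ∃ λ ν → NonZero ν × ν ∣ m × ν ≢ m × ⟦ M ⟧ ≡ p ^ ν
    subfield-degree {p} {m} p-prime q≡ (x , x∉) with prime-power-divisor p-prime m (subst (⟦ M ⟧ ∣_) q≡ ∣M∣∣q)
    ... | zero , eq = contradiction (trans (sym eq) (∣∖𝟎∣ M 𝟎∈))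
        (λ eq′ → ℕ.<⇒≢ (s≤s (∣∣≥1 M* (𝟏∈ , λ eq → 𝟎≢𝟏 (sym eq)))) eq′)
    ... | suc ν , eq = suc ν , _ , exponent-divides p-prime (suc ν) m m ℕ.≤-refl
        (subst₂ (λ a b → a ∸ 1 ∣ b ∸ 1) eq q≡ (subst₂ _∣_ (sym ∣M*∣) (sym q∸1) ∣M*∣∣∣Units∣)) ,
        (λ ν≡m → x∉ (⊇-by-size All M _ (ℕ.≤-reflexive (trans ∣All∣ (trans q≡ (trans (cong (p ^_) (sym ν≡m)) (sym eq))))) tt)) , eq

  pow-gcd : ∀ x a b → pow x a ≡ 𝟏 → pow x b ≡ 𝟏 → pow x (gcd a b) ≡ 𝟏
  pow-gcd x a b pa pb with Bézout.identity (gcd-GCD a b)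
  ... | Bézout.+- u v eq = trans (sym (⊗-identityʳ _)) (trans (cong (pow x (gcd a b) ⊗_) (sym (multiple v b pb)))
    (trans (sym (pow-+ x (gcd a b) (v * b))) (trans (cong (pow x) eq) (multiple u a pa))))
    where
    multiple : ∀ k b → pow x b ≡ 𝟏 → pow x (k * b) ≡ 𝟏
    multiple k b pb = trans (pow-* x k b) (trans (cong (λ t → pow t k) pb) (pow-𝟏 k))
  ... | Bézout.-+ u v eq = trans (sym (⊗-identityʳ _)) (trans (cong (pow x (gcd a b) ⊗_) (sym (multiple u a pa)))
    (trans (sym (pow-+ x (gcd a b) (u * a))) (trans (cong (pow x) eq) (multiple v b pb))))
    where
    multiple : ∀ k b → pow x b ≡ 𝟏 → pow x (k * b) ≡ 𝟏
    multiple k b pb = trans (pow-* x k b) (trans (cong (λ t → pow t k) pb) (pow-𝟏 k))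

module Powers {q : ℕ} (𝔽 : FieldOn q) (n : ℕ) .{{_ : NonZero n}} where

  open FieldSets 𝔽
  open Growth 𝔽
  open Inverses 𝔽
  open FiniteFieldFacts 𝔽
  open Subfields 𝔽

  H Ker : FSet
  H = ⟨ (λ t → Fin.any? λ x → ¬? (x Fin.≟ 𝟎) ×-dec (pow x n Fin.≟ t)) ⟩
  Ker = Units ∩ unityRoots n

  κ : ℕ
  κ = ⟦ Ker ⟧

  κ≤n : κ ≤ n
  κ≤n = ℕ.≤-trans (∣∣-mono Ker (unityRoots n) proj₂) (∣unityRoots∣ n)

  fibre : Fin q → FSet
  fibre t = Units ∩ ⟨ (λ x → pow x n Fin.≟ t) ⟩

  ∣fibre∣ : ∀ t → ⟦ fibre t ⟧ ≡ κ * ι H t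
  ∣fibre∣ t = go (mem? H t)
    where
    go : (d : Dec (t ∈ H)) → ⟦ fibre t ⟧ ≡ κ * 𝟙 d
    go (no t∉) = trans (∣∅∣ (fibre t) λ {x} (x≢𝟎 , eq) → t∉ (x , x≢𝟎 , eq)) (sym (ℕ.*-zeroʳ κ))
    go (yes (x₀ , x₀≢𝟎 , eq₀)) = trans (ℕ.≤-antisym
      (∣∣-bij (fibre t) Ker (inv x₀ ⊗_) (x₀ ⊗_) (inv-cancel x₀≢𝟎) (inv-cancel′ x₀≢𝟎) λ {x} (x≢𝟎 , eq) →
        ⊗≢𝟎 (≢𝟎⇒inv≢𝟎 x₀≢𝟎) x≢𝟎 , ⊗-cancelˡ (pow≢𝟎 x₀≢𝟎 n)
          (trans (sym (pow-⊗ x₀ _ n)) (trans (cong (λ z → pow z n) (inv-cancel′ x₀≢𝟎 x)) (trans eq (sym (trans (⊗-identityʳ _) eq₀))))))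
      (∣∣-bij Ker (fibre t) (x₀ ⊗_) (inv x₀ ⊗_) (inv-cancel′ x₀≢𝟎) (inv-cancel x₀≢𝟎) λ {x} (x≢𝟎 , eq) →
        ⊗≢𝟎 x₀≢𝟎 x≢𝟎 , trans (pow-⊗ x₀ x n) (trans (cong₂ _⊗_ eq₀ eq) (⊗-identityʳ t))))
      (sym (ℕ.*-identityʳ κ))

  κ*∣H∣ : κ * ⟦ H ⟧ ≡ ⟦ Units ⟧
  κ*∣H∣ = begin
    κ * ⟦ H ⟧
      ≡⟨ trans (cong (κ *_) (⟦⟧-sum H)) (*-distribˡ-sum κ (ι H)) ⟩
    sum (λ t → κ * ι H t)
      ≡⟨ sum-cong-≗ (λ t → sym (trans (sym (⟦⟧-sum (fibre t))) (∣fibre∣ t))) ⟩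
    sum (λ t → sum (λ x → ι (fibre t) x))
      ≡⟨ ∑-comm (λ t x → ι (fibre t) x) ⟩
    sum (λ x → sum (λ t → ι (fibre t) x))
      ≡⟨ sum-cong-≗ (λ x → column x) ⟩
    sum (ι Units)
      ≡⟨ ⟦⟧-sum Units ⟨
    ⟦ Units ⟧ ∎
    where
    open ≡-Reasoning
    column : ∀ x → sum (λ t → ι (fibre t) x) ≡ ι Units x
    column x = trans (sum-cong-≗ λ t → 𝟙-× (mem? Units x) (pow x n Fin.≟ t))
      (trans (sym (*-distribˡ-sum (ι Units x) (λ t → 𝟙 (pow x n Fin.≟ t))))
        (trans (cong (ι Units x *_) (ℕ.≤-antisym (∑-atMostOne (pow x n Fin.≟_) (λ p r → trans (sym p) r))
          (ℕ.≤-trans (ℕ.≤-reflexive (sym (𝟙-yes (pow x n Fin.≟ pow x n) refl))) (term≤∑ (λ t → 𝟙 (pow x n Fin.≟ t)) (pow x n)))))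
          (ℕ.*-identityʳ _)))

  𝟏∈H : 𝟏 ∈ H
  𝟏∈H = 𝟏 , (λ eq → 𝟎≢𝟏 (sym eq)) , pow-𝟏 n

  H-⊗ : ∀ {x y} → x ∈ H → y ∈ H → x ⊗ y ∈ H
  H-⊗ (u , u≢𝟎 , refl) (v , v≢𝟎 , refl) = u ⊗ v , ⊗≢𝟎 u≢𝟎 v≢𝟎 , pow-⊗ u v n

  H≢𝟎 : ∀ {x} → x ∈ H → x ≢ 𝟎
  H≢𝟎 (u , u≢𝟎 , refl) = pow≢𝟎 u≢𝟎 n

  H-inv : ∀ {x} → x ∈ H → inv x ∈ H
  H-inv (u , u≢𝟎 , refl) = inv u , ≢𝟎⇒inv≢𝟎 u≢𝟎 ,
    inv-unique (pow≢𝟎 u≢𝟎 n) (trans (sym (pow-⊗ u (inv u) n)) (trans (cong (λ t → pow t n) (inverseʳ u≢𝟎)) (pow-𝟏 n)))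

  H-subgroup : IsSubgroup 𝔽 H
  H-subgroup = record { 𝟏∈H = 𝟏∈H ; H-⊗ = H-⊗ ; H-inv = H-inv ; H≢𝟎 = H≢𝟎 }

  -- The intersection with a subfield of r elements consists of common roots of unity of
  -- orders (q - 1) / n and r - 1.
  ∣H∩M∣ : ∀ {M} → IsSubfield 𝔽 M → ∀ N₀ → ⟦ Units ⟧ ≡ N₀ * n → .{{_ : NonZero (⟦ M ⟧ ∸ 1)}} →
          ⟦ H ∩ M ⟧ * n ≤ (⟦ M ⟧ ∸ 1) * gcd n ((q ∸ 1) ℕ./ (⟦ M ⟧ ∸ 1))
  ∣H∩M∣ {M} M-sub N₀ N₀n = begin
    ⟦ H ∩ M ⟧ * n
      ≤⟨ ℕ.*-monoˡ-≤ n (ℕ.≤-trans (∣∣-mono (H ∩ M) (unityRoots (gcd N₀ r′)) λ {x} → order x)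
           (∣unityRoots∣ (gcd N₀ r′) {{ℕ.≢-nonZero (gcd[m,n]≢0 N₀ r′ (inj₂ (ℕ.≢-nonZero⁻¹ r′)))}})) ⟩
    gcd N₀ r′ * n
      ≡⟨ gcd-exchange n N₀ r′ Q (trans (sym N₀n) units) ⟩
    r′ * gcd n Q
      ≡⟨ cong (λ k → r′ * gcd n k) (sym (trans (cong (ℕ._/ r′) (trans (q∸1 M-sub) units)) (ℕ.m*n/n≡m Q r′))) ⟩
    r′ * gcd n ((q ∸ 1) ℕ./ r′) ∎
    where
    open ℕ.≤-Reasoning
    open IsSubfield M-sub
    r′ Q : ℕ
    r′ = ⟦ M ⟧ ∸ 1
    Q = _∣_.quotient (∣M*∣∣∣Units∣ M-sub)
    units : ⟦ Units ⟧ ≡ Q * r′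
    units = trans (_∣_.equality (∣M*∣∣∣Units∣ M-sub)) (cong (Q *_) (sym (∣M*∣ M-sub)))
    order : ∀ x → x ∈ H ∩ M → pow x (gcd N₀ r′) ≡ 𝟏
    order x (x∈H@(u , u≢𝟎 , refl) , x∈M) = pow-gcd x N₀ r′
      (trans (sym (pow-* u N₀ n)) (trans (cong (pow u) (sym N₀n)) (fermat-units u≢𝟎)))
      (trans (cong (pow x) (∣M*∣ M-sub)) (fermat (M* M-sub) x (H≢𝟎 x∈H) proj₂
        λ (y∈ , y≢𝟎) → ⊗∈ x∈M y∈ , ⊗≢𝟎 (H≢𝟎 x∈H) y≢𝟎))

Eventually : (ℕ → Set) → Set
Eventually P = ∃ λ N → ∀ n → N ≤ n → P n

eventually-map₂ : ∀ {P Q R : ℕ → Set} → (∀ n → P n → Q n → R n) → Eventually P → Eventually Q → Eventually R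
eventually-map₂ f (N₁ , p) (N₂ , r) = N₁ ℕ.⊔ N₂ , λ n ≤n →
  f n (p n (ℕ.m⊔n≤o⇒m≤o N₁ N₂ ≤n)) (r n (ℕ.m⊔n≤o⇒n≤o N₁ N₂ ≤n))

eventually-map : ∀ {P Q : ℕ → Set} → (∀ n → P n → Q n) → Eventually P → Eventually Q
eventually-map f (N , p) = N , λ n N≤n → f n (p n N≤n)

-- Unlike _≈ᴿ_, this relation does not unfold, so its arguments can be inferred.
record _≋_ (x y : ℝ) : Set where
  constructor mk≋
  field
    ≋⇒≈ : x ≈ᴿ y

open _≋_ public

infix 4 _≋_

pointwise : ∀ {x y} → (∀ n → seq x n ≡ seq y n) → x ≋ y
pointwise {x} {y} p .≋⇒≈ ε ε>0 = 0 , λ n _ → subst (λ a → ℚ.∣ a ∣ ℚ.≤ ε)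
  (sym (trans (cong (ℚ._- seq y n) (p n)) (ℚ.+-inverseʳ (seq y n)))) (ℚ.<⇒≤ (ℚ.positive⁻¹ ε {{ε>0}}))

≋-sym : ∀ {x y} → x ≋ y → y ≋ x
≋-sym {x} {y} p .≋⇒≈ ε ε>0 = eventually-map (λ n → subst (ℚ._≤ ε)
  (trans (sym (ℚ.∣-p∣≡∣p∣ (seq x n ℚ.- seq y n))) (cong ℚ.∣_∣ (solve 2 (λ a b → :- (a :- b) := b :- a) refl (seq x n) (seq y n))))) (p .≋⇒≈ ε ε>0)
  where open ℚ-Solver.+-*-Solver

∣∣-split : ∀ {a b c d ε} → c ≡ a ℚ.+ b → ℚ.∣ a ∣ ℚ.≤ ½ ℚ.* ε → ℚ.∣ b ∣ ℚ.≤ ½ ℚ.* ε → c ≡ d → ℚ.∣ d ∣ ℚ.≤ ε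
∣∣-split {a} {b} {ε = ε} refl p r refl = ℚ.≤-trans (ℚ.∣p+q∣≤∣p∣+∣q∣ a b)
  (ℚ.≤-trans (ℚ.+-mono-≤ p r) (ℚ.≤-reflexive (½+½ ε)))

≋-trans : ∀ {x y z} → x ≋ y → y ≋ z → x ≋ z
≋-trans {x} {y} {z} p r .≋⇒≈ ε ε>0 = eventually-map₂ (λ n u v → ∣∣-split refl u v
  (solve 3 (λ a b c → (a :- b) :+ (b :- c) := a :- c) refl (seq x n) (seq y n) (seq z n)))
  (p .≋⇒≈ (½ ℚ.* ε) (half-pos ε ε>0)) (r .≋⇒≈ (½ ℚ.* ε) (half-pos ε ε>0))
  where open ℚ-Solver.+-*-Solver

+ᴿ-cong : ∀ {x x′ y y′} → x ≋ x′ → y ≋ y′ → x +ᴿ y ≋ x′ +ᴿ y′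
+ᴿ-cong {x} {x′} {y} {y′} p r .≋⇒≈ ε ε>0 = eventually-map₂ (λ n u v → ∣∣-split refl u v
  (solve 4 (λ a b c d → (a :- b) :+ (c :- d) := a :+ c :- (b :+ d)) refl (seq x n) (seq x′ n) (seq y n) (seq y′ n)))
  (p .≋⇒≈ (½ ℚ.* ε) (half-pos ε ε>0)) (r .≋⇒≈ (½ ℚ.* ε) (half-pos ε ε>0))
  where open ℚ-Solver.+-*-Solver

-ᴿ-cong : ∀ {x y} → x ≋ y → -ᴿ x ≋ -ᴿ y
-ᴿ-cong {x} {y} p .≋⇒≈ ε ε>0 = eventually-map (λ n → subst (ℚ._≤ ε)
  (trans (sym (ℚ.∣-p∣≡∣p∣ (seq x n ℚ.- seq y n))) (cong ℚ.∣_∣ (ℚ.neg-distrib-+ (seq x n) (ℚ.- seq y n))))) (p .≋⇒≈ ε ε>0)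

*ᴿ-cong : ∀ {x x′ y y′} → x ≋ x′ → y ≋ y′ → x *ᴿ y ≋ x′ *ᴿ y′
*ᴿ-cong {x} {x′} {y} {y′} p r .≋⇒≈ ε ε>0 =
  let B , B>0 , b = bounded x
      C , C>0 , c = bounded y′
      δ₁ , δ₁>0 , Bδ₁ = scale B B>0 (½ ℚ.* ε) (half-pos ε ε>0)
      δ₂ , δ₂>0 , Cδ₂ = scale C C>0 (½ ℚ.* ε) (half-pos ε ε>0)
  in eventually-map₂ (λ n (u , v) (w , z) →
       product-close {seq x n} {seq y n} {seq x′ n} {seq y′ n} B>0 C>0 Bδ₁ Cδ₂ u v w z)
     (eventually-map₂ (λ n → _,_) b c) (eventually-map₂ (λ n → _,_) (r .≋⇒≈ δ₁ δ₁>0) (p .≋⇒≈ δ₂ δ₂>0))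

module ℚ-Laws where

  open ℚ-Solver.+-*-Solver

  assoc-re : ∀ a b c d e f → (a ℚ.* c ℚ.+ ℚ.- (b ℚ.* d)) ℚ.* e ℚ.+ ℚ.- ((a ℚ.* d ℚ.+ b ℚ.* c) ℚ.* f) ≡
             a ℚ.* (c ℚ.* e ℚ.+ ℚ.- (d ℚ.* f)) ℚ.+ ℚ.- (b ℚ.* (c ℚ.* f ℚ.+ d ℚ.* e))
  assoc-re = solve 6 (λ a b c d e f → (a :* c :+ :- (b :* d)) :* e :+ :- ((a :* d :+ b :* c) :* f)
    := a :* (c :* e :+ :- (d :* f)) :+ :- (b :* (c :* f :+ d :* e))) refl

  assoc-im : ∀ a b c d e f → (a ℚ.* c ℚ.+ ℚ.- (b ℚ.* d)) ℚ.* f ℚ.+ (a ℚ.* d ℚ.+ b ℚ.* c) ℚ.* e ≡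
             a ℚ.* (c ℚ.* f ℚ.+ d ℚ.* e) ℚ.+ b ℚ.* (c ℚ.* e ℚ.+ ℚ.- (d ℚ.* f))
  assoc-im = solve 6 (λ a b c d e f → (a :* c :+ :- (b :* d)) :* f :+ (a :* d :+ b :* c) :* e
    := a :* (c :* f :+ d :* e) :+ b :* (c :* e :+ :- (d :* f))) refl

  comm-re : ∀ a b c d → a ℚ.* c ℚ.+ ℚ.- (b ℚ.* d) ≡ c ℚ.* a ℚ.+ ℚ.- (d ℚ.* b)
  comm-re = solve 4 (λ a b c d → a :* c :+ :- (b :* d) := c :* a :+ :- (d :* b)) refl

  comm-im : ∀ a b c d → a ℚ.* d ℚ.+ b ℚ.* c ≡ c ℚ.* b ℚ.+ d ℚ.* a
  comm-im = solve 4 (λ a b c d → a :* d :+ b :* c := c :* b :+ d :* a) refl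

  one-re : ∀ a b → 1ℚ ℚ.* a ℚ.+ ℚ.- (0ℚ ℚ.* b) ≡ a
  one-re = solve 2 (λ a b → con 1ℚ :* a :+ :- (con 0ℚ :* b) := a) refl

  one-im : ∀ a b → 1ℚ ℚ.* b ℚ.+ 0ℚ ℚ.* a ≡ b
  one-im = solve 2 (λ a b → con 1ℚ :* b :+ con 0ℚ :* a := b) refl

  distrib-re : ∀ a b c d e f → a ℚ.* (c ℚ.+ e) ℚ.+ ℚ.- (b ℚ.* (d ℚ.+ f)) ≡
               (a ℚ.* c ℚ.+ ℚ.- (b ℚ.* d)) ℚ.+ (a ℚ.* e ℚ.+ ℚ.- (b ℚ.* f))
  distrib-re = solve 6 (λ a b c d e f → a :* (c :+ e) :+ :- (b :* (d :+ f))
    := (a :* c :+ :- (b :* d)) :+ (a :* e :+ :- (b :* f))) refl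

  distrib-im : ∀ a b c d e f → a ℚ.* (d ℚ.+ f) ℚ.+ b ℚ.* (c ℚ.+ e) ≡
               (a ℚ.* d ℚ.+ b ℚ.* c) ℚ.+ (a ℚ.* f ℚ.+ b ℚ.* e)
  distrib-im = solve 6 (λ a b c d e f → a :* (d :+ f) :+ b :* (c :+ e)
    := (a :* d :+ b :* c) :+ (a :* f :+ b :* e)) refl

-- The operations of ℂ-Ring, made opaque: conversion checking would otherwise η-expand
-- every real number and compare moduli of convergence.
opaque
  infixl 6 _+ᶜ_
  infixl 7 _*ᶜ_
  infix  8 -ᶜ_
  infix  4 _≋ᶜ_

  _+ᶜ_ _*ᶜ_ : ℂ → ℂ → ℂ
  _+ᶜ_ = ℂ-Ring._+_
  _*ᶜ_ = ℂ-Ring._*_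

  -ᶜ_ : ℂ → ℂ
  -ᶜ_ = ℂ-Ring.-_

  0ᶜ 1ᶜ : ℂ
  0ᶜ = ℂ-Ring.0#
  1ᶜ = ℂ-Ring.1#

  _≋ᶜ_ : ℂ → ℂ → Set
  z ≋ᶜ w = (re z ≋ re w) × (im z ≋ im w)

  ≋ᶜ-refl : ∀ {x} → x ≋ᶜ x
  ≋ᶜ-refl {x} = pointwise {re x} {re x} (λ _ → refl) , pointwise {im x} {im x} (λ _ → refl)

  ≋ᶜ-sym : ∀ {x y} → x ≋ᶜ y → y ≋ᶜ x
  ≋ᶜ-sym {x} {y} (p , r) = ≋-sym {re x} {re y} p , ≋-sym {im x} {im y} r

  ≋ᶜ-trans : ∀ {x y z} → x ≋ᶜ y → y ≋ᶜ z → x ≋ᶜ z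
  ≋ᶜ-trans {x} {y} {z} (p , r) (p′ , r′) = ≋-trans {re x} {re y} {re z} p p′ , ≋-trans {im x} {im y} {im z} r r′

  +ᶜ-cong : ∀ {x x′ y y′} → x ≋ᶜ x′ → y ≋ᶜ y′ → x +ᶜ y ≋ᶜ x′ +ᶜ y′
  +ᶜ-cong {x} {x′} {y} {y′} (p , r) (p′ , r′) =
    +ᴿ-cong {re x} {re x′} {re y} {re y′} p p′ , +ᴿ-cong {im x} {im x′} {im y} {im y′} r r′

  *ᶜ-cong : ∀ {x x′ y y′} → x ≋ᶜ x′ → y ≋ᶜ y′ → x *ᶜ y ≋ᶜ x′ *ᶜ y′
  *ᶜ-cong {x} {x′} {y} {y′} (p , r) (p′ , r′) =
    +ᴿ-cong {re x *ᴿ re y} {re x′ *ᴿ re y′} { -ᴿ (im x *ᴿ im y)} { -ᴿ (im x′ *ᴿ im y′)}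
      (*ᴿ-cong {re x} {re x′} {re y} {re y′} p p′)
      (-ᴿ-cong {im x *ᴿ im y} {im x′ *ᴿ im y′} (*ᴿ-cong {im x} {im x′} {im y} {im y′} r r′)) ,
    +ᴿ-cong {re x *ᴿ im y} {re x′ *ᴿ im y′} {im x *ᴿ re y} {im x′ *ᴿ re y′}
      (*ᴿ-cong {re x} {re x′} {im y} {im y′} p r′) (*ᴿ-cong {im x} {im x′} {re y} {re y′} r p′)

  -ᶜ-cong : ∀ {x y} → x ≋ᶜ y → -ᶜ x ≋ᶜ -ᶜ y
  -ᶜ-cong {x} {y} (p , r) = -ᴿ-cong {re x} {re y} p , -ᴿ-cong {im x} {im y} r

  pointwiseᶜ : ∀ {z w} → (∀ n → seq (re z) n ≡ seq (re w) n) → (∀ n → seq (im z) n ≡ seq (im w) n) → z ≋ᶜ w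
  pointwiseᶜ {z} {w} p r = pointwise {re z} {re w} p , pointwise {im z} {im w} r

  +ᶜ-assoc : ∀ x y z → (x +ᶜ y) +ᶜ z ≋ᶜ x +ᶜ (y +ᶜ z)
  +ᶜ-assoc x y z = pointwiseᶜ {(x +ᶜ y) +ᶜ z} {x +ᶜ (y +ᶜ z)}
    (λ n → ℚ.+-assoc (seq (re x) n) (seq (re y) n) (seq (re z) n)) (λ n → ℚ.+-assoc (seq (im x) n) (seq (im y) n) (seq (im z) n))

  +ᶜ-comm : ∀ x y → x +ᶜ y ≋ᶜ y +ᶜ x
  +ᶜ-comm x y = pointwiseᶜ {x +ᶜ y} {y +ᶜ x} (λ n → ℚ.+-comm (seq (re x) n) (seq (re y) n)) (λ n → ℚ.+-comm (seq (im x) n) (seq (im y) n))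

  +ᶜ-identityˡ : ∀ x → 0ᶜ +ᶜ x ≋ᶜ x
  +ᶜ-identityˡ x = pointwiseᶜ {0ᶜ +ᶜ x} {x} (λ n → ℚ.+-identityˡ (seq (re x) n)) (λ n → ℚ.+-identityˡ (seq (im x) n))

  +ᶜ-inverseˡ : ∀ x → -ᶜ x +ᶜ x ≋ᶜ 0ᶜ
  +ᶜ-inverseˡ x = pointwiseᶜ { -ᶜ x +ᶜ x} {0ᶜ} (λ n → ℚ.+-inverseˡ (seq (re x) n)) (λ n → ℚ.+-inverseˡ (seq (im x) n))

  *ᶜ-assoc : ∀ x y z → (x *ᶜ y) *ᶜ z ≋ᶜ x *ᶜ (y *ᶜ z)
  *ᶜ-assoc x y z = pointwiseᶜ {(x *ᶜ y) *ᶜ z} {x *ᶜ (y *ᶜ z)}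
    (λ n → ℚ-Laws.assoc-re (seq (re x) n) (seq (im x) n) (seq (re y) n) (seq (im y) n) (seq (re z) n) (seq (im z) n))
    (λ n → ℚ-Laws.assoc-im (seq (re x) n) (seq (im x) n) (seq (re y) n) (seq (im y) n) (seq (re z) n) (seq (im z) n))

  *ᶜ-comm : ∀ x y → x *ᶜ y ≋ᶜ y *ᶜ x
  *ᶜ-comm x y = pointwiseᶜ {x *ᶜ y} {y *ᶜ x}
    (λ n → ℚ-Laws.comm-re (seq (re x) n) (seq (im x) n) (seq (re y) n) (seq (im y) n))
    (λ n → ℚ-Laws.comm-im (seq (re x) n) (seq (im x) n) (seq (re y) n) (seq (im y) n))

  *ᶜ-identityˡ : ∀ x → 1ᶜ *ᶜ x ≋ᶜ x
  *ᶜ-identityˡ x = pointwiseᶜ {1ᶜ *ᶜ x} {x}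
    (λ n → ℚ-Laws.one-re (seq (re x) n) (seq (im x) n)) (λ n → ℚ-Laws.one-im (seq (re x) n) (seq (im x) n))

  *ᶜ-distribˡ-+ᶜ : ∀ x y z → x *ᶜ (y +ᶜ z) ≋ᶜ (x *ᶜ y) +ᶜ (x *ᶜ z)
  *ᶜ-distribˡ-+ᶜ x y z = pointwiseᶜ {x *ᶜ (y +ᶜ z)} {(x *ᶜ y) +ᶜ (x *ᶜ z)}
    (λ n → ℚ-Laws.distrib-re (seq (re x) n) (seq (im x) n) (seq (re y) n) (seq (im y) n) (seq (re z) n) (seq (im z) n))
    (λ n → ℚ-Laws.distrib-im (seq (re x) n) (seq (im x) n) (seq (re y) n) (seq (im y) n) (seq (re z) n) (seq (im z) n))

ℂ-isCommutativeRing : IsCommutativeRing _≋ᶜ_ _+ᶜ_ _*ᶜ_ -ᶜ_ 0ᶜ 1ᶜ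
ℂ-isCommutativeRing = record
  { isRing = record
    { +-isAbelianGroup = record
      { isGroup = record
        { isMonoid = record
          { isSemigroup = record
            { isMagma = record
              { isEquivalence = record { refl = ≋ᶜ-refl ; sym = ≋ᶜ-sym ; trans = ≋ᶜ-trans }
              ; ∙-cong = +ᶜ-cong
              }
            ; assoc = +ᶜ-assoc
            }
          ; identity = +ᶜ-identityˡ , λ x → ≋ᶜ-trans (+ᶜ-comm x 0ᶜ) (+ᶜ-identityˡ x)
          }
        ; inverse = +ᶜ-inverseˡ , λ x → ≋ᶜ-trans (+ᶜ-comm x (-ᶜ x)) (+ᶜ-inverseˡ x)
        ; ⁻¹-cong = -ᶜ-cong
        }
      ; comm = +ᶜ-comm
      }
    ; *-cong = *ᶜ-cong
    ; *-assoc = *ᶜ-assoc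
    ; *-identity = *ᶜ-identityˡ , λ x → ≋ᶜ-trans (*ᶜ-comm x 1ᶜ) (*ᶜ-identityˡ x)
    ; distrib = *ᶜ-distribˡ-+ᶜ , λ x y z → ≋ᶜ-trans (*ᶜ-comm (y +ᶜ z) x)
        (≋ᶜ-trans (*ᶜ-distribˡ-+ᶜ x y z) (+ᶜ-cong (*ᶜ-comm x y) (*ᶜ-comm x z)))
    }
  ; *-comm = *ᶜ-comm
  }

ℂ-commutativeRing : CommutativeRing 0ℓ 0ℓ
ℂ-commutativeRing = record { isCommutativeRing = ℂ-isCommutativeRing }

module RingSums (R : CommutativeRing 0ℓ 0ℓ) where

  open CommutativeRing R public
    using (Carrier; _≈_; setoid; 0#; 1#; -_)
    renaming ( _+_ to infixl 6 _+ᴬ_; _*_ to infixl 7 _*ᴬ_; refl to ≈-refl; sym to ≈-sym; trans to ≈-trans; reflexive to ≈-reflexive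
             ; +-cong to +ᴬ-cong; *-cong to *ᴬ-cong; *-congˡ to *ᴬ-congˡ; *-congʳ to *ᴬ-congʳ; +-congˡ to +ᴬ-congˡ
             ; *-assoc to *ᴬ-assoc; *-comm to *ᴬ-comm; zeroˡ to *ᴬ-zeroˡ; zeroʳ to *ᴬ-zeroʳ
             ; *-identityˡ to *ᴬ-identityˡ; *-identityʳ to *ᴬ-identityʳ; +-identityˡ to +ᴬ-identityˡ; +-identityʳ to +ᴬ-identityʳ
             ; +-comm to +ᴬ-comm; distribˡ to *ᴬ-distribˡ; distribʳ to *ᴬ-distribʳ; semiring to semiringᴬ )
  open SemiringSum semiringᴬ public
    using () renaming ( sum to ∑ᴬ; sum-cong-≋ to ∑ᴬ-cong; ∑-comm to ∑ᴬ-comm; sum-permute to ∑ᴬ-permute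
                      ; *-distribˡ-sum to *-distribˡ-∑ᴬ; *-distribʳ-sum to *-distribʳ-∑ᴬ; ∑-distrib-+ to ∑ᴬ-distrib-+
                      ; sum-replicate-zero to ∑ᴬ-zero )
  open SemiringMult semiringᴬ using () renaming (_×_ to _·_; ×-homo-+ to ·-homo-+; ×1-homo-* to ·1-homo-*)

  ν : ℕ → Carrier
  ν k = k · 1#

  ν-+ : ∀ j k → ν (j + k) ≈ ν j +ᴬ ν k
  ν-+ = ·-homo-+ 1#

  ν-* : ∀ j k → ν (j * k) ≈ ν j *ᴬ ν k
  ν-* = ·1-homo-*

  ν-∑ : ∀ {n} (f : Fin n → ℕ) → ν (sum f) ≈ ∑ᴬ (λ i → ν (f i))
  ν-∑ {zero}  f = ≈-refl
  ν-∑ {suc n} f = ≈-trans (ν-+ (f zero) (sum (f ∘ suc))) (+ᴬ-congˡ (ν-∑ (f ∘ suc)))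

  ∑ᴬ-bij : ∀ {n} (f : Fin n → Carrier) (π π⁻¹ : Fin n → Fin n) →
           (∀ x → π (π⁻¹ x) ≡ x) → (∀ x → π⁻¹ (π x) ≡ x) → ∑ᴬ f ≈ ∑ᴬ (f ∘ π)
  ∑ᴬ-bij f π π⁻¹ inv₁ inv₂ = ∑ᴬ-permute f (permutation π π⁻¹ inv₁ inv₂)

  indicator : {P : Set} → Dec P → Carrier → Carrier
  indicator d x = if does d then x else 0#

  indicator-yes : {P : Set} (d : Dec P) {x : Carrier} → P → indicator d x ≈ x
  indicator-yes (yes _) _ = ≈-refl
  indicator-yes (no ¬p) p = contradiction p ¬p

  indicator-no : {P : Set} (d : Dec P) {x : Carrier} → ¬ P → indicator d x ≈ 0#
  indicator-no (yes p) ¬p = contradiction p ¬p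
  indicator-no (no _)  _  = ≈-refl

  ∑ᴬ-indicator : ∀ {n} {P : Fin n → Set} (P? : ∀ j → Dec (P j)) (h : Fin n → Carrier) i → P i →
                 (∀ {j} → P j → j ≡ i) → ∑ᴬ (λ j → indicator (P? j) (h j)) ≈ h i
  ∑ᴬ-indicator {suc n} P? h zero p u = ≈-trans (+ᴬ-cong (indicator-yes (P? zero) p)
    (≈-trans (∑ᴬ-cong λ j → indicator-no (P? (suc j)) λ r → Fin.0≢1+n (sym (u r))) (∑ᴬ-zero n))) (+ᴬ-identityʳ _)
  ∑ᴬ-indicator {suc n} P? h (suc i) p u = ≈-trans (+ᴬ-cong (indicator-no (P? zero) λ r → Fin.0≢1+n (u r))
    (∑ᴬ-indicator (P? ∘ suc) (h ∘ suc) i p λ r → Fin.suc-injective (u r))) (+ᴬ-identityˡ _)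

  ∑ᴬ² : ∀ {m n} → (Fin m → Fin n → Carrier) → Carrier
  ∑ᴬ² f = ∑ᴬ λ i → ∑ᴬ λ j → f i j

  ∑ᴬ-product : ∀ {m n} (f : Fin m → Carrier) (g : Fin n → Carrier) → ∑ᴬ f *ᴬ ∑ᴬ g ≈ ∑ᴬ² (λ i j → f i *ᴬ g j)
  ∑ᴬ-product f g = ≈-trans (*-distribʳ-∑ᴬ (∑ᴬ g) f) (∑ᴬ-cong λ i → *-distribˡ-∑ᴬ (f i) g)

module Convolution {q : ℕ} (𝔽 : FieldOn q) where

  open FieldSets 𝔽

  convolution : (Fin q → ℕ) → Fin q → ℕ
  convolution r u = sum λ h → r h * r (u ⊝ h)

  ∑convolution : ∀ H → sum (convolution (ι H)) ≡ ⟦ H ⟧ * ⟦ H ⟧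
  ∑convolution H = trans (∑-comm (λ u h → ι H h * ι H (u ⊝ h))) (trans (sum-cong-≗ λ h → trans (sym (*-distribˡ-sum (ι H h) (λ u → ι H (u ⊝ h))))
    (cong (ι H h *_) (trans (sym (⟦⟧-sum (shift h H))) (∣shift∣ h H)))) (trans (sym (*-distribʳ-sum ⟦ H ⟧ (ι H))) (cong (_* ⟦ H ⟧) (sym (⟦⟧-sum H)))))

module Fourier {q : ℕ} (𝔽 : FieldOn q) (R : CommutativeRing 0ℓ 0ℓ)
  (ψ : Fin q → CommutativeRing.Carrier R) (conj : CommutativeRing.Carrier R → CommutativeRing.Carrier R) where

  open FieldSets 𝔽 hiding (solve; con; _:=_; _:+_; _:*_; _:-_; :-_)
  open Growth 𝔽
  open Inverses 𝔽
  open Convolution 𝔽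
  open RingSums R
  open SetoidReasoning setoid
  open IntegerSolver R using (solve; _:=_; _:*_)

  module WithCharacter
    (ψ-⊕ : ∀ x y → ψ (x ⊕ y) ≈ ψ x *ᴬ ψ y)
    (ψ-𝟎 : ψ 𝟎 ≈ 1#)
    (∑ψ : ∑ᴬ ψ ≈ 0#)
    (conj-cong : ∀ {x y} → x ≈ y → conj x ≈ conj y)
    (conj-+ : ∀ x y → conj (x +ᴬ y) ≈ conj x +ᴬ conj y)
    (conj-* : ∀ x y → conj (x *ᴬ y) ≈ conj x *ᴬ conj y)
    (conj-0 : conj 0# ≈ 0#)
    (conj-1 : conj 1# ≈ 1#)
    (conj-ψ : ∀ x → conj (ψ x) ≈ ψ (⊖ x))
    where

    transform : (Fin q → ℕ) → Fin q → Carrier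
    transform r t = ∑ᴬ λ s → ν (r s) *ᴬ ψ (s ⊗ t)

    norm² : Carrier → Carrier
    norm² z = z *ᴬ conj z

    conj-ν : ∀ k → conj (ν k) ≈ ν k
    conj-ν zero    = conj-0
    conj-ν (suc k) = ≈-trans (conj-+ 1# (ν k)) (+ᴬ-cong conj-1 (conj-ν k))

    conj-∑ : ∀ {n} (f : Fin n → Carrier) → conj (∑ᴬ f) ≈ ∑ᴬ (λ i → conj (f i))
    conj-∑ {zero}  f = conj-0
    conj-∑ {suc n} f = ≈-trans (conj-+ (f zero) _) (+ᴬ-congˡ (conj-∑ (f ∘ suc)))

    orthogonality : ∀ u → ∑ᴬ (λ t → ψ (u ⊗ t)) ≈ indicator (u Fin.≟ 𝟎) (ν q)
    orthogonality u with u Fin.≟ 𝟎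
    ... | yes refl = ≈-trans (∑ᴬ-cong λ t → ≈-trans (≈-reflexive (cong ψ (⊗-zeroˡ t))) ψ-𝟎) (ones q)
      where
      ones : ∀ n → ∑ᴬ {n} (λ _ → 1#) ≈ ν n
      ones zero    = ≈-refl
      ones (suc n) = +ᴬ-congˡ (ones n)
    ... | no u≢𝟎 = ≈-trans (≈-sym (∑ᴬ-bij ψ (u ⊗_) (inv u ⊗_) (inv-cancel′ u≢𝟎) (inv-cancel u≢𝟎))) ∑ψ

    norm²-transform : ∀ r t → norm² (transform r t) ≈ ∑ᴬ² (λ s s′ → ν (r s) *ᴬ ν (r s′) *ᴬ ψ ((s ⊝ s′) ⊗ t))
    norm²-transform r t = begin
      transform r t *ᴬ conj (transform r t)
        ≈⟨ *ᴬ-congˡ (≈-trans (conj-∑ (λ s → ν (r s) *ᴬ ψ (s ⊗ t)))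
             (∑ᴬ-cong λ s → ≈-trans (conj-* _ _) (*ᴬ-cong (conj-ν (r s)) (conj-ψ (s ⊗ t))))) ⟩
      transform r t *ᴬ ∑ᴬ (λ s → ν (r s) *ᴬ ψ (⊖ (s ⊗ t)))
        ≈⟨ ∑ᴬ-product (λ s → ν (r s) *ᴬ ψ (s ⊗ t)) (λ s → ν (r s) *ᴬ ψ (⊖ (s ⊗ t))) ⟩
      ∑ᴬ² (λ s s′ → ν (r s) *ᴬ ψ (s ⊗ t) *ᴬ (ν (r s′) *ᴬ ψ (⊖ (s′ ⊗ t))))
        ≈⟨ ∑ᴬ-cong (λ s → ∑ᴬ-cong λ s′ → ≈-trans
             (solve 4 (λ a b c d → a :* b :* (c :* d) := a :* c :* (b :* d)) ≈-refl (ν (r s)) (ψ (s ⊗ t)) (ν (r s′)) (ψ (⊖ (s′ ⊗ t))))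
             (*ᴬ-congˡ (≈-trans (≈-sym (ψ-⊕ (s ⊗ t) (⊖ (s′ ⊗ t)))) (≈-reflexive (cong ψ
               (FieldSets.solve 𝔽 3 (λ s s′ t → s ∶* t ∶+ ∶- (s′ ∶* t) ∶= (s ∶- s′) ∶* t) refl s s′ t)))))) ⟩
      ∑ᴬ² (λ s s′ → ν (r s) *ᴬ ν (r s′) *ᴬ ψ ((s ⊝ s′) ⊗ t)) ∎
      where open FieldSets 𝔽 using () renaming (_:=_ to _∶=_; _:+_ to _∶+_; _:*_ to _∶*_; _:-_ to _∶-_; :-_ to ∶-_)

    parseval : ∀ r → ∑ᴬ (λ t → norm² (transform r t)) ≈ ν (q * sum (λ s → r s * r s))
    parseval r = begin
      ∑ᴬ (λ t → norm² (transform r t))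
        ≈⟨ ∑ᴬ-cong (norm²-transform r) ⟩
      ∑ᴬ (λ t → ∑ᴬ² (λ s s′ → F s s′ t))
        ≈⟨ ≈-trans (∑ᴬ-comm (λ t s → ∑ᴬ λ s′ → F s s′ t)) (∑ᴬ-cong λ s → ∑ᴬ-comm (λ t s′ → F s s′ t)) ⟩
      ∑ᴬ² (λ s s′ → ∑ᴬ (F s s′))
        ≈⟨ ∑ᴬ-cong (λ s → ∑ᴬ-cong λ s′ → ≈-trans (≈-sym (*-distribˡ-∑ᴬ (ν (r s) *ᴬ ν (r s′)) (λ t → ψ ((s ⊝ s′) ⊗ t))))
             (≈-trans (*ᴬ-congˡ (orthogonality (s ⊝ s′))) (pull (s ⊝ s′ Fin.≟ 𝟎)))) ⟩
      ∑ᴬ² (λ s s′ → indicator (s ⊝ s′ Fin.≟ 𝟎) (ν (r s) *ᴬ ν (r s′) *ᴬ ν q))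
        ≈⟨ ∑ᴬ-cong (λ s → ∑ᴬ-indicator (λ s′ → s ⊝ s′ Fin.≟ 𝟎) (λ s′ → ν (r s) *ᴬ ν (r s′) *ᴬ ν q) s (⊖-inverseʳ s)
             λ {s′} eq → trans (sym (⊝-⊝ s s′)) (trans (cong (s ⊝_) eq) (subst (λ z → s ⊝ z ≡ s) (⊖-inverseʳ s) (⊝-⊝ s s)))) ⟩
      ∑ᴬ (λ s → ν (r s) *ᴬ ν (r s) *ᴬ ν q)
        ≈⟨ ∑ᴬ-cong (λ s → ≈-trans (*ᴬ-congʳ (≈-sym (ν-* (r s) (r s)))) (*ᴬ-comm _ _)) ⟩
      ∑ᴬ (λ s → ν q *ᴬ ν (r s * r s))
        ≈⟨ *-distribˡ-∑ᴬ (ν q) (λ s → ν (r s * r s)) ⟨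
      ν q *ᴬ ∑ᴬ (λ s → ν (r s * r s))
        ≈⟨ *ᴬ-congˡ (ν-∑ (λ s → r s * r s)) ⟨
      ν q *ᴬ ν (sum (λ s → r s * r s))
        ≈⟨ ν-* q _ ⟨
      ν (q * sum (λ s → r s * r s)) ∎
      where
      F : Fin q → Fin q → Fin q → Carrier
      F s s′ t = ν (r s) *ᴬ ν (r s′) *ᴬ ψ ((s ⊝ s′) ⊗ t)
      pull : ∀ {a} {P : Set} (d : Dec P) → a *ᴬ indicator d (ν q) ≈ indicator d (a *ᴬ ν q)
      pull     (yes _) = ≈-refl
      pull {a} (no _)  = *ᴬ-zeroʳ a

    transform-square : ∀ r t → transform r t *ᴬ transform r t ≈ transform (convolution r) t
    transform-square r t = begin
      transform r t *ᴬ transform r t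
        ≈⟨ ∑ᴬ-product (λ h → ν (r h) *ᴬ ψ (h ⊗ t)) (λ h → ν (r h) *ᴬ ψ (h ⊗ t)) ⟩
      ∑ᴬ² (λ h h′ → ν (r h) *ᴬ ψ (h ⊗ t) *ᴬ (ν (r h′) *ᴬ ψ (h′ ⊗ t)))
        ≈⟨ ∑ᴬ-cong (λ h → ∑ᴬ-bij (λ h′ → ν (r h) *ᴬ ψ (h ⊗ t) *ᴬ (ν (r h′) *ᴬ ψ (h′ ⊗ t)))
             (_⊝ h) (_⊕ h) (λ x → ⊕⊝ x h) (λ x → ⊝⊕ x h)) ⟩
      ∑ᴬ² (λ h u → ν (r h) *ᴬ ψ (h ⊗ t) *ᴬ (ν (r (u ⊝ h)) *ᴬ ψ ((u ⊝ h) ⊗ t)))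
        ≈⟨ ∑ᴬ-cong (λ h → ∑ᴬ-cong λ u → ≈-trans
             (solve 4 (λ a b c d → a :* b :* (c :* d) := a :* c :* (b :* d)) ≈-refl (ν (r h)) (ψ (h ⊗ t)) (ν (r (u ⊝ h))) (ψ ((u ⊝ h) ⊗ t)))
             (*ᴬ-cong (≈-sym (ν-* (r h) (r (u ⊝ h)))) (≈-trans (≈-sym (ψ-⊕ (h ⊗ t) ((u ⊝ h) ⊗ t))) (≈-reflexive (cong ψ
               (FieldSets.solve 𝔽 3 (λ h u t → h ∶* t ∶+ (u ∶- h) ∶* t ∶= u ∶* t) refl h u t)))))) ⟩
      ∑ᴬ² (λ h u → ν (r h * r (u ⊝ h)) *ᴬ ψ (u ⊗ t))
        ≈⟨ ∑ᴬ-comm (λ h u → ν (r h * r (u ⊝ h)) *ᴬ ψ (u ⊗ t)) ⟩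
      ∑ᴬ² (λ u h → ν (r h * r (u ⊝ h)) *ᴬ ψ (u ⊗ t))
        ≈⟨ ∑ᴬ-cong (λ u → ≈-trans (≈-sym (*-distribʳ-∑ᴬ (ψ (u ⊗ t)) (λ h → ν (r h * r (u ⊝ h)))))
             (*ᴬ-congʳ (≈-sym (ν-∑ (λ h → r h * r (u ⊝ h)))))) ⟩
      transform (convolution r) t ∎
      where open FieldSets 𝔽 using () renaming (_:=_ to _∶=_; _:+_ to _∶+_; _:*_ to _∶*_; _:-_ to _∶-_; :-_ to ∶-_)

    module WithSubgroup (H : FSet) (H-⊗ : ∀ {x y} → x ∈ H → y ∈ H → x ⊗ y ∈ H)
             (H-inv : ∀ {x} → x ∈ H → inv x ∈ H) (H≢𝟎 : ∀ {x} → x ∈ H → x ≢ 𝟎) where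

      g : Fin q → Carrier
      g = transform (ι H)

      g-invariant : ∀ {y} → y ∈ H → g y ≈ g 𝟏
      g-invariant {y} y∈ = ≈-trans
        (∑ᴬ-bij (λ h → ν (ι H h) *ᴬ ψ (h ⊗ y)) (inv y ⊗_) (y ⊗_) (inv-cancel y≢𝟎) (inv-cancel′ y≢𝟎))
        (∑ᴬ-cong λ h → *ᴬ-cong
          (≈-reflexive (cong ν (𝟙-cong (mem? H (inv y ⊗ h)) (mem? H h)
            (λ m → subst (_∈ H) (inv-cancel′ y≢𝟎 h) (H-⊗ y∈ m)) (H-⊗ (H-inv y∈)))))
          (≈-reflexive (cong ψ (trans (⊗-comm _ y) (trans (inv-cancel′ y≢𝟎 h) (sym (⊗-identityʳ h)))))))
        where y≢𝟎 = H≢𝟎 y∈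

      average : ∀ (F : Carrier → Carrier) → (∀ {x y} → x ≈ y → F x ≈ F y) →
                ν ⟦ H ⟧ *ᴬ F (g 𝟏) ≈ ∑ᴬ (λ y → ν (ι H y) *ᴬ F (g y))
      average F F-cong = begin
        ν ⟦ H ⟧ *ᴬ F (g 𝟏)
          ≈⟨ *ᴬ-congʳ (≈-trans (≈-reflexive (cong ν (⟦⟧-sum H))) (ν-∑ (ι H))) ⟩
        ∑ᴬ (λ y → ν (ι H y)) *ᴬ F (g 𝟏)
          ≈⟨ *-distribʳ-∑ᴬ (F (g 𝟏)) (λ y → ν (ι H y)) ⟩
        ∑ᴬ (λ y → ν (ι H y) *ᴬ F (g 𝟏))
          ≈⟨ ∑ᴬ-cong (λ y → step y (mem? H y)) ⟩
        ∑ᴬ (λ y → ν (ι H y) *ᴬ F (g y)) ∎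
        where
        step : ∀ y (d : Dec (y ∈ H)) → ν (𝟙 d) *ᴬ F (g 𝟏) ≈ ν (𝟙 d) *ᴬ F (g y)
        step y (yes y∈) = *ᴬ-congˡ (F-cong (≈-sym (g-invariant y∈)))
        step y (no _)   = ≈-trans (*ᴬ-zeroˡ _) (≈-sym (*ᴬ-zeroˡ _))

      r : Fin q → ℕ
      r = convolution (ι H)

      average-square : ν ⟦ H ⟧ *ᴬ (g 𝟏 *ᴬ g 𝟏) ≈ ∑ᴬ (λ u → ν (r u) *ᴬ g u)
      average-square = begin
        ν ⟦ H ⟧ *ᴬ (g 𝟏 *ᴬ g 𝟏)
          ≈⟨ average (λ z → z *ᴬ z) (λ eq → *ᴬ-cong eq eq) ⟩
        ∑ᴬ (λ y → ν (ι H y) *ᴬ (g y *ᴬ g y))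
          ≈⟨ ∑ᴬ-cong (λ y → ≈-trans (*ᴬ-congˡ (transform-square (ι H) y)) (*-distribˡ-∑ᴬ (ν (ι H y)) (λ u → ν (r u) *ᴬ ψ (u ⊗ y)))) ⟩
        ∑ᴬ² (λ y u → ν (ι H y) *ᴬ (ν (r u) *ᴬ ψ (u ⊗ y)))
          ≈⟨ ∑ᴬ-comm (λ y u → ν (ι H y) *ᴬ (ν (r u) *ᴬ ψ (u ⊗ y))) ⟩
        ∑ᴬ² (λ u y → ν (ι H y) *ᴬ (ν (r u) *ᴬ ψ (u ⊗ y)))
          ≈⟨ ∑ᴬ-cong (λ u → ≈-trans (∑ᴬ-cong λ y → ≈-trans
               (solve 3 (λ a b c → a :* (b :* c) := b :* (a :* c)) ≈-refl (ν (ι H y)) (ν (r u)) (ψ (u ⊗ y)))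
               (*ᴬ-congˡ (*ᴬ-congˡ (≈-reflexive (cong ψ (⊗-comm u y))))))
               (≈-sym (*-distribˡ-∑ᴬ (ν (r u)) (λ y → ν (ι H y) *ᴬ ψ (y ⊗ u))))) ⟩
        ∑ᴬ (λ u → ν (r u) *ᴬ g u) ∎

      fourth-moment : ∑ᴬ (λ t → norm² (g t *ᴬ g t)) ≈ ν (q * sum (λ u → r u * r u))
      fourth-moment = ≈-trans (∑ᴬ-cong λ t → *ᴬ-cong (transform-square (ι H) t) (conj-cong (transform-square (ι H) t))) (parseval r)

≤1⇒pow≤ : ∀ k {a} → 0ℚ ℚ.≤ a → a ℚ.≤ 1ℚ → a ^ℚ suc k ℚ.≤ a
≤1⇒pow≤ k {a} 0≤a a≤1 = ℚ.≤-trans (*-mono-≤ (0≤pow k 0≤a) 0≤a ℚ.≤-refl (pow≤1 k)) (ℚ.≤-reflexive (ℚ.*-identityʳ a))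
  where
  pow≤1 : ∀ k → a ^ℚ k ℚ.≤ 1ℚ
  pow≤1 zero    = ℚ.≤-refl
  pow≤1 (suc k) = ℚ.≤-trans (*-mono-≤ (0≤pow k 0≤a) 0≤1 a≤1 (pow≤1 k)) (ℚ.≤-reflexive (ℚ.*-identityˡ 1ℚ))

-- |a - 1| ≤ |aᵏ - 1| for a ≥ 0 and k ≥ 1.
root-of-1-close : ∀ k {a ε} → 0ℚ ℚ.≤ a → 0ℚ ℚ.≤ ε → ℚ.∣ a ^ℚ suc k ℚ.- 1ℚ ∣ ℚ.≤ ε → ℚ.∣ a ℚ.- 1ℚ ∣ ℚ.≤ ε
root-of-1-close k {a} {ε} 0≤a 0≤ε close = ≤⇒∣-∣ a 1ℚ (upper (ℚ.≤-total a 1ℚ)) (lower (ℚ.≤-total a 1ℚ))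
  where
  1≤1+ε : 1ℚ ℚ.≤ 1ℚ ℚ.+ ε
  1≤1+ε = subst (ℚ._≤ 1ℚ ℚ.+ ε) (ℚ.+-identityʳ 1ℚ) (ℚ.+-monoʳ-≤ 1ℚ 0≤ε)
  upper : a ℚ.≤ 1ℚ ⊎ 1ℚ ℚ.≤ a → a ℚ.≤ 1ℚ ℚ.+ ε
  upper (inj₁ a≤1) = ℚ.≤-trans a≤1 1≤1+ε
  upper (inj₂ 1≤a) = ℚ.≤-trans (a≤pow k 1≤a) (∣-∣⇒≤ (a ^ℚ suc k) 1ℚ close)
  flipped : 1ℚ ℚ.≤ a ^ℚ suc k ℚ.+ ε
  flipped = ∣-∣⇒≤ 1ℚ (a ^ℚ suc k) (subst (ℚ._≤ ε)
    (trans (sym (ℚ.∣-p∣≡∣p∣ (a ^ℚ suc k ℚ.- 1ℚ))) (cong ℚ.∣_∣ (solve 2 (λ x y → :- (x :- y) := y :- x) refl (a ^ℚ suc k) 1ℚ))) close)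
    where open ℚ-Solver.+-*-Solver
  lower : a ℚ.≤ 1ℚ ⊎ 1ℚ ℚ.≤ a → 1ℚ ℚ.≤ a ℚ.+ ε
  lower (inj₁ a≤1) = ℚ.≤-trans flipped (ℚ.+-monoˡ-≤ ε (≤1⇒pow≤ k 0≤a a≤1))
  lower (inj₂ 1≤a) = ℚ.≤-trans 1≤a (subst (ℚ._≤ a ℚ.+ ε) (ℚ.+-identityʳ a) (ℚ.+-monoʳ-≤ a 0≤ε))

0≤sq : ∀ a → 0ℚ ℚ.≤ a ℚ.* a
0≤sq a with ℚ.≤-total 0ℚ a
... | inj₁ 0≤a = 0≤* 0≤a 0≤a
... | inj₂ a≤0 = subst (0ℚ ℚ.≤_) (solve 1 (λ x → :- x :* :- x := x :* x) refl a) (0≤* 0≤-a 0≤-a)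
  where
  open ℚ-Solver.+-*-Solver
  0≤-a = ℚ.neg-antimono-≤ a≤0

sq≤⇒∣∣≤ : ∀ {a b} → 0ℚ ℚ.≤ b → a ℚ.* a ℚ.< b ℚ.* b → ℚ.∣ a ∣ ℚ.≤ b
sq≤⇒∣∣≤ {a} {b} 0≤b lt = ∣∣-intro (cancel a lt) (cancel (ℚ.- a) (subst (ℚ._< b ℚ.* b) (solve 1 (λ x → x :* x := :- x :* :- x) refl a) lt))
  where
  open ℚ-Solver.+-*-Solver
  square : ∀ x → x ^ℚ 2 ≡ x ℚ.* x
  square x = cong (x ℚ.*_) (ℚ.*-identityʳ x)
  cancel : ∀ x → x ℚ.* x ℚ.< b ℚ.* b → x ℚ.≤ b
  cancel x lt = pow-cancel 2 0≤b (subst₂ ℚ._<_ (sym (square x)) (sym (square b)) lt)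

SmallAt : ℝ → ℚ → Set
SmallAt x ε = Eventually λ n → ℚ.∣ seq x n ∣ ℚ.≤ ε

Apart : ℝ → Set
Apart x = Σ ℚ λ η → Positive η × Eventually λ n → η ℚ.≤ ℚ.∣ seq x n ∣

small-or-apart : ∀ x ε → Positive ε → SmallAt x ε ⊎ Apart x
small-or-apart x ε ε>0 with cauchy x (½ ℚ.* (½ ℚ.* ε)) (half-pos (½ ℚ.* ε) (half-pos ε ε>0))
... | N , close = go (ℚ.≤-total ℚ.∣ seq x N ∣ (½ ℚ.* ε))
  where
  η = ½ ℚ.* (½ ℚ.* ε)
  η>0 = half-pos (½ ℚ.* ε) (half-pos ε ε>0)
  near : ∀ i j → N ≤ i → N ≤ j → ℚ.∣ seq x i ∣ ℚ.≤ ℚ.∣ seq x j ∣ ℚ.+ η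
  near i j N≤i N≤j = ℚ.≤-trans (ℚ.≤-trans (ℚ.≤-reflexive (cong ℚ.∣_∣ (solve 2 (λ a b → a := b :+ (a :- b)) refl (seq x i) (seq x j))))
    (ℚ.∣p+q∣≤∣p∣+∣q∣ (seq x j) (seq x i ℚ.- seq x j))) (ℚ.+-monoʳ-≤ ℚ.∣ seq x j ∣ (close i j N≤i N≤j))
    where open ℚ-Solver.+-*-Solver
  η≤½ε : η ℚ.≤ ½ ℚ.* ε
  η≤½ε = subst₂ ℚ._≤_ (ℚ.+-identityˡ η) (½+½ (½ ℚ.* ε)) (ℚ.+-monoˡ-≤ η (ℚ.<⇒≤ (ℚ.positive⁻¹ η {{η>0}})))
  go : ℚ.∣ seq x N ∣ ℚ.≤ ½ ℚ.* ε ⊎ ½ ℚ.* ε ℚ.≤ ℚ.∣ seq x N ∣ → SmallAt x ε ⊎ Apart x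
  go (inj₁ le) = inj₁ (N , λ n N≤n → ℚ.≤-trans (near n N N≤n ℕ.≤-refl) (ℚ.≤-trans (ℚ.+-mono-≤ le η≤½ε) (ℚ.≤-reflexive (½+½ ε))))
  go (inj₂ ge) = inj₂ (η , η>0 , N , λ n N≤n → cancel (ℚ.≤-trans (ℚ.≤-reflexive (½+½ (½ ℚ.* ε))) (ℚ.≤-trans ge (near N n ℕ.≤-refl N≤n))))
    where
    open ℚ-Solver.+-*-Solver
    cancel : ∀ {a} → η ℚ.+ η ℚ.≤ a ℚ.+ η → η ℚ.≤ a
    cancel {a} h = subst₂ ℚ._≤_ (solve 1 (λ d → d :+ d :- d := d) refl η) (solve 2 (λ a d → a :+ d :- d := a) refl a η) (ℚ.+-monoˡ-≤ (ℚ.- η) h)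

Null : ℝ → Set
Null x = ∀ ε → Positive ε → SmallAt x ε

apart⇒¬null : ∀ x → Apart x → ¬ Null x
apart⇒¬null x (η , η>0 , N₁ , big) null with null (½ ℚ.* η) (half-pos η η>0)
... | N₂ , small = ℚ.<-irrefl refl (ℚ.<-≤-trans ½η<η (ℚ.≤-trans (big M (ℕ.m≤m⊔n N₁ N₂)) (small M (ℕ.m≤n⊔m N₁ N₂))))
  where
  M = N₁ ℕ.⊔ N₂
  ½η<η : ½ ℚ.* η ℚ.< η
  ½η<η = subst₂ ℚ._<_ (ℚ.+-identityˡ _) (½+½ η) (ℚ.+-monoˡ-< (½ ℚ.* η) (ℚ.positive⁻¹ (½ ℚ.* η) {{half-pos η η>0}}))

no-zero-divisors : ∀ x y → Null (x *ᴿ y) → ¬ Null x → Null y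
no-zero-divisors x y xy≈0 x≉0 ε ε>0 with small-or-apart y ε ε>0
... | inj₁ small = small
... | inj₂ (η , η>0 , ap) = contradiction x≈0 x≉0
  where
  x≈0 : Null x
  x≈0 ε′ ε′>0 with small-or-apart x ε′ ε′>0
  ... | inj₁ small = small
  ... | inj₂ (η′ , η′>0 , ap′) = contradiction xy≈0 (apart⇒¬null (x *ᴿ y)
    (η′ ℚ.* η , ℚ.pos*pos⇒pos η′ {{η′>0}} η {{η>0}} , eventually-map₂ (λ n u v → ℚ.≤-trans
      (*-mono-≤ (ℚ.<⇒≤ (ℚ.positive⁻¹ η {{η>0}})) (ℚ.0≤∣p∣ (seq x n)) u v) (ℚ.≤-reflexive (sym (ℚ.∣p*q∣≡∣p∣*∣q∣ (seq x n) (seq y n))))) ap′ ap))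

module 𝒞 = RingSums ℂ-commutativeRing

∥_∥² : ℂ → ℕ → ℚ
∥ z ∥² n = seq (re z) n ℚ.* seq (re z) n ℚ.+ seq (im z) n ℚ.* seq (im z) n

0≤∥∥² : ∀ z n → 0ℚ ℚ.≤ ∥ z ∥² n
0≤∥∥² z n = 0≤+ (0≤sq (seq (re z) n)) (0≤sq (seq (im z) n))

opaque
  unfolding _+ᶜ_ _*ᶜ_ -ᶜ_ 0ᶜ 1ᶜ _≋ᶜ_

  conjᶜ : ℂ → ℂ
  conjᶜ z = re z +i (-ᴿ im z)

  conjᶜ-cong : ∀ {x y} → x ≋ᶜ y → conjᶜ x ≋ᶜ conjᶜ y
  conjᶜ-cong {x} {y} (p , r) = p , -ᴿ-cong {im x} {im y} r

  conjᶜ-+ : ∀ x y → conjᶜ (x +ᶜ y) ≋ᶜ conjᶜ x +ᶜ conjᶜ y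
  conjᶜ-+ x y = pointwiseᶜ {conjᶜ (x +ᶜ y)} {conjᶜ x +ᶜ conjᶜ y} (λ n → refl) (λ n → ℚ.neg-distrib-+ (seq (im x) n) (seq (im y) n))

  conjᶜ-* : ∀ x y → conjᶜ (x *ᶜ y) ≋ᶜ conjᶜ x *ᶜ conjᶜ y
  conjᶜ-* x y = pointwiseᶜ {conjᶜ (x *ᶜ y)} {conjᶜ x *ᶜ conjᶜ y}
    (λ n → solve 4 (λ a b c d → a :* c :+ :- (b :* d) := a :* c :+ :- (:- b :* :- d)) refl (seq (re x) n) (seq (im x) n) (seq (re y) n) (seq (im y) n))
    (λ n → solve 4 (λ a b c d → :- (a :* d :+ b :* c) := a :* :- d :+ :- b :* c) refl (seq (re x) n) (seq (im x) n) (seq (re y) n) (seq (im y) n))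
    where open ℚ-Solver.+-*-Solver

  conjᶜ-0 : conjᶜ 0ᶜ ≋ᶜ 0ᶜ
  conjᶜ-0 = pointwiseᶜ {conjᶜ 0ᶜ} {0ᶜ} (λ n → refl) (λ n → refl)

  conjᶜ-1 : conjᶜ 1ᶜ ≋ᶜ 1ᶜ
  conjᶜ-1 = pointwiseᶜ {conjᶜ 1ᶜ} {1ᶜ} (λ n → refl) (λ n → refl)

  re-+ : ∀ x y n → seq (re (x +ᶜ y)) n ≡ seq (re x) n ℚ.+ seq (re y) n
  re-+ x y n = refl

  im-+ : ∀ x y n → seq (im (x +ᶜ y)) n ≡ seq (im x) n ℚ.+ seq (im y) n
  im-+ x y n = refl

  re-* : ∀ x y n → seq (re (x *ᶜ y)) n ≡ seq (re x) n ℚ.* seq (re y) n ℚ.- seq (im x) n ℚ.* seq (im y) n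
  re-* x y n = refl

  im-* : ∀ x y n → seq (im (x *ᶜ y)) n ≡ seq (re x) n ℚ.* seq (im y) n ℚ.+ seq (im x) n ℚ.* seq (re y) n
  im-* x y n = refl

  re-0 : ∀ n → seq (re 0ᶜ) n ≡ 0ℚ
  re-0 n = refl

  im-0 : ∀ n → seq (im 0ᶜ) n ≡ 0ℚ
  im-0 n = refl

  re-1 : ∀ n → seq (re 1ᶜ) n ≡ 1ℚ
  re-1 n = refl

  im-1 : ∀ n → seq (im 1ᶜ) n ≡ 0ℚ
  im-1 n = refl

  re-norm² : ∀ z n → seq (re (z *ᶜ conjᶜ z)) n ≡ ∥ z ∥² n
  re-norm² z n = solve 2 (λ a b → a :* a :+ :- (b :* :- b) := a :* a :+ b :* b) refl (seq (re z) n) (seq (im z) n)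
    where open ℚ-Solver.+-*-Solver

  im-norm² : ∀ z n → seq (im (z *ᶜ conjᶜ z)) n ≡ 0ℚ
  im-norm² z n = solve 2 (λ a b → a :* :- b :+ b :* a := con 0ℚ) refl (seq (re z) n) (seq (im z) n)
    where open ℚ-Solver.+-*-Solver

  ≋ᶜ⇒re : ∀ {z w} → z ≋ᶜ w → ∀ ε → Positive ε → Eventually λ n → ℚ.∣ seq (re z) n ℚ.- seq (re w) n ∣ ℚ.≤ ε
  ≋ᶜ⇒re (p , _) = ≋⇒≈ p

  ≋ᶜ⇒≈ : ∀ {z w} → z ≋ᶜ w → z ℂ-Ring.≈ w
  ≋ᶜ⇒≈ (p , r) = ≋⇒≈ p , ≋⇒≈ r

  ≈⇒≋ᶜ : ∀ {z w} → z ℂ-Ring.≈ w → z ≋ᶜ w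
  ≈⇒≋ᶜ (p , r) = mk≋ p , mk≋ r

  *ᶜ-link : ∀ x y → x ℂ-Ring.* y ≋ᶜ x *ᶜ y
  *ᶜ-link x y = ≋ᶜ-refl {x *ᶜ y}

  1ᶜ-link : ℂ-Ring.1# ≋ᶜ 1ᶜ
  1ᶜ-link = ≋ᶜ-refl {1ᶜ}

  null-norm² : ∀ z → Null (re (z *ᶜ conjᶜ z)) → z ≋ᶜ 0ᶜ
  null-norm² z null = mk≋ (component (re z) λ n → ℚ.≤-trans (bound₁ n) (ℚ.≤-reflexive (sym (re-norm² z n)))) ,
                      mk≋ (component (im z) λ n → ℚ.≤-trans (bound₂ n) (ℚ.≤-reflexive (sym (re-norm² z n))))
    where
    bound₁ : ∀ n → seq (re z) n ℚ.* seq (re z) n ℚ.≤ ∥ z ∥² n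
    bound₁ n = subst (ℚ._≤ ∥ z ∥² n) (ℚ.+-identityʳ _) (ℚ.+-monoʳ-≤ (seq (re z) n ℚ.* seq (re z) n) (0≤sq (seq (im z) n)))
    bound₂ : ∀ n → seq (im z) n ℚ.* seq (im z) n ℚ.≤ ∥ z ∥² n
    bound₂ n = subst (ℚ._≤ ∥ z ∥² n) (ℚ.+-identityˡ _) (ℚ.+-monoˡ-≤ (seq (im z) n ℚ.* seq (im z) n) (0≤sq (seq (re z) n)))
    component : ∀ x → (∀ n → seq x n ℚ.* seq x n ℚ.≤ seq (re (z *ᶜ conjᶜ z)) n) →
                ∀ ε → Positive ε → Eventually λ n → ℚ.∣ seq x n ℚ.- 0ℚ ∣ ℚ.≤ ε
    component x bound ε ε>0 = eventually-map (λ n small → subst (λ a → ℚ.∣ a ∣ ℚ.≤ ε) (sym (ℚ.+-identityʳ (seq x n)))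
      (sq≤⇒∣∣≤ (ℚ.<⇒≤ (ℚ.positive⁻¹ ε {{ε>0}})) (ℚ.≤-<-trans (ℚ.≤-trans (bound n) (ℚ.≤-trans (a≤∣a∣ _) small)) half<)))
      (null (½ ℚ.* (ε ℚ.* ε)) (half-pos (ε ℚ.* ε) ε²>0))
      where
      ε²>0 : Positive (ε ℚ.* ε)
      ε²>0 = ℚ.pos*pos⇒pos ε {{ε>0}} ε {{ε>0}}
      half< : ½ ℚ.* (ε ℚ.* ε) ℚ.< ε ℚ.* ε
      half< = subst₂ ℚ._<_ (ℚ.+-identityˡ _) (½+½ (ε ℚ.* ε))
        (ℚ.+-monoˡ-< (½ ℚ.* (ε ℚ.* ε)) (ℚ.positive⁻¹ (½ ℚ.* (ε ℚ.* ε)) {{half-pos (ε ℚ.* ε) ε²>0}}))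

  ≋ᶜ0⇒null : ∀ {w} → w ≋ᶜ 0ᶜ → Null (re w)
  ≋ᶜ0⇒null {w} w≋0 ε ε>0 = eventually-map (λ n → subst (λ a → ℚ.∣ a ∣ ℚ.≤ ε) (ℚ.+-identityʳ (seq (re w) n))) (≋ᶜ⇒re w≋0 ε ε>0)

  real-one : ∀ w k .{{_ : NonZero k}} → (∀ n → seq (im w) n ≡ 0ℚ) → (∀ n → 0ℚ ℚ.≤ seq (re w) n) →
             (∀ ε → Positive ε → Eventually λ n → ℚ.∣ seq (re w) n ^ℚ k ℚ.- 1ℚ ∣ ℚ.≤ ε) → w ≋ᶜ 1ᶜ
  real-one w (suc k) im≡0 0≤re lim = mk≋ (λ ε ε>0 → eventually-map (λ n → root-of-1-close k (0≤re n) (ℚ.<⇒≤ (ℚ.positive⁻¹ ε {{ε>0}}))) (lim ε ε>0)) ,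
    pointwise {im w} {im 1ᶜ} im≡0

powᶜ : ℂ → ℕ → ℂ
powᶜ z zero    = 1ᶜ
powᶜ z (suc k) = z *ᶜ powᶜ z k

powᶜ-real : ∀ w n → seq (im w) n ≡ 0ℚ → ∀ k → seq (re (powᶜ w k)) n ≡ seq (re w) n ^ℚ k × seq (im (powᶜ w k)) n ≡ 0ℚ
powᶜ-real w n im≡0 zero    = re-1 n , im-1 n
powᶜ-real w n im≡0 (suc k) with powᶜ-real w n im≡0 k
... | re-eq , im-eq =
  trans (re-* w (powᶜ w k) n) (trans (cong₂ (λ a b → seq (re w) n ℚ.* a ℚ.- seq (im w) n ℚ.* b) re-eq im-eq)
    (solve 3 (λ a b c → a :* b :- c :* con 0ℚ := a :* b) refl (seq (re w) n) (seq (re w) n ^ℚ k) (seq (im w) n))) ,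
  trans (im-* w (powᶜ w k) n) (trans (cong₂ (λ a b → seq (re w) n ℚ.* a ℚ.+ b ℚ.* seq (re (powᶜ w k)) n) im-eq im≡0)
    (solve 2 (λ a b → a :* con 0ℚ :+ con 0ℚ :* b := con 0ℚ) refl (seq (re w) n) (seq (re (powᶜ w k)) n)))
  where open ℚ-Solver.+-*-Solver

module Character {q : ℕ} (𝔽 : FieldOn q) (ψ : Fin q → ℂ)
  (ψ-⊕ : ∀ x y → ψ (FieldOn._⊕_ 𝔽 x y) ≋ᶜ ψ x *ᶜ ψ y) (ψ-𝟎 : ψ (FieldOn.𝟎 𝔽) ≋ᶜ 1ᶜ) where

  open FieldSets 𝔽 hiding (solve; con; _:=_; _:+_; _:*_; _:-_; :-_)
  open 𝒞
  open IntegerSolver ℂ-commutativeRing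
  open CommutativeMonoidSum (CommutativeRing.+-commutativeMonoid commutativeRing) using ()
    renaming (sum to ∑ⱽ; sum-permute to ∑ⱽ-permute; ∑-distrib-+ to ∑ⱽ-distrib)
  multiple : ℕ → Fin q → Fin q
  multiple n x = ∑ⱽ {n} λ _ → x

  multiple-q : ∀ x → multiple q x ≡ 𝟎
  multiple-q x = trans (sym (⊕⊝ˡ (∑ⱽ (λ y → y)) (multiple q x))) (trans (cong (_⊝ ∑ⱽ (λ y → y))
    (trans (sym (∑ⱽ-distrib (λ y → y) (λ _ → x))) (sym (∑ⱽ-permute (λ y → y) (permutation (_⊕ x) (_⊝ x) (λ y → ⊝⊕ y x) (λ y → ⊕⊝ y x))))))
    (⊖-inverseʳ (∑ⱽ (λ y → y))))

  ψ-multiple : ∀ n x → ψ (multiple n x) ≈ powᶜ (ψ x) n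
  ψ-multiple zero    x = ψ-𝟎
  ψ-multiple (suc n) x = ≈-trans (ψ-⊕ x (multiple n x)) (*ᴬ-congˡ (ψ-multiple n x))

  norm²-pow : ∀ z n → powᶜ (z *ᶜ conjᶜ z) n ≈ powᶜ z n *ᶜ conjᶜ (powᶜ z n)
  norm²-pow z zero    = ≈-sym (≈-trans (*ᴬ-congˡ conjᶜ-1) (*ᴬ-identityˡ 1ᶜ))
  norm²-pow z (suc n) = ≈-trans (*ᴬ-congˡ (norm²-pow z n)) (≈-trans
    (solve 4 (λ a b c d → a :* b :* (c :* d) := a :* c :* (b :* d)) ≈-refl z (conjᶜ z) (powᶜ z n) (conjᶜ (powᶜ z n)))
    (*ᴬ-congˡ (≈-sym (conjᶜ-* z (powᶜ z n)))))

  ∣ψ∣² : ∀ x → ψ x *ᶜ conjᶜ (ψ x) ≈ 1ᶜ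
  ∣ψ∣² x = real-one w q {{Fin.nonZeroIndex 𝟎}} (im-norm² (ψ x)) (λ n → ℚ.≤-trans (0≤∥∥² (ψ x) n) (ℚ.≤-reflexive (sym (re-norm² (ψ x) n)))) λ ε ε>0 →
    eventually-map (λ n → subst₂ (λ a b → ℚ.∣ a ℚ.- b ∣ ℚ.≤ ε) (proj₁ (powᶜ-real w n (im-norm² (ψ x) n) q)) (re-1 n)) (≋ᶜ⇒re w^q ε ε>0)
    where
    w = ψ x *ᶜ conjᶜ (ψ x)
    ψx^q : powᶜ (ψ x) q ≈ 1ᶜ
    ψx^q = ≈-trans (≈-sym (ψ-multiple q x)) (≈-trans (≈-reflexive (cong ψ (multiple-q x))) ψ-𝟎)
    w^q : powᶜ w q ≈ 1ᶜ
    w^q = ≈-trans (norm²-pow (ψ x) q) (≈-trans (*ᴬ-cong ψx^q (conjᶜ-cong ψx^q)) (≈-trans (*ᴬ-congˡ conjᶜ-1) (*ᴬ-identityˡ 1ᶜ)))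

  conj-ψ : ∀ x → conjᶜ (ψ x) ≈ ψ (⊖ x)
  conj-ψ x = ≈-trans (≈-sym (*ᴬ-identityʳ _)) (≈-trans (*ᴬ-congˡ (≈-sym (≈-trans (≈-sym (ψ-⊕ x (⊖ x)))
    (≈-trans (≈-reflexive (cong ψ (⊖-inverseʳ x))) ψ-𝟎)))) (≈-trans
    (solve 3 (λ a b c → a :* (b :* c) := b :* a :* c) ≈-refl (conjᶜ (ψ x)) (ψ x) (ψ (⊖ x)))
    (≈-trans (*ᴬ-congʳ (∣ψ∣² x)) (*ᴬ-identityˡ _))))

  ∑ψ≈0 : ∀ x₀ → ¬ ψ x₀ ≈ 1ᶜ → ∑ᴬ ψ ≈ 0ᶜ
  ∑ψ≈0 x₀ ψx₀≉1 = null-norm² s (no-zero-divisors (re (z *ᶜ conjᶜ z)) (re (s *ᶜ conjᶜ s)) product-null z≉0)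
    where
    s = ∑ᴬ ψ
    z = ψ x₀ +ᶜ -ᶜ 1ᶜ
    shifted : ψ x₀ *ᶜ s ≈ s
    shifted = ≈-trans (*-distribˡ-∑ᴬ (ψ x₀) ψ) (≈-trans (∑ᴬ-cong λ x → ≈-sym (ψ-⊕ x₀ x))
      (≈-sym (∑ᴬ-bij ψ (x₀ ⊕_) (_⊝ x₀) (λ x → trans (⊕-comm x₀ _) (⊝⊕ x x₀)) (λ x → ⊕⊝ˡ x₀ x))))
    zs≈0 : z *ᶜ s ≈ 0ᶜ
    zs≈0 = ≈-trans (solve 3 (λ u s o → (u :+ :- o) :* s := u :* s :+ :- (o :* s)) ≈-refl (ψ x₀) s 1ᶜ)
      (≈-trans (+ᴬ-cong shifted (-ᶜ-cong (*ᴬ-identityˡ s))) (≈-trans (+ᴬ-comm s (-ᶜ s)) (+ᶜ-inverseˡ s)))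
    product : (z *ᶜ conjᶜ z) *ᶜ (s *ᶜ conjᶜ s) ≈ 0ᶜ
    product = ≈-trans (solve 4 (λ a b c d → a :* b :* (c :* d) := a :* c :* (b :* d)) ≈-refl z (conjᶜ z) s (conjᶜ s))
      (≈-trans (*ᴬ-congʳ zs≈0) (*ᴬ-zeroˡ _))
    product-null : Null (re (z *ᶜ conjᶜ z) *ᴿ re (s *ᶜ conjᶜ s))
    product-null ε ε>0 = eventually-map (λ n → subst (λ a → ℚ.∣ a ∣ ℚ.≤ ε)
      (trans (re-* (z *ᶜ conjᶜ z) (s *ᶜ conjᶜ s) n) (trans (cong (λ b → seq (re (z *ᶜ conjᶜ z)) n ℚ.* seq (re (s *ᶜ conjᶜ s)) n ℚ.- b ℚ.* seq (im (s *ᶜ conjᶜ s)) n) (im-norm² z n))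
        (ℚ-Solver.+-*-Solver.solve 3 (λ a b c → a ∶* b ∶- ∶con 0ℚ ∶* c ∶= a ∶* b) refl (seq (re (z *ᶜ conjᶜ z)) n) (seq (re (s *ᶜ conjᶜ s)) n) (seq (im (s *ᶜ conjᶜ s)) n)))))
      (≋ᶜ0⇒null product ε ε>0)
      where open ℚ-Solver.+-*-Solver using () renaming (_:*_ to _∶*_; _:-_ to _∶-_; con to ∶con; _:=_ to _∶=_)
    z≉0 : ¬ Null (re (z *ᶜ conjᶜ z))
    z≉0 null = ψx₀≉1 (≈-trans (solve 2 (λ u o → u := u :+ :- o :+ o) ≈-refl (ψ x₀) 1ᶜ)
      (≈-trans (+ᴬ-cong (null-norm² z null) ≈-refl) (+ᴬ-identityˡ 1ᶜ)))

ℕ→ℚ-+ : ∀ a b → ℕ→ℚ (a + b) ≡ ℕ→ℚ a ℚ.+ ℕ→ℚ b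
ℕ→ℚ-+ zero    b = sym (ℚ.+-identityˡ (ℕ→ℚ b))
ℕ→ℚ-+ (suc a) b = trans (ℕ→ℚ-suc (a + b)) (trans (cong (ℚ._+ 1ℚ) (ℕ→ℚ-+ a b))
  (trans (solve 3 (λ x y z → x :+ y :+ z := x :+ z :+ y) refl (ℕ→ℚ a) (ℕ→ℚ b) 1ℚ) (cong (ℚ._+ ℕ→ℚ b) (sym (ℕ→ℚ-suc a)))))
  where open ℚ-Solver.+-*-Solver

ℕ→ℚ-mono : ∀ {a b} → a ≤ b → ℕ→ℚ a ℚ.≤ ℕ→ℚ b
ℕ→ℚ-mono {a} {b} a≤b = subst₂ ℚ._≤_ (ℚ.+-identityʳ (ℕ→ℚ a)) (trans (sym (ℕ→ℚ-+ a (b ∸ a))) (cong ℕ→ℚ (ℕ.m+[n∸m]≡n a≤b)))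
  (ℚ.+-monoʳ-≤ (ℕ→ℚ a) (0≤ℕ→ℚ (b ∸ a)))

module ∑ℚ = RingSums ℚ.+-*-commutativeRing

∑ℚ : ∀ {n} → (Fin n → ℚ) → ℚ
∑ℚ = ∑ℚ.∑ᴬ

∑ℚ-mono : ∀ {n} {f g : Fin n → ℚ} → (∀ i → f i ℚ.≤ g i) → ∑ℚ f ℚ.≤ ∑ℚ g
∑ℚ-mono {zero}  p = ℚ.≤-refl
∑ℚ-mono {suc n} p = ℚ.+-mono-≤ (p zero) (∑ℚ-mono (p ∘ suc))

∑ℚ-nonneg : ∀ {n} {f : Fin n → ℚ} → (∀ i → 0ℚ ℚ.≤ f i) → 0ℚ ℚ.≤ ∑ℚ f
∑ℚ-nonneg {zero}  p = ℚ.≤-refl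
∑ℚ-nonneg {suc n} p = 0≤+ (p zero) (∑ℚ-nonneg (p ∘ suc))

∑ℚ-ℕ→ℚ : ∀ {n} (f : Fin n → ℕ) → ∑ℚ (λ i → ℕ→ℚ (f i)) ≡ ℕ→ℚ (sum f)
∑ℚ-ℕ→ℚ {zero}  f = refl
∑ℚ-ℕ→ℚ {suc n} f = trans (cong (ℕ→ℚ (f zero) ℚ.+_) (∑ℚ-ℕ→ℚ (f ∘ suc))) (sym (ℕ→ℚ-+ (f zero) _))

≤-double : ∀ {a b} → a ℚ.+ a ℚ.≤ b ℚ.+ b → a ℚ.≤ b
≤-double {a} {b} h = subst₂ ℚ._≤_ (halve a) (halve b) (ℚ.*-monoˡ-≤-nonNeg ½ h)
  where
  halve : ∀ a → ½ ℚ.* (a ℚ.+ a) ≡ a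
  halve a = trans (ℚ.*-distribˡ-+ ½ a a) (½+½ a)

-- Lagrange's identity: the defect is half the sum of all ρᵢ ρⱼ (aᵢ bⱼ - aⱼ bᵢ)².
weighted-cauchy-schwarz : ∀ {n} (ρ a b : Fin n → ℚ) → (∀ i → 0ℚ ℚ.≤ ρ i) → let C = ∑ℚ (λ i → ρ i ℚ.* a i ℚ.* b i) in
  C ℚ.* C ℚ.≤ ∑ℚ (λ i → ρ i ℚ.* a i ℚ.* a i) ℚ.* ∑ℚ (λ i → ρ i ℚ.* b i ℚ.* b i)
weighted-cauchy-schwarz {n} ρ a b 0≤ρ = ≤-double (subst₂ ℚ._≤_ (ℚ.+-identityʳ (CC ℚ.+ CC)) cancel (ℚ.+-monoʳ-≤ (CC ℚ.+ CC) defect))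
  where
  open ℚ-Solver.+-*-Solver
  open ≡-Reasoning
  aa bb ab : Fin n → ℚ
  aa i = ρ i ℚ.* a i ℚ.* a i
  bb i = ρ i ℚ.* b i ℚ.* b i
  ab i = ρ i ℚ.* a i ℚ.* b i
  A B C CC : ℚ
  A = ∑ℚ aa
  B = ∑ℚ bb
  C = ∑ℚ ab
  CC = C ℚ.* C
  square : Fin n → Fin n → ℚ
  square i j = ρ i ℚ.* ρ j ℚ.* ((a i ℚ.* b j ℚ.- a j ℚ.* b i) ℚ.* (a i ℚ.* b j ℚ.- a j ℚ.* b i))
  split : ∀ i j → square i j ℚ.+ (ab i ℚ.* ab j ℚ.+ ab i ℚ.* ab j) ≡ aa i ℚ.* bb j ℚ.+ bb i ℚ.* aa j
  split i j = solve 6 (λ r s a c b d → r :* s :* ((a :* d :- c :* b) :* (a :* d :- c :* b)) :+ ((r :* a :* b) :* (s :* c :* d) :+ (r :* a :* b) :* (s :* c :* d))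
    := (r :* a :* a) :* (s :* d :* d) :+ (r :* b :* b) :* (s :* c :* c)) refl (ρ i) (ρ j) (a i) (a j) (b i) (b j)
  sum₂ : (Fin n → Fin n → ℚ) → ℚ
  sum₂ f = ∑ℚ λ i → ∑ℚ λ j → f i j
  sum₂-+ : ∀ f g → sum₂ (λ i j → f i j ℚ.+ g i j) ≡ sum₂ f ℚ.+ sum₂ g
  sum₂-+ f g = trans (∑ℚ.∑ᴬ-cong λ i → ∑ℚ.∑ᴬ-distrib-+ (f i) (g i)) (∑ℚ.∑ᴬ-distrib-+ (λ i → ∑ℚ (f i)) (λ i → ∑ℚ (g i)))
  total : sum₂ square ℚ.+ (CC ℚ.+ CC) ≡ A ℚ.* B ℚ.+ A ℚ.* B
  total = begin
    sum₂ square ℚ.+ (CC ℚ.+ CC)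
      ≡⟨ cong (λ c → sum₂ square ℚ.+ (c ℚ.+ c)) (∑ℚ.∑ᴬ-product ab ab) ⟩
    sum₂ square ℚ.+ (sum₂ (λ i j → ab i ℚ.* ab j) ℚ.+ sum₂ (λ i j → ab i ℚ.* ab j))
      ≡⟨ cong (sum₂ square ℚ.+_) (sum₂-+ (λ i j → ab i ℚ.* ab j) (λ i j → ab i ℚ.* ab j)) ⟨
    sum₂ square ℚ.+ sum₂ (λ i j → ab i ℚ.* ab j ℚ.+ ab i ℚ.* ab j)
      ≡⟨ sum₂-+ square (λ i j → ab i ℚ.* ab j ℚ.+ ab i ℚ.* ab j) ⟨
    sum₂ (λ i j → square i j ℚ.+ (ab i ℚ.* ab j ℚ.+ ab i ℚ.* ab j))
      ≡⟨ ∑ℚ.∑ᴬ-cong (λ i → ∑ℚ.∑ᴬ-cong λ j → split i j) ⟩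
    sum₂ (λ i j → aa i ℚ.* bb j ℚ.+ bb i ℚ.* aa j)
      ≡⟨ sum₂-+ (λ i j → aa i ℚ.* bb j) (λ i j → bb i ℚ.* aa j) ⟩
    sum₂ (λ i j → aa i ℚ.* bb j) ℚ.+ sum₂ (λ i j → bb i ℚ.* aa j)
      ≡⟨ cong₂ ℚ._+_ (∑ℚ.∑ᴬ-product aa bb) (∑ℚ.∑ᴬ-product bb aa) ⟨
    A ℚ.* B ℚ.+ B ℚ.* A
      ≡⟨ cong (A ℚ.* B ℚ.+_) (ℚ.*-comm B A) ⟩
    A ℚ.* B ℚ.+ A ℚ.* B ∎
  defect : 0ℚ ℚ.≤ sum₂ square
  defect = ∑ℚ-nonneg λ i → ∑ℚ-nonneg λ j → 0≤* (0≤* (0≤ρ i) (0≤ρ j)) (0≤sq (a i ℚ.* b j ℚ.- a j ℚ.* b i))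
  cancel : CC ℚ.+ CC ℚ.+ sum₂ square ≡ A ℚ.* B ℚ.+ A ℚ.* B
  cancel = trans (ℚ.+-comm (CC ℚ.+ CC) (sum₂ square)) total

open 𝒞 using (∑ᴬ; ν)

re-∑ : ∀ {k} (f : Fin k → ℂ) n → seq (re (∑ᴬ f)) n ≡ ∑ℚ (λ i → seq (re (f i)) n)
re-∑ {zero}  f n = re-0 n
re-∑ {suc k} f n = trans (re-+ (f zero) _ n) (cong (seq (re (f zero)) n ℚ.+_) (re-∑ (f ∘ suc) n))

im-∑ : ∀ {k} (f : Fin k → ℂ) n → seq (im (∑ᴬ f)) n ≡ ∑ℚ (λ i → seq (im (f i)) n)
im-∑ {zero}  f n = im-0 n
im-∑ {suc k} f n = trans (im-+ (f zero) _ n) (cong (seq (im (f zero)) n ℚ.+_) (im-∑ (f ∘ suc) n))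

re-ν : ∀ k n → seq (re (ν k)) n ≡ ℕ→ℚ k
re-ν zero    n = re-0 n
re-ν (suc k) n = trans (re-+ 1ᶜ (ν k) n) (trans (cong₂ ℚ._+_ (re-1 n) (re-ν k n)) (trans (ℚ.+-comm 1ℚ (ℕ→ℚ k)) (sym (ℕ→ℚ-suc k))))

im-ν : ∀ k n → seq (im (ν k)) n ≡ 0ℚ
im-ν zero    n = im-0 n
im-ν (suc k) n = trans (im-+ 1ᶜ (ν k) n) (trans (cong₂ ℚ._+_ (im-1 n) (im-ν k n)) (ℚ.+-identityˡ 0ℚ))

re-ν* : ∀ k z n → seq (re (ν k *ᶜ z)) n ≡ ℕ→ℚ k ℚ.* seq (re z) n
re-ν* k z n = trans (re-* (ν k) z n) (trans (cong₂ (λ a b → a ℚ.* seq (re z) n ℚ.- b ℚ.* seq (im z) n) (re-ν k n) (im-ν k n))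
  (solve 3 (λ a b c → a :* b :- con 0ℚ :* c := a :* b) refl (ℕ→ℚ k) (seq (re z) n) (seq (im z) n)))
  where open ℚ-Solver.+-*-Solver

im-ν* : ∀ k z n → seq (im (ν k *ᶜ z)) n ≡ ℕ→ℚ k ℚ.* seq (im z) n
im-ν* k z n = trans (im-* (ν k) z n) (trans (cong₂ (λ a b → a ℚ.* seq (im z) n ℚ.+ b ℚ.* seq (re z) n) (re-ν k n) (im-ν k n))
  (solve 3 (λ a b c → a :* c :+ con 0ℚ :* b := a :* c) refl (ℕ→ℚ k) (seq (re z) n) (seq (im z) n)))
  where open ℚ-Solver.+-*-Solver

∥*∥² : ∀ x y n → ∥ x *ᶜ y ∥² n ≡ ∥ x ∥² n ℚ.* ∥ y ∥² n
∥*∥² x y n = trans (cong₂ (λ a b → a ℚ.* a ℚ.+ b ℚ.* b) (re-* x y n) (im-* x y n))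
  (solve 4 (λ a b c d → (a :* c :- b :* d) :* (a :* c :- b :* d) :+ (a :* d :+ b :* c) :* (a :* d :+ b :* c)
    := (a :* a :+ b :* b) :* (c :* c :+ d :* d)) refl (seq (re x) n) (seq (im x) n) (seq (re y) n) (seq (im y) n))
  where open ℚ-Solver.+-*-Solver

∥ν*∥² : ∀ k z n → ∥ ν k *ᶜ z ∥² n ≡ ℕ→ℚ k ℚ.* ℕ→ℚ k ℚ.* ∥ z ∥² n
∥ν*∥² k z n = trans (cong₂ (λ a b → a ℚ.* a ℚ.+ b ℚ.* b) (re-ν* k z n) (im-ν* k z n))
  (solve 3 (λ k a b → k :* a :* (k :* a) :+ k :* b :* (k :* b) := k :* k :* (a :* a :+ b :* b)) refl (ℕ→ℚ k) (seq (re z) n) (seq (im z) n))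
  where open ℚ-Solver.+-*-Solver

within-1 : ∀ {z w} → z ≋ᶜ w → Eventually λ n → seq (re z) n ℚ.≤ seq (re w) n ℚ.+ 1ℚ
within-1 {z} {w} eq = eventually-map (λ n → ∣-∣⇒≤ (seq (re z) n) (seq (re w) n)) (≋ᶜ⇒re eq 1ℚ _)

norm²-within-1 : ∀ {z w} → z ≋ᶜ w → Eventually λ n → ∥ z ∥² n ℚ.≤ ∥ w ∥² n ℚ.+ 1ℚ
norm²-within-1 {z} {w} eq = eventually-map (λ n → subst₂ (λ a b → a ℚ.≤ b ℚ.+ 1ℚ) (re-norm² z n) (re-norm² w n))
  (within-1 (*ᶜ-cong eq (conjᶜ-cong eq)))

module Moments {q : ℕ} (𝔽 : FieldOn q) (ψ : Fin q → ℂ)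
  (ψ-⊕ : ∀ x y → ψ (FieldOn._⊕_ 𝔽 x y) ≋ᶜ ψ x *ᶜ ψ y) (ψ-𝟎 : ψ (FieldOn.𝟎 𝔽) ≋ᶜ 1ᶜ)
  (x₀ : Fin q) (ψx₀≉1 : ¬ ψ x₀ ≋ᶜ 1ᶜ)
  (H : Counting.FSet q) (H-sub : IsSubgroup 𝔽 H) where

  open FieldSets 𝔽 hiding (solve; con; _:=_; _:+_; _:*_; _:-_; :-_)
  open IsSubgroup H-sub
  open Convolution 𝔽 using (∑convolution)
  open Character 𝔽 ψ ψ-⊕ ψ-𝟎
  open Fourier.WithCharacter 𝔽 ℂ-commutativeRing ψ conjᶜ ψ-⊕ ψ-𝟎 (∑ψ≈0 x₀ ψx₀≉1)
    conjᶜ-cong conjᶜ-+ conjᶜ-* conjᶜ-0 conjᶜ-1 conj-ψ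
  open WithSubgroup H H-⊗ H-inv H≢𝟎 public

  private
    N = ⟦ H ⟧

  energy : ℕ
  energy = sum λ u → r u * r u

  1≤q : 1 ≤ q
  1≤q = >-nonZero⁻¹ q {{Fin.nonZeroIndex 𝟎}}

  1≤N : 1 ≤ N
  1≤N = ∣∣≥1 H 𝟏∈H

  s : Fin q → ℕ → ℚ
  s u = ∥ g u ∥²

  second-moment : Eventually λ n → s 𝟏 n ℚ.≤ ℕ→ℚ (3 * q)
  second-moment = eventually-map₂ bound (within-1 (average norm² λ eq → *ᶜ-cong eq (conjᶜ-cong eq))) (within-1 (parseval (ι H)))
    where
    open ℚ.≤-Reasoning
    below : ∀ y n → ℕ→ℚ (ι H y) ℚ.* s y n ℚ.≤ s y n
    below y n = ℚ.≤-trans (*-mono-≤ (0≤∥∥² (g y) n) 0≤1 (ℕ→ℚ-mono (𝟙≤1 (mem? H y))) ℚ.≤-refl) (ℚ.≤-reflexive (ℚ.*-identityˡ _))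
    bound : ∀ n → seq (re (ν N *ᶜ norm² (g 𝟏))) n ℚ.≤ seq (re (∑ᴬ λ y → ν (ι H y) *ᶜ norm² (g y))) n ℚ.+ 1ℚ →
            seq (re (∑ᴬ λ t → norm² (g t))) n ℚ.≤ seq (re (ν (q * sum (λ u → ι H u * ι H u)))) n ℚ.+ 1ℚ → s 𝟏 n ℚ.≤ ℕ→ℚ (3 * q)
    bound n h₁ h₂ = ℚ.*-cancelˡ-≤-pos (ℕ→ℚ N) {{posN}} (begin
      ℕ→ℚ N ℚ.* s 𝟏 n
        ≡⟨ trans (re-ν* N (norm² (g 𝟏)) n) (cong (ℕ→ℚ N ℚ.*_) (re-norm² (g 𝟏) n)) ⟨
      seq (re (ν N *ᶜ norm² (g 𝟏))) n
        ≤⟨ h₁ ⟩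
      seq (re (∑ᴬ λ y → ν (ι H y) *ᶜ norm² (g y))) n ℚ.+ 1ℚ
        ≡⟨ cong (ℚ._+ 1ℚ) (trans (re-∑ (λ y → ν (ι H y) *ᶜ norm² (g y)) n)
             (∑ℚ.∑ᴬ-cong λ y → trans (re-ν* (ι H y) (norm² (g y)) n) (cong (ℕ→ℚ (ι H y) ℚ.*_) (re-norm² (g y) n)))) ⟩
      ∑ℚ (λ y → ℕ→ℚ (ι H y) ℚ.* s y n) ℚ.+ 1ℚ
        ≤⟨ ℚ.+-monoˡ-≤ 1ℚ (∑ℚ-mono λ y → below y n) ⟩
      ∑ℚ (λ y → s y n) ℚ.+ 1ℚ
        ≡⟨ cong (ℚ._+ 1ℚ) (trans (re-∑ (λ y → norm² (g y)) n) (∑ℚ.∑ᴬ-cong λ y → re-norm² (g y) n)) ⟨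
      seq (re (∑ᴬ λ t → norm² (g t))) n ℚ.+ 1ℚ
        ≤⟨ ℚ.+-monoˡ-≤ 1ℚ h₂ ⟩
      seq (re (ν (q * sum (λ u → ι H u * ι H u)))) n ℚ.+ 1ℚ ℚ.+ 1ℚ
        ≡⟨ cong (λ a → a ℚ.+ 1ℚ ℚ.+ 1ℚ) (trans (re-ν (q * sum (λ u → ι H u * ι H u)) n)
             (cong (λ j → ℕ→ℚ (q * j)) (trans (sum-cong-≗ λ u → 𝟙-idem (mem? H u)) (sym (⟦⟧-sum H))))) ⟩
      ℕ→ℚ (q * N) ℚ.+ 1ℚ ℚ.+ 1ℚ
        ≡⟨ trans (ℕ→ℚ-+ (q * N + 1) 1) (cong (ℚ._+ 1ℚ) (ℕ→ℚ-+ (q * N) 1)) ⟨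
      ℕ→ℚ (q * N + 1 + 1)
        ≤⟨ ℕ→ℚ-mono nat ⟩
      ℕ→ℚ (N * (3 * q))
        ≡⟨ ℕ→ℚ-* N (3 * q) ⟩
      ℕ→ℚ N ℚ.* ℕ→ℚ (3 * q) ∎)
      where
      posN : Positive (ℕ→ℚ N)
      posN = ℚ.positive (ℚ.<-≤-trans (ℚ.positive⁻¹ 1ℚ) (ℕ→ℚ-mono 1≤N))
      nat : q * N + 1 + 1 ≤ N * (3 * q)
      nat = ℕ.≤-trans (ℕ.+-mono-≤ (ℕ.+-monoʳ-≤ (q * N) 1≤qN) 1≤qN) (ℕ.≤-reflexive (three q N))
        where
        1≤qN : 1 ≤ q * N
        1≤qN = ℕ.*-mono-≤ 1≤q 1≤N
        three : ∀ q n → q * n + q * n + q * n ≡ n * (3 * q)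
        three = ℕ-Solver.solve-∀

  1≤energy : 1 ≤ energy
  1≤energy = ℕ.n≢0⇒n>0 λ eq → contradiction (subst (1 ≤_) (trans (sym (∑convolution H)) (∑-zero λ u → zero-square (r u)
    (ℕ.n≤0⇒n≡0 (ℕ.≤-trans (term≤∑ (λ u → r u * r u) u) (ℕ.≤-reflexive eq))))) (ℕ.*-mono-≤ 1≤N 1≤N)) λ()
    where
    zero-square : ∀ j → j * j ≡ 0 → j ≡ 0
    zero-square zero _ = refl

  fourth-power : Eventually λ n → s 𝟏 n ^ℚ 4 ℚ.≤ ℕ→ℚ (6 * (q * (energy * energy)))
  fourth-power = eventually-map₂ bound (norm²-within-1 average-square) (within-1 fourth-moment)
    where
    open ℚ.≤-Reasoning
    E = energy
    bound : ∀ n → ∥ ν N *ᶜ (g 𝟏 *ᶜ g 𝟏) ∥² n ℚ.≤ ∥ ∑ᴬ (λ u → ν (r u) *ᶜ g u) ∥² n ℚ.+ 1ℚ →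
            seq (re (∑ᴬ λ t → norm² (g t *ᶜ g t))) n ℚ.≤ seq (re (ν (q * E))) n ℚ.+ 1ℚ →
            s 𝟏 n ^ℚ 4 ℚ.≤ ℕ→ℚ (6 * (q * (E * E)))
    bound n h₁ h₂ = begin
      s₁ ^ℚ 4
        ≡⟨ solve 1 (λ x → x :* (x :* (x :* (x :* con 1ℚ))) := x :* x :* (x :* x)) refl s₁ ⟩
      s₁ ℚ.* s₁ ℚ.* (s₁ ℚ.* s₁)
        ≤⟨ *-mono-≤ (0≤sq s₁) (ℚ.≤-trans (0≤sq s₁) square-bound) square-bound square-bound ⟩
      (Q ℚ.+ 1ℚ) ℚ.* (Q ℚ.+ 1ℚ)
        ≤⟨ sq-sum ⟩
      (Q ℚ.* Q ℚ.+ Q ℚ.* Q) ℚ.+ (1ℚ ℚ.+ 1ℚ)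
        ≤⟨ ℚ.+-monoˡ-≤ (1ℚ ℚ.+ 1ℚ) (ℚ.+-mono-≤ Q²-bound Q²-bound) ⟩
      (ℕ→ℚ (E * (q * E + 1)) ℚ.+ ℕ→ℚ (E * (q * E + 1))) ℚ.+ (1ℚ ℚ.+ 1ℚ)
        ≡⟨ trans (ℕ→ℚ-+ (E * (q * E + 1) + E * (q * E + 1)) 2) (cong (ℚ._+ ℕ→ℚ 2) (ℕ→ℚ-+ (E * (q * E + 1)) (E * (q * E + 1)))) ⟨
      ℕ→ℚ (E * (q * E + 1) + E * (q * E + 1) + 2)
        ≤⟨ ℕ→ℚ-mono nat ⟩
      ℕ→ℚ (6 * (q * (E * E))) ∎
      where
      open ℚ-Solver.+-*-Solver
      s₁ Q F : ℚ
      s₁ = s 𝟏 n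
      ρ a b : Fin q → ℚ
      ρ u = ℕ→ℚ (r u)
      a u = seq (re (g u)) n
      b u = seq (im (g u)) n
      Q = ∑ℚ λ u → ρ u ℚ.* s u n
      F = ∑ℚ λ u → s u n ℚ.* s u n
      0≤ρ : ∀ u → 0ℚ ℚ.≤ ρ u
      0≤ρ u = 0≤ℕ→ℚ (r u)
      component : ∀ x → ∑ℚ (λ u → ρ u ℚ.* x u) ℚ.* ∑ℚ (λ u → ρ u ℚ.* x u) ℚ.≤ ℕ→ℚ (N * N) ℚ.* ∑ℚ (λ u → ρ u ℚ.* x u ℚ.* x u)
      component x = subst₂ ℚ._≤_
        (cong (λ c → c ℚ.* c) (∑ℚ.∑ᴬ-cong λ u → cong (ℚ._* x u) (ℚ.*-identityʳ (ρ u))))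
        (cong (ℚ._* ∑ℚ (λ u → ρ u ℚ.* x u ℚ.* x u)) (trans (∑ℚ.∑ᴬ-cong λ u → trans (cong (ℚ._* 1ℚ) (ℚ.*-identityʳ (ρ u))) (ℚ.*-identityʳ (ρ u)))
          (trans (∑ℚ-ℕ→ℚ r) (cong ℕ→ℚ (∑convolution H)))))
        (weighted-cauchy-schwarz ρ (λ _ → 1ℚ) x 0≤ρ)
      square-bound : s₁ ℚ.* s₁ ℚ.≤ Q ℚ.+ 1ℚ
      square-bound = ℚ.*-cancelˡ-≤-pos (ℕ→ℚ (N * N)) {{posNN}} (begin
        ℕ→ℚ (N * N) ℚ.* (s₁ ℚ.* s₁)
          ≡⟨ trans (∥ν*∥² N (g 𝟏 *ᶜ g 𝟏) n) (cong₂ ℚ._*_ (sym (ℕ→ℚ-* N N)) (∥*∥² (g 𝟏) (g 𝟏) n)) ⟨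
        ∥ ν N *ᶜ (g 𝟏 *ᶜ g 𝟏) ∥² n
          ≤⟨ h₁ ⟩
        ∥ ∑ᴬ (λ u → ν (r u) *ᶜ g u) ∥² n ℚ.+ 1ℚ
          ≡⟨ cong (ℚ._+ 1ℚ) (cong₂ (λ x y → x ℚ.* x ℚ.+ y ℚ.* y)
               (trans (re-∑ (λ u → ν (r u) *ᶜ g u) n) (∑ℚ.∑ᴬ-cong λ u → re-ν* (r u) (g u) n))
               (trans (im-∑ (λ u → ν (r u) *ᶜ g u) n) (∑ℚ.∑ᴬ-cong λ u → im-ν* (r u) (g u) n))) ⟩
        ∑ℚ (λ u → ρ u ℚ.* a u) ℚ.* ∑ℚ (λ u → ρ u ℚ.* a u) ℚ.+ ∑ℚ (λ u → ρ u ℚ.* b u) ℚ.* ∑ℚ (λ u → ρ u ℚ.* b u) ℚ.+ 1ℚ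
          ≤⟨ ℚ.+-mono-≤ (ℚ.+-mono-≤ (component a) (component b)) (ℕ→ℚ-mono (ℕ.*-mono-≤ 1≤N 1≤N)) ⟩
        ℕ→ℚ (N * N) ℚ.* ∑ℚ (λ u → ρ u ℚ.* a u ℚ.* a u) ℚ.+ ℕ→ℚ (N * N) ℚ.* ∑ℚ (λ u → ρ u ℚ.* b u ℚ.* b u) ℚ.+ ℕ→ℚ (N * N)
          ≡⟨ solve 3 (λ m x y → m :* x :+ m :* y :+ m := m :* ((x :+ y) :+ con 1ℚ)) refl (ℕ→ℚ (N * N)) (∑ℚ λ u → ρ u ℚ.* a u ℚ.* a u) (∑ℚ λ u → ρ u ℚ.* b u ℚ.* b u) ⟩
        ℕ→ℚ (N * N) ℚ.* ((∑ℚ (λ u → ρ u ℚ.* a u ℚ.* a u) ℚ.+ ∑ℚ (λ u → ρ u ℚ.* b u ℚ.* b u)) ℚ.+ 1ℚ)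
          ≡⟨ cong (λ x → ℕ→ℚ (N * N) ℚ.* (x ℚ.+ 1ℚ)) (trans (sym (∑ℚ.∑ᴬ-distrib-+ (λ u → ρ u ℚ.* a u ℚ.* a u) (λ u → ρ u ℚ.* b u ℚ.* b u)))
               (∑ℚ.∑ᴬ-cong λ u → solve 3 (λ r x y → r :* x :* x :+ r :* y :* y := r :* (x :* x :+ y :* y)) refl (ρ u) (a u) (b u))) ⟩
        ℕ→ℚ (N * N) ℚ.* (Q ℚ.+ 1ℚ) ∎)
        where
        posNN : Positive (ℕ→ℚ (N * N))
        posNN = ℚ.positive (ℚ.<-≤-trans (ℚ.positive⁻¹ 1ℚ) (ℕ→ℚ-mono (ℕ.*-mono-≤ 1≤N 1≤N)))
      sq-sum : (Q ℚ.+ 1ℚ) ℚ.* (Q ℚ.+ 1ℚ) ℚ.≤ (Q ℚ.* Q ℚ.+ Q ℚ.* Q) ℚ.+ (1ℚ ℚ.+ 1ℚ)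
      sq-sum = subst₂ ℚ._≤_ (ℚ.+-identityʳ _)
        (solve 1 (λ x → (x :+ con 1ℚ) :* (x :+ con 1ℚ) :+ (x :- con 1ℚ) :* (x :- con 1ℚ) := (x :* x :+ x :* x) :+ (con 1ℚ :+ con 1ℚ)) refl Q)
        (ℚ.+-monoʳ-≤ ((Q ℚ.+ 1ℚ) ℚ.* (Q ℚ.+ 1ℚ)) (0≤sq (Q ℚ.- 1ℚ)))
      F-bound : F ℚ.≤ ℕ→ℚ (q * E + 1)
      F-bound = begin
        F
          ≡⟨ trans (re-∑ (λ t → norm² (g t *ᶜ g t)) n) (∑ℚ.∑ᴬ-cong λ t → trans (re-norm² (g t *ᶜ g t) n) (∥*∥² (g t) (g t) n)) ⟨
        seq (re (∑ᴬ λ t → norm² (g t *ᶜ g t))) n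
          ≤⟨ h₂ ⟩
        seq (re (ν (q * E))) n ℚ.+ 1ℚ
          ≡⟨ trans (cong (ℚ._+ 1ℚ) (re-ν (q * E) n)) (sym (ℕ→ℚ-+ (q * E) 1)) ⟩
        ℕ→ℚ (q * E + 1) ∎
      Q²-bound : Q ℚ.* Q ℚ.≤ ℕ→ℚ (E * (q * E + 1))
      Q²-bound = begin
        Q ℚ.* Q
          ≤⟨ subst₂ ℚ._≤_ (cong (λ c → c ℚ.* c) (∑ℚ.∑ᴬ-cong λ u → cong (ℚ._* s u n) (ℚ.*-identityˡ (ρ u))))
               (cong₂ ℚ._*_ (trans (∑ℚ.∑ᴬ-cong λ u → trans (cong (ℚ._* ρ u) (ℚ.*-identityˡ (ρ u))) (sym (ℕ→ℚ-* (r u) (r u)))) (∑ℚ-ℕ→ℚ (λ u → r u * r u)))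
                 (∑ℚ.∑ᴬ-cong λ u → cong (ℚ._* s u n) (ℚ.*-identityˡ (s u n))))
               (weighted-cauchy-schwarz (λ _ → 1ℚ) ρ (λ u → s u n) (λ _ → 0≤1)) ⟩
        ℕ→ℚ E ℚ.* F
          ≤⟨ ℚ.*-monoˡ-≤-nonNeg (ℕ→ℚ E) F-bound ⟩
        ℕ→ℚ E ℚ.* ℕ→ℚ (q * E + 1)
          ≡⟨ ℕ→ℚ-* E (q * E + 1) ⟨
        ℕ→ℚ (E * (q * E + 1)) ∎
      nat : E * (q * E + 1) + E * (q * E + 1) + 2 ≤ 6 * (q * (E * E))
      nat = ℕ.≤-trans (ℕ.+-mono-≤ (ℕ.+-mono-≤ half half) (ℕ.+-mono-≤ one one)) (ℕ.≤-reflexive (six (q * (E * E))))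
        where
        one : 1 ≤ q * (E * E)
        one = ℕ.*-mono-≤ {1} {q} 1≤q (ℕ.*-mono-≤ 1≤energy 1≤energy)
        half : E * (q * E + 1) ≤ q * (E * E) + q * (E * E)
        half = ℕ.≤-trans (ℕ.≤-reflexive (expand E q)) (ℕ.+-monoʳ-≤ (q * (E * E)) (ℕ.≤-trans (ℕ.≤-reflexive (sym (ℕ.*-identityʳ E)))
          (ℕ.≤-trans (ℕ.*-monoʳ-≤ E 1≤energy) (ℕ.m≤n*m (E * E) q {{>-nonZero 1≤q}}))))
          where
          expand : ∀ e q → e * (q * e + 1) ≡ q * (e * e) + e
          expand = ℕ-Solver.solve-∀
        six : ∀ x → x + x + (x + x) + (x + x) ≡ 6 * x
        six = ℕ-Solver.solve-∀

module Transfer {q : ℕ} (F : FiniteField q) (2≤q : 2 ≤ q) where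

  open FiniteField F
  open HeytingField heytingField using (_≈_; _#_; tight; #⇒invertible)
    renaming ( _+_ to _+ꟳ_; _*_ to _*ꟳ_; -_ to -ꟳ_; 0# to 0ꟳ; 1# to 1ꟳ; isCommutativeRing to isCommutativeRingꟳ
             ; +-cong to +ꟳ-cong; *-cong to *ꟳ-cong; -‿cong to -ꟳ-cong; sym to ≈-sym; trans to ≈-trans; refl to ≈-refl; reflexive to ≈-reflexive
             ; zeroˡ to *ꟳ-zeroˡ; *-identityˡ to *ꟳ-identityˡ; +-identityʳ to +ꟳ-identityʳ; +-identityˡ to +ꟳ-identityˡ; -‿inverseʳ to -ꟳ-inverseʳ; *-comm to *ꟳ-comm )
  open Inverse enumeration using (to; from; from-cong; strictlyInverseˡ; strictlyInverseʳ)

  to-from : ∀ x → to (from x) ≈ x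
  to-from = strictlyInverseˡ

  to-injective : ∀ {i j} → to i ≈ to j → i ≡ j
  to-injective {i} {j} eq = trans (sym (strictlyInverseʳ i)) (trans (from-cong eq) (strictlyInverseʳ j))

  _⊕_ _⊗_ : Fin q → Fin q → Fin q
  i ⊕ j = from (to i +ꟳ to j)
  i ⊗ j = from (to i *ꟳ to j)

  ⊖_ : Fin q → Fin q
  ⊖ i = from (-ꟳ to i)

  𝟎 𝟏 : Fin q
  𝟎 = from 0ꟳ
  𝟏 = from 1ꟳ

  finRing : RawRing 0ℓ 0ℓ
  finRing = record { Carrier = Fin q ; _≈_ = _≡_ ; _+_ = _⊕_ ; _*_ = _⊗_ ; -_ = ⊖_ ; 0# = 𝟎 ; 1# = 𝟏 }

  to-isRingMonomorphism : RingMorphisms.IsRingMonomorphism finRing rawRing to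
  to-isRingMonomorphism = record
    { isRingHomomorphism = record
      { isSemiringHomomorphism = record
        { isNearSemiringHomomorphism = record
          { +-isMonoidHomomorphism = record
            { isMagmaHomomorphism = record
              { isRelHomomorphism = record { cong = λ { refl → ≈-refl } }
              ; homo = λ i j → to-from (to i +ꟳ to j)
              }
            ; ε-homo = to-from 0ꟳ
            }
          ; *-homo = λ i j → to-from (to i *ꟳ to j)
          }
        ; 1#-homo = to-from 1ꟳ
        }
      ; -‿homo = λ i → to-from (-ꟳ to i)
      }
    ; injective = to-injective
    }

  isCommutativeRing : IsCommutativeRing _≡_ _⊕_ _⊗_ ⊖_ 𝟎 𝟏
  isCommutativeRing = RingMonomorphism.isCommutativeRing to-isRingMonomorphism isCommutativeRingꟳ

  private module Fin-Ring = IsCommutativeRing isCommutativeRing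

  𝟎≢𝟏 : 𝟎 ≢ 𝟏
  𝟎≢𝟏 eq = distinct 2≤q λ i → trans (sym (Fin-Ring.*-identityˡ i)) (trans (cong (_⊗ i) (sym eq)) (Fin-Ring.zeroˡ i))
    where
    distinct : ∀ {n} {c : Fin n} → 2 ≤ n → ¬ (∀ i → i ≡ c)
    distinct (s≤s (s≤s _)) all = Fin.0≢1+n (trans (all zero) (sym (all (suc zero))))

  invertible? : ∀ i → Dec (∃ λ j → i ⊗ j ≡ 𝟏)
  invertible? i = Fin.any? λ j → i ⊗ j Fin.≟ 𝟏

  inverse : ∀ {i} → Dec (∃ λ j → i ⊗ j ≡ 𝟏) → Fin q
  inverse (yes (j , _)) = j
  inverse (no _)        = 𝟎

  inverseʳ : ∀ {i} → i ≢ 𝟎 → (d : Dec (∃ λ j → i ⊗ j ≡ 𝟏)) → i ⊗ inverse d ≡ 𝟏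
  inverseʳ i≢𝟎 (yes (j , eq)) = eq
  inverseʳ {i} i≢𝟎 (no ¬j) = contradiction (to-injective (≈-trans (proj₁ (tight (to i) 0ꟳ) ¬#) (≈-sym (to-from 0ꟳ)))) i≢𝟎
    where
    ¬# : ¬ to i # 0ꟳ
    ¬# apart = let y , _ , eq = #⇒invertible apart in ¬j (from y , to-injective
      (≈-trans (to-from _) (≈-trans (*ꟳ-cong (≈-sym i-0) (to-from y)) (≈-trans eq (≈-sym (to-from 1ꟳ))))))
      where
      i-0 : to i +ꟳ (-ꟳ 0ꟳ) ≈ to i
      i-0 = ≈-trans (+ꟳ-cong ≈-refl (≈-trans (≈-sym (+ꟳ-identityˡ (-ꟳ 0ꟳ))) (-ꟳ-inverseʳ 0ꟳ))) (+ꟳ-identityʳ (to i))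

  inverse-𝟎 : (d : Dec (∃ λ j → 𝟎 ⊗ j ≡ 𝟏)) → inverse d ≡ 𝟎
  inverse-𝟎 (yes (j , eq)) = contradiction (trans (sym (Fin-Ring.zeroˡ j)) eq) 𝟎≢𝟏
  inverse-𝟎 (no _)         = refl

  𝔽 : FieldOn q
  𝔽 = record
    { _⊕_ = _⊕_ ; _⊗_ = _⊗_ ; ⊖_ = ⊖_ ; 𝟎 = 𝟎 ; 𝟏 = 𝟏
    ; isCommutativeRing = isCommutativeRing
    ; 𝟎≢𝟏 = 𝟎≢𝟏
    ; inv = λ i → inverse (invertible? i)
    ; inv-𝟎 = inverse-𝟎 (invertible? 𝟎)
    ; inverseʳ = λ {i} i≢𝟎 → inverseʳ i≢𝟎 (invertible? i)
    }

  open RawSemiringDefinitions (RawRing.rawSemiring rawRing) using () renaming (_^_ to _^ꟳ_)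
  open FiniteFieldFacts 𝔽 using (pow)

  to-pow : ∀ i n → to (pow i n) ≈ to i ^ꟳ n
  to-pow i zero    = to-from 1ꟳ
  to-pow i (suc n) = ≈-trans (to-from _) (*ꟳ-cong ≈-refl (to-pow i n))

  module _ {ψ : Carrier → ℂ} (ψ-char : IsAdditiveCharacter F ψ) where

    open MonoidMorphisms.IsMonoidHomomorphism ψ-char using (homo; ε-homo; ⟦⟧-cong)

    ψ′ : Fin q → ℂ
    ψ′ i = ψ (to i)

    ψ-≋ : ∀ {x y} → x ≈ y → ψ x ≋ᶜ ψ y
    ψ-≋ {x} {y} eq = ≈⇒≋ᶜ {ψ x} {ψ y} (⟦⟧-cong eq)

    ψ′-⊕ : ∀ i j → ψ′ (i ⊕ j) ≋ᶜ ψ′ i *ᶜ ψ′ j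
    ψ′-⊕ i j = ≋ᶜ-trans (ψ-≋ (to-from (to i +ꟳ to j)))
      (≋ᶜ-trans (≈⇒≋ᶜ {ψ (to i +ꟳ to j)} {ψ (to i) ℂ-Ring.* ψ (to j)} (homo (to i) (to j))) (*ᶜ-link (ψ (to i)) (ψ (to j))))

    ψ′-𝟎 : ψ′ 𝟎 ≋ᶜ 1ᶜ
    ψ′-𝟎 = ≋ᶜ-trans (ψ-≋ (to-from 0ꟳ)) (≋ᶜ-trans (≈⇒≋ᶜ {ψ 0ꟳ} {ℂ-Ring.1#} ε-homo) 1ᶜ-link)

    ψ′-nontrivial : NonTrivialCharacter F ψ → ∃ λ i → ¬ ψ′ i ≋ᶜ 1ᶜ
    ψ′-nontrivial (x , ψx≉1) = from x , λ eq → ψx≉1 (≋ᶜ⇒≈ {ψ x} {ℂ-Ring.1#}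
      (≋ᶜ-trans (ψ-≋ (≈-sym (to-from x))) (≋ᶜ-trans eq (≋ᶜ-sym 1ᶜ-link))))

    ψ′-pow : ∀ i n → ψ (to i ^ꟳ n) ≋ᶜ ψ′ (pow i n)
    ψ′-pow i n = ψ-≋ (≈-sym (to-pow i n))

open RawSemiringDefinitions ℂ-Ring.rawSemiring using () renaming (sum to ∑ℂ)

opaque
  unfolding _+ᶜ_ 0ᶜ _≋ᶜ_

  +ᶜ-link : ∀ x y → x ℂ-Ring.+ y ≋ᶜ x +ᶜ y
  +ᶜ-link x y = ≋ᶜ-refl {x +ᶜ y}

  0ᶜ-link : ℂ-Ring.0# ≋ᶜ 0ᶜ
  0ᶜ-link = ≋ᶜ-refl {0ᶜ}

foldr-transfer : {A : Set} (_∼_ : A → A → Set) (_+₁_ _+₂_ : A → A → A) (0₁ 0₂ : A) →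
  (∀ {x y z} → x ∼ y → y ∼ z → x ∼ z) → (∀ x y → (x +₁ y) ∼ (x +₂ y)) → 0₁ ∼ 0₂ →
  (∀ {x x′ y y′} → x ∼ x′ → y ∼ y′ → (x +₂ y) ∼ (x′ +₂ y′)) →
  ∀ {n} (f g : Fin n → A) → (∀ i → f i ∼ g i) → Vector.foldr _+₁_ 0₁ f ∼ Vector.foldr _+₂_ 0₂ g
foldr-transfer _∼_ _+₁_ _+₂_ 0₁ 0₂ tr link link₀ +₂-cong {zero}  f g eq = link₀
foldr-transfer _∼_ _+₁_ _+₂_ 0₁ 0₂ tr link link₀ +₂-cong {suc n} f g eq = tr (link _ _)
  (+₂-cong (eq zero) (foldr-transfer _∼_ _+₁_ _+₂_ 0₁ 0₂ tr link link₀ +₂-cong (f ∘ suc) (g ∘ suc) (eq ∘ suc)))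

∑-link : ∀ {n} (f g : Fin n → ℂ) → (∀ i → f i ≋ᶜ g i) → ∑ℂ f ≋ᶜ ∑ᴬ g
∑-link = foldr-transfer _≋ᶜ_ ℂ-Ring._+_ _+ᶜ_ ℂ-Ring.0# 0ᶜ ≋ᶜ-trans +ᶜ-link 0ᶜ-link +ᶜ-cong

module PowerSum {q : ℕ} (𝔽 : FieldOn q) (ψ : Fin q → ℂ) (n : ℕ) .{{_ : NonZero n}} where

  open FieldSets 𝔽 hiding (solve; con; _:=_; _:+_; _:*_; _:-_; :-_)
  open FiniteFieldFacts 𝔽
  open Powers 𝔽 n
  open 𝒞
  open import Relation.Binary.Reasoning.Setoid setoid

  count : Fin q → ℕ
  count t = sum λ i → 𝟙 (pow i n Fin.≟ t)

  pow-𝟎 : pow 𝟎 n ≡ 𝟎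
  pow-𝟎 = go n
    where
    go : ∀ n → .{{_ : NonZero n}} → pow 𝟎 n ≡ 𝟎
    go (suc n) = ⊗-zeroˡ _

  ι-singleton : ∀ t → sum (λ i → 𝟙 (i Fin.≟ 𝟎) * 𝟙 (pow i n Fin.≟ t)) ≡ 𝟙 (𝟎 Fin.≟ t)
  ι-singleton t = ℕ.≤-antisym
    (ℕ.≤-trans (∑-mono λ i → below i (i Fin.≟ 𝟎)) (ℕ.≤-trans (ℕ.≤-reflexive (sym (*-distribʳ-sum (𝟙 (𝟎 Fin.≟ t)) (λ i → 𝟙 (i Fin.≟ 𝟎)))))
      (ℕ.≤-trans (ℕ.*-monoˡ-≤ (𝟙 (𝟎 Fin.≟ t)) (∑-atMostOne (Fin._≟ 𝟎) λ p r → trans p (sym r))) (ℕ.≤-reflexive (ℕ.*-identityˡ _)))))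
    (ℕ.≤-trans (ℕ.≤-reflexive (sym (trans (cong₂ _*_ (𝟙-yes (𝟎 Fin.≟ 𝟎) refl) (cong (λ z → 𝟙 (z Fin.≟ t)) pow-𝟎)) (ℕ.*-identityˡ _))))
      (term≤∑ (λ i → 𝟙 (i Fin.≟ 𝟎) * 𝟙 (pow i n Fin.≟ t)) 𝟎))
    where
    below : ∀ i (d : Dec (i ≡ 𝟎)) → 𝟙 d * 𝟙 (pow i n Fin.≟ t) ≤ 𝟙 d * 𝟙 (𝟎 Fin.≟ t)
    below i (yes refl) = ℕ.*-monoʳ-≤ 1 (ℕ.≤-reflexive (cong (λ z → 𝟙 (z Fin.≟ t)) pow-𝟎))
    below i (no _)     = z≤n

  count≡ : ∀ t → count t ≡ κ * ι H t + 𝟙 (𝟎 Fin.≟ t)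
  count≡ t = trans (sum-cong-≗ λ i → split i (i Fin.≟ 𝟎)) (trans (∑-distrib-+ (ι (fibre t)) (λ i → 𝟙 (i Fin.≟ 𝟎) * 𝟙 (pow i n Fin.≟ t)))
    (cong₂ _+_ (trans (sym (⟦⟧-sum (fibre t))) (∣fibre∣ t)) (ι-singleton t)))
    where
    split : ∀ i (d : Dec (i ≡ 𝟎)) → 𝟙 (pow i n Fin.≟ t) ≡ 𝟙 (¬? d ×-dec (pow i n Fin.≟ t)) + 𝟙 d * 𝟙 (pow i n Fin.≟ t)
    split i (yes _) = sym (ℕ.+-identityʳ _)
    split i (no ¬p) = sym (trans (ℕ.+-identityʳ _) (trans (𝟙-× (¬? (no ¬p)) (pow i n Fin.≟ t)) (ℕ.*-identityˡ _)))

  power-sum : ψ 𝟎 ≈ 1# → ∑ᴬ (λ i → ψ (pow i n)) ≈ 1# +ᴬ ν κ *ᴬ ∑ᴬ (λ s → ν (ι H s) *ᴬ ψ (s ⊗ 𝟏))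
  power-sum ψ-𝟎 = begin
    ∑ᴬ (λ i → ψ (pow i n))
      ≈⟨ ∑ᴬ-cong (λ i → ≈-sym (∑ᴬ-indicator (λ t → pow i n Fin.≟ t) ψ (pow i n) refl sym)) ⟩
    ∑ᴬ² (λ i t → indicator (pow i n Fin.≟ t) (ψ t))
      ≈⟨ ∑ᴬ-comm (λ i t → indicator (pow i n Fin.≟ t) (ψ t)) ⟩
    ∑ᴬ² (λ t i → indicator (pow i n Fin.≟ t) (ψ t))
      ≈⟨ ∑ᴬ-cong (λ t → ≈-trans (∑ᴬ-cong λ i → weight (pow i n Fin.≟ t)) (≈-trans (≈-sym (*-distribʳ-∑ᴬ (ψ t) (λ i → ν (𝟙 (pow i n Fin.≟ t)))))
           (*ᴬ-congʳ (≈-sym (ν-∑ (λ i → 𝟙 (pow i n Fin.≟ t))))))) ⟩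
    ∑ᴬ (λ t → ν (count t) *ᴬ ψ t)
      ≈⟨ ∑ᴬ-cong (λ t → ≈-trans (*ᴬ-congʳ (≈-trans (≈-reflexive (cong ν (count≡ t))) (≈-trans (ν-+ (κ * ι H t) _) (+ᴬ-cong (ν-* κ (ι H t)) ≈-refl))))
           (≈-trans (*ᴬ-distribʳ (ψ t) (ν κ *ᴬ ν (ι H t)) (ν (𝟙 (𝟎 Fin.≟ t)))) (+ᴬ-cong
             (≈-trans (*ᴬ-assoc _ _ _) (*ᴬ-congˡ (*ᴬ-congˡ (≈-reflexive (cong ψ (sym (⊗-identityʳ t)))))))
             (≈-sym (weight (𝟎 Fin.≟ t)))))) ⟩
    ∑ᴬ (λ t → ν κ *ᴬ (ν (ι H t) *ᴬ ψ (t ⊗ 𝟏)) +ᴬ indicator (𝟎 Fin.≟ t) (ψ t))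
      ≈⟨ ∑ᴬ-distrib-+ (λ t → ν κ *ᴬ (ν (ι H t) *ᴬ ψ (t ⊗ 𝟏))) (λ t → indicator (𝟎 Fin.≟ t) (ψ t)) ⟩
    ∑ᴬ (λ t → ν κ *ᴬ (ν (ι H t) *ᴬ ψ (t ⊗ 𝟏))) +ᴬ ∑ᴬ (λ t → indicator (𝟎 Fin.≟ t) (ψ t))
      ≈⟨ +ᴬ-cong (≈-sym (*-distribˡ-∑ᴬ (ν κ) (λ t → ν (ι H t) *ᴬ ψ (t ⊗ 𝟏))))
           (≈-trans (∑ᴬ-indicator (λ t → 𝟎 Fin.≟ t) ψ 𝟎 refl sym) ψ-𝟎) ⟩
    ν κ *ᴬ ∑ᴬ (λ s → ν (ι H s) *ᴬ ψ (s ⊗ 𝟏)) +ᴬ 1#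
      ≈⟨ +ᴬ-comm _ _ ⟩
    1# +ᴬ ν κ *ᴬ ∑ᴬ (λ s → ν (ι H s) *ᴬ ψ (s ⊗ 𝟏)) ∎
    where
    weight : ∀ {P : Set} {x} (d : Dec P) → indicator d x ≈ ν (𝟙 d) *ᴬ x
    weight {x = x} (yes _) = ≈-sym (≈-trans (*ᴬ-congʳ (+ᴬ-identityʳ 1#)) (*ᴬ-identityˡ x))
    weight {x = x} (no _)  = ≈-sym (*ᴬ-zeroˡ x)

^-cancelˡ-≤ : ∀ k .{{_ : NonZero k}} {a b} → a ^ k ≤ b ^ k → a ≤ b
^-cancelˡ-≤ k {a} {b} h = ℕ.≮⇒≥ λ b<a → ℕ.<⇒≱ (ℕ.^-monoˡ-< k b<a) h

^-swap : ∀ x a b → (x ^ a) ^ b ≡ (x ^ b) ^ a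
^-swap x a b = trans (ℕ.^-*-assoc x a b) (trans (cong (x ^_) (ℕ.*-comm a b)) (sym (ℕ.^-*-assoc x b a)))

rescale : ∀ {s c N} a b .{{_ : NonZero a}} → 1 ≤ N → 1 ≤ c → 56 * b ≤ 55 * a → s ^ a ≤ c * N ^ b → s ^ 56 ≤ c ^ 56 * N ^ 55
rescale {s} {c} {N} a b 1≤N 1≤c exponents h = ^-cancelˡ-≤ a (begin
  (s ^ 56) ^ a                   ≡⟨ ^-swap s 56 a ⟩
  (s ^ a) ^ 56                   ≤⟨ ℕ.^-monoˡ-≤ 56 h ⟩
  (c * N ^ b) ^ 56               ≡⟨ ^-distribʳ-* 56 c (N ^ b) ⟩
  c ^ 56 * (N ^ b) ^ 56          ≡⟨ cong (c ^ 56 *_) (trans (ℕ.^-*-assoc N b 56) (cong (N ^_) (ℕ.*-comm b 56))) ⟩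
  c ^ 56 * N ^ (56 * b)          ≤⟨ ℕ.*-mono-≤ (ℕ.≤-trans (ℕ.≤-reflexive (sym (ℕ.^-identityʳ (c ^ 56)))) (ℕ.^-monoʳ-≤ (c ^ 56) {{c^56≢0}} {1} {a} (>-nonZero⁻¹ a)))
                                      (ℕ.^-monoʳ-≤ N {{>-nonZero 1≤N}} exponents) ⟩
  (c ^ 56) ^ a * N ^ (55 * a)    ≡⟨ cong ((c ^ 56) ^ a *_) (ℕ.^-*-assoc N 55 a) ⟨
  (c ^ 56) ^ a * (N ^ 55) ^ a    ≡⟨ ^-distribʳ-* a (c ^ 56) (N ^ 55) ⟨
  (c ^ 56 * N ^ 55) ^ a          ∎)
  where
  open ℕ.≤-Reasoning
  c^56≢0 : NonZero (c ^ 56)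
  c^56≢0 = ℕ.m^n≢0 c 56 {{>-nonZero 1≤c}}

all-ratios-arithmetic : ∀ {q s N} c → 1 ≤ q → 1 ≤ N → N ^ 19 ≤ q ^ 10 →
  q * s ^ 46 ≤ c * N ^ 43 * (N ^ 4 + q * N ^ 2) → s ^ 46 ≤ 2 * c * N ^ 45 ⊎ s ^ 460 ≤ (2 * c) ^ 10 * N ^ 451
all-ratios-arithmetic {q} {s} {N} c 1≤q 1≤N small h = go (ℕ.≤-total (N ^ 4) (q * N ^ 2))
  where
  open ℕ.≤-Reasoning
  double : ∀ c m x → c * m * (x + x) ≡ 2 * c * (m * x)
  double = ℕ-Solver.solve-∀
  pull : ∀ c q m x → 2 * c * (m * (q * x)) ≡ q * (2 * c * (m * x))
  pull = ℕ-Solver.solve-∀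
  swap : ∀ a b c → a * (b * c) ≡ b * (a * c)
  swap = ℕ-Solver.solve-∀
  go : N ^ 4 ≤ q * N ^ 2 ⊎ q * N ^ 2 ≤ N ^ 4 → s ^ 46 ≤ 2 * c * N ^ 45 ⊎ s ^ 460 ≤ (2 * c) ^ 10 * N ^ 451
  go (inj₁ le) = inj₁ (ℕ.*-cancelˡ-≤ q {{>-nonZero 1≤q}} (begin
    q * s ^ 46                                ≤⟨ h ⟩
    c * N ^ 43 * (N ^ 4 + q * N ^ 2)          ≤⟨ ℕ.*-monoʳ-≤ (c * N ^ 43) (ℕ.+-monoˡ-≤ (q * N ^ 2) le) ⟩
    c * N ^ 43 * (q * N ^ 2 + q * N ^ 2)      ≡⟨ double c (N ^ 43) (q * N ^ 2) ⟩
    2 * c * (N ^ 43 * (q * N ^ 2))            ≡⟨ pull c q (N ^ 43) (N ^ 2) ⟩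
    q * (2 * c * (N ^ 43 * N ^ 2))            ≡⟨ cong (λ x → q * (2 * c * x)) (ℕ.^-distribˡ-+-* N 43 2) ⟨
    q * (2 * c * N ^ 45)                      ∎))
  go (inj₂ le) = inj₂ (ℕ.*-cancelˡ-≤ (N ^ 19) {{ℕ.m^n≢0 N 19 {{>-nonZero 1≤N}}}} (begin
    N ^ 19 * s ^ 460                          ≤⟨ ℕ.*-monoˡ-≤ (s ^ 460) small ⟩
    q ^ 10 * s ^ 460                          ≡⟨ cong (q ^ 10 *_) (ℕ.^-*-assoc s 46 10) ⟨
    q ^ 10 * (s ^ 46) ^ 10                    ≡⟨ ^-distribʳ-* 10 q (s ^ 46) ⟨
    (q * s ^ 46) ^ 10                         ≤⟨ ℕ.^-monoˡ-≤ 10 step ⟩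
    (2 * c * N ^ 47) ^ 10                     ≡⟨ ^-distribʳ-* 10 (2 * c) (N ^ 47) ⟩
    (2 * c) ^ 10 * (N ^ 47) ^ 10              ≡⟨ cong ((2 * c) ^ 10 *_) (trans (ℕ.^-*-assoc N 47 10) (ℕ.^-distribˡ-+-* N 19 451)) ⟩
    (2 * c) ^ 10 * (N ^ 19 * N ^ 451)         ≡⟨ swap ((2 * c) ^ 10) (N ^ 19) (N ^ 451) ⟩
    N ^ 19 * ((2 * c) ^ 10 * N ^ 451)         ∎))
    where
    step : q * s ^ 46 ≤ 2 * c * N ^ 47
    step = begin
      q * s ^ 46                              ≤⟨ h ⟩
      c * N ^ 43 * (N ^ 4 + q * N ^ 2)        ≤⟨ ℕ.*-monoʳ-≤ (c * N ^ 43) (ℕ.+-monoʳ-≤ (N ^ 4) le) ⟩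
      c * N ^ 43 * (N ^ 4 + N ^ 4)            ≡⟨ double c (N ^ 43) (N ^ 4) ⟩
      2 * c * (N ^ 43 * N ^ 4)                ≡⟨ cong (2 * c *_) (ℕ.^-distribˡ-+-* N 43 4) ⟨
      2 * c * N ^ 47                          ∎

maximum : ∀ {n} {P : Fin n → Set} (P? : ∀ i → Dec (P i)) (f : Fin n → ℕ) → ∃ P → ∃ λ i → P i × (∀ {j} → P j → f j ≤ f i)
maximum {n} {P} P? f (i , p) = go (sum f) i p (ℕ.m≤m+n (sum f) (f i))
  where
  go : ∀ fuel i → P i → sum f ≤ fuel + f i → ∃ λ i → P i × (∀ {j} → P j → f j ≤ f i)
  go fuel i p bound with Fin.any? (λ j → P? j ×-dec (f i ℕ.<? f j))
  ... | no ¬j = i , p , λ {j} pj → ℕ.≮⇒≥ λ lt → ¬j (j , pj , lt)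
  go zero i p bound | yes (j , pj , lt) = contradiction (ℕ.≤-trans (term≤∑ f j) bound) (ℕ.<⇒≱ lt)
  go (suc fuel) i p bound | yes (j , pj , lt) = go fuel j pj
    (ℕ.≤-trans bound (ℕ.≤-trans (ℕ.≤-reflexive (sym (ℕ.+-suc fuel (f i)))) (ℕ.+-monoʳ-≤ fuel lt)))

-- Applied with d = 2; Agda would evaluate the powers of a literal.
representationBound : ℕ → ℕ → ℕ
representationBound d c = (C₃ * d ^ 43) ^ 56 + ((2 * (16 * (C₂ * d ^ 43) * d ^ 4)) ^ 56 + (((2 * (16 * (C₂ * d ^ 43) * d ^ 4)) ^ 10) ^ 56 + ((d * d) ^ 605 * c) ^ 56))

1≤representationBound : ∀ d c → 1 ≤ d → 1 ≤ representationBound d c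
1≤representationBound d c 1≤d = ℕ.≤-trans
  (ℕ.m^n>0 (C₃ * d ^ 43) {{>-nonZero (ℕ.*-mono-≤ (ℕ.*-mono-≤ {1} {4} (s≤s z≤n) 1≤C₂) (ℕ.m^n>0 d {{>-nonZero 1≤d}} 43))}} 56) (ℕ.m≤m+n _ _)

trichotomy-arithmetic : ∀ {q s N n̂} d c → 1 ≤ d → 1 ≤ c → 1 ≤ q → 1 ≤ N → N ^ 19 ≤ q ^ 10 → n̂ ≤ d * N →
  s ^ 44 ≤ C₃ * n̂ ^ 43 ⊎ q * s ^ 46 ≤ 16 * (C₂ * n̂ ^ 43) * (n̂ ^ 4 + q * n̂ ^ 2) ⊎ (∃ λ m → s ≤ d * (d * m) × m ^ 605 ≤ c * N ^ 486) →
  s ^ 56 ≤ representationBound d c * N ^ 55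
trichotomy-arithmetic {q} {s} {N} {n̂} d c 1≤d 1≤c 1≤q 1≤N small n̂≤ = outcomes
  where
  open ℕ.≤-Reasoning
  c₁ c₂ x₁ x₂ x₃ x₄ : ℕ
  c₁ = C₃ * d ^ 43
  c₂ = 16 * (C₂ * d ^ 43) * d ^ 4
  x₁ = c₁ ^ 56
  x₂ = (2 * c₂) ^ 56
  x₃ = ((2 * c₂) ^ 10) ^ 56
  x₄ = ((d * d) ^ 605 * c) ^ 56
  1≤d^ : ∀ k → 1 ≤ d ^ k
  1≤d^ k = ℕ.m^n>0 d {{>-nonZero 1≤d}} k
  1≤c₁ : 1 ≤ c₁
  1≤c₁ = ℕ.*-mono-≤ (ℕ.*-mono-≤ {1} {4} (s≤s z≤n) 1≤C₂) (1≤d^ 43)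
  1≤2c₂ : 1 ≤ 2 * c₂
  1≤2c₂ = ℕ.*-mono-≤ {1} {2} (s≤s z≤n) (ℕ.*-mono-≤ (ℕ.*-mono-≤ {1} {16} (s≤s z≤n) (ℕ.*-mono-≤ 1≤C₂ (1≤d^ 43))) (1≤d^ 4))
  power-bound : ∀ k → n̂ ^ k ≤ d ^ k * N ^ k
  power-bound k = ℕ.≤-trans (ℕ.^-monoˡ-≤ k n̂≤) (ℕ.≤-reflexive (^-distribʳ-* k d N))
  widen : ∀ {a b c} {m} → a ≤ b * m → b ≤ c → a ≤ c * m
  widen {m = m} h le = ℕ.≤-trans h (ℕ.*-monoˡ-≤ m le)
  collect : ∀ k d m e x q y → 16 * (k * (d * m)) * (e * x + q * (e * y)) ≡ 16 * (k * d) * e * m * (x + q * y)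
  collect = ℕ-Solver.solve-∀
  outcomes : s ^ 44 ≤ C₃ * n̂ ^ 43 ⊎ q * s ^ 46 ≤ 16 * (C₂ * n̂ ^ 43) * (n̂ ^ 4 + q * n̂ ^ 2) ⊎ (∃ λ m → s ≤ d * (d * m) × m ^ 605 ≤ c * N ^ 486) →
    s ^ 56 ≤ representationBound d c * N ^ 55
  outcomes (inj₁ h) = widen {b = x₁} (rescale {s} {c₁} {N} 44 43 1≤N 1≤c₁ (ℕ.≤ᵇ⇒≤ (56 * 43) (55 * 44) _) (begin
    s ^ 44                     ≤⟨ h ⟩
    C₃ * n̂ ^ 43                ≤⟨ ℕ.*-monoʳ-≤ C₃ (power-bound 43) ⟩
    C₃ * (d ^ 43 * N ^ 43)     ≡⟨ ℕ.*-assoc C₃ (d ^ 43) (N ^ 43) ⟨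
    C₃ * d ^ 43 * N ^ 43       ∎)) (ℕ.m≤m+n x₁ (x₂ + (x₃ + x₄)))
  outcomes (inj₂ (inj₁ h)) = [
      (λ h′ → widen {b = x₂} (rescale {s} {2 * c₂} {N} 46 45 1≤N 1≤2c₂ (ℕ.≤ᵇ⇒≤ (56 * 45) (55 * 46) _) h′)
        (ℕ.≤-trans (ℕ.m≤m+n x₂ (x₃ + x₄)) (ℕ.m≤n+m (x₂ + (x₃ + x₄)) x₁))) ,
      (λ h′ → widen {b = x₃} (rescale {s} {(2 * c₂) ^ 10} {N} 460 451 1≤N (ℕ.m^n>0 (2 * c₂) {{>-nonZero 1≤2c₂}} 10) (ℕ.≤ᵇ⇒≤ (56 * 451) (55 * 460) _) h′)
        (ℕ.≤-trans (ℕ.m≤m+n x₃ x₄) (ℕ.≤-trans (ℕ.m≤n+m (x₃ + x₄) x₂) (ℕ.m≤n+m (x₂ + (x₃ + x₄)) x₁)))) ]′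
    (all-ratios-arithmetic {q} {s} {N} c₂ 1≤q 1≤N small (begin
      q * s ^ 46
        ≤⟨ h ⟩
      16 * (C₂ * n̂ ^ 43) * (n̂ ^ 4 + q * n̂ ^ 2)
        ≤⟨ ℕ.*-mono-≤ (ℕ.*-monoʳ-≤ 16 (ℕ.*-monoʳ-≤ C₂ (power-bound 43))) (ℕ.+-mono-≤ (power-bound 4)
             (ℕ.*-monoʳ-≤ q (ℕ.≤-trans (power-bound 2) (ℕ.*-monoˡ-≤ (N ^ 2) (ℕ.^-monoʳ-≤ d {{>-nonZero 1≤d}} {2} {4} (s≤s (s≤s z≤n))))))) ⟩
      16 * (C₂ * (d ^ 43 * N ^ 43)) * (d ^ 4 * N ^ 4 + q * (d ^ 4 * N ^ 2))
        ≡⟨ collect C₂ (d ^ 43) (N ^ 43) (d ^ 4) (N ^ 4) q (N ^ 2) ⟩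
      c₂ * N ^ 43 * (N ^ 4 + q * N ^ 2) ∎))
  outcomes (inj₂ (inj₂ (m , h , hm))) = widen {b = x₄}
    (rescale {s} {(d * d) ^ 605 * c} {N} 605 486 1≤N (ℕ.*-mono-≤ (ℕ.m^n>0 (d * d) {{>-nonZero (ℕ.*-mono-≤ 1≤d 1≤d)}} 605) 1≤c) (ℕ.≤ᵇ⇒≤ (56 * 486) (55 * 605) _) (begin
      s ^ 605                          ≤⟨ ℕ.^-monoˡ-≤ 605 (ℕ.≤-trans h (ℕ.≤-reflexive (sym (ℕ.*-assoc d d m)))) ⟩
      (d * d * m) ^ 605                ≡⟨ ^-distribʳ-* 605 (d * d) m ⟩
      (d * d) ^ 605 * m ^ 605          ≤⟨ ℕ.*-monoʳ-≤ ((d * d) ^ 605) hm ⟩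
      (d * d) ^ 605 * (c * N ^ 486)    ≡⟨ ℕ.*-assoc ((d * d) ^ 605) c (N ^ 486) ⟨
      (d * d) ^ 605 * c * N ^ 486      ∎))
    (ℕ.≤-trans (ℕ.m≤n+m x₄ x₃) (ℕ.≤-trans (ℕ.m≤n+m (x₃ + x₄) x₂) (ℕ.m≤n+m (x₂ + (x₃ + x₄)) x₁)))

module Symmetrised {q : ℕ} (𝔽 : FieldOn q) (H : Counting.FSet q) (H-sub : IsSubgroup 𝔽 H) where

  open FieldSets 𝔽
  open IsSubgroup H-sub
  open Growth 𝔽
  open Inverses 𝔽
  open Convolution 𝔽

  ±H : FSet
  ±H = H ∪ neg H

  N : ℕ
  N = ⟦ H ⟧

  1≤N : 1 ≤ N
  1≤N = ∣∣≥1 H 𝟏∈H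

  ∣±H∣ : ⟦ ±H ⟧ ≤ 2 * N
  ∣±H∣ = ℕ.≤-trans (∣∪∣ H (neg H)) (ℕ.≤-reflexive (cong (N +_) (trans (∣neg∣ H) (sym (ℕ.+-identityʳ N)))))

  ⊖⊗ : ∀ x y → (⊖ x) ⊗ (⊖ y) ≡ x ⊗ y
  ⊖⊗ = solve 2 (λ x y → :- x :* :- y := x :* y) refl

  ±H-subgroup : IsSymmetricSubgroup 𝔽 ±H
  ±H-subgroup = record
    { 𝟏∈ = inj₁ 𝟏∈H
    ; ⊖𝟏∈ = inj₂ (∈neg H 𝟏∈H)
    ; ⊗∈ = mult
    ; inv∈ = invert
    ; ∈⇒≢𝟎 = nonzero
    }
    where
    mult : ∀ {x y} → x ∈ ±H → y ∈ ±H → x ⊗ y ∈ ±H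
    mult {x} {y} (inj₁ x∈) (inj₁ y∈) = inj₁ (H-⊗ x∈ y∈)
    mult {x} {y} (inj₁ x∈) (inj₂ y∈) = inj₂ (subst (_∈ H) (solve 2 (λ x y → x :* :- y := :- (x :* y)) refl x y) (H-⊗ x∈ y∈))
    mult {x} {y} (inj₂ x∈) (inj₁ y∈) = inj₂ (subst (_∈ H) (solve 2 (λ x y → :- x :* y := :- (x :* y)) refl x y) (H-⊗ x∈ y∈))
    mult {x} {y} (inj₂ x∈) (inj₂ y∈) = inj₁ (subst (_∈ H) (⊖⊗ x y) (H-⊗ x∈ y∈))
    nonzero : ∀ {x} → x ∈ ±H → x ≢ 𝟎
    nonzero (inj₁ x∈) = H≢𝟎 x∈
    nonzero {x} (inj₂ x∈) eq = H≢𝟎 x∈ (trans (cong ⊖_ eq) (trans (sym (⊕-identityˡ (⊖ 𝟎))) (⊖-inverseʳ 𝟎)))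
    invert : ∀ {x} → x ∈ ±H → inv x ∈ ±H
    invert (inj₁ x∈) = inj₁ (H-inv x∈)
    invert {x} (inj₂ x∈) = inj₂ (subst (_∈ H) (sym (inv-unique (H≢𝟎 x∈) (trans (⊖⊗ x (inv x)) (inverseʳ (nonzero (inj₂ x∈)))))) (H-inv x∈))

  r : Fin q → ℕ
  r = convolution (ι H)

  r𝟎≤N : ∀ u → r u ≤ N
  r𝟎≤N u = ℕ.≤-trans (∑-mono λ h → ℕ.≤-trans (ℕ.*-monoʳ-≤ (ι H h) (𝟙≤1 (mem? H (u ⊝ h)))) (ℕ.≤-reflexive (ℕ.*-identityʳ _)))
    (ℕ.≤-reflexive (sym (⟦⟧-sum H)))

  energy-bound : ∀ ρ → (∀ {u} → u ≢ 𝟎 → r u ≤ ρ) → sum (λ u → r u * r u) ≤ N * N + ρ * (N * N)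
  energy-bound ρ bound = begin
    sum (λ u → r u * r u)
      ≤⟨ ∑-mono (λ u → pointwise-bound u (u Fin.≟ 𝟎)) ⟩
    sum (λ u → 𝟙 (u Fin.≟ 𝟎) * (N * N) + ρ * r u)
      ≡⟨ ∑-distrib-+ (λ u → 𝟙 (u Fin.≟ 𝟎) * (N * N)) (λ u → ρ * r u) ⟩
    sum (λ u → 𝟙 (u Fin.≟ 𝟎) * (N * N)) + sum (λ u → ρ * r u)
      ≡⟨ cong₂ _+_ (sym (*-distribʳ-sum (N * N) (λ u → 𝟙 (u Fin.≟ 𝟎)))) (trans (sym (*-distribˡ-sum ρ r)) (cong (ρ *_) (∑convolution H))) ⟩
    sum (λ u → 𝟙 (u Fin.≟ 𝟎)) * (N * N) + ρ * (N * N)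
      ≤⟨ ℕ.+-monoˡ-≤ (ρ * (N * N)) (ℕ.≤-trans (ℕ.*-monoˡ-≤ (N * N) (∑-atMostOne (Fin._≟ 𝟎) λ p r → trans p (sym r))) (ℕ.≤-reflexive (ℕ.*-identityˡ (N * N)))) ⟩
    N * N + ρ * (N * N) ∎
    where
    open ℕ.≤-Reasoning
    pointwise-bound : ∀ u (d : Dec (u ≡ 𝟎)) → r u * r u ≤ 𝟙 d * (N * N) + ρ * r u
    pointwise-bound u (yes _)   = ℕ.≤-trans (ℕ.*-mono-≤ (r𝟎≤N u) (r𝟎≤N u)) (ℕ.≤-trans (ℕ.≤-reflexive (sym (ℕ.*-identityˡ (N * N)))) (ℕ.m≤m+n _ _))
    pointwise-bound u (no u≢𝟎) = ℕ.*-monoˡ-≤ (r u) (bound u≢𝟎)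

  module _ {p : Fin q} (p≢𝟎 : p ≢ 𝟎) where

    open CayleyGraph 𝔽 ±H ±H-subgroup p p≢𝟎 using (S; σ)

    -- h + h′ = p is the same as 1 - p h⁻¹ = - h′ h⁻¹.
    r≤σ : r p ≤ σ
    r≤σ = ℕ.≤-trans (ℕ.≤-reflexive (trans (sum-cong-≗ λ h → sym (𝟙-× (mem? H h) (mem? H (p ⊝ h)))) (sym (⟦⟧-sum Reps))))
      (∣∣-bij Reps S (λ h → 𝟏 ⊝ p ⊗ inv h) (λ s → inv (inv p ⊗ (𝟏 ⊝ s)))
        (λ s → trans (cong (λ z → 𝟏 ⊝ p ⊗ z) (inv-inv _)) (trans (cong (𝟏 ⊝_) (inv-cancel′ p≢𝟎 _)) (⊝-⊝ 𝟏 s)))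
        (λ h → trans (cong (λ z → inv (inv p ⊗ z)) (⊝-⊝ 𝟏 _)) (trans (cong inv (inv-cancel p≢𝟎 _)) (inv-inv h)))
        λ {h} (h∈ , h′∈) → inj₂ (subst (_∈ H) (ratio h (H≢𝟎 h∈)) (H-⊗ h′∈ (H-inv h∈))) ,
          inj₂ (subst (_∈ H) (trans (sym (⊖⊖ (inv h))) (cong ⊖_ (back h))) (H-inv h∈)))
      where
      Reps : FSet
      Reps = ⟨ (λ h → mem? H h ×-dec mem? H (p ⊝ h)) ⟩
      ratio : ∀ h → h ≢ 𝟎 → (p ⊝ h) ⊗ inv h ≡ ⊖ (𝟏 ⊝ p ⊗ inv h)
      ratio h h≢𝟎 = trans (solve 3 (λ p h h′ → (p :- h) :* h′ := :- (h :* h′ :- p :* h′)) refl p h (inv h))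
        (cong (λ z → ⊖ (z ⊝ p ⊗ inv h)) (inverseʳ h≢𝟎))
      back : ∀ h → ⊖ inv h ≡ inv p ⊗ (𝟏 ⊝ p ⊗ inv h ⊝ 𝟏)
      back h = trans (cong ⊖_ (sym (inv-cancel p≢𝟎 (inv h))))
        (solve 4 (λ o p p′ h → :- (p′ :* (p :* h)) := p′ :* (o :- p :* h :- o)) refl 𝟏 p (inv p) (inv h))

    module _ (c : ℕ) (1≤c : 1 ≤ c) (small : N ^ 19 ≤ q ^ 10)
             (subfields : ∀ {M} → IsSubfield 𝔽 M → (∃ λ x → ¬ x ∈ M) → ⟦ H ∩ M ⟧ ^ 605 ≤ c * N ^ 486) where

      1≤q : 1 ≤ q
      1≤q = go p
        where
        go : ∀ {n} → Fin n → 1 ≤ n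
        go zero    = s≤s z≤n
        go (suc _) = s≤s z≤n

      σ-bound : 1 ≤ σ → σ ^ 56 ≤ representationBound 2 c * N ^ 55
      σ-bound 1≤σ = trichotomy-arithmetic {q} {σ} {N} {⟦ ±H ⟧} 2 c (s≤s z≤n) 1≤c 1≤q 1≤N small ∣±H∣
        (Sum.map₂ (Sum.map₂ λ (M , M-sub , proper , h) →
          ⟦ H ∩ M ⟧ , ℕ.≤-trans h (ℕ.*-monoʳ-≤ 2 (half M M-sub)) , subfields M-sub proper) (core 𝔽 ±H ±H-subgroup p p≢𝟎 1≤σ))
        where
        half : ∀ M → IsSubfield 𝔽 M → ⟦ ±H ∩ M ⟧ ≤ 2 * ⟦ H ∩ M ⟧
        half M M-sub = ℕ.≤-trans (∣∣-mono (±H ∩ M) ((H ∩ M) ∪ neg (H ∩ M))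
            λ { (inj₁ x∈ , m) → inj₁ (x∈ , m) ; (inj₂ x∈ , m) → inj₂ (x∈ , IsSubfield.⊖∈ M-sub m) })
          (ℕ.≤-trans (∣∪∣ (H ∩ M) (neg (H ∩ M))) (ℕ.≤-reflexive (cong (⟦ H ∩ M ⟧ +_) (trans (∣neg∣ (H ∩ M)) (sym (ℕ.+-identityʳ _))))))

  module _ (c : ℕ) (1≤c : 1 ≤ c) (small : N ^ 19 ≤ q ^ 10)
           (subfields : ∀ {M} → IsSubfield 𝔽 M → (∃ λ x → ¬ x ∈ M) → ⟦ H ∩ M ⟧ ^ 605 ≤ c * N ^ 486) where

    representations-bound : ∃ λ ρ → 1 ≤ ρ × (∀ {u} → u ≢ 𝟎 → r u ≤ ρ) × ρ ^ 56 ≤ representationBound 2 c * N ^ 55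
    representations-bound = go (maximum (λ u → ¬? (u Fin.≟ 𝟎)) r (𝟏 , 𝟎≢𝟏 ∘ sym))
      where
      go : (∃ λ p → p ≢ 𝟎 × (∀ {u} → u ≢ 𝟎 → r u ≤ r p)) → ∃ λ ρ → 1 ≤ ρ × (∀ {u} → u ≢ 𝟎 → r u ≤ ρ) × ρ ^ 56 ≤ representationBound 2 c * N ^ 55
      go (p , p≢𝟎 , largest) = split (1 ℕ.≤? r p)
        where
        split : Dec (1 ≤ r p) → ∃ λ ρ → 1 ≤ ρ × (∀ {u} → u ≢ 𝟎 → r u ≤ ρ) × ρ ^ 56 ≤ representationBound 2 c * N ^ 55
        split (yes 1≤r) = r p , 1≤r , largest ,
          ℕ.≤-trans (ℕ.^-monoˡ-≤ 56 (r≤σ p≢𝟎)) (σ-bound p≢𝟎 c 1≤c small subfields (ℕ.≤-trans 1≤r (r≤σ p≢𝟎)))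
        split (no 1≰r)  = 1 , s≤s z≤n , (λ u≢𝟎 → ℕ.≤-trans (largest u≢𝟎) (ℕ.<⇒≤ (ℕ.≰⇒> 1≰r))) ,
          ℕ.≤-trans (ℕ.≤-reflexive (ℕ.^-zeroˡ 56)) (ℕ.*-mono-≤ (1≤representationBound 2 c (s≤s z≤n)) (ℕ.m^n>0 N {{>-nonZero 1≤N}} 55))

    energy-estimate : ∃ λ ρ → sum (λ u → r u * r u) ≤ 2 * (ρ * (N * N)) × ρ ^ 56 ≤ representationBound 2 c * N ^ 55
    energy-estimate = let ρ , 1≤ρ , bound , ρ^56 = representations-bound in
      ρ , ℕ.≤-trans (energy-bound ρ bound) (ℕ.≤-trans (ℕ.+-monoˡ-≤ (ρ * (N * N)) (ℕ.≤-trans (ℕ.≤-reflexive (sym (ℕ.*-identityˡ (N * N)))) (ℕ.*-monoˡ-≤ (N * N) 1≤ρ)))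
        (ℕ.≤-reflexive (cong (ρ * (N * N) +_) (sym (ℕ.+-identityʳ _))))) , ρ^56

ℕ→ℚ-^ : ∀ a k → ℕ→ℚ (a ^ k) ≡ ℕ→ℚ a ^ℚ k
ℕ→ℚ-^ a zero    = refl
ℕ→ℚ-^ a (suc k) = trans (ℕ→ℚ-* a (a ^ k)) (cong (ℕ→ℚ a ℚ.*_) (ℕ→ℚ-^ a k))

ℕ→ℚ-cancel-≤ : ∀ {a b} → ℕ→ℚ a ℚ.≤ ℕ→ℚ b → a ≤ b
ℕ→ℚ-cancel-≤ {a} {b} h = ℕ.≮⇒≥ λ b<a → ℚ.<-irrefl refl (ℚ.<-≤-trans (subst (ℕ→ℚ b ℚ.<_) (sym (ℕ→ℚ-suc b)) (a<a+1 (ℕ→ℚ b))) (ℚ.≤-trans (ℕ→ℚ-mono b<a) h))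

rootApprox-power : ∀ k x i → 0ℚ ℚ.≤ x → rootApprox (suc k) x i ^ℚ suc k ℚ.≤ x
rootApprox-power k x i 0≤x = [ (λ eq → ℚ.≤-trans (ℚ.≤-reflexive (trans (cong (λ a → a ℚ.* a ^ℚ k) eq) (ℚ.*-zeroˡ (0ℚ ^ℚ k)))) 0≤x) , id ]′
  (rootApprox-lower (suc k) x i)

0≤rootApprox : ∀ k x i → 0ℚ ℚ.≤ rootApprox k x i
0≤rootApprox k x i = 0≤grid i (rootNumerator k x i)

reciprocal : ∀ r .{{_ : NonZero r}} → ℕ→ℚ r ℚ.* (ℤ.+ 1 ℚ./ r) ≡ 1ℚ
reciprocal (suc k) = trans (cong (ℕ→ℚ (suc k) ℚ.*_) (ℚ.↥p/↧p≡p (1/suc k))) (1/suc-inverse k)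

gcd-arithmetic : ∀ {γ r X Y} B k {K a b w} → 1 ≤ γ → K ℚ.≤ ℕ→ℚ B → 0ℚ ℚ.≤ a → 0ℚ ℚ.≤ b → 0ℚ ℚ.≤ w → ℕ→ℚ r ℚ.* w ≡ 1ℚ →
  a ^ℚ k ℚ.≤ ℕ→ℚ X → b ^ℚ k ℚ.≤ ℕ→ℚ Y → ℕ→ℚ γ ℚ.≤ K ℚ.* (a ℚ.* b ℚ.* w) ℚ.+ ½ → (γ * r) ^ k ≤ (2 * B) ^ k * (X * Y)
gcd-arithmetic {γ} {r} {X} {Y} B k {K} {a} {b} {w} 1≤γ K≤B 0≤a 0≤b 0≤w rw≡1 a^k b^k h = ℕ→ℚ-cancel-≤ (begin
  ℕ→ℚ ((γ * r) ^ k)                                    ≡⟨ ℕ→ℚ-^ (γ * r) k ⟩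
  ℕ→ℚ (γ * r) ^ℚ k                                     ≤⟨ pow-mono k (0≤ℕ→ℚ (γ * r)) linear ⟩
  (ℕ→ℚ (2 * B) ℚ.* (a ℚ.* b)) ^ℚ k                     ≡⟨ ^ℚ-distrib-* (ℕ→ℚ (2 * B)) (a ℚ.* b) k ⟩
  ℕ→ℚ (2 * B) ^ℚ k ℚ.* (a ℚ.* b) ^ℚ k                  ≡⟨ cong (ℕ→ℚ (2 * B) ^ℚ k ℚ.*_) (^ℚ-distrib-* a b k) ⟩
  ℕ→ℚ (2 * B) ^ℚ k ℚ.* (a ^ℚ k ℚ.* b ^ℚ k)             ≤⟨ *-mono-≤ (0≤* (0≤pow k 0≤a) (0≤pow k 0≤b)) (0≤pow k (0≤ℕ→ℚ (2 * B))) ℚ.≤-refl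
                                                            (*-mono-≤ (0≤pow k 0≤b) (0≤ℕ→ℚ X) a^k b^k) ⟩
  ℕ→ℚ (2 * B) ^ℚ k ℚ.* (ℕ→ℚ X ℚ.* ℕ→ℚ Y)               ≡⟨ cong₂ ℚ._*_ (ℕ→ℚ-^ (2 * B) k) (ℕ→ℚ-* X Y) ⟨
  ℕ→ℚ ((2 * B) ^ k) ℚ.* ℕ→ℚ (X * Y)                    ≡⟨ ℕ→ℚ-* ((2 * B) ^ k) (X * Y) ⟨
  ℕ→ℚ ((2 * B) ^ k * (X * Y))                          ∎)
  where
  open ℚ.≤-Reasoning
  open ℚ-Solver.+-*-Solver
  P g : ℚ
  P = a ℚ.* b ℚ.* w
  g = ℕ→ℚ γ
  doubled : g ℚ.+ 1ℚ ℚ.≤ (K ℚ.* P ℚ.+ K ℚ.* P) ℚ.+ 1ℚ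
  doubled = ℚ.≤-trans (ℚ.+-monoʳ-≤ g (ℕ→ℚ-mono 1≤γ)) (ℚ.≤-trans (ℚ.+-mono-≤ h h)
    (ℚ.≤-reflexive (solve 1 (λ x → (x :+ con ½) :+ (x :+ con ½) := (x :+ x) :+ con 1ℚ) refl (K ℚ.* P))))
  g≤ : g ℚ.≤ K ℚ.* P ℚ.+ K ℚ.* P
  g≤ = subst₂ ℚ._≤_ (drop g) (drop (K ℚ.* P ℚ.+ K ℚ.* P)) (ℚ.+-monoˡ-≤ (ℚ.- 1ℚ) doubled)
    where
    drop : ∀ x → x ℚ.+ 1ℚ ℚ.- 1ℚ ≡ x
    drop = solve 1 (λ x → x :+ con 1ℚ :- con 1ℚ := x) refl
  linear : ℕ→ℚ (γ * r) ℚ.≤ ℕ→ℚ (2 * B) ℚ.* (a ℚ.* b)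
  linear = begin
    ℕ→ℚ (γ * r)
      ≡⟨ ℕ→ℚ-* γ r ⟩
    g ℚ.* ℕ→ℚ r
      ≤⟨ *-mono-≤ (0≤ℕ→ℚ r) (ℚ.≤-trans (0≤ℕ→ℚ γ) g≤) g≤ ℚ.≤-refl ⟩
    (K ℚ.* P ℚ.+ K ℚ.* P) ℚ.* ℕ→ℚ r
      ≡⟨ solve 5 (λ k a b w r → (k :* (a :* b :* w) :+ k :* (a :* b :* w)) :* r := (k :+ k) :* (a :* b) :* (r :* w)) refl K a b w (ℕ→ℚ r) ⟩
    (K ℚ.+ K) ℚ.* (a ℚ.* b) ℚ.* (ℕ→ℚ r ℚ.* w)
      ≡⟨ trans (cong ((K ℚ.+ K) ℚ.* (a ℚ.* b) ℚ.*_) rw≡1) (ℚ.*-identityʳ _) ⟩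
    (K ℚ.+ K) ℚ.* (a ℚ.* b)
      ≤⟨ *-mono-≤ (0≤* 0≤a 0≤b) (0≤+ (0≤ℕ→ℚ B) (0≤ℕ→ℚ B)) (ℚ.+-mono-≤ K≤B K≤B) ℚ.≤-refl ⟩
    (ℕ→ℚ B ℚ.+ ℕ→ℚ B) ℚ.* (a ℚ.* b)
      ≡⟨ cong (ℚ._* (a ℚ.* b)) (trans (sym (ℕ→ℚ-+ B B)) (cong (λ j → ℕ→ℚ (B + j)) (sym (ℕ.+-identityʳ B)))) ⟩
    ℕ→ℚ (2 * B) ℚ.* (a ℚ.* b) ∎

subfieldConstant : ℕ → ℕ → ℕ
subfieldConstant d B = suc ((d * B) ^ 605 * d ^ 486)

subfield-arithmetic : ∀ {g γ r n q N} d B → 1 ≤ n → g * n ≤ γ * r → q ≤ d * (n * N) →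
  (γ * r) ^ 605 ≤ (d * B) ^ 605 * (n ^ 119 * q ^ 486) → g ^ 605 ≤ subfieldConstant d B * N ^ 486
subfield-arithmetic {g} {γ} {r} {n} {q} {N} d B 1≤n gn≤ q≤ h =
  ℕ.≤-trans (ℕ.*-cancelʳ-≤ _ _ (n ^ 605) {{ℕ.m^n≢0 n 605 {{>-nonZero 1≤n}}}} (begin
    g ^ 605 * n ^ 605
      ≡⟨ ^-distribʳ-* 605 g n ⟨
    (g * n) ^ 605
      ≤⟨ ℕ.^-monoˡ-≤ 605 gn≤ ⟩
    (γ * r) ^ 605
      ≤⟨ h ⟩
    D * (n ^ 119 * q ^ 486)
      ≤⟨ ℕ.*-monoʳ-≤ D (ℕ.*-monoʳ-≤ (n ^ 119) (ℕ.^-monoˡ-≤ 486 q≤)) ⟩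
    D * (n ^ 119 * (d * (n * N)) ^ 486)
      ≡⟨ cong (λ x → D * (n ^ 119 * x)) (trans (^-distribʳ-* 486 d (n * N)) (cong (d ^ 486 *_) (^-distribʳ-* 486 n N))) ⟩
    D * (n ^ 119 * (d ^ 486 * (n ^ 486 * N ^ 486)))
      ≡⟨ rearrange D (n ^ 119) (d ^ 486) (n ^ 486) (N ^ 486) ⟩
    D * d ^ 486 * N ^ 486 * (n ^ 119 * n ^ 486)
      ≡⟨ cong (D * d ^ 486 * N ^ 486 *_) (ℕ.^-distribˡ-+-* n 119 486) ⟨
    D * d ^ 486 * N ^ 486 * n ^ 605 ∎)) (ℕ.*-monoˡ-≤ (N ^ 486) (ℕ.n≤1+n (D * d ^ 486)))
  where
  open ℕ.≤-Reasoning
  D : ℕ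
  D = (d * B) ^ 605
  rearrange : ∀ a x b y z → a * (x * (b * (y * z))) ≡ a * b * z * (x * y)
  rearrange = ℕ-Solver.solve-∀

large-subgroup-arithmetic : ∀ {κ N q n} b → 1 ≤ q → κ * N ≤ q → κ ≤ n → q ^ 10 ≤ N ^ 19 →
  (κ * κ) ^ 112 * (b * q) ^ 112 ≤ b ^ 112 * (q ^ 195 * n ^ 57)
large-subgroup-arithmetic {κ} {N} {q} {n} b 1≤q κN≤q κ≤n large = begin
  (κ * κ) ^ 112 * (b * q) ^ 112                      ≡⟨ cong₂ _*_ κ^ (^-distribʳ-* 112 b q) ⟩
  κ ^ 167 * κ ^ 57 * (b ^ 112 * q ^ 112)             ≤⟨ ℕ.*-monoˡ-≤ (b ^ 112 * q ^ 112) (ℕ.*-mono-≤ κ^167≤ (ℕ.^-monoˡ-≤ 57 κ≤n)) ⟩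
  q ^ 83 * n ^ 57 * (b ^ 112 * q ^ 112)              ≡⟨ rearrange (q ^ 83) (n ^ 57) (b ^ 112) (q ^ 112) ⟩
  b ^ 112 * (q ^ 83 * q ^ 112 * n ^ 57)              ≡⟨ cong (λ x → b ^ 112 * (x * n ^ 57)) (ℕ.^-distribˡ-+-* q 83 112) ⟨
  b ^ 112 * (q ^ 195 * n ^ 57)                       ∎
  where
  open ℕ.≤-Reasoning
  rearrange : ∀ x y z w → x * y * (z * w) ≡ z * (x * w * y)
  rearrange = ℕ-Solver.solve-∀
  κ^ : (κ * κ) ^ 112 ≡ κ ^ 167 * κ ^ 57
  κ^ = trans (^-distribʳ-* 112 κ κ) (trans (sym (ℕ.^-distribˡ-+-* κ 112 112)) (ℕ.^-distribˡ-+-* κ 167 57))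
  κ^19≤ : κ ^ 19 ≤ q ^ 9
  κ^19≤ = ℕ.*-cancelʳ-≤ (κ ^ 19) (q ^ 9) (q ^ 10) {{ℕ.m^n≢0 q 10 {{>-nonZero 1≤q}}}} (begin
    κ ^ 19 * q ^ 10    ≤⟨ ℕ.*-monoʳ-≤ (κ ^ 19) large ⟩
    κ ^ 19 * N ^ 19    ≡⟨ ^-distribʳ-* 19 κ N ⟨
    (κ * N) ^ 19       ≤⟨ ℕ.^-monoˡ-≤ 19 κN≤q ⟩
    q ^ 19             ≡⟨ ℕ.^-distribˡ-+-* q 9 10 ⟩
    q ^ 9 * q ^ 10     ∎)
  κ^167≤ : κ ^ 167 ≤ q ^ 83
  κ^167≤ = ^-cancelˡ-≤ 19 (begin
    (κ ^ 167) ^ 19     ≡⟨ ^-swap κ 167 19 ⟩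
    (κ ^ 19) ^ 167     ≤⟨ ℕ.^-monoˡ-≤ 167 κ^19≤ ⟩
    (q ^ 9) ^ 167      ≡⟨ ℕ.^-*-assoc q 9 167 ⟩
    q ^ 1503           ≤⟨ ℕ.^-monoʳ-≤ q {{>-nonZero 1≤q}} (ℕ.≤ᵇ⇒≤ 1503 1577 _) ⟩
    q ^ 1577           ≡⟨ ℕ.^-*-assoc q 83 19 ⟨
    (q ^ 83) ^ 19      ∎)

small-subgroup-arithmetic : ∀ {κ N q n E ρ} b d R → κ * N ≤ q → κ ≤ n → E ≤ d * (ρ * (N * N)) → ρ ^ 56 ≤ R * N ^ 55 →
  (κ * κ) ^ 112 * (b * (q * (E * E))) ^ 28 ≤ b ^ 28 * (d ^ 56 * R) * (q ^ 195 * n ^ 57)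
small-subgroup-arithmetic {κ} {N} {q} {n} {E} {ρ} b d R κN≤q κ≤n E≤ ρ≤ = begin
  (κ * κ) ^ 112 * (b * (q * (E * E))) ^ 28
    ≡⟨ cong₂ _*_ κ^ (trans (^-distribʳ-* 28 b (q * (E * E))) (cong (b ^ 28 *_) (trans (^-distribʳ-* 28 q (E * E)) (cong (q ^ 28 *_) E^)))) ⟩
  κ ^ 167 * κ ^ 57 * (b ^ 28 * (q ^ 28 * E ^ 56))
    ≤⟨ ℕ.*-mono-≤ (ℕ.*-monoʳ-≤ (κ ^ 167) (ℕ.^-monoˡ-≤ 57 κ≤n)) (ℕ.*-monoʳ-≤ (b ^ 28) (ℕ.*-monoʳ-≤ (q ^ 28) E^56≤)) ⟩
  κ ^ 167 * n ^ 57 * (b ^ 28 * (q ^ 28 * (d ^ 56 * (R * N ^ 167))))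
    ≡⟨ rearrange (κ ^ 167) (n ^ 57) (b ^ 28) (q ^ 28) (d ^ 56) R (N ^ 167) ⟩
  b ^ 28 * (d ^ 56 * R) * (κ ^ 167 * N ^ 167 * q ^ 28 * n ^ 57)
    ≤⟨ ℕ.*-monoʳ-≤ (b ^ 28 * (d ^ 56 * R)) (ℕ.*-monoˡ-≤ (n ^ 57) (ℕ.*-monoˡ-≤ (q ^ 28)
         (ℕ.≤-trans (ℕ.≤-reflexive (sym (^-distribʳ-* 167 κ N))) (ℕ.^-monoˡ-≤ 167 κN≤q)))) ⟩
  b ^ 28 * (d ^ 56 * R) * (q ^ 167 * q ^ 28 * n ^ 57)
    ≡⟨ cong (λ x → b ^ 28 * (d ^ 56 * R) * (x * n ^ 57)) (ℕ.^-distribˡ-+-* q 167 28) ⟨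
  b ^ 28 * (d ^ 56 * R) * (q ^ 195 * n ^ 57) ∎
  where
  open ℕ.≤-Reasoning
  rearrange : ∀ k n b q d r m → k * n * (b * (q * (d * (r * m)))) ≡ b * (d * r) * (k * m * q * n)
  rearrange = ℕ-Solver.solve-∀
  double : ∀ x j → (x * x) ^ j ≡ x ^ (j + j)
  double x j = trans (^-distribʳ-* j x x) (sym (ℕ.^-distribˡ-+-* x j j))
  κ^ : (κ * κ) ^ 112 ≡ κ ^ 167 * κ ^ 57
  κ^ = trans (double κ 112) (ℕ.^-distribˡ-+-* κ 167 57)
  E^ : (E * E) ^ 28 ≡ E ^ 56
  E^ = double E 28
  E^56≤ : E ^ 56 ≤ d ^ 56 * (R * N ^ 167)
  E^56≤ = begin
    E ^ 56                                   ≤⟨ ℕ.^-monoˡ-≤ 56 E≤ ⟩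
    (d * (ρ * (N * N))) ^ 56                 ≡⟨ trans (^-distribʳ-* 56 d (ρ * (N * N))) (cong (d ^ 56 *_) (^-distribʳ-* 56 ρ (N * N))) ⟩
    d ^ 56 * (ρ ^ 56 * (N * N) ^ 56)         ≤⟨ ℕ.*-monoʳ-≤ (d ^ 56) (ℕ.*-mono-≤ ρ≤ (ℕ.≤-reflexive (double N 56))) ⟩
    d ^ 56 * (R * N ^ 55 * N ^ 112)          ≡⟨ cong (d ^ 56 *_) (trans (ℕ.*-assoc R (N ^ 55) (N ^ 112)) (cong (R *_) (sym (ℕ.^-distribˡ-+-* N 55 112)))) ⟩
    d ^ 56 * (R * N ^ 167)                   ∎

norm-power : ∀ k κ {S D M s t} → 0ℚ ℚ.≤ s → 0ℚ ℚ.≤ t → t ℚ.≤ ℕ→ℚ 3 ℚ.+ ℕ→ℚ 2 ℚ.* (ℕ→ℚ (κ * κ) ℚ.* s) →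
  s ^ℚ k ℚ.≤ ℕ→ℚ S → (κ * κ) ^ k * S ≤ D * M → 1 ≤ M → t ^ℚ k ℚ.≤ ℕ→ℚ (5 ^ k * suc D * M)
norm-power k κ {S} {D} {M} {s} {t} 0≤s 0≤t t≤ s^k κS≤ 1≤M = go (ℚ.≤-total x 1ℚ)
  where
  open ℚ.≤-Reasoning
  open ℚ-Solver.+-*-Solver
  x : ℚ
  x = ℕ→ℚ (κ * κ) ℚ.* s
  0≤x : 0ℚ ℚ.≤ x
  0≤x = 0≤* (0≤ℕ→ℚ (κ * κ)) 0≤s
  bound : ∀ {y} → 1ℚ ℚ.≤ y → x ℚ.≤ y → t ℚ.≤ ℕ→ℚ 5 ℚ.* y
  bound {y} 1≤y x≤y = begin
    t                                        ≤⟨ t≤ ⟩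
    ℕ→ℚ 3 ℚ.+ ℕ→ℚ 2 ℚ.* x                    ≡⟨ cong (ℚ._+ ℕ→ℚ 2 ℚ.* x) (ℚ.*-identityʳ (ℕ→ℚ 3)) ⟨
    ℕ→ℚ 3 ℚ.* 1ℚ ℚ.+ ℕ→ℚ 2 ℚ.* x             ≤⟨ ℚ.+-mono-≤ (ℚ.*-monoˡ-≤-nonNeg (ℕ→ℚ 3) 1≤y) (ℚ.*-monoˡ-≤-nonNeg (ℕ→ℚ 2) x≤y) ⟩
    ℕ→ℚ 3 ℚ.* y ℚ.+ ℕ→ℚ 2 ℚ.* y              ≡⟨ ℚ.*-distribʳ-+ y (ℕ→ℚ 3) (ℕ→ℚ 2) ⟨
    ℕ→ℚ 5 ℚ.* y                              ∎
  power : ∀ {y Y} → 1ℚ ℚ.≤ y → x ℚ.≤ y → y ^ℚ k ℚ.≤ ℕ→ℚ Y → Y ≤ suc D * M → t ^ℚ k ℚ.≤ ℕ→ℚ (5 ^ k * suc D * M)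
  power {y} {Y} 1≤y x≤y y^k Y≤ = begin
    t ^ℚ k                        ≤⟨ pow-mono k 0≤t (bound 1≤y x≤y) ⟩
    (ℕ→ℚ 5 ℚ.* y) ^ℚ k            ≡⟨ ^ℚ-distrib-* (ℕ→ℚ 5) y k ⟩
    ℕ→ℚ 5 ^ℚ k ℚ.* y ^ℚ k         ≤⟨ *-mono-≤ (0≤pow k (ℚ.≤-trans 0≤1 1≤y)) (0≤pow k (0≤ℕ→ℚ 5)) ℚ.≤-refl (ℚ.≤-trans y^k (ℕ→ℚ-mono Y≤)) ⟩
    ℕ→ℚ 5 ^ℚ k ℚ.* ℕ→ℚ (suc D * M) ≡⟨ cong (ℚ._* ℕ→ℚ (suc D * M)) (ℕ→ℚ-^ 5 k) ⟨
    ℕ→ℚ (5 ^ k) ℚ.* ℕ→ℚ (suc D * M) ≡⟨ ℕ→ℚ-* (5 ^ k) (suc D * M) ⟨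
    ℕ→ℚ (5 ^ k * (suc D * M))     ≡⟨ cong ℕ→ℚ (ℕ.*-assoc (5 ^ k) (suc D) M) ⟨
    ℕ→ℚ (5 ^ k * suc D * M)       ∎
  go : x ℚ.≤ 1ℚ ⊎ 1ℚ ℚ.≤ x → t ^ℚ k ℚ.≤ ℕ→ℚ (5 ^ k * suc D * M)
  go (inj₁ x≤1) = power {1ℚ} {1} ℚ.≤-refl x≤1
    (ℚ.≤-reflexive (trans (sym (ℕ→ℚ-^ 1 k)) (cong ℕ→ℚ (ℕ.^-zeroˡ k)))) (ℕ.≤-trans 1≤M (ℕ.m≤m+n M (D * M)))
  go (inj₂ 1≤x) = power {x} {(κ * κ) ^ k * S} 1≤x ℚ.≤-refl (begin
    x ^ℚ k                                   ≡⟨ ^ℚ-distrib-* (ℕ→ℚ (κ * κ)) s k ⟩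
    ℕ→ℚ (κ * κ) ^ℚ k ℚ.* s ^ℚ k              ≤⟨ *-mono-≤ (0≤pow k 0≤s) (0≤pow k (0≤ℕ→ℚ (κ * κ))) ℚ.≤-refl s^k ⟩
    ℕ→ℚ (κ * κ) ^ℚ k ℚ.* ℕ→ℚ S               ≡⟨ cong (ℚ._* ℕ→ℚ S) (ℕ→ℚ-^ (κ * κ) k) ⟨
    ℕ→ℚ ((κ * κ) ^ k) ℚ.* ℕ→ℚ S              ≡⟨ ℕ→ℚ-* ((κ * κ) ^ k) S ⟨
    ℕ→ℚ ((κ * κ) ^ k * S)                    ∎) (ℕ.≤-trans κS≤ (ℕ.m≤n+m (D * M) M))

power-1 : ∀ k → 1ℚ ^ℚ k ≡ 1ℚ
power-1 k = trans (sym (ℕ→ℚ-^ 1 k)) (cong ℕ→ℚ (ℕ.^-zeroˡ k))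

-- For i = 0 the approximation, of precision 1/(i + 1), could be 0.
doubled-root : ∀ k {X} i → 1 ≤ i → 1 ≤ X → let x = rootApprox (suc k) (ℕ→ℚ X) i in ℕ→ℚ X ℚ.≤ (x ℚ.+ x) ^ℚ suc k
doubled-root k {X} i 1≤i 1≤X = ℚ.≤-trans (ℚ.<⇒≤ (rootApprox-upper k (ℕ→ℚ X) i))
  (pow-mono (suc k) (0≤+ 0≤x (0≤1/suc i)) (ℚ.+-monoʳ-≤ x u≤x))
  where
  open ℚ.≤-Reasoning
  open ℚ-Solver.+-*-Solver
  x u : ℚ
  x = rootApprox (suc k) (ℕ→ℚ X) i
  u = 1/suc i
  0≤x : 0ℚ ℚ.≤ x
  0≤x = 0≤rootApprox (suc k) (ℕ→ℚ X) i
  1≤x+u : 1ℚ ℚ.≤ x ℚ.+ u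
  1≤x+u = pow-cancel (suc k) (0≤+ 0≤x (0≤1/suc i)) (begin-strict
    1ℚ ^ℚ suc k          ≡⟨ power-1 (suc k) ⟩
    1ℚ                   ≤⟨ ℕ→ℚ-mono 1≤X ⟩
    ℕ→ℚ X                <⟨ rootApprox-upper k (ℕ→ℚ X) i ⟩
    (x ℚ.+ u) ^ℚ suc k   ∎)
  u+u≤1 : u ℚ.+ u ℚ.≤ 1ℚ
  u+u≤1 = begin
    u ℚ.+ u                          ≡⟨ solve 1 (λ u → u :+ u := (con 1ℚ :+ con 1ℚ) :* u) refl u ⟩
    ℕ→ℚ 2 ℚ.* u                      ≤⟨ *-mono-≤ (0≤1/suc i) (0≤ℕ→ℚ (suc i)) (ℕ→ℚ-mono (s≤s 1≤i)) ℚ.≤-refl ⟩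
    ℕ→ℚ (suc i) ℚ.* u                ≡⟨ 1/suc-inverse i ⟩
    1ℚ                               ∎
  u≤x : u ℚ.≤ x
  u≤x = begin
    u                        ≡⟨ solve 1 (λ u → u := u :+ u :- u) refl u ⟩
    u ℚ.+ u ℚ.- u            ≤⟨ ℚ.+-monoˡ-≤ (ℚ.- u) (ℚ.≤-trans u+u≤1 1≤x+u) ⟩
    x ℚ.+ u ℚ.- u            ≡⟨ solve 2 (λ x u → x :+ u :- u := x) refl x u ⟩
    x                        ∎

modulus-arithmetic : ∀ h C {X Y t} i → 1 ≤ i → 1 ≤ X → 1 ≤ Y → 0ℚ ℚ.≤ t → t ^ℚ suc h ℚ.≤ ℕ→ℚ (C * (X * Y)) →
  rootApprox 2 t i ℚ.≤ ℕ→ℚ (4 * suc C) ℚ.* (rootApprox (2 * suc h) (ℕ→ℚ X) i ℚ.* rootApprox (2 * suc h) (ℕ→ℚ Y) i ℚ.* ℕ→ℚ 1)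
modulus-arithmetic h C {X} {Y} {t} i 1≤i 1≤X 1≤Y 0≤t t≤ = ℚ.≤-trans (pow-cancel k 0≤rhs (begin-strict
    m ^ℚ k                                     ≡⟨ ^ℚ-*-assoc m 2 (suc h) ⟨
    (m ^ℚ 2) ^ℚ suc h                          ≤⟨ pow-mono (suc h) (0≤pow 2 (0≤rootApprox 2 t i)) (rootApprox-power 1 t i 0≤t) ⟩
    t ^ℚ suc h                                 ≤⟨ t≤ ⟩
    ℕ→ℚ (C * (X * Y))                          <⟨ subst (ℕ→ℚ (C * (X * Y)) ℚ.<_) (sym (ℕ→ℚ-suc (C * (X * Y)))) (a<a+1 (ℕ→ℚ (C * (X * Y)))) ⟩
    ℕ→ℚ (suc (C * (X * Y)))                    ≤⟨ ℕ→ℚ-mono (ℕ.+-monoˡ-≤ (C * (X * Y)) (ℕ.*-mono-≤ 1≤X 1≤Y)) ⟩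
    ℕ→ℚ (suc C * (X * Y))                      ≡⟨ trans (ℕ→ℚ-* (suc C) (X * Y)) (cong (c ℚ.*_) (ℕ→ℚ-* X Y)) ⟩
    c ℚ.* (ℕ→ℚ X ℚ.* ℕ→ℚ Y)                    ≤⟨ *-mono-≤ (0≤* (0≤ℕ→ℚ X) (0≤ℕ→ℚ Y)) (0≤pow k (0≤ℕ→ℚ (suc C))) (a≤pow k′ (ℕ→ℚ-mono {1} {suc C} (s≤s z≤n)))
                                                    (*-mono-≤ (0≤ℕ→ℚ Y) (0≤pow k (0≤+ 0≤x 0≤x)) (doubled-root k′ i 1≤i 1≤X) (doubled-root k′ i 1≤i 1≤Y)) ⟩
    c ^ℚ k ℚ.* ((x ℚ.+ x) ^ℚ k ℚ.* (y ℚ.+ y) ^ℚ k) ≡⟨ cong (c ^ℚ k ℚ.*_) (^ℚ-distrib-* (x ℚ.+ x) (y ℚ.+ y) k) ⟨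
    c ^ℚ k ℚ.* ((x ℚ.+ x) ℚ.* (y ℚ.+ y)) ^ℚ k  ≡⟨ ^ℚ-distrib-* c ((x ℚ.+ x) ℚ.* (y ℚ.+ y)) k ⟨
    (c ℚ.* ((x ℚ.+ x) ℚ.* (y ℚ.+ y))) ^ℚ k     ∎))
  (ℚ.≤-reflexive (trans (solve 3 (λ c x y → c :* ((x :+ x) :* (y :+ y)) := con (ℕ→ℚ 4) :* c :* (x :* y :* con (ℕ→ℚ 1))) refl c x y)
    (cong (ℚ._* (x ℚ.* y ℚ.* ℕ→ℚ 1)) (sym (ℕ→ℚ-* 4 (suc C))))))
  where
  open ℚ.≤-Reasoning
  open ℚ-Solver.+-*-Solver
  k′ k : ℕ
  k′ = h + 1 * suc h
  k = suc k′
  m x y c : ℚ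
  m = rootApprox 2 t i
  x = rootApprox (2 * suc h) (ℕ→ℚ X) i
  y = rootApprox (2 * suc h) (ℕ→ℚ Y) i
  c = ℕ→ℚ (suc C)
  0≤x : 0ℚ ℚ.≤ x
  0≤x = 0≤rootApprox (2 * suc h) (ℕ→ℚ X) i
  0≤y : 0ℚ ℚ.≤ y
  0≤y = 0≤rootApprox (2 * suc h) (ℕ→ℚ Y) i
  0≤rhs : 0ℚ ℚ.≤ c ℚ.* ((x ℚ.+ x) ℚ.* (y ℚ.+ y))
  0≤rhs = 0≤* (0≤ℕ→ℚ (suc C)) (0≤* (0≤+ 0≤x 0≤x) (0≤+ 0≤y 0≤y))

naturalBound : ∀ (x : ℝ) → ∃ λ B → Eventually λ i → seq x i ℚ.≤ ℕ→ℚ B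
naturalBound x = let B , _ , bound = bounded x in
  ℤ.∣ ℚ.↥ B ∣ , eventually-map (λ i h → ℚ.≤-trans (a≤∣a∣ (seq x i)) (ℚ.≤-trans h (x≤∣↥x∣ B))) bound

gcd-power : ∀ {K B p m n} (p-prime : Prime p) → Eventually (λ i → seq K i ℚ.≤ ℕ→ℚ B) → GcdBound K p m n p-prime →
  ∀ ν .{{_ : NonZero ν}} .{{_ : NonZero (p ^ ν ∸ 1)}} → ν ∣ m → ν ≢ m → let γ = gcd n ((p ^ m ∸ 1) ℕ./ (p ^ ν ∸ 1)) in
  1 ≤ γ → (γ * p ^ ν) ^ 605 ≤ (2 * B) ^ 605 * (n ^ 119 * (p ^ m) ^ 486)
gcd-power {K} {B} {p} {m} {n} p-prime K≤B gcd-bound ν ν∣m ν≢m 1≤γ =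
  let N , bound = eventually-map₂ (λ i → _,_) K≤B (gcd-bound ν ν∣m ν≢m ½ _)
      K≤ , γ≤ = bound N ℕ.≤-refl
  in gcd-arithmetic {γ} {p ^ ν} {n ^ 119} {(p ^ m) ^ 486} B 605 1≤γ K≤
    (0≤rootApprox 605 (ℕ→ℚ (n ^ 119)) N) (0≤rootApprox 605 (ℕ→ℚ ((p ^ m) ^ 486)) N)
    (ℚ.nonNegative⁻¹ (1/p^ν) {{ℚ.normalize-nonNeg 1 (p ^ ν) {{p^ν≢0}}}}) (reciprocal (p ^ ν) {{p^ν≢0}})
    (rootApprox-power 604 (ℕ→ℚ (n ^ 119)) N (0≤ℕ→ℚ (n ^ 119))) (rootApprox-power 604 (ℕ→ℚ ((p ^ m) ^ 486)) N (0≤ℕ→ℚ ((p ^ m) ^ 486))) γ≤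
  where
  γ : ℕ
  γ = gcd n ((p ^ m ∸ 1) ℕ./ (p ^ ν ∸ 1))
  p^ν≢0 : NonZero (p ^ ν)
  p^ν≢0 = ℕ.m^n≢0 p ν {{prime⇒nonZero p-prime}}
  1/p^ν : ℚ
  1/p^ν = (ℤ.+ 1 ℚ./ (p ^ ν)) {{p^ν≢0}}

module Bounds {q : ℕ} (𝔽 : FieldOn q) (n : ℕ) .{{n≢0 : NonZero n}} where

  open FieldSets 𝔽 hiding (solve; con; _:=_; _:+_; _:*_; _:-_; :-_)
  open FiniteFieldFacts 𝔽
  open Powers 𝔽 n
  open Subfields 𝔽

  1≤n : 1 ≤ n
  1≤n = >-nonZero⁻¹ n

  1≤N : 1 ≤ ⟦ H ⟧
  1≤N = ∣∣≥1 H 𝟏∈H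

  κN≤q : κ * ⟦ H ⟧ ≤ q
  κN≤q = ℕ.≤-trans (ℕ.≤-reflexive κ*∣H∣) (ℕ.≤-trans (ℕ.n≤1+n ⟦ Units ⟧) (ℕ.≤-reflexive (sym ∣Units∣)))

  q≤2nN : q ≤ 2 * (n * ⟦ H ⟧)
  q≤2nN = ℕ.≤-trans (ℕ.≤-reflexive (trans ∣Units∣ (cong suc (sym κ*∣H∣))))
    (ℕ.+-mono-≤ (ℕ.*-mono-≤ 1≤n 1≤N) (ℕ.≤-trans (ℕ.*-monoˡ-≤ ⟦ H ⟧ κ≤n) (ℕ.≤-reflexive (sym (ℕ.+-identityʳ (n * ⟦ H ⟧))))))

  subfield-bound : ∀ {K B p m} (p-prime : Prime p) → q ≡ p ^ m → n ∣ p ^ m ∸ 1 →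
    Eventually (λ i → seq K i ℚ.≤ ℕ→ℚ B) → GcdBound K p m n p-prime →
    ∀ {M} → IsSubfield 𝔽 M → (∃ λ x → ¬ x ∈ M) → ⟦ H ∩ M ⟧ ^ 605 ≤ subfieldConstant 2 B * ⟦ H ⟧ ^ 486
  subfield-bound {K} {B} {p} {m} p-prime refl (divides N₀ N₀n) K≤B gcd-bound {M} M-sub proper =
    go (subfield-degree M-sub p-prime refl proper)
    where
    ∣Units∣≡ : ⟦ Units ⟧ ≡ N₀ * n
    ∣Units∣≡ = trans (sym (cong (_∸ 1) ∣Units∣)) N₀n
    go : (∃ λ ν → NonZero ν × ν ∣ m × ν ≢ m × ⟦ M ⟧ ≡ p ^ ν) → ⟦ H ∩ M ⟧ ^ 605 ≤ subfieldConstant 2 B * ⟦ H ⟧ ^ 486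
    go (ν , ν≢0 , ν∣m , ν≢m , ∣M∣) = subfield-arithmetic {⟦ H ∩ M ⟧} {γ} {p ^ ν} {n} {q} {⟦ H ⟧} 2 B 1≤n
      (ℕ.≤-trans (transport ∣M∣ (λ {{r}} → ∣H∩M∣ M-sub N₀ ∣Units∣≡ {{r}}))
        (ℕ.≤-trans (ℕ.*-monoˡ-≤ γ (ℕ.m∸n≤m (p ^ ν) 1)) (ℕ.≤-reflexive (ℕ.*-comm (p ^ ν) γ)))) q≤2nN
      (gcd-power {K} {B} {p} {m} {n} p-prime K≤B gcd-bound ν {{ν≢0}} {{r≢0}} ν∣m ν≢m
        (ℕ.n≢0⇒n>0 (gcd[m,n]≢0 n ((p ^ m ∸ 1) ℕ./ (p ^ ν ∸ 1)) (inj₁ (ℕ.≢-nonZero⁻¹ n)))))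
      where
      instance
        r≢0 : NonZero (p ^ ν ∸ 1)
        r≢0 = p^ν∸1≢0 p-prime ν {{ν≢0}}
      γ : ℕ
      γ = gcd n ((p ^ m ∸ 1) ℕ./ (p ^ ν ∸ 1))
      transport : ∀ {r} → r ≡ p ^ ν → (.{{_ : NonZero (r ∸ 1)}} → ⟦ H ∩ M ⟧ * n ≤ (r ∸ 1) * gcd n ((p ^ m ∸ 1) ℕ./ (r ∸ 1))) →
                  ⟦ H ∩ M ⟧ * n ≤ (p ^ ν ∸ 1) * γ
      transport refl h = h

powerConstant : ℕ → ℕ → ℕ → ℕ → ℕ
powerConstant a b d R = a ^ 112 + b ^ 28 * (d ^ 56 * R)

large-subgroup : ∀ {κ N q n s t X Y C} a b d R → X ≡ q ^ 195 → Y ≡ n ^ 57 → C ≡ 5 ^ 112 * suc (powerConstant a b d R) → 1 ≤ q → 1 ≤ n → κ * N ≤ q → κ ≤ n → q ^ 10 ≤ N ^ 19 → 0ℚ ℚ.≤ s → 0ℚ ℚ.≤ t →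
  t ℚ.≤ ℕ→ℚ 3 ℚ.+ ℕ→ℚ 2 ℚ.* (ℕ→ℚ (κ * κ) ℚ.* s) → s ℚ.≤ ℕ→ℚ (a * q) →
  t ^ℚ 112 ℚ.≤ ℕ→ℚ (C * (X * Y))
large-subgroup {κ} {N} {q} {n} {s} {t} a b d R refl refl refl 1≤q 1≤n κN≤q κ≤n large 0≤s 0≤t t≤ s≤ =
  norm-power 112 κ {(a * q) ^ 112} {powerConstant a b d R} {q ^ 195 * n ^ 57} {s} {t} 0≤s 0≤t t≤
    (power 112 s≤)
    (ℕ.≤-trans (large-subgroup-arithmetic {κ} {N} {q} {n} a 1≤q κN≤q κ≤n large)
      (ℕ.*-monoˡ-≤ (q ^ 195 * n ^ 57) (ℕ.m≤m+n (a ^ 112) (b ^ 28 * (d ^ 56 * R)))))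
    (ℕ.*-mono-≤ (ℕ.m^n>0 q {{>-nonZero 1≤q}} 195) (ℕ.m^n>0 n {{>-nonZero 1≤n}} 57))
  where
  power : ∀ k → s ℚ.≤ ℕ→ℚ (a * q) → s ^ℚ k ℚ.≤ ℕ→ℚ ((a * q) ^ k)
  power k h = ℚ.≤-trans (pow-mono k 0≤s h) (ℚ.≤-reflexive (sym (ℕ→ℚ-^ (a * q) k)))

small-subgroup : ∀ {κ N q n E ρ s t X Y C} a b d R → X ≡ q ^ 195 → Y ≡ n ^ 57 → C ≡ 5 ^ 112 * suc (powerConstant a b d R) → 1 ≤ q → 1 ≤ n → κ * N ≤ q → κ ≤ n → E ≤ d * (ρ * (N * N)) → ρ ^ 56 ≤ R * N ^ 55 →
  0ℚ ℚ.≤ s → 0ℚ ℚ.≤ t → t ℚ.≤ ℕ→ℚ 3 ℚ.+ ℕ→ℚ 2 ℚ.* (ℕ→ℚ (κ * κ) ℚ.* s) → s ^ℚ 4 ℚ.≤ ℕ→ℚ (b * (q * (E * E))) →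
  t ^ℚ 112 ℚ.≤ ℕ→ℚ (C * (X * Y))
small-subgroup {κ} {N} {q} {n} {E} {ρ} {s} {t} a b d R refl refl refl 1≤q 1≤n κN≤q κ≤n E≤ ρ≤ 0≤s 0≤t t≤ s⁴≤ =
  norm-power 112 κ {S ^ 28} {powerConstant a b d R} {q ^ 195 * n ^ 57} {s} {t} 0≤s 0≤t t≤
    (power 4 28 s⁴≤)
    (ℕ.≤-trans (small-subgroup-arithmetic {κ} {N} {q} {n} {E} {ρ} b d R κN≤q κ≤n E≤ ρ≤)
      (ℕ.*-monoˡ-≤ (q ^ 195 * n ^ 57) (ℕ.m≤n+m (b ^ 28 * (d ^ 56 * R)) (a ^ 112))))
    (ℕ.*-mono-≤ (ℕ.m^n>0 q {{>-nonZero 1≤q}} 195) (ℕ.m^n>0 n {{>-nonZero 1≤n}} 57))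
  where
  S : ℕ
  S = b * (q * (E * E))
  power : ∀ j k → s ^ℚ j ℚ.≤ ℕ→ℚ S → s ^ℚ (j * k) ℚ.≤ ℕ→ℚ (S ^ k)
  power j k h = ℚ.≤-trans (ℚ.≤-reflexive (sym (^ℚ-*-assoc s j k)))
    (ℚ.≤-trans (pow-mono k (0≤pow j 0≤s) h) (ℚ.≤-reflexive (sym (ℕ→ℚ-^ S k))))

open 𝒞 using (ν)

module Estimate {q : ℕ} (𝔽 : FieldOn q) (ψ : Fin q → ℂ)
  (ψ-⊕ : ∀ x y → ψ (FieldOn._⊕_ 𝔽 x y) ≋ᶜ ψ x *ᶜ ψ y) (ψ-𝟎 : ψ (FieldOn.𝟎 𝔽) ≋ᶜ 1ᶜ)
  (x₀ : Fin q) (ψx₀≉1 : ¬ ψ x₀ ≋ᶜ 1ᶜ) (n : ℕ) .{{_ : NonZero n}} where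

  open FieldSets 𝔽 hiding (solve; con; _:=_; _:+_; _:*_; _:-_; :-_)
  open Powers 𝔽 n
  open Bounds 𝔽 n
  open Moments 𝔽 ψ ψ-⊕ ψ-𝟎 x₀ ψx₀≉1 H H-subgroup using (1≤q; s; g; energy; second-moment; fourth-power)

  powerSum : ℂ
  powerSum = 1ᶜ +ᶜ ν κ *ᶜ g 𝟏

  ∥powerSum∥² : ∀ i → ∥ powerSum ∥² i ℚ.≤ ℕ→ℚ 2 ℚ.+ ℕ→ℚ 2 ℚ.* (ℕ→ℚ (κ * κ) ℚ.* s 𝟏 i)
  ∥powerSum∥² i = begin
    ∥ powerSum ∥² i
      ≡⟨ cong₂ (λ x y → x ℚ.* x ℚ.+ y ℚ.* y) (trans (re-+ 1ᶜ w i) (cong (ℚ._+ a) (re-1 i))) (trans (im-+ 1ᶜ w i) (cong (ℚ._+ b) (im-1 i))) ⟩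
    (1ℚ ℚ.+ a) ℚ.* (1ℚ ℚ.+ a) ℚ.+ (0ℚ ℚ.+ b) ℚ.* (0ℚ ℚ.+ b)
      ≡⟨ ℚ.+-identityʳ _ ⟨
    (1ℚ ℚ.+ a) ℚ.* (1ℚ ℚ.+ a) ℚ.+ (0ℚ ℚ.+ b) ℚ.* (0ℚ ℚ.+ b) ℚ.+ 0ℚ
      ≤⟨ ℚ.+-monoʳ-≤ ((1ℚ ℚ.+ a) ℚ.* (1ℚ ℚ.+ a) ℚ.+ (0ℚ ℚ.+ b) ℚ.* (0ℚ ℚ.+ b)) (0≤+ (0≤sq (1ℚ ℚ.- a)) (0≤sq b)) ⟩
    (1ℚ ℚ.+ a) ℚ.* (1ℚ ℚ.+ a) ℚ.+ (0ℚ ℚ.+ b) ℚ.* (0ℚ ℚ.+ b) ℚ.+ ((1ℚ ℚ.- a) ℚ.* (1ℚ ℚ.- a) ℚ.+ b ℚ.* b)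
      ≡⟨ solve 2 (λ a b → (con 1ℚ :+ a) :* (con 1ℚ :+ a) :+ (con 0ℚ :+ b) :* (con 0ℚ :+ b) :+ ((con 1ℚ :- a) :* (con 1ℚ :- a) :+ b :* b)
           := con (ℕ→ℚ 2) :+ con (ℕ→ℚ 2) :* (a :* a :+ b :* b)) refl a b ⟩
    ℕ→ℚ 2 ℚ.+ ℕ→ℚ 2 ℚ.* ∥ w ∥² i
      ≡⟨ cong (λ x → ℕ→ℚ 2 ℚ.+ ℕ→ℚ 2 ℚ.* x) (trans (∥ν*∥² κ (g 𝟏) i) (cong (ℚ._* s 𝟏 i) (sym (ℕ→ℚ-* κ κ)))) ⟩
    ℕ→ℚ 2 ℚ.+ ℕ→ℚ 2 ℚ.* (ℕ→ℚ (κ * κ) ℚ.* s 𝟏 i) ∎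
    where
    open ℚ.≤-Reasoning
    open ℚ-Solver.+-*-Solver
    w : ℂ
    w = ν κ *ᶜ g 𝟏
    a b : ℚ
    a = seq (re w) i
    b = seq (im w) i

  power-bound : ∀ c → 1 ≤ c → (∀ {M} → IsSubfield 𝔽 M → (∃ λ x → ¬ x ∈ M) → ⟦ H ∩ M ⟧ ^ 605 ≤ c * ⟦ H ⟧ ^ 486) →
    ∀ {X Y C} → X ≡ q ^ 195 → Y ≡ n ^ 57 → C ≡ 5 ^ 112 * suc (powerConstant 3 6 2 (representationBound 2 c)) →
    ∀ {z} → z ≋ᶜ powerSum → Eventually λ i → ∥ z ∥² i ^ℚ 112 ℚ.≤ ℕ→ℚ (C * (X * Y))
  power-bound c 1≤c subfields {X} {Y} {C} X≡ Y≡ C≡ {z} z≋ = split (⟦ H ⟧ ^ 19 ℕ.≤? q ^ 10)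
    where
    norm-bound : ∀ i → ∥ z ∥² i ℚ.≤ ∥ powerSum ∥² i ℚ.+ 1ℚ → ∥ z ∥² i ℚ.≤ ℕ→ℚ 3 ℚ.+ ℕ→ℚ 2 ℚ.* (ℕ→ℚ (κ * κ) ℚ.* s 𝟏 i)
    norm-bound i h = ℚ.≤-trans h (ℚ.≤-trans (ℚ.+-monoˡ-≤ 1ℚ (∥powerSum∥² i)) (ℚ.≤-reflexive (three (ℕ→ℚ 2 ℚ.* (ℕ→ℚ (κ * κ) ℚ.* s 𝟏 i)))))
      where
      open ℚ-Solver.+-*-Solver
      three : ∀ x → ℕ→ℚ 2 ℚ.+ x ℚ.+ 1ℚ ≡ ℕ→ℚ 3 ℚ.+ x
      three = solve 1 (λ x → con (ℕ→ℚ 2) :+ x :+ con 1ℚ := con (ℕ→ℚ 3) :+ x) refl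
    split : Dec (⟦ H ⟧ ^ 19 ≤ q ^ 10) → Eventually λ i → ∥ z ∥² i ^ℚ 112 ℚ.≤ ℕ→ℚ (C * (X * Y))
    split (no large) = eventually-map₂ (λ i h near → large-subgroup {κ} {⟦ H ⟧} {q} {n} {s 𝟏 i} {∥ z ∥² i} {X} {Y} {C} 3 6 2 (representationBound 2 c)
      X≡ Y≡ C≡ 1≤q 1≤n κN≤q κ≤n (ℕ.<⇒≤ (ℕ.≰⇒> large)) (0≤∥∥² (g 𝟏) i) (0≤∥∥² z i) (norm-bound i near) h) second-moment (norm²-within-1 z≋)
    split (yes small) = let ρ , E≤ , ρ^56 = Symmetrised.energy-estimate 𝔽 H H-subgroup c 1≤c small subfields in
      eventually-map₂ (λ i h near → small-subgroup {κ} {⟦ H ⟧} {q} {n} {energy} {ρ} {s 𝟏 i} {∥ z ∥² i} {X} {Y} {C} 3 6 2 (representationBound 2 c)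
        X≡ Y≡ C≡ 1≤q 1≤n κN≤q κ≤n E≤ ρ^56 (0≤∥∥² (g 𝟏) i) (0≤∥∥² z i) (norm-bound i near) h) fourth-power (norm²-within-1 z≋)

opaque
  -- Given by an equation, since Agda would evaluate the number in a conversion check.
  normConstant-spec : ∀ B → ∃ λ C → C ≡ 5 ^ 112 * suc (powerConstant 3 6 2 (representationBound 2 (subfieldConstant 2 B)))
  normConstant-spec B = _ , refl

normConstant : ℕ → ℕ
normConstant B = proj₁ (normConstant-spec B)

monomialSum-bound : ∀ {K B p m n q} .{{_ : NonZero n}} (p-prime : Prime p) → q ≡ p ^ m → 2 ≤ q → n ∣ p ^ m ∸ 1 →
  Eventually (λ i → seq K i ℚ.≤ ℕ→ℚ B) → GcdBound K p m n p-prime →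
  (F : FiniteField q) (ψ : FiniteField.Carrier F → ℂ) → IsAdditiveCharacter F ψ → NonTrivialCharacter F ψ →
  ∀ {X Y} → X ≡ q ^ 195 → Y ≡ n ^ 57 → Eventually λ i → ∥ monomialSum F ψ n ∥² i ^ℚ 112 ℚ.≤ ℕ→ℚ (normConstant B * (X * Y))
monomialSum-bound {K} {B} {p} {m} {n} {q} p-prime q≡ 2≤q n∣ K≤B gcd-bound F ψ ψ-char nontrivial {X} {Y} X≡ Y≡ =
  go (subfieldConstant 2 B) (s≤s z≤n) (proj₂ (normConstant-spec B)) (Bounds.subfield-bound 𝔽 n {K} {B} {p} {m} p-prime q≡ n∣ K≤B gcd-bound)
  where
  open Transfer F 2≤q
  open FiniteFieldFacts 𝔽 using (pow)
  open Inverse (FiniteField.enumeration F) using (to)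
  open RawSemiringDefinitions (RawRing.rawSemiring (FiniteField.rawRing F)) using () renaming (_^_ to _^ꟳ_)
  open FieldSets 𝔽 hiding (solve; con; _:=_; _:+_; _:*_; _:-_; :-_)
  open Powers 𝔽 n
  nontrivial′ : ∃ λ i → ¬ ψ′ ψ-char i ≋ᶜ 1ᶜ
  nontrivial′ = ψ′-nontrivial ψ-char nontrivial
  module E = Estimate 𝔽 (ψ′ ψ-char) (ψ′-⊕ ψ-char) (ψ′-𝟎 ψ-char) (proj₁ nontrivial′) (proj₂ nontrivial′) n
  sum≋ : monomialSum F ψ n ≋ᶜ E.powerSum
  sum≋ = ≋ᶜ-trans (∑-link (λ i → ψ (to i ^ꟳ n)) (λ i → ψ′ ψ-char (pow i n)) (λ i → ψ′-pow ψ-char i n))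
      (PowerSum.power-sum 𝔽 (ψ′ ψ-char) n (ψ′-𝟎 ψ-char))
  go : ∀ c → 1 ≤ c → normConstant B ≡ 5 ^ 112 * suc (powerConstant 3 6 2 (representationBound 2 c)) → 
    (∀ {M} → IsSubfield 𝔽 M → (∃ λ x → ¬ x ∈ M) → ⟦ H ∩ M ⟧ ^ 605 ≤ c * ⟦ H ⟧ ^ 486) →
    Eventually λ i → ∥ monomialSum F ψ n ∥² i ^ℚ 112 ℚ.≤ ℕ→ℚ (normConstant B * (X * Y))
  go c 1≤c C≡ subfields = E.power-bound c 1≤c subfields {X} {Y} {normConstant B} X≡ Y≡ C≡ {monomialSum F ψ n} sum≋

2≤p^m : ∀ {p} → Prime p → ∀ m .{{_ : NonZero m}} → 2 ≤ p ^ m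
2≤p^m {p} p-prime (suc m) = ℕ.≤-trans (nonTrivial⇒n>1 p {{prime⇒nonTrivial p-prime}})
  (ℕ.≤-trans (ℕ.≤-reflexive (sym (ℕ.*-identityʳ p))) (ℕ.*-monoʳ-≤ p (ℕ.m^n>0 p {{prime⇒nonZero p-prime}} m)))

≤-widen : ∀ {a b} ε → Positive ε → a ℚ.≤ b → a ℚ.≤ b ℚ.+ ε
≤-widen {a} {b} ε ε>0 a≤b = ℚ.≤-trans a≤b (subst (ℚ._≤ b ℚ.+ ε) (ℚ.+-identityʳ b) (ℚ.+-monoʳ-≤ b (ℚ.<⇒≤ (ℚ.positive⁻¹ ε {{ε>0}}))))

open import Data.Integer.Base using (+_)

theorem4 : Σ ℕ λ A → (K : ℝ) → Σ ℝ λ C →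
    (p m n : ℕ) → .{{_ : NonZero m}} → .{{_ : NonZero n}} →
    (p-prime : Prime p) → n ∣ p ^ m ∸ 1 → GcdBound K p m n p-prime →
    (F : FiniteField (p ^ m)) (ψ : FiniteField.Carrier F → ℂ) →
    IsAdditiveCharacter F ψ → NonTrivialCharacter F ψ →
    modulus (monomialSum F ψ n) ≤ᴿ
    C *ᴿ ((p ^ m) ^ᴿ ((+ 7 / 1 -ℚ + 2 / 1 *ℚ δ₂) *ℚ (+ 1 / 8))
    *ᴿ n ^ᴿ ((+ 2 / 1 +ℚ + 2 / 1 *ℚ δ₂) *ℚ (+ 1 / 8))
    *ᴿ fromℕ (⌈log₂ p ^ m ⌉ ^ A))
theorem4 = 0 , λ K → let B , K≤B = naturalBound K in
  fromℕ (4 * suc (normConstant B)) , λ p m n p-prime n∣ gcd-bound F ψ ψ-char nontrivial ε ε>0 →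
    let t = ∥ monomialSum F ψ n ∥²
        N , bound = monomialSum-bound {K} {B} {p} {m} {n} p-prime refl (2≤p^m p-prime m) n∣ K≤B gcd-bound F ψ ψ-char nontrivial
          {(p ^ m) ^ 195} {n ^ 57} refl refl
    in suc N , λ i N<i → ≤-widen ε ε>0
      (modulus-arithmetic 111 (normConstant B) {(p ^ m) ^ 195} {n ^ 57} {t i} i (ℕ.≤-trans (s≤s z≤n) N<i)
        (ℕ.m^n>0 (p ^ m) {{>-nonZero (ℕ.<⇒≤ (2≤p^m p-prime m))}} 195) (ℕ.m^n>0 n 57)
        (0≤∥∥² (monomialSum F ψ n) i) (bound i (ℕ.<⇒≤ N<i)))
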